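{- Let $d\ge 2$ be fixed. As $x\to\infty$, the number of primes $p\le x$ such that $p\equiv 1\pmod d$ and $(S_d(\mathbb{F}_p)-1)\setminus\{0\}$ can be written as $AB$ for some $A,B\subset\mathbb{F}_p^*$ with $|A|,|B|\ge 2$ is $o(\pi(x))$.
   Context: $S_d(\mathbb{F}_p)=\{x^d:x\in\mathbb{F}_p^*\}$, $S_d(\mathbb{F}_p)-1=\{s-1:s\in S_d(\mathbb{F}_p)\}$, $AB=\{ab:a\in A,b\in B\}$, and $\pi(x)$ is the number of primes up to $x$. -}

module Defs where

open import Data.Nat using (ℕ; zero; suc; _+_; _*_; _∸_; _^_; _≤_; _<_)
open import Data.Nat.DivMod using (_%_)
open import Data.Nat.Primality using (Prime; prime?)
open import Data.Fin using (Fin; toℕ)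
open import Data.Fin.Subset using (Subset; _∈_; ∣_∣)
open import Data.List using (List; length; filter; upTo)
open import Data.Product using (Σ; ∃; ∃-syntax; _×_)
open import Relation.Binary.PropositionalEquality using (_≡_; _≢_)

-- reduction modulo p (only used for p ≥ 1; for p = 0 it is the identity)
_mod⟨_⟩ : ℕ → ℕ → ℕ
n mod⟨ zero ⟩ = n
n mod⟨ suc m ⟩ = n % suc m

-- r ∈ S_d(F_p) = { x^d : x ∈ F_p^* }, residues represented by 0..p-1
InS : ℕ → ℕ → ℕ → Set
InS d p r = ∃[ x ] (1 ≤ x × x < p × (x ^ d) mod⟨ p ⟩ ≡ r)

InT : ℕ → ℕ → ℕ → Set
InT d p r = r ≢ 0 × ∃[ s ] (InS d p s × (s + (p ∸ 1)) mod⟨ p ⟩ ≡ r)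

InProd : (p : ℕ) → Subset p → Subset p → Fin p → Set
InProd p A B r = ∃[ a ] ∃[ b ] (a ∈ A × b ∈ B × (toℕ a * toℕ b) mod⟨ p ⟩ ≡ toℕ r)

NonzeroSubset : (p : ℕ) → Subset p → Set
NonzeroSubset p A = ∀ a → a ∈ A → toℕ a ≢ 0

Decomposable : ℕ → ℕ → Set
Decomposable d p =
  ∃[ A ] ∃[ B ] (NonzeroSubset p A × NonzeroSubset p B × 2 ≤ ∣ A ∣ × 2 ≤ ∣ B ∣ ×
    (∀ (r : Fin p) → (InT d p (toℕ r) → InProd p A B r) × (InProd p A B r → InT d p (toℕ r))))

π : ℕ → ℕ
π x = length (filter prime? (upTo (suc x)))

{-# OPTIONS --safe #-}
-- Let (S − 1) \ {0} = A B with n = |A| and m = |B|. Stepanov's method, applied to the linear forms 1 + a x (a ∈ A) and the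
-- points B ∪ {0}, gives n m ≤ (p − 1)/d − 1, which is the number of elements available; hence p = d n m + d + 1. A second
-- application bounds the joint distribution of the d-th power residue classes of several of these forms, and counting
-- collisions among them shows that n and m both have order √p. So N = (p − d − 1)/d has a divisor near √N, which is rare
-- among the N for which d N + d + 1 is prime. Let V = Π (1 − 1/q)⁻¹ over the primes q ≤ w not dividing d (d + 1), choose κ
-- with 3^κ ≈ √V, and let T = 3 κ. Either N has at least T prime factors q ≤ w, and is counted by the sieve with weight
-- (3/2)^T, or (n, m) has fewer, and is counted in dyadic boxes with weight 2^(−T). Both weights gain a factor (8/9)^κ over
-- the sieve bound 1/V, which beats the number of boxes and, V being of order log w, also the loss in log x / log w.
module Submission where

open import Defs
open import Algebra.Bundles using (CommutativeRing; RawRing)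
import Algebra.Properties.CommutativeMonoid.Sum as FinSum
import Algebra.Properties.CommutativeSemiring.Exp as CExp
import Algebra.Properties.Group as GroupProps
import Algebra.Properties.Ring as RingProps
import Algebra.Properties.Semiring.Exp as Exp
import Algebra.Properties.Semiring.Mult as Mult
import Algebra.Properties.Semiring.Sum as SemiringSum
import Algebra.Solver.Ring
import Algebra.Solver.Ring.AlmostCommutativeRing as ACR
open import Data.Empty using (⊥; ⊥-elim)
open import Data.Fin as Fin using (Fin; zero; suc; toℕ; fromℕ<; punchIn)
import Data.Fin.Properties as Fin
open import Data.List as List using (List; []; _∷_; _++_; length; map; filter; upTo; applyUpTo; cartesianProductWith)
open import Data.List.Membership.Propositional.Properties using (∈-++⁺ˡ; ∈-++⁺ʳ; ∈-filter⁺; ∈-upTo⁺; ∈-cartesianProductWith⁺)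
open import Data.List.Properties using (length-map; length-applyUpTo; length-++; length-upTo)
open import Data.List.Relation.Unary.All as All using (All; []; _∷_)
import Data.List.Relation.Unary.All.Properties as AllP
open import Data.List.Relation.Unary.AllPairs as AllPairs using (AllPairs; []; _∷_)
import Data.List.Relation.Unary.AllPairs.Properties as AP
open import Data.List.Relation.Unary.Any as Any using (Any; here; there)
import Data.List.Relation.Unary.Any.Properties as AnyP
open import Data.List.Relation.Unary.Unique.Propositional using (Unique)
open import Data.Maybe using (Maybe; just; nothing)
open import Data.Nat as N using (ℕ; zero; suc; z≤n; s≤s; NonZero)
open import Data.Nat.Coprimality using (Coprime; coprime-Bézout; coprime-divisor; prime⇒coprime; 1-coprimeTo)
open import Data.Nat.Divisibility using (_∣_; _∣?_; _∣0; 1∣_; divides; divides-refl; ∣-refl; ∣-trans; ∣⇒≤; m∣m*n; n∣m*n; ∣m∣n⇒∣m+n; ∣m+n∣m⇒∣n; *-monoʳ-∣; *-monoˡ-∣)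
import Data.Nat.DivMod as N
open import Data.Nat.GCD using (module Bézout)
open import Data.Nat.ListAction using (product)
open import Data.Nat.Primality using (Prime; prime?; prime⇒irreducible; prime⇒nonZero; prime⇒nonTrivial; euclidsLemma; ¬prime[1])
open import Data.Nat.Primality.Factorisation using (PrimeFactorisation; factorise; factorisationHasAllPrimeFactors)
import Data.Nat.Properties as N
open import Data.Nat.Tactic.RingSolver using (solve-∀)
open import Data.Product using (Σ; _×_; _,_; ∃-syntax; proj₁; proj₂)
open import Data.Product.Properties using (≡-dec)
import Data.Rational as ℚ
import Data.Rational.Properties as ℚ
open import Data.Sum using (_⊎_; inj₁; inj₂)
open import Data.Vec as Vec using (Vec; []; _∷_; here; there; lookup; tabulate)
open import Data.Vec.Functional using (insertAt)
open import Data.Vec.Functional.Properties using (insertAt-lookup; insertAt-punchIn)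
import Data.Vec.Properties as Vec
open import Function using (_∘_)
open import Level using (0ℓ)
open import Relation.Binary.Bundles using (Preorder)
open import Relation.Binary.Definitions using (tri<; tri≈; tri>)
open import Relation.Binary.PropositionalEquality as ≡ using (_≡_; _≢_)
import Relation.Binary.Reasoning.Preorder as PreorderReasoning
import Relation.Binary.Reasoning.Setoid as Reasoning
open import Relation.Nullary using (¬_; Dec; yes; no; ¬?; _×-dec_)
open import Relation.Nullary.Decidable using (decidable-stable; map′)
open import Relation.Unary using (Decidable)

-- The sieve half is Erdős's multiplication-table argument: a typical N has about log log w prime
-- factors up to w, a typical pair (n, m) has twice as many, and T lies in between. On average
-- (3/2)^ω is of order √V over N and (1/2)^ω of order 1/V over pairs, so 3^T = V^(3/2) balances
-- (3/2)^(-T) √V against 2^T / V, which explains T = 3 κ. The obstacle in the algebraic half is that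
-- collisions of single forms bound m only by order p / n, which n m = (p - 1)/d - 1 satisfies
-- anyway. Products of two forms supply about n²/2 values instead of n, and then m is bounded by
-- order p / n² + √p. This helps only when n exceeds a constant depending on d; below it,
-- prescribing the classes of up to five forms makes B too sparse, and d = n = 2 needs an argument
-- of its own. All sizes are carried by natural parameters: s is about √p, x about 2^a, a about 2^b,
-- and w = 2^c.

infixr 6 _⟫_
_⟫_ : ∀ {i j k} → i N.≤ j → j N.≤ k → i N.≤ k
_⟫_ = N.≤-trans

-- A ring solver with integer coefficients

module PSolver (R : CommutativeRing 0ℓ 0ℓ) where
  open CommutativeRing R
  open import Algebra.Properties.Semiring.Mult semiring using () renaming (_×_ to _×ₙ_; ×-homo-+ to ×-+; ×1-homo-* to ×1-*)
  open import Algebra.Properties.Ring ring using (-‿+-comm; -‿distribˡ-*; -‿distribʳ-*; -‿involutive; -0#≈0#)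
  open import Algebra.Properties.CommutativeSemigroup +-commutativeSemigroup using (interchange)
  open import Relation.Binary.Reasoning.Setoid setoid

  -- Integer coefficients as reduced formal differences a − b of naturals.
  reduce : ℕ × ℕ → ℕ × ℕ
  reduce (a , b) = a N.∸ b , b N.∸ a

  Coeff : RawRing 0ℓ 0ℓ
  Coeff = record
    { Carrier = ℕ × ℕ ; _≈_ = _≡_
    ; _+_ = λ (a , b) (c , d) → reduce (a N.+ c , b N.+ d)
    ; _*_ = λ (a , b) (c , d) → reduce (a N.* c N.+ b N.* d , a N.* d N.+ b N.* c)
    ; -_ = λ (a , b) → b , a ; 0# = 0 , 0 ; 1# = 1 , 0 }

  private
    ι : ℕ → Carrier
    ι n = n ×ₙ 1#

    ι-+ : ∀ m n → ι (m N.+ n) ≈ ι m + ι n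
    ι-+ = ×-+ 1#

    ⟦_⟧ : ℕ × ℕ → Carrier
    ⟦ a , b ⟧ = ι a + - ι b

    +-hom : ∀ x y u v → (x + u) + - (y + v) ≈ (x + - y) + (u + - v)
    +-hom x y u v = trans (+-congˡ (sym (-‿+-comm y v))) (interchange x u (- y) (- v))

    neg-hom : ∀ x y → y + - x ≈ - (x + - y)
    neg-hom x y = trans (+-comm y (- x)) (trans (+-congˡ (sym (-‿involutive y))) (-‿+-comm x (- y)))

    *-hom : ∀ x y u v → (x * u + y * v) + - (x * v + y * u) ≈ (x + - y) * (u + - v)
    *-hom x y u v = sym (begin
      (x + - y) * (u + - v) ≈⟨ distribʳ _ x (- y) ⟩
      x * (u + - v) + - y * (u + - v) ≈⟨ +-cong (distribˡ x u (- v)) (distribˡ (- y) u (- v)) ⟩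
      (x * u + x * - v) + (- y * u + - y * - v) ≈⟨ +-cong (+-congˡ (sym (-‿distribʳ-* x v))) (+-cong (sym (-‿distribˡ-* y u)) (trans (sym (-‿distribˡ-* y (- v))) (trans (-‿cong (sym (-‿distribʳ-* y v))) (-‿involutive _)))) ⟩
      (x * u + - (x * v)) + (- (y * u) + y * v) ≈⟨ +-congˡ (+-comm _ _) ⟩
      (x * u + - (x * v)) + (y * v + - (y * u)) ≈⟨ interchange _ _ _ _ ⟩
      (x * u + y * v) + (- (x * v) + - (y * u)) ≈⟨ +-congˡ (-‿+-comm _ _) ⟩
      (x * u + y * v) + - (x * v + y * u) ∎)

    acr : ACR.AlmostCommutativeRing 0ℓ 0ℓ
    acr = ACR.fromCommutativeRing R

    ι-prod : ∀ a b c d → ι (a N.* c N.+ b N.* d) ≈ ι a * ι c + ι b * ι d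
    ι-prod a b c d = trans (ι-+ (a N.* c) (b N.* d)) (+-cong (×1-* a c) (×1-* b d))

    -- The coefficient 1 has a clause of its own so that `con (1 , 0)` denotes `1#` itself instead
    -- of `(1# + 0#) + - 0#`; equations written with `1#` then match the solver's reading of them.
    ⟦_⟧₁ : ℕ × ℕ → Carrier
    ⟦ 1 , 0 ⟧₁ = 1#
    ⟦ c ⟧₁ = ⟦ c ⟧

    ⟦⟧₁≈ : ∀ c → ⟦ c ⟧₁ ≈ ⟦ c ⟧
    ⟦⟧₁≈ (0 , b) = refl
    ⟦⟧₁≈ (1 , 0) = sym (trans (+-congˡ -0#≈0#) (trans (+-identityʳ _) (+-identityʳ 1#)))
    ⟦⟧₁≈ (1 , N.suc b) = refl
    ⟦⟧₁≈ (N.suc (N.suc a) , b) = refl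

    cross : ∀ x y u v → x + v ≈ u + y → x + - y ≈ u + - v
    cross x y u v e = begin
      x + - y ≈⟨ sym (+-identityʳ _) ⟩
      (x + - y) + 0# ≈⟨ +-congˡ (sym (-‿inverseʳ v)) ⟩
      (x + - y) + (v + - v) ≈⟨ interchange x (- y) v (- v) ⟩
      (x + v) + (- y + - v) ≈⟨ +-congʳ e ⟩
      (u + y) + (- y + - v) ≈⟨ +-congˡ (+-comm (- y) (- v)) ⟩
      (u + y) + (- v + - y) ≈⟨ interchange u y (- v) (- y) ⟩
      (u + - v) + (y + - y) ≈⟨ +-congˡ (-‿inverseʳ y) ⟩
      (u + - v) + 0# ≈⟨ +-identityʳ _ ⟩
      u + - v ∎

    reduce-sum : ∀ a b → (a N.∸ b) N.+ b ≡ a N.+ (b N.∸ a)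
    reduce-sum N.zero b = ≡.cong (N._+ b) (N.0∸n≡0 b)
    reduce-sum (N.suc a) N.zero = ≡.refl
    reduce-sum (N.suc a) (N.suc b) = ≡.trans (N.+-suc _ b) (≡.cong N.suc (reduce-sum a b))

    reduce≈ : ∀ c → ⟦ reduce c ⟧₁ ≈ ⟦ c ⟧
    reduce≈ (a , b) = trans (⟦⟧₁≈ (reduce (a , b))) (cross (ι (a N.∸ b)) (ι (b N.∸ a)) (ι a) (ι b)
      (trans (sym (ι-+ (a N.∸ b) b)) (trans (reflexive (≡.cong ι (reduce-sum a b))) (ι-+ a (b N.∸ a)))))

    hom : Coeff ACR.-Raw-AlmostCommutative⟶ acr
    hom = record
      { ⟦_⟧ = ⟦_⟧₁
      ; +-homo = λ x@(a , b) y@(c , d) → trans (reduce≈ (a N.+ c , b N.+ d)) (trans (trans (+-cong (ι-+ a c) (-‿cong (ι-+ b d))) (+-hom (ι a) (ι b) (ι c) (ι d))) (+-cong (sym (⟦⟧₁≈ x)) (sym (⟦⟧₁≈ y))))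
      ; *-homo = λ x@(a , b) y@(c , d) → trans (reduce≈ (a N.* c N.+ b N.* d , a N.* d N.+ b N.* c)) (trans (trans (+-cong (ι-prod a b c d) (-‿cong (ι-prod a b d c))) (*-hom (ι a) (ι b) (ι c) (ι d))) (*-cong (sym (⟦⟧₁≈ x)) (sym (⟦⟧₁≈ y))))
      ; -‿homo = λ x@(a , b) → trans (⟦⟧₁≈ (b , a)) (trans (neg-hom (ι a) (ι b)) (-‿cong (sym (⟦⟧₁≈ x))))
      ; 0-homo = trans (+-congˡ -0#≈0#) (+-identityʳ 0#)
      ; 1-homo = refl }

    coeff≟ : ∀ x y → Maybe (⟦ x ⟧₁ ≈ ⟦ y ⟧₁)
    coeff≟ x@(a , b) y@(c , d) with a N.+ d N.≟ c N.+ b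
    ... | yes e = just (trans (⟦⟧₁≈ x) (trans (cross (ι a) (ι b) (ι c) (ι d) (trans (sym (ι-+ a d)) (trans (reflexive (≡.cong ι e)) (ι-+ c b)))) (sym (⟦⟧₁≈ y))))
    ... | no _ = nothing

  open Algebra.Solver.Ring Coeff acr hom coeff≟ public hiding (⟦_⟧)

-- Finite sums in a ring

module Sum (R : CommutativeRing 0ℓ 0ℓ) where
  open import Data.Nat using (_<_)
  open CommutativeRing R
  open import Algebra.Properties.CommutativeSemigroup +-commutativeSemigroup using (interchange)

  ∑ : ℕ → (ℕ → Carrier) → Carrier
  ∑ zero f = 0#
  ∑ (suc n) f = f 0 + ∑ n (λ i → f (suc i))

  ∑-cong< : ∀ n {f g} → (∀ i → i < n → f i ≈ g i) → ∑ n f ≈ ∑ n g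
  ∑-cong< zero e = refl
  ∑-cong< (suc n) e = +-cong (e 0 (s≤s z≤n)) (∑-cong< n (λ i h → e (suc i) (s≤s h)))

  ∑-cong : ∀ n {f g} → (∀ i → f i ≈ g i) → ∑ n f ≈ ∑ n g
  ∑-cong n e = ∑-cong< n (λ i _ → e i)

  ∑-zero : ∀ n {f} → (∀ i → i < n → f i ≈ 0#) → ∑ n f ≈ 0#
  ∑-zero zero e = refl
  ∑-zero (suc n) e = trans (+-cong (e 0 (s≤s z≤n)) (∑-zero n (λ i h → e (suc i) (s≤s h)))) (+-identityʳ 0#)

  ∑-+ : ∀ n f g → ∑ n (λ i → f i + g i) ≈ ∑ n f + ∑ n g
  ∑-+ zero f g = sym (+-identityʳ 0#)
  ∑-+ (suc n) f g = trans (+-congˡ (∑-+ n _ _)) (interchange _ _ _ _)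

  ∑-*ˡ : ∀ n a f → ∑ n (λ i → a * f i) ≈ a * ∑ n f
  ∑-*ˡ zero a f = sym (zeroʳ a)
  ∑-*ˡ (suc n) a f = trans (+-congˡ (∑-*ˡ n a _)) (sym (distribˡ a _ _))

  ∑-*ʳ : ∀ n a f → ∑ n (λ i → f i * a) ≈ ∑ n f * a
  ∑-*ʳ n a f = trans (∑-cong n (λ i → *-comm (f i) a)) (trans (∑-*ˡ n a f) (*-comm a _))

  ∑-append : ∀ m n f → ∑ (m N.+ n) f ≈ ∑ m f + ∑ n (λ i → f (m N.+ i))
  ∑-append zero n f = sym (+-identityˡ _)
  ∑-append (suc m) n f = trans (+-congˡ (∑-append m n _)) (sym (+-assoc _ _ _))

  ∑-blocks : ∀ m n f → ∑ (m N.* n) f ≈ ∑ m (λ a → ∑ n (λ b → f (a N.* n N.+ b)))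
  ∑-blocks zero n f = refl
  ∑-blocks (suc m) n f = trans (∑-append n (m N.* n) f) (+-congˡ (trans (∑-blocks m n _)
    (∑-cong m (λ a → ∑-cong n (λ b → reflexive (≡.cong f (≡.sym (N.+-assoc n (a N.* n) b))))))))

  ∑-swap : ∀ m n (f : ℕ → ℕ → Carrier) → ∑ m (λ i → ∑ n (λ j → f i j)) ≈ ∑ n (λ j → ∑ m (λ i → f i j))
  ∑-swap zero n f = sym (∑-zero n (λ _ _ → refl))
  ∑-swap (suc m) n f = trans (+-congˡ (∑-swap m n (λ i → f (suc i)))) (sym (∑-+ n (f 0) (λ j → ∑ m (λ i → f (suc i) j))))

-- Indicator sums, pigeonhole, digit vectors and pairs

module Counting where
  open import Data.Nat using (_≤_; _<_; _+_; _*_)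
  open import Data.Vec using (sum)
  open import Data.Vec.Properties using (lookup∘tabulate)
  open import Relation.Binary.PropositionalEquality using (refl; sym; trans; cong; cong₂)

  ⟦_⟧ : {A : Set} → Dec A → ℕ
  ⟦ yes _ ⟧ = 1
  ⟦ no _ ⟧ = 0

  ⟦⟧≤1 : {A : Set} (a : Dec A) → ⟦ a ⟧ ≤ 1
  ⟦⟧≤1 (yes _) = N.≤-refl
  ⟦⟧≤1 (no _) = z≤n

  ⟦⟧-mono : {A B : Set} (a : Dec A) (b : Dec B) → (A → B) → ⟦ a ⟧ ≤ ⟦ b ⟧
  ⟦⟧-mono (no _) b f = z≤n
  ⟦⟧-mono (yes x) (yes _) f = N.≤-refl
  ⟦⟧-mono (yes x) (no ¬b) f = ⊥-elim (¬b (f x))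

  ⟦⟧-yes : {A : Set} (a : Dec A) → A → ⟦ a ⟧ ≡ 1
  ⟦⟧-yes (yes _) _ = refl
  ⟦⟧-yes (no ¬a) a = ⊥-elim (¬a a)

  ⟦⟧-no : {A : Set} (a : Dec A) → ¬ A → ⟦ a ⟧ ≡ 0
  ⟦⟧-no (yes a) ¬a = ⊥-elim (¬a a)
  ⟦⟧-no (no _) _ = refl

  module _ {A : Set} where

    Σ[_] : List A → (A → ℕ) → ℕ
    Σ[ [] ] f = 0
    Σ[ x ∷ xs ] f = f x + Σ[ xs ] f

    Σ-mono : ∀ {f g : A → ℕ} xs → All (λ x → f x ≤ g x) xs → Σ[ xs ] f ≤ Σ[ xs ] g
    Σ-mono [] [] = z≤n
    Σ-mono (x ∷ xs) (h ∷ hs) = N.+-mono-≤ h (Σ-mono xs hs)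

    Σ-const : ∀ c xs → Σ[ xs ] (λ _ → c) ≡ length xs * c
    Σ-const c [] = refl
    Σ-const c (x ∷ xs) = cong (c +_) (Σ-const c xs)

    Σ-+ : ∀ (f g : A → ℕ) xs → Σ[ xs ] (λ x → f x + g x) ≡ Σ[ xs ] f + Σ[ xs ] g
    Σ-+ f g [] = refl
    Σ-+ f g (x ∷ xs) = trans (cong (f x + g x +_) (Σ-+ f g xs)) (lem (f x) (g x) _ _)
      where
      lem : ∀ a b c d → a + b + (c + d) ≡ (a + c) + (b + d)
      lem = solve-∀

    Σ-*ˡ : ∀ c (f : A → ℕ) xs → Σ[ xs ] (λ x → c * f x) ≡ c * Σ[ xs ] f
    Σ-*ˡ c f [] = sym (N.*-zeroʳ c)
    Σ-*ˡ c f (x ∷ xs) = trans (cong (c * f x +_) (Σ-*ˡ c f xs)) (sym (N.*-distribˡ-+ c (f x) _))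

    Σ-cong : ∀ {f g : A → ℕ} xs → (∀ x → f x ≡ g x) → Σ[ xs ] f ≡ Σ[ xs ] g
    Σ-cong [] e = refl
    Σ-cong (x ∷ xs) e = cong₂ _+_ (e x) (Σ-cong xs e)

    length-filter : ∀ {P : A → Set} (P? : Decidable P) xs → length (filter P? xs) ≡ Σ[ xs ] (λ x → ⟦ P? x ⟧)
    length-filter P? [] = refl
    length-filter P? (x ∷ xs) with P? x
    ... | yes _ = cong suc (length-filter P? xs)
    ... | no _ = length-filter P? xs

  Σ-swap : ∀ {A B : Set} (f : A → B → ℕ) xs ys → Σ[ xs ] (λ x → Σ[ ys ] (λ y → f x y)) ≡ Σ[ ys ] (λ y → Σ[ xs ] (λ x → f x y))
  Σ-swap f [] ys = sym (trans (Σ-const 0 ys) (N.*-zeroʳ (length ys)))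
  Σ-swap f (x ∷ xs) ys = trans (cong (Σ[ ys ] (f x) +_) (Σ-swap f xs ys)) (sym (Σ-+ (f x) (λ y → Σ[ xs ] (λ x → f x y)) ys))

  module _ {A : Set} (_~_ : A → A → Set) (~-sym : ∀ {x y} → x ~ y → y ~ x) (~-trans : ∀ {x y z} → x ~ y → y ~ z → x ~ z) where

    remove : ∀ {x ys} → Any (x ~_) ys → List A
    remove {ys = y ∷ ys} (here _) = ys
    remove {ys = y ∷ ys} (there m) = y ∷ remove m

    length-remove : ∀ {x ys} (m : Any (x ~_) ys) → length ys ≡ suc (length (remove m))
    length-remove (here _) = refl
    length-remove (there m) = cong suc (length-remove m)

    keep : ∀ {x z ys} (m : Any (x ~_) ys) → ¬ x ~ z → Any (z ~_) ys → Any (z ~_) (remove m)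
    keep (here e) n (here e′) = ⊥-elim (n (~-trans e (~-sym e′)))
    keep (here e) n (there m′) = m′
    keep (there m) n (here e′) = here e′
    keep (there m) n (there m′) = there (keep m n m′)

    -- Each entry of `xs` deletes one partner from `ys`. By `keep` later entries still find a
    -- partner: losing it would make two entries of `xs` equivalent.
    length-≤ : ∀ xs ys → AllPairs (λ x y → ¬ x ~ y) xs → All (λ x → Any (x ~_) ys) xs → length xs ≤ length ys
    length-≤ [] ys _ _ = z≤n
    length-≤ (x ∷ xs) ys (n ∷ ap) (m ∷ ms) = s≤s (length-≤ xs (remove m) ap (All.zipWith (λ { (nz , a) → keep m nz a }) (n , ms))) ⟫ N.≤-reflexive (sym (length-remove m))

  -- Base-d digits, least significant first; they enumerate the d^k exponent vectors with entries
  -- below d.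
  digits : (d : ℕ) .{{_ : NonZero d}} → ∀ k → ℕ → Vec ℕ k
  digits d zero e = []
  digits d (suc k) e = e N.% d ∷ digits d k (e N./ d)

  digits-sum : ∀ d .{{_ : NonZero d}} k e → sum (digits d k e) ≤ k * d
  digits-sum d zero e = z≤n
  digits-sum d (suc k) e = N.+-mono-≤ (N.<⇒≤ (N.m%n<n e d)) (digits-sum d k (e N./ d))

  digits-< : ∀ d .{{_ : NonZero d}} k e t → lookup (digits d k e) t < d
  digits-< d (suc k) e zero = N.m%n<n e d
  digits-< d (suc k) e (suc t) = digits-< d k (e N./ d) t

  digits-distinct : ∀ d .{{_ : NonZero d}} k {i j} → i ≢ j → i < d N.^ k → j < d N.^ k → ∃[ t ] lookup (digits d k i) t ≢ lookup (digits d k j) t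
  digits-distinct d zero {zero} {zero} i≢j _ _ = ⊥-elim (i≢j refl)
  digits-distinct d zero {zero} {suc j} i≢j _ (s≤s ())
  digits-distinct d zero {suc i} {j} i≢j (s≤s ()) _
  digits-distinct d (suc k) {i} {j} i≢j i< j< with i N.% d N.≟ j N.% d
  ... | no ne = zero , ne
  ... | yes e with digits-distinct d k {i N./ d} {j N./ d} (λ q → i≢j (trans (N.m≡m%n+[m/n]*n i d) (trans (cong₂ (λ a b → a + b * d) e q) (sym (N.m≡m%n+[m/n]*n j d)))))
         (N.m<n*o⇒m/o<n (N.<-≤-trans i< (N.≤-reflexive (N.*-comm d (d N.^ k))))) (N.m<n*o⇒m/o<n (N.<-≤-trans j< (N.≤-reflexive (N.*-comm d (d N.^ k)))))
  ... | t , ne = suc t , ne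

  pairs : ℕ → List (ℕ × ℕ)
  pairs zero = []
  pairs (suc n) = map (_, n) (upTo n) ++ pairs n

  length-pairs : ∀ n → 2 * length (pairs n) + n ≡ n * n
  length-pairs zero = refl
  length-pairs (suc n) = trans (cong (λ l → 2 * l + suc n) (trans (length-++ (map (_, n) (upTo n))) (cong (_+ length (pairs n)) (trans (length-map (_, n) (upTo n)) (length-applyUpTo _ n)))))
    (trans (lem n (length (pairs n))) (trans (cong (λ t → suc (n + n) + t) (length-pairs n)) (lem′ n)))
    where
    lem : ∀ n l → 2 * (n + l) + suc n ≡ suc (n + n) + (2 * l + n)
    lem = solve-∀
    lem′ : ∀ n → suc (n + n) + n * n ≡ suc n * suc n
    lem′ = solve-∀

  pairs-bounds : ∀ n → All (λ q → proj₁ q < proj₂ q × proj₂ q < n) (pairs n)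
  pairs-bounds zero = []
  pairs-bounds (suc n) = AllP.++⁺ (AllP.map⁺ (AllP.applyUpTo⁺₁ _ n (λ {i} i<n → i<n , N.≤-refl))) (All.map (λ (a , b) → a , N.m<n⇒m<1+n b) (pairs-bounds n))

  pairs-distinct : ∀ n → AllPairs _≢_ (pairs n)
  pairs-distinct zero = []
  pairs-distinct (suc n) = AP.++⁺ (AP.map⁺ (AP.applyUpTo⁺₁ _ n (λ i<j j<n e → N.<⇒≢ i<j (cong proj₁ e)))) (pairs-distinct n)
    (AllP.map⁺ (AllP.applyUpTo⁺₁ _ n (λ i<n → All.map (λ { (_ , b) refl → N.<-irrefl refl b }) (pairs-bounds n))))

open Counting

-- A truncated sieve for prime values of d N + d + 1

module ShiftedProducts where
  open import Data.List.Membership.Propositional using (_∈_)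

  -- The sieve works with densities through these axioms only; `ℚ-field` is the model in which it is
  -- finally run. Strict positivity is expressed as `¬ x ≤ 0#`.
  record OrderedField : Set₁ where
    field
      commutativeRing : CommutativeRing 0ℓ 0ℓ
    open CommutativeRing commutativeRing public hiding (zero)
    infix 4 _≤_
    field
      _≤_ : Carrier → Carrier → Set
      ≤-reflexive : ∀ {x y} → x ≈ y → x ≤ y
      ≤-trans : ∀ {x y z} → x ≤ y → y ≤ z → x ≤ z
      ≤-total : ∀ x y → x ≤ y ⊎ y ≤ x
      +-mono-≤ : ∀ {x y u v} → x ≤ y → u ≤ v → x + u ≤ y + v
      *-nonneg : ∀ {x y} → 0# ≤ x → 0# ≤ y → 0# ≤ x * y
      0≤1 : 0# ≤ 1#
      1≰0 : ¬ 1# ≤ 0#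
      inverse : ∀ x → ¬ x ≤ 0# → ∃[ y ] x * y ≈ 1#

  ℚ-field : OrderedField
  ℚ-field = record
    { commutativeRing = ℚ.+-*-commutativeRing
    ; _≤_ = ℚ._≤_ ; ≤-reflexive = ℚ.≤-reflexive ; ≤-trans = ℚ.≤-trans ; ≤-total = ℚ.≤-total ; +-mono-≤ = ℚ.+-mono-≤
    ; *-nonneg = λ {x} {y} p q → ℚ.nonNegative⁻¹ (x ℚ.* y) {{ℚ.nonNeg*nonNeg⇒nonNeg x {{ℚ.nonNegative p}} y {{ℚ.nonNegative q}}}}
    ; 0≤1 = ℚ.nonNegative⁻¹ ℚ.1ℚ
    ; 1≰0 = λ h → ℚ.<-irrefl ≡.refl (ℚ.<-≤-trans (ℚ.positive⁻¹ ℚ.1ℚ) h)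
    ; inverse = λ x h → let nz = ℚ.≢-nonZero (λ e → h (ℚ.≤-reflexive e)) in ℚ.1/_ x {{nz}} , ℚ.*-inverseʳ x {{nz}} }

  module OrderTheory (O : OrderedField) where
    open OrderedField O public
    open Mult semiring public using (×-homo-+; ×1-homo-*) renaming (_×_ to _×ₙ_)
    open Exp semiring public using (_^_; ^-congˡ; ^-homo-*; ^-assocʳ)
    open RingProps ring public using (-0#≈0#)
    module S = PSolver commutativeRing
    open Sum commutativeRing public

    ≤-refl : ∀ {x} → x ≤ x
    ≤-refl = ≤-reflexive refl

    preorder : Preorder 0ℓ 0ℓ 0ℓ
    preorder = record { Carrier = Carrier ; _≈_ = _≈_ ; _≲_ = _≤_ ; isPreorder = record { isEquivalence = isEquivalence ; reflexive = ≤-reflexive ; trans = ≤-trans } }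

    module ≤R = PreorderReasoning preorder
    module ≈R = Reasoning setoid

    infixr 6 _⋙_
    _⋙_ : ∀ {x y z} → x ≤ y → y ≤ z → x ≤ z
    _⋙_ = ≤-trans

    +-monoˡ : ∀ {x y} z → x ≤ y → x + z ≤ y + z
    +-monoˡ z h = +-mono-≤ h ≤-refl

    +-monoʳ : ∀ {x y} z → x ≤ y → z + x ≤ z + y
    +-monoʳ z h = +-mono-≤ ≤-refl h

    sub-nonneg : ∀ {x y} → x ≤ y → 0# ≤ y + - x
    sub-nonneg {x} {y} h = ≤-reflexive (sym (-‿inverseʳ x)) ⋙ +-monoˡ (- x) h

    nonneg-sub : ∀ {x y} → 0# ≤ y + - x → x ≤ y
    nonneg-sub {x} {y} h = ≤-reflexive (sym (+-identityˡ x)) ⋙ +-monoˡ x h ⋙ ≤-reflexive (S.solve 2 (λ x y → y S.:+ S.:- x S.:+ x S.:= y) refl x y)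

    -‿mono : ∀ {x y} → x ≤ y → - y ≤ - x
    -‿mono {x} {y} h = nonneg-sub (sub-nonneg h ⋙ ≤-reflexive (S.solve 2 (λ x y → y S.:+ S.:- x S.:= S.:- x S.:+ S.:- (S.:- y)) refl x y))

    *-monoʳ : ∀ {x y z} → 0# ≤ z → x ≤ y → z * x ≤ z * y
    *-monoʳ {x} {y} {z} hz h = nonneg-sub (*-nonneg hz (sub-nonneg h) ⋙ ≤-reflexive (S.solve 3 (λ x y z → z S.:* (y S.:+ S.:- x) S.:= z S.:* y S.:+ S.:- (z S.:* x)) refl x y z))

    *-monoˡ : ∀ {x y z} → 0# ≤ z → x ≤ y → x * z ≤ y * z
    *-monoˡ hz h = ≤-reflexive (*-comm _ _) ⋙ *-monoʳ hz h ⋙ ≤-reflexive (*-comm _ _)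

    *-mono : ∀ {x y u v} → 0# ≤ x → x ≤ y → 0# ≤ u → u ≤ v → x * u ≤ y * v
    *-mono hx h hu h′ = *-monoˡ hu h ⋙ *-monoʳ (hx ⋙ h) h′

    +-nonneg : ∀ {x y} → 0# ≤ x → 0# ≤ y → 0# ≤ x + y
    +-nonneg h h′ = ≤-reflexive (sym (+-identityʳ 0#)) ⋙ +-mono-≤ h h′

    ≤-+ʳ : ∀ {x y} → 0# ≤ y → x ≤ x + y
    ≤-+ʳ {x} h = ≤-reflexive (sym (+-identityʳ x)) ⋙ +-monoʳ x h

    ≤-+ˡ : ∀ {x y} → 0# ≤ y → x ≤ y + x
    ≤-+ˡ h = (≤-+ʳ h) ⋙ ≤-reflexive (+-comm _ _)

    +-cancel : ∀ {x y} z → x + z ≤ y + z → x ≤ y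
    +-cancel {x} {y} z h = nonneg-sub (sub-nonneg h ⋙ ≤-reflexive (S.solve 3 (λ x y z → (y S.:+ z) S.:+ S.:- (x S.:+ z) S.:= y S.:+ S.:- x) refl x y z))

    ^-nonneg : ∀ {x} n → 0# ≤ x → 0# ≤ x ^ n
    ^-nonneg zero h = 0≤1
    ^-nonneg (suc n) h = *-nonneg h (^-nonneg n h)

    ^-mono : ∀ {x y} n → 0# ≤ x → x ≤ y → x ^ n ≤ y ^ n
    ^-mono zero hx h = ≤-refl
    ^-mono (suc n) hx h = *-mono hx h (^-nonneg n hx) (^-mono n hx h)

    1≤^ : ∀ {x} n → 1# ≤ x → 1# ≤ x ^ n
    1≤^ zero h = ≤-refl
    1≤^ (suc n) h = ≤-reflexive (sym (*-identityʳ 1#)) ⋙ (*-mono 0≤1 h 0≤1 (1≤^ n h))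

    ι : ℕ → Carrier
    ι n = n ×ₙ 1#

    ι-nonneg : ∀ n → 0# ≤ ι n
    ι-nonneg zero = ≤-refl
    ι-nonneg (suc n) = +-nonneg 0≤1 (ι-nonneg n)

    ι-+ : ∀ m n → ι (m N.+ n) ≈ ι m + ι n
    ι-+ = ×-homo-+ 1#

    ι-* : ∀ m n → ι (m N.* n) ≈ ι m * ι n
    ι-* = ×1-homo-*

    ι-1 : ι 1 ≈ 1#
    ι-1 = +-identityʳ 1#

    ι-^ : ∀ m n → ι (m N.^ n) ≈ ι m ^ n
    ι-^ m zero = ι-1
    ι-^ m (suc n) = trans (ι-* m (m N.^ n)) (*-congˡ (ι-^ m n))

    ι-mono : ∀ {m n} → m N.≤ n → ι m ≤ ι n
    ι-mono {m} {n} h = (≤-+ʳ (ι-nonneg (n N.∸ m))) ⋙ ≤-reflexive (trans (sym (ι-+ m (n N.∸ m))) (reflexive (≡.cong ι (N.m+[n∸m]≡n h))))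

    ι-reflect : ∀ {m n} → ι m ≤ ι n → m N.≤ n
    ι-reflect {m} {n} h with N.≤-<-connex m n
    ... | inj₁ le = le
    ... | inj₂ lt = ⊥-elim (1≰0 (+-cancel (ι n) (ι-mono lt ⋙ h ⋙ ≤-reflexive (sym (+-identityˡ (ι n))))))

    ι-pos : ∀ n → ¬ ι (suc n) ≤ 0#
    ι-pos n h = 1≰0 ((≤-+ʳ (ι-nonneg n)) ⋙ h)

    positive-inverse : ∀ {x y} → 0# ≤ x → x * y ≈ 1# → 0# ≤ y
    positive-inverse {x} {y} hx e with ≤-total 0# y
    ... | inj₁ h = h
    ... | inj₂ h = ⊥-elim (1≰0 (≤-reflexive (sym e) ⋙ *-monoʳ hx h ⋙ ≤-reflexive (zeroʳ x)))

    inv : ℕ → Carrier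
    inv zero = 0#
    inv (suc n) = proj₁ (inverse (ι (suc n)) (ι-pos n))

    inv-spec : ∀ n → ι (suc n) * inv (suc n) ≈ 1#
    inv-spec n = proj₂ (inverse (ι (suc n)) (ι-pos n))

    inv-nonneg : ∀ n → 0# ≤ inv n
    inv-nonneg zero = ≤-refl
    inv-nonneg (suc n) = positive-inverse (ι-nonneg (suc n)) (inv-spec n)

    *-cancel : ∀ {x y} a b → a * b ≈ 1# → 0# ≤ b → a * x ≤ a * y → x ≤ y
    *-cancel {x} {y} a b e hb h = ≤-reflexive (sym (unit x)) ⋙ *-monoʳ hb h ⋙ ≤-reflexive (unit y)
      where
      unit : ∀ x → b * (a * x) ≈ x
      unit x = trans (S.solve 3 (λ a b x → b S.:* (a S.:* x) S.:= (a S.:* b) S.:* x) refl a b x) (trans (*-congʳ e) (*-identityˡ x))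

    ι-cancel : ∀ {x y} n → ι (suc n) * x ≤ ι (suc n) * y → x ≤ y
    ι-cancel n = *-cancel (ι (suc n)) (inv (suc n)) (inv-spec n) (inv-nonneg (suc n))

    ≈-cancel : ∀ {x y} a b → a * b ≈ 1# → a * x ≈ a * y → x ≈ y
    ≈-cancel {x} {y} a b e h = trans (sym (unit x)) (trans (*-congˡ h) (unit y))
      where
      unit : ∀ x → b * (a * x) ≈ x
      unit x = trans (S.solve 3 (λ a b x → b S.:* (a S.:* x) S.:= (a S.:* b) S.:* x) refl a b x) (trans (*-congʳ e) (*-identityˡ x))

    ∑-mono : ∀ n {f g} → (∀ i → i N.< n → f i ≤ g i) → ∑ n f ≤ ∑ n g
    ∑-mono zero h = ≤-refl
    ∑-mono (suc n) h = +-mono-≤ (h 0 (s≤s z≤n)) (∑-mono n (λ i l → h (suc i) (s≤s l)))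

    ∑-nonneg : ∀ n {f} → (∀ i → 0# ≤ f i) → 0# ≤ ∑ n f
    ∑-nonneg zero h = ≤-refl
    ∑-nonneg (suc n) h = +-nonneg (h 0) (∑-nonneg n (λ i → h (suc i)))

    ∑-extend : ∀ {m n} f → (∀ i → 0# ≤ f i) → m N.≤ n → ∑ m f ≤ ∑ n f
    ∑-extend {m} {n} f h le = (≤-+ʳ (∑-nonneg (n N.∸ m) (λ i → h (m N.+ i)))) ⋙ ≤-reflexive (trans (sym (∑-append m (n N.∸ m) f)) (reflexive (≡.cong (λ k → ∑ k f) (N.m+[n∸m]≡n le))))

    ∑-const : ∀ n c → ∑ n (λ _ → c) ≈ ι n * c
    ∑-const zero c = sym (zeroˡ c)
    ∑-const (suc n) c = trans (+-cong (sym (*-identityˡ c)) (∑-const n c)) (sym (distribʳ c 1# (ι n)))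

  coprime-inverse : ∀ {D q} → Coprime D q → ∃[ e ] ∃[ j ] ∃[ k ] D N.* e N.+ j N.* q ≡ 1 N.+ k N.* q
  coprime-inverse {D} {q} c with coprime-Bézout c
  ... | Bézout.+- x y e = x , 0 , y , ≡.trans (N.+-identityʳ _) (≡.trans (N.*-comm D x) (≡.sym e))
  -- Here x D ≡ -1 modulo q, so (x D)² ≡ 1 and the inverse of D is x (x D).
  ... | Bézout.-+ x y e = x N.* (x N.* D) , y , x N.* D N.* y , ≡.trans (≡.cong (D N.* (x N.* (x N.* D)) N.+_) (≡.sym e))
      (≡.trans (lem₁ D x) (≡.cong (1 N.+_) (≡.trans (≡.cong (x N.* D N.*_) e) (≡.sym (N.*-assoc (x N.* D) y q)))))
    where
    lem₁ : ∀ D x → D N.* (x N.* (x N.* D)) N.+ (1 N.+ x N.* D) ≡ 1 N.+ x N.* D N.* (1 N.+ x N.* D)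
    lem₁ = solve-∀

  -- Periodic functions of two variables and their sums over boxes

  module SieveTheory (O : OrderedField) where
    open OrderTheory O

    Periodic : ℕ → (ℕ → Carrier) → Set
    Periodic q f = ∀ n → f (q N.+ n) ≈ f n

    periodic-* : ∀ {q f} → Periodic q f → ∀ k n → f (k N.* q N.+ n) ≈ f n
    periodic-* h zero n = refl
    periodic-* {q} {f} h (suc k) n = trans (reflexive (≡.cong f (N.+-assoc q (k N.* q) n))) (trans (h (k N.* q N.+ n)) (periodic-* h k n))

    shift-period : ∀ {q f} → Periodic q f → ∀ c → ∑ q (λ i → f (c N.+ i)) ≈ ∑ q f
    shift-period h zero = refl
    shift-period {q} {f} h (suc c) = trans (+-cancelˡ′ (trans left (sym right))) (shift-period h c)
      where
      g : ℕ → Carrier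
      g i = f (c N.+ i)
      left : g 0 + ∑ q (λ i → f (suc c N.+ i)) ≈ ∑ (suc q) g
      left = +-congˡ (∑-cong q (λ i → reflexive (≡.cong f (≡.sym (N.+-suc c i)))))
      right : g 0 + ∑ q g ≈ ∑ (suc q) g
      right = trans (+-comm _ _) (sym (trans (reflexive (≡.cong (λ n → ∑ n g) (N.+-comm 1 q))) (trans (∑-append q 1 g)
        (+-congˡ (trans (+-identityʳ _) (trans (reflexive (≡.cong f (lem c q))) (h (c N.+ 0))))))))
        where
        lem : ∀ c q → c N.+ (q N.+ 0) ≡ q N.+ (c N.+ 0)
        lem = solve-∀
      +-cancelˡ′ : ∀ {a x y} → a + x ≈ a + y → x ≈ y
      +-cancelˡ′ {a} {x} {y} e = trans (S.solve 2 (λ a x → x S.:= (a S.:+ x) S.:+ S.:- a) refl a x) (trans (+-congʳ e) (S.solve 2 (λ a x → (a S.:+ x) S.:+ S.:- a S.:= x) refl a y))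

    -- The sum over a full period along a progression with step D does not change under b ↦ b + D, hence
    -- not under b ↦ b + 1 when D is invertible modulo q; average over b.
    progression : ∀ {D q f} → Coprime D q → Periodic q f → ∀ b → ∑ q (λ a → f (a N.* D N.+ b)) ≈ ∑ q f
    progression {D} {zero} {f} c h b = refl
    progression {D} {q@(suc q-1)} {f} c h b = trans (constant b) (≈-cancel (ι q) (inv q) (inv-spec q-1) average)
      where
      S′ : ℕ → Carrier
      S′ b = ∑ q (λ a → f (a N.* D N.+ b))
      step-D : ∀ b → S′ (D N.+ b) ≈ S′ b
      step-D b = trans (∑-cong q (λ a → reflexive (≡.cong f (lem a D b)))) (shift-period {q} {λ a → f (a N.* D N.+ b)}
          (λ n → trans (reflexive (≡.cong f (lem′ q n D b))) (periodic-* h D (n N.* D N.+ b))) 1)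
        where
        lem : ∀ a D b → a N.* D N.+ (D N.+ b) ≡ (1 N.+ a) N.* D N.+ b
        lem = solve-∀
        lem′ : ∀ q n D b → (q N.+ n) N.* D N.+ b ≡ D N.* q N.+ (n N.* D N.+ b)
        lem′ = solve-∀
      step-eD : ∀ e b → S′ (D N.* e N.+ b) ≈ S′ b
      step-eD zero b = reflexive (≡.cong (λ t → S′ (t N.+ b)) (N.*-zeroʳ D))
      step-eD (suc e) b = trans (reflexive (≡.cong S′ (≡.trans (≡.cong (N._+ b) (N.*-suc D e)) (N.+-assoc D (D N.* e) b)))) (trans (step-D _) (step-eD e b))
      step-q : ∀ k b → S′ (k N.* q N.+ b) ≈ S′ b
      step-q k b = ∑-cong q (λ a → trans (reflexive (≡.cong f (lem (a N.* D) (k N.* q) b))) (periodic-* h k (a N.* D N.+ b)))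
        where
        lem : ∀ a k b → a N.+ (k N.+ b) ≡ k N.+ (a N.+ b)
        lem = solve-∀
      step : ∀ b → S′ (suc b) ≈ S′ b
      step b with coprime-inverse c
      ... | e , j , k , eq = trans (sym (step-q k (suc b))) (trans (reflexive (≡.cong S′ (≡.trans (lem (k N.* q) b) (≡.trans (≡.cong (N._+ b) (≡.sym eq)) (N.+-assoc (D N.* e) (j N.* q) b)))))
          (trans (step-eD e (j N.* q N.+ b)) (step-q j b)))
        where
        lem : ∀ k b → k N.+ suc b ≡ 1 N.+ k N.+ b
        lem = solve-∀
      constant : ∀ b → S′ b ≈ S′ 0
      constant zero = refl
      constant (suc b) = trans (step b) (constant b)
      average : ι q * S′ 0 ≈ ι q * ∑ q f
      average = trans (sym (∑-const q (S′ 0))) (trans (∑-cong q (λ b → sym (constant b))) (trans (∑-swap q q (λ b a → f (a N.* D N.+ b)))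
        (trans (∑-cong q (λ a → shift-period h (a N.* D))) (∑-const q _))))

    -- A nonnegative function of two residues modulo D together with its mean μ over the D × D
    -- square. Knowing 0 ≤ μ ≤ 1 lets box errors be stated by areas alone.
    record Per (D : ℕ) (μ : Carrier) (F : ℕ → ℕ → Carrier) : Set where
      field
        nonneg : ∀ n m → 0# ≤ F n m
        shift₁ : ∀ m → Periodic D (λ n → F n m)
        shift₂ : ∀ n → Periodic D (F n)
        total : ∑ D (λ n → ∑ D (F n)) ≈ ι D * ι D * μ
        0≤μ : 0# ≤ μ
        μ≤1 : μ ≤ 1#
    open Per

    Per-one : Per 1 1# (λ _ _ → 1#)
    Per-one = record { nonneg = λ _ _ → 0≤1 ; shift₁ = λ _ _ → refl ; shift₂ = λ _ _ → refl
      ; total = trans (+-identityʳ _) (trans (+-identityʳ _) (sym (trans (*-identityʳ _) (trans (*-cong ι-1 ι-1) (*-identityʳ 1#))))) ; 0≤μ = 0≤1 ; μ≤1 = ≤-refl }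

    -- Independence for coprime moduli. In blocks n = a D + b, F sees only b, while for fixed b the
    -- points a D + b run through all residues modulo q, so `progression` evaluates the sum of h.
    Per-* : ∀ {D q μ ρ F h} → Coprime D q → Per D μ F → Per q ρ h → Per (D N.* q) (μ * ρ) (λ n m → F n m * h n m)
    Per-* {D} {q} {μ} {ρ} {F} {h} c P Q = record
      { nonneg = λ n m → *-nonneg (nonneg P n m) (nonneg Q n m)
      ; shift₁ = λ m n → *-cong (trans (reflexive (≡.cong (λ t → F (t N.+ n) m) (N.*-comm D q))) (periodic-* (shift₁ P m) q n)) (periodic-* (shift₁ Q m) D n)
      ; shift₂ = λ n m → *-cong (trans (reflexive (≡.cong (λ t → F n (t N.+ m)) (N.*-comm D q))) (periodic-* (shift₂ P n) q m)) (periodic-* (shift₂ Q n) D m)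
      ; total = tot
      ; 0≤μ = *-nonneg (0≤μ P) (0≤μ Q)
      ; μ≤1 = *-mono (0≤μ P) (μ≤1 P) (0≤μ Q) (μ≤1 Q) ⋙ ≤-reflexive (*-identityʳ 1#) }
      where
      inner : ∀ b b′ → ∑ q (λ a → ∑ q (λ a′ → h (a N.* D N.+ b) (a′ N.* D N.+ b′))) ≈ ι q * ι q * ρ
      inner b b′ = trans (∑-cong q (λ a → progression c (shift₂ Q (a N.* D N.+ b)) b′)) (trans (∑-swap q q (λ a a′ → h (a N.* D N.+ b) a′))
        (trans (∑-cong q (λ a′ → progression c (shift₁ Q a′) b)) (trans (∑-swap q q (λ a′ a → h a a′)) (total Q))))
      tot : ∑ (D N.* q) (λ n → ∑ (D N.* q) (λ m → F n m * h n m)) ≈ ι (D N.* q) * ι (D N.* q) * (μ * ρ)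
      tot = begin
        ∑ (D N.* q) (λ n → ∑ (D N.* q) (λ m → F n m * h n m))
          ≡⟨ ≡.cong (λ t → ∑ t (λ n → ∑ t (λ m → F n m * h n m))) (N.*-comm D q) ⟩
        ∑ (q N.* D) (λ n → ∑ (q N.* D) (λ m → F n m * h n m))
          ≈⟨ trans (∑-blocks q D _) (∑-cong q (λ a → ∑-cong D (λ b → ∑-blocks q D _))) ⟩
        ∑ q (λ a → ∑ D (λ b → ∑ q (λ a′ → ∑ D (λ b′ → F (a N.* D N.+ b) (a′ N.* D N.+ b′) * h (a N.* D N.+ b) (a′ N.* D N.+ b′)))))
          ≈⟨ ∑-cong q (λ a → ∑-cong D (λ b → ∑-cong q (λ a′ → ∑-cong D (λ b′ → *-congʳ (trans (periodic-* (shift₁ P (a′ N.* D N.+ b′)) a b) (periodic-* (shift₂ P b) a′ b′)))))) ⟩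
        ∑ q (λ a → ∑ D (λ b → ∑ q (λ a′ → ∑ D (λ b′ → F b b′ * h (a N.* D N.+ b) (a′ N.* D N.+ b′)))))
          ≈⟨ trans (∑-cong q (λ a → ∑-cong D (λ b → ∑-swap q D (λ a′ b′ → F b b′ * h (a N.* D N.+ b) (a′ N.* D N.+ b′))))) (trans (∑-swap q D (λ a b → ∑ D (λ b′ → ∑ q (λ a′ → F b b′ * h (a N.* D N.+ b) (a′ N.* D N.+ b′)))))
               (∑-cong D (λ b → ∑-swap q D (λ a b′ → ∑ q (λ a′ → F b b′ * h (a N.* D N.+ b) (a′ N.* D N.+ b′)))))) ⟩
        ∑ D (λ b → ∑ D (λ b′ → ∑ q (λ a → ∑ q (λ a′ → F b b′ * h (a N.* D N.+ b) (a′ N.* D N.+ b′)))))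
          ≈⟨ ∑-cong D (λ b → ∑-cong D (λ b′ → trans (∑-cong q (λ a → ∑-*ˡ q (F b b′) (λ a′ → h (a N.* D N.+ b) (a′ N.* D N.+ b′)))) (trans (∑-*ˡ q (F b b′) _) (*-congˡ (inner b b′))))) ⟩
        ∑ D (λ b → ∑ D (λ b′ → F b b′ * (ι q * ι q * ρ)))
          ≈⟨ trans (∑-cong D (λ b → ∑-*ʳ D (ι q * ι q * ρ) (F b))) (∑-*ʳ D (ι q * ι q * ρ) (λ b → ∑ D (F b))) ⟩
        ∑ D (λ b → ∑ D (F b)) * (ι q * ι q * ρ) ≈⟨ *-congʳ (total P) ⟩
        (ι D * ι D * μ) * (ι q * ι q * ρ)
          ≈⟨ S.solve 4 (λ D q m r → (D S.:* D S.:* m) S.:* (q S.:* q S.:* r) S.:= (D S.:* q) S.:* (D S.:* q) S.:* (m S.:* r)) refl (ι D) (ι q) μ ρ ⟩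
        (ι D * ι q) * (ι D * ι q) * (μ * ρ) ≈⟨ *-congʳ (*-cong (ι-* D q) (ι-* D q)) ⟨
        ι (D N.* q) * ι (D N.* q) * (μ * ρ) ∎
        where open ≈R

    Box : ℕ → ℕ → (ℕ → ℕ → Carrier) → Carrier
    Box X Y F = ∑ X (λ n → ∑ Y (F n))

    Box-mono : ∀ {X X′ Y Y′ F} → (∀ n m → 0# ≤ F n m) → X N.≤ X′ → Y N.≤ Y′ → Box X Y F ≤ Box X′ Y′ F
    Box-mono {X} {X′} {Y} {Y′} {F} h le le′ = ∑-mono X (λ n _ → ∑-extend (F n) (h n) le′) ⋙ ∑-extend (λ n → ∑ Y′ (F n)) (λ n → ∑-nonneg Y′ (h n)) le

    Box-period : ∀ {D μ F} → Per D μ F → ∀ a b → Box (a N.* D) (b N.* D) F ≈ ι (a N.* D) * ι (b N.* D) * μ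
    Box-period {D} {μ} {F} P a b = begin
      ∑ (a N.* D) (λ n → ∑ (b N.* D) (F n)) ≈⟨ trans (∑-blocks a D _) (∑-cong a (λ i → ∑-cong D (λ n → ∑-blocks b D _))) ⟩
      ∑ a (λ i → ∑ D (λ n → ∑ b (λ j → ∑ D (λ m → F (i N.* D N.+ n) (j N.* D N.+ m)))))
        ≈⟨ ∑-cong a (λ i → ∑-cong D (λ n → ∑-cong b (λ j → ∑-cong D (λ m → trans (periodic-* (shift₁ P (j N.* D N.+ m)) i n) (periodic-* (shift₂ P n) j m))))) ⟩
      ∑ a (λ i → ∑ D (λ n → ∑ b (λ j → ∑ D (F n)))) ≈⟨ trans (∑-cong a (λ i → trans (∑-cong D (λ n → ∑-const b (∑ D (F n)))) (∑-*ˡ D (ι b) (λ n → ∑ D (F n))))) (∑-const a _) ⟩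
      ι a * (ι b * ∑ D (λ n → ∑ D (F n))) ≈⟨ *-congˡ (*-congˡ (total P)) ⟩
      ι a * (ι b * (ι D * ι D * μ)) ≈⟨ S.solve 4 (λ a b D m → a S.:* (b S.:* (D S.:* D S.:* m)) S.:= (a S.:* D) S.:* (b S.:* D) S.:* m) refl (ι a) (ι b) (ι D) μ ⟩
      (ι a * ι D) * (ι b * ι D) * μ ≈⟨ *-congʳ (*-cong (ι-* a D) (ι-* b D)) ⟨
      ι (a N.* D) * ι (b N.* D) * μ ∎
      where open ≈R

    infix 4 _≈[_]±_
    _≈[_]±_ : Carrier → Carrier → Carrier → Set
    x ≈[ e ]± y = (x ≤ y + e) × (y ≤ x + e)

    -- Bounds the area between the inner and the outer rectangle with sides divisible by D around X
    -- × Y.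
    error : ℕ → ℕ → ℕ → ℕ
    error X Y D = D N.* (X N.+ Y N.+ D)

    -- Box sum and main term both grow with the sides and agree on rectangles with sides divisible
    -- by D; hence both lie between their common values on the inner and on the outer rectangle.
    Box-error : ∀ {D μ F} .{{_ : NonZero D}} → Per D μ F → ∀ X Y → Box X Y F ≈[ ι (error X Y D) ]± (ι X * ι Y * μ)
    Box-error {D} {μ} {F} P X Y = upper , lower
      where
      a b X₀ Y₀ X₁ Y₁ : ℕ
      a = X N./ D
      b = Y N./ D
      X₀ = a N.* D
      Y₀ = b N.* D
      X₁ = suc a N.* D
      Y₁ = suc b N.* D
      X₀≤X : X₀ N.≤ X
      X₀≤X = N.m/n*n≤m X D
      Y₀≤Y : Y₀ N.≤ Y
      Y₀≤Y = N.m/n*n≤m Y D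
      up : ∀ X → X N.≤ suc (X N./ D) N.* D
      up X = N.≤-reflexive (N.m≡m%n+[m/n]*n X D) ⟫ N.+-monoˡ-≤ (X N./ D N.* D) (N.<⇒≤ (N.m%n<n X D))
      rect : X₁ N.* Y₁ N.≤ X₀ N.* Y₀ N.+ error X Y D
      rect = N.≤-reflexive (lem D X₀ Y₀) ⟫ N.+-monoʳ-≤ (X₀ N.* Y₀) (N.*-monoʳ-≤ D (N.+-monoˡ-≤ D (N.+-mono-≤ X₀≤X Y₀≤Y)))
        where
        lem : ∀ D x y → (D N.+ x) N.* (D N.+ y) ≡ x N.* y N.+ D N.* (x N.+ y N.+ D)
        lem = solve-∀
      rectμ : ι X₁ * ι Y₁ * μ ≤ ι X₀ * ι Y₀ * μ + ι (error X Y D)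
      rectμ = begin
        ι X₁ * ι Y₁ * μ ≲⟨ *-monoˡ (0≤μ P) (≤-reflexive (sym (ι-* X₁ Y₁)) ⋙ ι-mono rect) ⟩
        ι (X₀ N.* Y₀ N.+ error X Y D) * μ ≈⟨ *-congʳ (trans (ι-+ (X₀ N.* Y₀) _) (+-congʳ (ι-* X₀ Y₀))) ⟩
        (ι X₀ * ι Y₀ + ι (error X Y D)) * μ ≈⟨ distribʳ μ _ _ ⟩
        ι X₀ * ι Y₀ * μ + ι (error X Y D) * μ ≲⟨ +-monoʳ _ (*-monoʳ (ι-nonneg (error X Y D)) (μ≤1 P) ⋙ ≤-reflexive (*-identityʳ _)) ⟩
        ι X₀ * ι Y₀ * μ + ι (error X Y D) ∎
        where open ≤R
      ιι-mono : ∀ {x x′ y y′} → x N.≤ x′ → y N.≤ y′ → ι x * ι y * μ ≤ ι x′ * ι y′ * μ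
      ιι-mono {x} {x′} {y} {y′} h h′ = *-monoˡ (0≤μ P) (*-mono (ι-nonneg x) (ι-mono h) (ι-nonneg y) (ι-mono h′))
      upper : Box X Y F ≤ ι X * ι Y * μ + ι (error X Y D)
      upper = Box-mono (nonneg P) (up X) (up Y) ⋙ ≤-reflexive (Box-period P (suc a) (suc b)) ⋙ rectμ ⋙ (+-monoˡ _ (ιι-mono X₀≤X Y₀≤Y))
      lower : ι X * ι Y * μ ≤ Box X Y F + ι (error X Y D)
      lower = ιι-mono (up X) (up Y) ⋙ rectμ ⋙ (+-monoˡ _ (≤-reflexive (sym (Box-period P a b)) ⋙ Box-mono (nonneg P) X₀≤X Y₀≤Y))

  coprime-*ˡ : ∀ {m n o} → Coprime m o → Coprime n o → Coprime (m N.* n) o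
  coprime-*ˡ {m} {n} {o} c c′ {i} (i∣mn , i∣o) = c′ (coprime-divisor {m = i} {n = m} {o = n} (λ (a , b) → c (b , ∣-trans a i∣o)) i∣mn , i∣o)

  -- Brun's sieve with weights

  module BrunTheory (O : OrderedField) where
    open OrderTheory O
    open SieveTheory O
    open Per

    -- A one-sided approximation whose direction alternates with r: an upper bound on x for even r
    -- and a lower bound for odd r. Subtracting a term swaps the directions, as `within-neg`
    -- records.
    Within : ℕ → Carrier → Carrier → Carrier → Set
    Within zero x y e = x ≤ y + e
    Within (suc r) x y e = Within r y x e

    within-+ : ∀ r {x y e x′ y′ e′} → Within r x y e → Within r x′ y′ e′ → Within r (x + x′) (y + y′) (e + e′)
    within-+ zero {x} {y} {e} {x′} {y′} {e′} h h′ = +-mono-≤ h h′ ⋙ ≤-reflexive (S.solve 4 (λ y e y′ e′ → (y S.:+ e) S.:+ (y′ S.:+ e′) S.:= (y S.:+ y′) S.:+ (e S.:+ e′)) refl y e y′ e′)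
    within-+ (suc r) h h′ = within-+ r h h′

    within-neg : ∀ r {x y e} → Within r x y e → Within (suc r) (- x) (- y) e
    within-neg zero {x} {y} {e} h = +-cancel (x + y) (≤-reflexive (S.solve 2 (λ x y → S.:- y S.:+ (x S.:+ y) S.:= x) refl x y) ⋙ h ⋙ ≤-reflexive (S.solve 3 (λ x y e → y S.:+ e S.:= (S.:- x S.:+ e) S.:+ (x S.:+ y)) refl x y e))
    within-neg (suc r) h = within-neg r h

    within-≈ : ∀ r {x y e x′ y′ e′} → x ≈ x′ → y ≈ y′ → e ≤ e′ → Within r x y e → Within r x′ y′ e′
    within-≈ zero p q l h = ≤-reflexive (sym p) ⋙ h ⋙ +-mono-≤ (≤-reflexive q) l
    within-≈ (suc r) p q l h = within-≈ r q p l h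

    ±⇒within : ∀ r {x y e} → x ≈[ e ]± y → Within r x y e
    ±⇒within zero (a , b) = a
    ±⇒within (suc r) (a , b) = ±⇒within r (b , a)

    Box-cong : ∀ {X Y F G} → (∀ n m → F n m ≈ G n m) → Box X Y F ≈ Box X Y G
    Box-cong {X} {Y} h = ∑-cong X (λ n → ∑-cong Y (h n))

    Box-+ : ∀ X Y (F G : ℕ → ℕ → Carrier) → Box X Y (λ n m → F n m + G n m) ≈ Box X Y F + Box X Y G
    Box-+ X Y F G = trans (∑-cong X (λ n → ∑-+ Y (F n) (G n))) (∑-+ X (λ n → ∑ Y (F n)) (λ n → ∑ Y (G n)))

    Box-*ˡ : ∀ X Y a (F : ℕ → ℕ → Carrier) → Box X Y (λ n m → a * F n m) ≈ a * Box X Y F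
    Box-*ˡ X Y a F = trans (∑-cong X (λ n → ∑-*ˡ Y a (F n))) (∑-*ˡ X a (λ n → ∑ Y (F n)))

    Box-neg : ∀ X Y (F : ℕ → ℕ → Carrier) → Box X Y (λ n m → - F n m) ≈ - Box X Y F
    Box-neg X Y F = trans (Box-cong {X} {Y} (λ n m → lem (F n m))) (trans (Box-*ˡ X Y (- 1#) F) (sym (lem _)))
      where
      lem : ∀ x → - x ≈ - 1# * x
      lem x = S.solve 1 (λ x → S.:- x S.:= S.:- S.con (1 , 0) S.:* x) refl x

    Box-nonneg : ∀ X Y {F} → (∀ n m → 0# ≤ F n m) → 0# ≤ Box X Y F
    Box-nonneg X Y h = ∑-nonneg X (λ n → ∑-nonneg Y (h n))

    within-zero : ∀ r {x y e} → x ≈ 0# → y ≈ 0# → 0# ≤ e → Within r x y e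
    within-zero r {x} {y} {e} p q l = ±⇒within r (lem p q , lem q p)
      where
      lem : ∀ {x y} → x ≈ 0# → y ≈ 0# → x ≤ y + e
      lem p q = ≤-reflexive (trans p (sym q)) ⋙ (≤-+ʳ l)

    1-nonneg : ∀ {x} → x ≤ 1# → 0# ≤ 1# + - x
    1-nonneg = sub-nonneg

    -- Rankin's trick: a removed prime counts 4 times in `tail`, so the terms with more than r
    -- removals together weigh at most 4^(-(r + 1)) times `tail`.
    δ : ℕ → Carrier
    δ r = inv 4 ^ suc r

    δ-nonneg : ∀ r → 0# ≤ δ r
    δ-nonneg r = ^-nonneg (suc r) (inv-nonneg 4)

    4δ : ∀ r → ι 4 * δ (suc r) ≈ δ r
    4δ r = trans (sym (*-assoc (ι 4) (inv 4) (δ r))) (trans (*-congʳ (inv-spec 3)) (*-identityˡ _))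

    4δ0 : ι 4 * δ 0 ≈ 1#
    4δ0 = trans (*-congˡ (*-identityʳ (inv 4))) (inv-spec 3)

    module _ {A : Set} (o : A) where
      -- Spends one unit of a budget; `o` is the value when none is left.
      previous : (ℕ → A) → ℕ → A
      previous g zero = o
      previous g (suc n) = g n

    -- Weights k and h of mean κ and ρ: the sieve removes h, and each of at most T primes may contribute k.
    module Weights (k h : ℕ → ℕ → ℕ → Carrier) (κ ρ : ℕ → Carrier) where

      record Local (q : ℕ) : Set where
        field
          positive : 1 N.≤ q
          hits : Per q (κ q) (k q)
          removed : Per q (ρ q) (h q)
          removed≤1 : ∀ n m → h q n m ≤ 1#
      open Local

      weight : List ℕ → ℕ → ℕ → ℕ → Carrier
      weight [] T n m = 1#
      weight (q ∷ qs) T n m = k q n m * previous 0# (λ T → weight qs T n m) T + (1# + - h q n m) * weight qs T n m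

      mean : List ℕ → ℕ → Carrier
      mean [] T = 1#
      mean (q ∷ qs) T = κ q * previous 0# (mean qs) T + (1# + - ρ q) * mean qs T

      tail : List ℕ → Carrier
      tail [] = 1#
      tail (q ∷ qs) = (1# + κ q + ι 4 * ρ q) * tail qs

      -- The number of terms in the expansion with at most T hits and r removals; each of them
      -- contributes one box error to `err`.
      terms : List ℕ → ℕ → ℕ → ℕ
      terms [] T r = 1
      terms (q ∷ qs) T r = previous 0 (λ T → terms qs T r) T N.+ terms qs T r N.+ previous 0 (terms qs T) r

      weight-nonneg : ∀ {qs} → All Local qs → ∀ T n m → 0# ≤ weight qs T n m
      weight-nonneg [] T n m = 0≤1
      weight-nonneg {q ∷ qs} (l ∷ ls) T n m = +-nonneg (*-nonneg (nonneg (hits l) n m) (pre T)) (*-nonneg (1-nonneg (removed≤1 l n m)) (weight-nonneg ls T n m))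
        where
        pre : ∀ T → 0# ≤ previous 0# (λ T → weight qs T n m) T
        pre zero = ≤-refl
        pre (suc T) = weight-nonneg ls T n m

      density : List ℕ → Carrier
      density [] = 1#
      density (q ∷ qs) = (1# + - ρ q + κ q) * density qs

      density-nonneg : ∀ {qs} → All Local qs → 0# ≤ density qs
      density-nonneg [] = 0≤1
      density-nonneg (l ∷ ls) = *-nonneg (+-nonneg (1-nonneg (μ≤1 (removed l))) (0≤μ (hits l))) (density-nonneg ls)

      mean≤density : ∀ {qs} → All Local qs → ∀ T → mean qs T ≤ density qs
      mean≤density [] T = ≤-refl
      mean≤density {q ∷ qs} (l ∷ ls) T = ≤-trans (+-mono-≤ (*-monoʳ (0≤μ (hits l)) (pre T)) (*-monoʳ (1-nonneg (μ≤1 (removed l))) (mean≤density ls T)))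
          (≤-reflexive (S.solve 3 (λ k r d → k S.:* d S.:+ (S.con (1 , 0) S.:+ S.:- r) S.:* d S.:= (S.con (1 , 0) S.:+ S.:- r S.:+ k) S.:* d) refl (κ q) (ρ q) (density qs)))
        where
        pre : ∀ T → previous 0# (mean qs) T ≤ density qs
        pre zero = density-nonneg ls
        pre (suc T) = mean≤density ls T

      tail-nonneg : ∀ {qs} → All Local qs → 0# ≤ tail qs
      tail-nonneg [] = 0≤1
      tail-nonneg (l ∷ ls) = *-nonneg (+-nonneg (+-nonneg 0≤1 (0≤μ (hits l))) (*-nonneg (ι-nonneg 4) (0≤μ (removed l)))) (tail-nonneg ls)

      density≤tail : ∀ {qs} → All Local qs → density qs ≤ tail qs
      density≤tail [] = ≤-refl
      density≤tail {q ∷ qs} (l ∷ ls) = *-mono (+-nonneg (1-nonneg (μ≤1 (removed l))) (0≤μ (hits l)))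
        ((≤-+ʳ (+-nonneg (0≤μ (removed l)) (*-nonneg (ι-nonneg 4) (0≤μ (removed l))))) ⋙ (≤-reflexive
          (S.solve 3 (λ k r f → (S.con (1 , 0) S.:+ S.:- r S.:+ k) S.:+ (r S.:+ f S.:* r) S.:= S.con (1 , 0) S.:+ k S.:+ f S.:* r) refl (κ q) (ρ q) (ι 4))))
        (density-nonneg ls) (density≤tail ls)

      -- Each of the T + r units of budget stays unspent or names a prime, as a hit or as a removal.
      terms-bound : ∀ qs T r → terms qs T r N.≤ (1 N.+ 2 N.* length qs) N.^ (T N.+ r)
      terms-bound [] T r = N.≤-reflexive (≡.sym (N.^-zeroˡ (T N.+ r)))
      terms-bound (q ∷ qs) T r = bound T r
        where
        l : ℕ
        l = 1 N.+ 2 N.* length qs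
        L≡ : 1 N.+ 2 N.* suc (length qs) ≡ 2 N.+ l
        L≡ = lem (length qs)
          where
          lem : ∀ l → 1 N.+ 2 N.* suc l ≡ 2 N.+ (1 N.+ 2 N.* l)
          lem = solve-∀
        grow : ∀ s → l N.^ s N.+ l N.* l N.^ s N.+ l N.^ s N.≤ (1 N.+ 2 N.* suc (length qs)) N.^ suc s
        grow s = N.≤-reflexive (lem (l N.^ s) l) ⟫ N.*-monoʳ-≤ (2 N.+ l) (N.^-monoˡ-≤ s (N.m≤n+m l 2)) ⟫ N.≤-reflexive (≡.cong (N._^ suc s) (≡.sym L≡))
          where
          lem : ∀ t l → t N.+ l N.* t N.+ t ≡ (2 N.+ l) N.* t
          lem = solve-∀
        bound : ∀ T r → terms (q ∷ qs) T r N.≤ (1 N.+ 2 N.* suc (length qs)) N.^ (T N.+ r)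
        bound zero zero = N.≤-reflexive (N.+-identityʳ _) ⟫ terms-bound qs 0 0
        bound zero (suc r) = N.+-mono-≤ (N.+-mono-≤ (z≤n {l N.^ r}) (terms-bound qs 0 (suc r))) (terms-bound qs 0 r) ⟫ grow r
        bound (suc T) zero = N.+-mono-≤ (N.+-mono-≤ (terms-bound qs T 0) (terms-bound qs (suc T) 0)) (z≤n {l N.^ (T N.+ 0)}) ⟫ grow (T N.+ 0)
        bound (suc T) (suc r) = N.+-mono-≤ (N.+-mono-≤ (terms-bound qs T (suc r)) (terms-bound qs (suc T) (suc r))) (terms-bound qs (suc T) r ⟫ N.≤-reflexive (≡.cong (l N.^_) (≡.sym (N.+-suc T r)))) ⟫ grow (T N.+ suc r)

      module _ (X Y w W : ℕ) where
        B : Carrier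
        B = ι (error X Y W)

        err : List ℕ → ℕ → ℕ → Carrier → Carrier
        err qs T r μ = ι X * ι Y * μ * (δ r * tail qs) + B * ι (terms qs T r)

        -- Bonferroni: truncating the expansion of Π(1 − h) after r removed primes errs with the sign of (−1)^r.
        sieve : ∀ {D μ F} qs → All Local qs → All (N._≤ w) qs → AllPairs Coprime qs → All (Coprime D) qs → 1 N.≤ D → 1 N.≤ w → Per D μ F →
                ∀ T r → D N.* w N.^ (T N.+ r) N.≤ W →
                Within r (Box X Y (λ n m → F n m * weight qs T n m)) (ι X * ι Y * μ * mean qs T) (err qs T r μ)
        sieve {D} {μ} {F} [] ls qs≤w ap cs D≥1 w≥1 P T r le =
          within-≈ r (Box-cong {X} {Y} (λ n m → sym (*-identityʳ (F n m)))) (sym (*-identityʳ _)) bound (±⇒within r (Box-error {{N.>-nonZero D≥1}} P X Y))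
          where
          D≤W : D N.≤ W
          D≤W = N.m≤m*n D (w N.^ (T N.+ r)) {{N.m^n≢0 w (T N.+ r) {{N.>-nonZero w≥1}}}} ⟫ le
          bound : ι (error X Y D) ≤ err [] T r μ
          bound = ι-mono (N.*-mono-≤ D≤W (N.+-monoʳ-≤ (X N.+ Y) D≤W)) ⋙ (≤-trans (≤-reflexive (sym (trans (*-congˡ ι-1) (*-identityʳ B))))
            (≤-+ˡ (*-nonneg (*-nonneg (*-nonneg (ι-nonneg X) (ι-nonneg Y)) (0≤μ P)) (*-nonneg (δ-nonneg r) 0≤1))))
        sieve {D} {μ} {F} (q ∷ qs) (l ∷ ls) (q≤w ∷ qs≤w) (cq ∷ ap) (c ∷ cs) D≥1 w≥1 P T r le =
          within-≈ r (sym split) (S.solve 5 (λ M k p r m → M S.:* (k S.:* p) S.:+ (M S.:* m S.:+ S.:- (M S.:* (r S.:* m))) S.:= M S.:* (k S.:* p S.:+ (S.con (1 , 0) S.:+ S.:- r) S.:* m)) refl M (κ q) (previous 0# (mean qs) T) (ρ q) (mean qs T))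
            (≤-reflexive errors) (within-+ r (term₁ T le) (within-+ r (sieve qs ls qs≤w ap cs D≥1 w≥1 P T r le) (term₃ r le)))
          where
          M : Carrier
          M = ι X * ι Y * μ
          M≥0 : 0# ≤ M
          M≥0 = *-nonneg (*-nonneg (ι-nonneg X) (ι-nonneg Y)) (0≤μ P)
          csq : All (Coprime (D N.* q)) qs
          csq = All.zipWith (λ {x} → λ { (a , b) {i} → coprime-*ˡ {D} {q} {x} a b {i} }) (cs , cq)
          Dq≥1 : 1 N.≤ D N.* q
          Dq≥1 = N.*-mono-≤ D≥1 (positive l)
          -- Replacing the modulus D by D q costs a factor of at most w, which the unit of budget
          -- just spent provides; so every modulus in the recursion stays below W.
          deeper : ∀ s → D N.* w N.^ suc s N.≤ W → D N.* q N.* w N.^ s N.≤ W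
          deeper s h = N.≤-reflexive (N.*-assoc D q _) ⟫ N.*-monoʳ-≤ D (N.*-monoˡ-≤ (w N.^ s) q≤w) ⟫ h
          G₁ G₂ G₃ : ℕ → ℕ → Carrier
          G₁ n m = F n m * (k q n m * previous 0# (λ T → weight qs T n m) T)
          G₂ n m = F n m * weight qs T n m
          G₃ n m = F n m * (h q n m * weight qs T n m)
          split : Box X Y (λ n m → F n m * weight (q ∷ qs) T n m) ≈ Box X Y G₁ + (Box X Y G₂ + - Box X Y G₃)
          split = trans (Box-cong {X} {Y} {G = λ n m → G₁ n m + (G₂ n m + - G₃ n m)} (λ n m → S.solve 4 (λ f a h c → f S.:* (a S.:+ (S.con (1 , 0) S.:+ S.:- h) S.:* c) S.:= f S.:* a S.:+ (f S.:* c S.:+ S.:- (f S.:* (h S.:* c)))) refl (F n m) (k q n m * previous 0# (λ T → weight qs T n m) T) (h q n m) (weight qs T n m)))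
            (trans (Box-+ X Y G₁ (λ n m → G₂ n m + - G₃ n m)) (+-congˡ (trans (Box-+ X Y G₂ (λ n m → - G₃ n m)) (+-congˡ (Box-neg X Y G₃)))))
          e₁ : ℕ → Carrier
          e₁ T = M * (κ q * (δ r * tail qs)) + B * ι (previous 0 (λ T → terms qs T r) T)
          e₃ : ℕ → Carrier
          e₃ r = M * (ρ q * (ι 4 * δ r * tail qs)) + B * ι (previous 0 (terms qs T) r)
          term₁ : ∀ T → D N.* w N.^ (T N.+ r) N.≤ W →
                  Within r (Box X Y (λ n m → F n m * (k q n m * previous 0# (λ T → weight qs T n m) T))) (M * (κ q * previous 0# (mean qs) T)) (e₁ T)
          term₁ zero le = within-zero r (∑-zero X (λ n _ → ∑-zero Y (λ m _ → trans (*-congˡ (zeroʳ _)) (zeroʳ _)))) (trans (*-congˡ (zeroʳ _)) (zeroʳ _))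
            (+-nonneg (*-nonneg M≥0 (*-nonneg (0≤μ (hits l)) (*-nonneg (δ-nonneg r) (tail-nonneg ls)))) (*-nonneg (ι-nonneg (error X Y W)) ≤-refl))
          term₁ (suc T) le = within-≈ r (Box-cong {X} {Y} (λ n m → *-assoc _ _ _))
            (S.solve 5 (λ x y m k a → x S.:* y S.:* (m S.:* k) S.:* a S.:= x S.:* y S.:* m S.:* (k S.:* a)) refl (ι X) (ι Y) μ (κ q) (mean qs T))
            (≤-reflexive (+-congʳ (S.solve 5 (λ x y m k a → x S.:* y S.:* (m S.:* k) S.:* a S.:= x S.:* y S.:* m S.:* (k S.:* a)) refl (ι X) (ι Y) μ (κ q) (δ r * tail qs))))
            (sieve qs ls qs≤w ap csq Dq≥1 w≥1 (Per-* c P (hits l)) T r (deeper (T N.+ r) le))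
          term₃ : ∀ r → D N.* w N.^ (T N.+ r) N.≤ W → Within r (- Box X Y G₃) (- (M * (ρ q * mean qs T))) (e₃ r)
          -- With no removals left the subtracted box is dropped, as an upper bound permits. The
          -- loss, M ρ times the mean, fits under the error because 4 δ 0 = 1.
          term₃ zero le = ≤-trans (-‿mono (Box-nonneg X Y (λ n m → *-nonneg (nonneg P n m) (*-nonneg (nonneg (removed l) n m) (weight-nonneg ls T n m)))))
            (≤-reflexive -0#≈0# ⋙ (≤-trans (sub-nonneg (*-monoʳ M≥0 (*-monoʳ (0≤μ (removed l)) ((mean≤density ls T ⋙ density≤tail ls) ⋙ ≤-reflexive (sym (trans (*-congʳ 4δ0) (*-identityˡ _)))))))
              (≤-reflexive (+-comm _ _) ⋙ (+-monoʳ _ (≤-+ʳ (*-nonneg (ι-nonneg (error X Y W)) ≤-refl))))))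
          term₃ (suc r) le = within-neg r (within-≈ r (Box-cong {X} {Y} (λ n m → *-assoc _ _ _))
            (S.solve 5 (λ x y m k a → x S.:* y S.:* (m S.:* k) S.:* a S.:= x S.:* y S.:* m S.:* (k S.:* a)) refl (ι X) (ι Y) μ (ρ q) (mean qs T))
            (≤-reflexive (+-congʳ (trans (S.solve 5 (λ x y m k a → x S.:* y S.:* (m S.:* k) S.:* a S.:= x S.:* y S.:* m S.:* (k S.:* a)) refl (ι X) (ι Y) μ (ρ q) (δ r * tail qs)) (*-congˡ (*-congˡ (*-congʳ (sym (4δ r))))))))
            (sieve qs ls qs≤w ap csq Dq≥1 w≥1 (Per-* c P (removed l)) T r (deeper (T N.+ r) (≡.subst (λ s → D N.* w N.^ s N.≤ W) (N.+-suc T r) le))))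
          errors : e₁ T + (err qs T r μ + e₃ r) ≈ err (q ∷ qs) T r μ
          errors = trans (S.solve 10 (λ M k d t B a b c ρ f → (M S.:* (k S.:* (d S.:* t)) S.:+ B S.:* a) S.:+ ((M S.:* (d S.:* t) S.:+ B S.:* b) S.:+ (M S.:* (ρ S.:* (f S.:* d S.:* t)) S.:+ B S.:* c))
                S.:= M S.:* (d S.:* ((S.con (1 , 0) S.:+ k S.:+ f S.:* ρ) S.:* t)) S.:+ B S.:* (a S.:+ b S.:+ c)) refl M (κ q) (δ r) (tail qs) B (ι a) (ι b) (ι c′) (ρ q) (ι 4))
              (+-congˡ (*-congˡ (sym (trans (ι-+ (a N.+ b) c′) (+-congʳ (ι-+ a b))))))
            where
            a b c′ : ℕ
            a = previous 0 (λ T → terms qs T r) T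
            b = terms qs T r
            c′ = previous 0 (terms qs T) r

  prime-coprime : ∀ {q D} → Prime q → ¬ q ∣ D → Coprime D q
  prime-coprime {q} {D} pr q∤D {i} (i∣D , i∣q) = helper (prime⇒irreducible pr i∣q)
    where
    helper : i ≡ 1 ⊎ i ≡ q → i ≡ 1
    helper (inj₁ e) = e
    helper (inj₂ e) = ⊥-elim (q∤D (≡.subst (_∣ D) e i∣D))

  hits : List ℕ → ℕ → ℕ
  hits [] t = 0
  hits (q ∷ qs) t = ⟦ q ∣? t ⟧ N.+ hits qs t

  Rough : List ℕ → ℕ → Set
  Rough qs t = All (λ q → ¬ q ∣ t) qs

  -- As q does not divide d, the form d N + d + 1 has exactly one root modulo q; as q does not
  -- divide d + 1, this root is not 0, so dividing N and dividing the form exclude each other.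
  Admissible : ℕ → ℕ → Set
  Admissible d q = Prime q × ¬ q ∣ d × ¬ q ∣ suc d

  -- The two systems of local weights

  module PatternTheory (O : OrderedField) where
    open OrderTheory O
    open SieveTheory O
    open BrunTheory O
    open Per

    ½ : Carrier
    ½ = inv 2

    ½+½ : ½ + ½ ≈ 1#
    ½+½ = trans (sym (trans (*-congʳ (+-congˡ (+-identityʳ 1#))) (trans (distribʳ ½ 1# 1#) (+-cong (*-identityˡ ½) (*-identityˡ ½))))) (inv-spec 1)

    ½≥0 : 0# ≤ ½
    ½≥0 = inv-nonneg 2

    ½≤1 : ½ ≤ 1#
    ½≤1 = (≤-+ʳ ½≥0) ⋙ ≤-reflexive ½+½

    div : ℕ → ℕ → Carrier
    div q t = ι ⟦ q ∣? t ⟧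

    div-yes : ∀ {q t} → q ∣ t → div q t ≈ 1#
    div-yes {q} {t} h = trans (reflexive (≡.cong ι (⟦⟧-yes (q ∣? t) h))) ι-1

    div-no : ∀ {q t} → ¬ q ∣ t → div q t ≈ 0#
    div-no {q} {t} h = reflexive (≡.cong ι (⟦⟧-no (q ∣? t) h))

    div-nonneg : ∀ q t → 0# ≤ div q t
    div-nonneg q t = ι-nonneg ⟦ q ∣? t ⟧

    div≤1 : ∀ q t → div q t ≤ 1#
    div≤1 q t = ι-mono (⟦⟧≤1 (q ∣? t)) ⋙ ≤-reflexive ι-1

    div-periodic : ∀ q → Periodic q (div q)
    div-periodic q n = reflexive (≡.cong ι (N.≤-antisym (⟦⟧-mono (q ∣? (q N.+ n)) (q ∣? n) (λ h → ∣m+n∣m⇒∣n h ∣-refl)) (⟦⟧-mono (q ∣? n) (q ∣? (q N.+ n)) (∣m∣n⇒∣m+n ∣-refl))))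

    div-periodic-* : ∀ q k {s t} → s ≡ k N.* q N.+ t → div q s ≈ div q t
    div-periodic-* q k {t = t} e = trans (reflexive (≡.cong (div q) e)) (periodic-* {q} (div-periodic q) k t)

    ∑-div : ∀ {q} → 1 N.≤ q → ∑ q (div q) ≈ 1#
    ∑-div {suc q} _ = trans (+-cong (div-yes {suc q} (suc q ∣0)) (∑-zero q (λ i i<q → div-no {suc q} {suc i} (λ h → N.<⇒≱ (s≤s i<q) (∣⇒≤ h))))) (+-identityʳ 1#)

    ∑-div-progression : ∀ {q D} → 1 N.≤ q → Coprime D q → ∀ b (f : ℕ → ℕ) → (∀ a → f a ≡ a N.* D N.+ b) → ∑ q (λ a → div q (f a)) ≈ 1#
    ∑-div-progression {q} {D} q≥1 c b f e = trans (∑-cong q (λ a → reflexive (≡.cong (div q) (e a)))) (trans (progression (λ {i} → c {i}) (div-periodic q) b) (∑-div q≥1))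

    ι*inv : ∀ {q} → 1 N.≤ q → ι q * inv q ≈ 1#
    ι*inv {suc q} _ = inv-spec q

    mkPer : ∀ {q μ F} → 1 N.≤ q → (∀ n m → 0# ≤ F n m) → (∀ n m → F n m ≤ 1#) → (∀ m → Periodic q (λ n → F n m)) → (∀ n → Periodic q (F n)) →
            ∑ q (λ n → ∑ q (F n)) ≈ ι q * ι q * μ → Per q μ F
    mkPer {suc q} {μ} {F} _ h0 h1 s₁ s₂ t = record { nonneg = h0 ; shift₁ = s₁ ; shift₂ = s₂ ; total = t
      ; 0≤μ = ι-cancel q (ι-cancel q (≤-reflexive (trans (*-congˡ (zeroʳ _)) (zeroʳ _)) ⋙ Box-nonneg (suc q) (suc q) h0 ⋙ ≤-reflexive t ⋙ ≤-reflexive (*-assoc _ _ _)))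
      ; μ≤1 = ι-cancel q (ι-cancel q (≤-reflexive (trans (sym (*-assoc _ _ _)) (sym t)) ⋙ (≤-trans (∑-mono (suc q) (λ n _ → ∑-mono (suc q) (λ m _ → h1 n m)))
          (≤-reflexive (trans (∑-cong (suc q) (λ _ → ∑-const (suc q) 1#)) (∑-const (suc q) _)))))) }

    -- The factor 1 - h is 0 when q divides d n m + d + 1, it is ½ when q divides n m, and 1
    -- otherwise. With k = 0 the weight of a rough pair is therefore 2^(-hits).
    module PairPattern (d : ℕ) where
      k h : ℕ → ℕ → ℕ → Carrier
      k q n m = 0#
      h q n m = div q (d N.* (n N.* m) N.+ suc d) + ½ * div q (n N.* m)

      κ ρ : ℕ → Carrier
      κ q = 0#
      -- The row n = 0 contributes q/2. Each of the other q - 1 rows contains one root of d n m + d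
      -- + 1 and one root of n m.
      ρ q = inv q * inv q * (½ * ι q + (ι q + - 1#) * (1# + ½))

      open Weights k h κ ρ public

      module _ {q : ℕ} (pr : Prime q) (q∤d : ¬ q ∣ d) (q∤1+d : ¬ q ∣ suc d) where
        q≥1 : 1 N.≤ q
        q≥1 = N.>-nonZero⁻¹ q {{prime⇒nonZero pr}}

        disjoint : ∀ {t} → q ∣ t → ¬ q ∣ d N.* t N.+ suc d
        disjoint {t} h h′ = q∤1+d (∣m+n∣m⇒∣n h′ (∣-trans h (n∣m*n d)))

        h≤1 : ∀ n m → h q n m ≤ 1#
        h≤1 n m = cases (q ∣? (n N.* m))
          where
          cases : Dec (q ∣ n N.* m) → h q n m ≤ 1#
          cases (yes y) = ≤-reflexive (trans (+-cong (div-no {q} (disjoint y)) (trans (*-congˡ (div-yes {q} y)) (*-identityʳ ½))) (+-identityˡ ½)) ⋙ ½≤1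
          cases (no z) = ≤-reflexive (trans (+-congˡ (trans (*-congˡ (div-no {q} z)) (zeroʳ ½))) (+-identityʳ _)) ⋙ div≤1 q (d N.* (n N.* m) N.+ suc d)

        row0 : ∑ q (λ m → div q (d N.* (0 N.* m) N.+ suc d) + ½ * div q (0 N.* m)) ≈ ½ * ι q
        row0 = trans (∑-cong q (λ m → trans (+-cong (div-no {q} (disjoint (q ∣0))) (trans (*-congˡ (div-yes {q} (q ∣0))) (*-identityʳ ½))) (+-identityˡ ½))) (trans (∑-const q ½) (*-comm _ _))

        row : ∀ n → 1 N.≤ n → n N.< q → ∑ q (h q n) ≈ 1# + ½
        row n n≥1 n<q = trans (∑-+ q (λ m → div q (d N.* (n N.* m) N.+ suc d)) (λ m → ½ * div q (n N.* m)))
            (+-cong (∑-div-progression {q} {d N.* n} q≥1 (prime-coprime pr q∤dn) (suc d) _ (λ m → lem d n m))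
                    (trans (∑-*ˡ q ½ (λ m → div q (n N.* m))) (trans (*-congˡ (∑-div-progression {q} {n} q≥1 (prime-coprime pr q∤n) 0 _ (λ m → lem′ n m))) (*-identityʳ ½))))
          where
          q∤n : ¬ q ∣ n
          q∤n h = N.<⇒≱ n<q (∣⇒≤ {{N.>-nonZero n≥1}} h)
          q∤dn : ¬ q ∣ d N.* n
          q∤dn h = split (euclidsLemma d n pr h)
            where
            split : ¬ (q ∣ d ⊎ q ∣ n)
            split (inj₁ a) = q∤d a
            split (inj₂ b) = q∤n b
          lem : ∀ d n m → d N.* (n N.* m) N.+ suc d ≡ m N.* (d N.* n) N.+ suc d
          lem = solve-∀
          lem′ : ∀ n m → n N.* m ≡ m N.* n N.+ 0
          lem′ = solve-∀

        sum : ∑ q (λ n → ∑ q (h q n)) ≈ ½ * ι q + (ι q + - 1#) * (1# + ½)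
        sum = split q q≥1 row0 row
          where
          split : ∀ q′ → 1 N.≤ q′ → ∑ q (h q 0) ≈ ½ * ι q → (∀ n → 1 N.≤ n → n N.< q′ → ∑ q (h q n) ≈ 1# + ½) → ∑ q′ (λ n → ∑ q (h q n)) ≈ ½ * ι q + (ι q′ + - 1#) * (1# + ½)
          split (suc q′) _ r0 r = +-cong r0 (trans (∑-cong< q′ (λ i i< → r (suc i) (s≤s z≤n) (s≤s i<))) (trans (∑-const q′ (1# + ½)) (*-congʳ (S.solve 1 (λ x → x S.:= S.con (1 , 0) S.:+ x S.:+ S.:- S.con (1 , 0)) refl (ι q′)))))

      admissible : ∀ {q} → Admissible d q → Local q
      admissible {q} (pr , q∤d , q∤1+d) = record
        { positive = one ; removed≤1 = h≤1 pr q∤d q∤1+d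
        ; hits = mkPer one (λ _ _ → ≤-refl) (λ _ _ → 0≤1) (λ _ _ → refl) (λ _ _ → refl) (trans (∑-zero q (λ _ _ → ∑-zero q (λ _ _ → refl))) (sym (zeroʳ _)))
        ; removed = mkPer one (λ n m → +-nonneg (div-nonneg q _) (*-nonneg ½≥0 (div-nonneg q _))) (h≤1 pr q∤d q∤1+d)
            (λ m n → +-cong (div-periodic-* q (d N.* m) (lem₁ d q n m)) (*-congˡ (div-periodic-* q m (lem₂ q n m))))
            (λ n m → +-cong (div-periodic-* q (d N.* n) (lem₃ d q n m)) (*-congˡ (div-periodic-* q n (lem₄ q n m))))
            (trans (sum pr q∤d q∤1+d) (sym (trans (S.solve 3 (λ a b c → a S.:* a S.:* (b S.:* b S.:* c) S.:= (a S.:* b) S.:* ((a S.:* b) S.:* c)) refl (ι q) (inv q) _) (trans (*-cong (ι*inv one) (trans (*-congʳ (ι*inv one)) (*-identityˡ _))) (*-identityˡ _))))) }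
        where
        one : 1 N.≤ q
        one = q≥1 pr q∤d q∤1+d
        lem₁ : ∀ d q n m → d N.* ((q N.+ n) N.* m) N.+ suc d ≡ d N.* m N.* q N.+ (d N.* (n N.* m) N.+ suc d)
        lem₁ = solve-∀
        lem₂ : ∀ q n m → (q N.+ n) N.* m ≡ m N.* q N.+ n N.* m
        lem₂ = solve-∀
        lem₃ : ∀ d q n m → d N.* (n N.* (q N.+ m)) N.+ suc d ≡ d N.* n N.* q N.+ (d N.* (n N.* m) N.+ suc d)
        lem₃ = solve-∀
        lem₄ : ∀ q n m → n N.* (q N.+ m) ≡ n N.* q N.+ n N.* m
        lem₄ = solve-∀

      weight-rough : ∀ {qs} → All (Admissible d) qs → ∀ n m → Rough qs (d N.* (n N.* m) N.+ suc d) → 1# ≤ ι 2 ^ hits qs (n N.* m) * weight qs 0 n m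
      weight-rough [] n m _ = ≤-reflexive (sym (*-identityʳ 1#))
      weight-rough {q ∷ qs} (a ∷ as) n m (r ∷ rs) = cases (q ∣? (n N.* m))
        where
        w rest : Carrier
        w = weight qs 0 n m
        rest = ι 2 ^ hits qs (n N.* m) * w
        factor : ∀ x e → 1# + - h q n m ≈ x → ⟦ q ∣? (n N.* m) ⟧ ≡ e → ι 2 ^ e * x ≈ 1# → 1# ≤ ι 2 ^ hits (q ∷ qs) (n N.* m) * weight (q ∷ qs) 0 n m
        factor x e hx he eq = weight-rough as n m rs ⋙ (≤-reflexive (sym (trans (*-cong (trans (reflexive (≡.cong (λ e → ι 2 ^ (e N.+ hits qs (n N.* m))) he)) (^-homo-* (ι 2) e (hits qs (n N.* m)))) (trans (+-cong (zeroˡ 0#) (*-congʳ hx)) (+-identityˡ _)))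
            (trans (S.solve 4 (λ a b x w → (a S.:* b) S.:* (x S.:* w) S.:= (a S.:* x) S.:* (b S.:* w)) refl (ι 2 ^ e) (ι 2 ^ hits qs (n N.* m)) x w) (trans (*-congʳ eq) (*-identityˡ _))))))
        cases : Dec (q ∣ n N.* m) → 1# ≤ ι 2 ^ hits (q ∷ qs) (n N.* m) * weight (q ∷ qs) 0 n m
        cases (yes y) = factor ½ 1 (trans (+-congˡ (-‿cong (trans (+-cong (div-no {q} r) (trans (*-congˡ (div-yes {q} y)) (*-identityʳ ½))) (+-identityˡ ½)))) (trans (+-congʳ (sym ½+½)) (S.solve 1 (λ x → x S.:+ x S.:+ S.:- x S.:= x) refl ½)))
          (⟦⟧-yes (q ∣? (n N.* m)) y) (trans (*-congʳ (*-identityʳ (ι 2))) (inv-spec 1))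
        cases (no z) = factor 1# 0 (trans (+-congˡ (-‿cong (trans (+-cong (div-no {q} r) (trans (*-congˡ (div-no {q} z)) (zeroʳ ½))) (+-identityʳ 0#)))) (trans (+-congˡ -0#≈0#) (+-identityʳ 1#)))
          (⟦⟧-no (q ∣? (n N.* m)) z) (*-identityʳ 1#)

    -- The sieve for N alone, made constant in m so that the two-variable machinery applies. When d
    -- N + d + 1 is rough, the weight of N is the sum of 2^(-j) over the sets of j ≤ T sieving
    -- primes dividing N.
    module ProductPattern (d : ℕ) where
      k h : ℕ → ℕ → ℕ → Carrier
      k q n m = ½ * div q n
      h q n m = div q (d N.* n N.+ suc d)

      κ ρ : ℕ → Carrier
      κ q = ½ * inv q
      ρ q = inv q

      open Weights k h κ ρ public

      admissible : ∀ {q} → Admissible d q → Local q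
      admissible {q} (pr , q∤d , q∤1+d) = record
        { positive = one ; removed≤1 = λ n m → div≤1 q _
        ; hits = mkPer one (λ n m → *-nonneg ½≥0 (div-nonneg q n)) (λ n m → *-mono ½≥0 ½≤1 (div-nonneg q n) (div≤1 q n) ⋙ ≤-reflexive (*-identityʳ 1#))
            (λ m n → *-congˡ (div-periodic q n)) (λ n m → refl) (trans (constant (λ n → ½ * div q n)) (trans (*-congˡ (trans (∑-*ˡ q ½ (div q)) (trans (*-congˡ (∑-div one)) (*-identityʳ ½)))) (scale ½)))
        ; removed = mkPer one (λ n m → div-nonneg q _) (λ n m → div≤1 q _) (λ m n → div-periodic-* q d (lem₁ d q n)) (λ n m → refl)
            (trans (constant (λ n → div q (d N.* n N.+ suc d))) (trans (*-congˡ (∑-div-progression {q} {d} one (prime-coprime pr q∤d) (suc d) _ (λ n → lem₂ d n))) (trans (scale 1#) (*-congˡ (*-identityˡ (inv q)))))) }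
        where
        one : 1 N.≤ q
        one = N.>-nonZero⁻¹ q {{prime⇒nonZero pr}}
        constant : ∀ f → ∑ q (λ n → ∑ q (λ m → f n)) ≈ ι q * ∑ q f
        constant f = trans (∑-cong q (λ n → ∑-const q (f n))) (∑-*ˡ q (ι q) f)
        scale : ∀ x → ι q * x ≈ ι q * ι q * (x * inv q)
        scale x = sym (trans (S.solve 3 (λ a b x → a S.:* a S.:* (x S.:* b) S.:= a S.:* x S.:* (a S.:* b)) refl (ι q) (inv q) x) (trans (*-congˡ (ι*inv one)) (*-identityʳ _)))
        lem₁ : ∀ d q n → d N.* (q N.+ n) N.+ suc d ≡ d N.* q N.+ (d N.* n N.+ suc d)
        lem₁ = solve-∀
        lem₂ : ∀ d n → d N.* n N.+ suc d ≡ n N.* d N.+ suc d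
        lem₂ = solve-∀

      weight-mono : ∀ {qs} → All (Admissible d) qs → ∀ T n m → weight qs T n m ≤ weight qs (suc T) n m
      weight-mono [] T n m = ≤-refl
      weight-mono {q ∷ qs} (a ∷ as) T n m = +-mono-≤ (*-monoʳ (*-nonneg ½≥0 (div-nonneg q n)) (pre T)) (*-monoʳ (1-nonneg (div≤1 q _)) (weight-mono as T n m))
        where
        pre : ∀ T → previous 0# (λ T → weight qs T n m) T ≤ weight qs T n m
        pre zero = weight-nonneg (All.map admissible as) 0 n m
        pre (suc T) = weight-mono as T n m

      -- The subsets of T primes dividing n all respect the budget, and their contributions alone
      -- add up to (1 + ½)^T.
      weight-hits : ∀ {qs} → All (Admissible d) qs → ∀ T n m → Rough qs (d N.* n N.+ suc d) → T N.≤ hits qs n → ι 3 ^ T ≤ ι 2 ^ T * weight qs T n m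
      weight-hits [] zero n m _ _ = ≤-reflexive (sym (*-identityʳ 1#))
      weight-hits {q ∷ qs} (a ∷ as) T n m (r ∷ rs) le = cases T (q ∣? n) le
        where
        W : ℕ → Carrier
        W T = weight qs T n m
        unremoved : ∀ T → weight (q ∷ qs) T n m ≈ ½ * div q n * previous 0# W T + W T
        unremoved T = +-congˡ (trans (*-congʳ (trans (+-congˡ (-‿cong (div-no {q} r))) (trans (+-congˡ -0#≈0#) (+-identityʳ 1#)))) (*-identityˡ _))
        pre≥0 : ∀ T → 0# ≤ previous 0# W T
        pre≥0 zero = ≤-refl
        pre≥0 (suc T) = weight-nonneg (All.map admissible as) T n m
        skip : ∀ T → T N.≤ hits qs n → ι 3 ^ T ≤ ι 2 ^ T * weight (q ∷ qs) T n m
        skip T le = weight-hits as T n m rs le ⋙ *-monoʳ (^-nonneg T (ι-nonneg 2)) ((≤-+ˡ (*-nonneg (*-nonneg ½≥0 (div-nonneg q n)) (pre≥0 T))) ⋙ ≤-reflexive (sym (unremoved T)))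
        cases : ∀ T → Dec (q ∣ n) → T N.≤ ⟦ q ∣? n ⟧ N.+ hits qs n → ι 3 ^ T ≤ ι 2 ^ T * weight (q ∷ qs) T n m
        cases T (no z) le = skip T (≡.subst (λ e → T N.≤ e N.+ hits qs n) (⟦⟧-no (q ∣? n) z) le)
        cases zero (yes y) le = skip 0 z≤n
        cases (suc T) (yes y) le = begin
          ι 3 * ι 3 ^ T ≲⟨ *-monoʳ (ι-nonneg 3) (weight-hits as T n m rs (N.≤-pred (≡.subst (λ e → suc T N.≤ e N.+ hits qs n) (⟦⟧-yes (q ∣? n) y) le))) ⟩
          ι 3 * (ι 2 ^ T * W T) ≈⟨ *-congʳ three ⟩
          (ι 2 * ½ + ι 2) * (ι 2 ^ T * W T) ≈⟨ S.solve 4 (λ a b c w → (a S.:* b S.:+ a) S.:* (c S.:* w) S.:= (a S.:* c) S.:* (b S.:* w S.:+ w)) refl (ι 2) ½ (ι 2 ^ T) (W T) ⟩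
          ι 2 ^ suc T * (½ * W T + W T) ≲⟨ *-monoʳ (^-nonneg (suc T) (ι-nonneg 2)) (+-monoʳ _ (weight-mono as T n m)) ⟩
          ι 2 ^ suc T * (½ * W T + W (suc T)) ≈⟨ *-congˡ (trans (+-congʳ (*-congʳ (sym (trans (*-congˡ (div-yes {q} y)) (*-identityʳ ½))))) (sym (unremoved (suc T)))) ⟩
          ι 2 ^ suc T * weight (q ∷ qs) (suc T) n m ∎
          where
          open ≤R
          three : ι 3 ≈ ι 2 * ½ + ι 2
          three = +-congʳ (sym (inv-spec 1))

  open import Relation.Nullary.Decidable using (_×-dec_; ¬?)

  admissible? : ∀ d q → Dec (Admissible d q)
  admissible? d q = prime? q ×-dec (¬? (q ∣? d) ×-dec ¬? (q ∣? suc d))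

  extend : {P : Set} → Dec P → ℕ → List ℕ → List ℕ
  extend (yes _) q qs = q ∷ qs
  extend (no _) q qs = qs

  -- the admissible primes q with 3 ≤ q ≤ n + 2
  sieving : ℕ → ℕ → List ℕ
  sieving d zero = []
  sieving d (suc n) = extend (admissible? d (3 N.+ n)) (3 N.+ n) (sieving d n)

  -- The free starting point s is what allows an upper block to be split off the list of sieving
  -- primes in `sieving-block`.
  sieving-ind : ∀ d (I : ℕ → List ℕ → Set) s → I s (sieving d s) → (∀ n {qs} → Admissible d (3 N.+ n) → I n qs → I (suc n) (3 N.+ n ∷ qs)) →
                (∀ n {qs} → I n qs → I (suc n) qs) → ∀ k → I (k N.+ s) (sieving d (k N.+ s))
  sieving-ind d I s base take skip zero = base
  sieving-ind d I s base take skip (suc k) = cases (admissible? d (3 N.+ (k N.+ s)))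
    where
    cases : (a : Dec (Admissible d (3 N.+ (k N.+ s)))) → I (suc (k N.+ s)) (extend a (3 N.+ (k N.+ s)) (sieving d (k N.+ s)))
    cases (yes a) = take (k N.+ s) a (sieving-ind d I s base take skip k)
    cases (no _) = skip (k N.+ s) (sieving-ind d I s base take skip k)

  sieving-ind₀ : ∀ d (I : ℕ → List ℕ → Set) → I 0 [] → (∀ n {qs} → Admissible d (3 N.+ n) → I n qs → I (suc n) (3 N.+ n ∷ qs)) →
                (∀ n {qs} → I n qs → I (suc n) qs) → ∀ n → I n (sieving d n)
  sieving-ind₀ d I base take skip n = ≡.subst (λ n → I n (sieving d n)) (N.+-identityʳ n) (sieving-ind d I 0 base take skip n)

  sieving-admissible : ∀ d n → All (Admissible d) (sieving d n)
  sieving-admissible d = sieving-ind₀ d (λ _ → All (Admissible d)) [] (λ _ → _∷_) (λ _ x → x)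

  sieving-range : ∀ d n → All (λ q → 3 N.≤ q × q N.≤ 2 N.+ n) (sieving d n)
  sieving-range d = sieving-ind₀ d (λ n → All (λ q → 3 N.≤ q × q N.≤ 2 N.+ n)) [] (λ n _ x → (N.m≤m+n 3 n , N.≤-refl) ∷ All.map up x) (λ n x → All.map up x)
    where
    up : ∀ {n q} → 3 N.≤ q × q N.≤ 2 N.+ n → 3 N.≤ q × q N.≤ 3 N.+ n
    up (a , b) = a , N.m≤n⇒m≤1+n b

  sieving-distinct : ∀ d n → AllPairs _≢_ (sieving d n)
  sieving-distinct d n = proj₁ (sieving-ind₀ d (λ n qs → AllPairs _≢_ qs × All (N._< 3 N.+ n) qs) ([] , []) (λ n _ (a , b) → (All.map (λ lt e → N.<⇒≢ lt (≡.sym e)) b ∷ a) , N.≤-refl ∷ All.map N.m<n⇒m<1+n b)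
    (λ n (a , b) → a , All.map N.m<n⇒m<1+n b) n)

  prime-distinct-coprime : ∀ {p q} → Prime p → Prime q → p ≢ q → Coprime p q
  prime-distinct-coprime {p} {q} pp pq ne {i} = prime-coprime {q} {p} pq (λ h → helper h (prime⇒irreducible pp h)) {i}
    where
    helper : q ∣ p → q ≡ 1 ⊎ q ≡ p → ⊥
    helper h (inj₁ ≡.refl) = ¬prime[1] pq

    helper h (inj₂ e) = ne (≡.sym e)

  primes-coprime : ∀ {qs} → All Prime qs → AllPairs _≢_ qs → AllPairs Coprime qs
  primes-coprime [] [] = []
  primes-coprime (p ∷ ps) (x ∷ xs) = All.zipWith (λ { (pq , ne) {i} → prime-distinct-coprime p pq ne {i} }) (ps , x) ∷ primes-coprime ps xs

  sieving-coprime : ∀ d n → AllPairs Coprime (sieving d n)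
  sieving-coprime d n = primes-coprime (All.map proj₁ (sieving-admissible d n)) (sieving-distinct d n)

  sieving-length : ∀ d n → length (sieving d n) N.≤ n
  sieving-length d = sieving-ind₀ d (λ n qs → length qs N.≤ n) z≤n (λ _ _ → s≤s) (λ _ → N.m≤n⇒m≤1+n)

  sieving-complete : ∀ d n {q} → Admissible d q → 3 N.≤ q → q N.≤ 2 N.+ n → q ∈ sieving d n
  sieving-complete d zero a l u = ⊥-elim (N.<⇒≱ l u)
  sieving-complete d (suc n) {q} a l u = cases (admissible? d (3 N.+ n)) (N.m≤n⇒m<n∨m≡n u)
    where
    cases : (x : Dec (Admissible d (3 N.+ n))) → q N.< 3 N.+ n ⊎ q ≡ 3 N.+ n → q ∈ extend x (3 N.+ n) (sieving d n)
    cases (yes _) (inj₁ lt) = there (sieving-complete d n a l (N.≤-pred lt))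
    cases (no _) (inj₁ lt) = sieving-complete d n a l (N.≤-pred lt)
    cases (yes _) (inj₂ e) = here e
    cases (no na) (inj₂ e) = ⊥-elim (na (≡.subst (Admissible d) e a))

  -- Euler products over the sieving primes

  module EulerTheory (O : OrderedField) where
    open OrderTheory O
    open SieveTheory O
    open BrunTheory O
    open PatternTheory O

    Π : List ℕ → (ℕ → Carrier) → Carrier
    Π [] f = 1#
    Π (q ∷ qs) f = f q * Π qs f

    Π-nonneg : ∀ {qs f} → All (λ q → 0# ≤ f q) qs → 0# ≤ Π qs f
    Π-nonneg [] = 0≤1
    Π-nonneg (h ∷ hs) = *-nonneg h (Π-nonneg hs)

    Π-mono : ∀ {qs f g} → All (λ q → 0# ≤ f q × f q ≤ g q) qs → Π qs f ≤ Π qs g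
    Π-mono [] = ≤-refl
    Π-mono ((h , l) ∷ hs) = *-mono h l (Π-nonneg (All.map proj₁ hs)) (Π-mono hs)

    Π-≈ : ∀ {qs f g} → All (λ q → f q ≈ g q) qs → Π qs f ≈ Π qs g
    Π-≈ [] = refl
    Π-≈ (h ∷ hs) = *-cong h (Π-≈ hs)

    Π-* : ∀ qs f g → Π qs (λ q → f q * g q) ≈ Π qs f * Π qs g
    Π-* [] f g = sym (*-identityʳ 1#)
    Π-* (q ∷ qs) f g = trans (*-congˡ (Π-* qs f g)) (S.solve 4 (λ a b c e → a S.:* b S.:* (c S.:* e) S.:= a S.:* c S.:* (b S.:* e)) refl (f q) (g q) (Π qs f) (Π qs g))

    Π-^ : ∀ qs f n → Π qs (λ q → f q ^ n) ≈ Π qs f ^ n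
    Π-^ qs f zero = ones qs
      where
      ones : ∀ qs → Π qs (λ _ → 1#) ≈ 1#
      ones [] = refl
      ones (q ∷ qs) = trans (*-identityˡ _) (ones qs)
    Π-^ qs f (suc n) = trans (Π-* qs f (λ q → f q ^ n)) (*-congˡ (Π-^ qs f n))

    Π-++ : ∀ ps qs f → Π (ps ++ qs) f ≈ Π ps f * Π qs f
    Π-++ [] qs f = sym (*-identityˡ _)
    Π-++ (p ∷ ps) qs f = trans (*-congˡ (Π-++ ps qs f)) (sym (*-assoc _ _ _))

    bernoulli : ∀ n {y} → 0# ≤ y → 1# + ι n * y ≤ (1# + y) ^ n
    bernoulli zero {y} h = ≤-reflexive (trans (+-congˡ (zeroˡ y)) (+-identityʳ 1#))
    bernoulli (suc n) {y} h = ≤-trans ((≤-+ʳ (*-nonneg (ι-nonneg n) (*-nonneg h h))) ⋙ ≤-reflexive (S.solve 2 (λ n y → S.con (1 , 0) S.:+ (S.con (1 , 0) S.:+ n) S.:* y S.:+ n S.:* (y S.:* y) S.:= (S.con (1 , 0) S.:+ y) S.:* (S.con (1 , 0) S.:+ n S.:* y)) refl (ι n) y))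
      (*-monoʳ (+-nonneg 0≤1 h) (bernoulli n h))

    bernoulli⁻ : ∀ n {y} → 0# ≤ y → y ≤ 1# → 1# + - (ι n * y) ≤ (1# + - y) ^ n
    bernoulli⁻ zero {y} h l = ≤-reflexive (trans (+-congˡ (trans (-‿cong (zeroˡ y)) -0#≈0#)) (+-identityʳ 1#))
    bernoulli⁻ (suc n) {y} h l = ≤-trans ((≤-+ʳ (*-nonneg (ι-nonneg n) (*-nonneg h h))) ⋙ ≤-reflexive (S.solve 2 (λ n y → S.con (1 , 0) S.:+ S.:- ((S.con (1 , 0) S.:+ n) S.:* y) S.:+ n S.:* (y S.:* y) S.:= (S.con (1 , 0) S.:+ S.:- y) S.:* (S.con (1 , 0) S.:+ S.:- (n S.:* y))) refl (ι n) y))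
      (*-monoʳ (sub-nonneg l) (bernoulli⁻ n h l))

    ^≤1 : ∀ {x} n → 0# ≤ x → x ≤ 1# → x ^ n ≤ 1#
    ^≤1 zero h l = ≤-refl
    ^≤1 (suc n) h l = *-mono h l (^-nonneg n h) (^≤1 n h l) ⋙ ≤-reflexive (*-identityʳ 1#)

    ^-antitone : ∀ {x m n} → 0# ≤ x → x ≤ 1# → m N.≤ n → x ^ n ≤ x ^ m
    ^-antitone {x} {m} {n} h l le = ≤-trans (≤-reflexive (trans (reflexive (≡.cong (x ^_) (≡.sym (N.m∸n+n≡m le)))) (^-homo-* x (n N.∸ m) m)))
      (*-monoˡ (^-nonneg m h) (^≤1 (n N.∸ m) h l) ⋙ ≤-reflexive (*-identityˡ _))

    root : ∀ {x} n → 1 N.≤ n → 0# ≤ x → 1# ≤ x ^ n → 1# ≤ x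
    root {x} n n≥1 h p = cases (≤-total 1# x)
      where
      cases : 1# ≤ x ⊎ x ≤ 1# → 1# ≤ x
      cases (inj₁ le) = le
      cases (inj₂ le) = p ⋙ ^-antitone h le n≥1 ⋙ ≤-reflexive (*-identityʳ x)

    inv≤1 : ∀ n → inv n ≤ 1#
    inv≤1 zero = 0≤1
    inv≤1 (suc n) = (≤-reflexive (sym (*-identityˡ _)) ⋙ *-monoˡ (inv-nonneg (suc n)) (≤-+ʳ (ι-nonneg n))) ⋙ ≤-reflexive (inv-spec n)

    inv-antitone : ∀ {m n} → 1 N.≤ m → m N.≤ n → inv n ≤ inv m
    inv-antitone {suc m} {suc n} _ le = ι-cancel n (≤-reflexive (inv-spec n) ⋙ ≤-reflexive (sym (inv-spec m)) ⋙ *-monoˡ (inv-nonneg (suc m)) (ι-mono le))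

    -- With v = 1/(q - 1), α is the Euler factor 1 - 1/q and β its inverse. The factor ζ = 1 + v/2
    -- is a rational stand-in for √β: it satisfies β ≤ ζ² and ζ ≤ β.
    v α β ζ : ℕ → Carrier
    v q = inv (q N.∸ 1)
    α q = 1# + - inv q
    β q = 1# + v q
    ζ q = 1# + ½ * v q

    module Factor (q : ℕ) (q≥2 : 2 N.≤ q) where
      v≥0 : 0# ≤ v q
      v≥0 = inv-nonneg (q N.∸ 1)

      vt : v q * (ι q + - 1#) ≈ 1#
      vt = lem q q≥2
        where
        lem : ∀ q → 2 N.≤ q → inv (q N.∸ 1) * (ι q + - 1#) ≈ 1#
        lem (suc (suc t)) _ = trans (trans (*-congˡ (S.solve 1 (λ t → S.con (1 , 0) S.:+ t S.:+ S.:- S.con (1 , 0) S.:= t) refl (ι (suc t)))) (*-comm _ _)) (inv-spec t)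
        lem (suc zero) (s≤s ())

      β≈ : β q ≈ v q * ι q
      β≈ = trans (+-congʳ (sym vt)) (S.solve 2 (λ v q → v S.:* (q S.:+ S.:- S.con (1 , 0)) S.:+ v S.:= v S.:* q) refl (v q) (ι q))

      uβ : inv q * β q ≈ v q
      uβ = trans (*-congˡ β≈) (trans (S.solve 3 (λ u v q → u S.:* (v S.:* q) S.:= q S.:* u S.:* v) refl (inv q) (v q) (ι q)) (trans (*-congʳ (ι*inv (s≤s z≤n ⟫ q≥2))) (*-identityˡ _)))

      αβ : α q * β q ≈ 1#
      αβ = trans (S.solve 2 (λ u b → (S.con (1 , 0) S.:+ S.:- u) S.:* b S.:= b S.:+ S.:- (u S.:* b)) refl (inv q) (β q)) (trans (+-congˡ (-‿cong uβ)) (S.solve 1 (λ v → S.con (1 , 0) S.:+ v S.:+ S.:- v S.:= S.con (1 , 0)) refl (v q)))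

      αv : α q * v q ≈ inv q
      αv = trans (*-congˡ (sym uβ)) (trans (S.solve 3 (λ a u b → a S.:* (u S.:* b) S.:= a S.:* b S.:* u) refl (α q) (inv q) (β q)) (trans (*-congʳ αβ) (*-identityˡ _)))

      u≤v : inv q ≤ v q
      u≤v = inv-antitone (N.∸-monoˡ-≤ 1 q≥2) (N.m∸n≤m q 1)

      1≤β : 1# ≤ β q
      1≤β = ≤-+ʳ v≥0

      α≥0 : 0# ≤ α q
      α≥0 = sub-nonneg (inv≤1 q)

      1≤ζ : 1# ≤ ζ q
      1≤ζ = ≤-+ʳ (*-nonneg ½≥0 v≥0)

      ζ≤β : ζ q ≤ β q
      ζ≤β = +-monoʳ 1# (*-monoˡ v≥0 ½≤1 ⋙ ≤-reflexive (*-identityˡ _))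

      β≤ζ² : β q ≤ ζ q * ζ q
      β≤ζ² = (≤-+ʳ (*-nonneg (*-nonneg ½≥0 v≥0) (*-nonneg ½≥0 v≥0))) ⋙ (≤-reflexive (trans (+-congʳ (+-congˡ (trans (sym (*-identityˡ _)) (*-congʳ (sym ½+½)))))
        (S.solve 2 (λ h v → S.con (1 , 0) S.:+ (h S.:+ h) S.:* v S.:+ h S.:* v S.:* (h S.:* v) S.:= (S.con (1 , 0) S.:+ h S.:* v) S.:* (S.con (1 , 0) S.:+ h S.:* v)) refl ½ (v q))))

      y : Carrier
      y = v q + v q + ½ * (v q * v q)

      y≥0 : 0# ≤ y
      y≥0 = +-nonneg (+-nonneg v≥0 v≥0) (*-nonneg ½≥0 (*-nonneg v≥0 v≥0))

      1+y≤β² : 1# + y ≤ β q * β q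
      1+y≤β² = ≤-trans (+-monoʳ 1# (+-monoʳ (v q + v q) (*-monoˡ (*-nonneg v≥0 v≥0) ½≤1 ⋙ ≤-reflexive (*-identityˡ _))))
        (≤-reflexive (S.solve 1 (λ v → S.con (1 , 0) S.:+ (v S.:+ v S.:+ v S.:* v) S.:= (S.con (1 , 0) S.:+ v) S.:* (S.con (1 , 0) S.:+ v)) refl (v q)))

      -- Bernoulli turns 1 + 4 y into (1 + y)^4, and 1 + y ≤ β². The resulting exponent 8 bounds
      -- `tail` by V^8 and so determines how deep the expansion must go.
      tail-bound : ∀ {x} → x ≤ ι 4 * y → 1# + x ≤ β q ^ 8
      tail-bound {x} h = begin
        1# + x ≲⟨ +-monoʳ 1# h ⟩
        1# + ι 4 * y ≲⟨ bernoulli 4 y≥0 ⟩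
        (1# + y) ^ 4 ≲⟨ ^-mono 4 (+-nonneg 0≤1 y≥0) 1+y≤β² ⟩
        (β q * β q) ^ 4 ≈⟨ S.solve 1 (λ b → (b S.:* b) S.:^ 4 S.:= b S.:^ 8) refl (β q) ⟩
        β q ^ 8 ∎
        where open ≤R

    module PairFactor (d q : ℕ) (q≥2 : 2 N.≤ q) where
      open Factor q q≥2
      open PairPattern d using (ρ; κ)

      ρβ² : ρ q * (β q * β q) ≈ y
      ρβ² = begin
        inv q * inv q * (½ * ι q + (ι q + - 1#) * (1# + ½)) * (β q * β q)
          ≈⟨ S.solve 3 (λ u x b → u S.:* u S.:* x S.:* (b S.:* b) S.:= (u S.:* b) S.:* (u S.:* b) S.:* x) refl (inv q) _ (β q) ⟩
        (inv q * β q) * (inv q * β q) * (½ * ι q + (ι q + - 1#) * (1# + ½)) ≈⟨ *-congʳ (*-cong uβ uβ) ⟩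
        v q * v q * (½ * ι q + (ι q + - 1#) * (1# + ½))
          ≈⟨ S.solve 3 (λ v h q → v S.:* v S.:* (h S.:* q S.:+ (q S.:+ S.:- S.con (1 , 0)) S.:* (S.con (1 , 0) S.:+ h)) S.:= v S.:* (v S.:* (q S.:+ S.:- S.con (1 , 0))) S.:* (S.con (1 , 0) S.:+ (h S.:+ h)) S.:+ h S.:* (v S.:* v)) refl (v q) ½ (ι q) ⟩
        v q * (v q * (ι q + - 1#)) * (1# + (½ + ½)) + ½ * (v q * v q)
          ≈⟨ +-congʳ (trans (*-cong (trans (*-congˡ vt) (*-identityʳ _)) (+-congˡ ½+½)) (S.solve 1 (λ v → v S.:* (S.con (1 , 0) S.:+ S.con (1 , 0)) S.:= v S.:+ v) refl (v q))) ⟩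
        y ∎
        where open ≈R

      ρ≤y : 0# ≤ ρ q → ρ q ≤ y
      ρ≤y h = (≤-reflexive (sym (*-identityʳ _)) ⋙ *-monoʳ h (≤-reflexive (sym (*-identityʳ 1#)) ⋙ (*-mono 0≤1 1≤β 0≤1 1≤β))) ⋙ ≤-reflexive ρβ²

      tail≤ : 0# ≤ ρ q → 1# + κ q + ι 4 * ρ q ≤ β q ^ 8
      tail≤ h = ≤-reflexive (+-congʳ (+-identityʳ 1#)) ⋙ tail-bound (*-monoʳ (ι-nonneg 4) (ρ≤y h))

      -- With v = 1/(q−1) the product is (1 + v²/2)(1 + v/2)²(1 − v) ≤ 1.
      telescope : (1# + - ρ q + κ q) * (β q * (ζ q * ζ q)) * (1# + - v q) ≤ α q
      telescope = ≤-reflexive (sym (*-identityˡ _)) ⋙ ≤-reflexive (*-congʳ (sym αβ)) ⋙ ≤-reflexive (*-assoc _ _ _) ⋙ *-monoʳ α≥0 scaled ⋙ ≤-reflexive (*-identityʳ _)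
        where
        c : Carrier
        c = ½ * v q
        scaled : β q * ((1# + - ρ q + κ q) * (β q * (ζ q * ζ q)) * (1# + - v q)) ≤ 1#
        scaled = begin
          β q * ((1# + - ρ q + 0#) * (β q * (ζ q * ζ q)) * (1# + - v q))
            ≈⟨ trans (*-congˡ (*-congʳ (*-congʳ (+-identityʳ _)))) (S.solve 4 (λ b r z v → b S.:* ((S.con (1 , 0) S.:+ S.:- r) S.:* (b S.:* (z S.:* z)) S.:* (S.con (1 , 0) S.:+ S.:- v)) S.:= (b S.:* b S.:+ S.:- (r S.:* (b S.:* b))) S.:* (z S.:* z) S.:* (S.con (1 , 0) S.:+ S.:- v)) refl (β q) (ρ q) (ζ q) (v q)) ⟩
          (β q * β q + - (ρ q * (β q * β q))) * (ζ q * ζ q) * (1# + - v q)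
            ≈⟨ *-cong (*-congʳ (+-congˡ (-‿cong (trans ρβ² (+-cong (+-cong half half) (trans (sym (*-assoc _ _ _)) (*-congˡ half))))))) (+-congˡ (-‿cong half)) ⟩
          (β q * β q + - ((c + c) + (c + c) + c * (c + c))) * (ζ q * ζ q) * (1# + - (c + c))
            ≈⟨ *-congʳ (*-congʳ (+-congʳ (*-cong (+-congˡ half) (+-congˡ half)))) ⟩
          ((1# + (c + c)) * (1# + (c + c)) + - ((c + c) + (c + c) + c * (c + c))) * ((1# + c) * (1# + c)) * (1# + - (c + c))
            ≈⟨ S.solve 1 (λ c → ((S.con (1 , 0) S.:+ (c S.:+ c)) S.:* (S.con (1 , 0) S.:+ (c S.:+ c)) S.:+ S.:- ((c S.:+ c) S.:+ (c S.:+ c) S.:+ c S.:* (c S.:+ c))) S.:* ((S.con (1 , 0) S.:+ c) S.:* (S.con (1 , 0) S.:+ c)) S.:* (S.con (1 , 0) S.:+ S.:- (c S.:+ c))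
                 S.:= S.con (1 , 0) S.:+ S.:- (c S.:* c S.:* (S.con (1 , 0) S.:+ c S.:+ c S.:+ (c S.:+ c S.:+ c) S.:* (c S.:+ c) S.:+ (c S.:+ c) S.:* (c S.:+ c) S.:* c))) refl c ⟩
          1# + - (c * c * (1# + c + c + (c + c + c) * (c + c) + (c + c) * (c + c) * c))
            ≲⟨ (+-monoʳ 1# (-‿mono rest ⋙ ≤-reflexive -0#≈0#)) ⋙ ≤-reflexive (+-identityʳ 1#) ⟩
          1# ∎
          where
          open ≤R
          half : v q ≈ c + c
          half = sym (trans (sym (distribʳ (v q) ½ ½)) (trans (*-congʳ ½+½) (*-identityˡ _)))
          c≥0 : 0# ≤ c
          c≥0 = *-nonneg ½≥0 v≥0
          rest : 0# ≤ c * c * (1# + c + c + (c + c + c) * (c + c) + (c + c) * (c + c) * c)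
          rest = *-nonneg (*-nonneg c≥0 c≥0) (+-nonneg (+-nonneg (+-nonneg (+-nonneg 0≤1 c≥0) c≥0) (*-nonneg (+-nonneg (+-nonneg c≥0 c≥0) c≥0) (+-nonneg c≥0 c≥0))) (*-nonneg (*-nonneg (+-nonneg c≥0 c≥0) (+-nonneg c≥0 c≥0)) c≥0))

    module ProductFactor (d q : ℕ) (q≥2 : 2 N.≤ q) where
      open Factor q q≥2
      open ProductPattern d using (ρ; κ)

      density-factor : 1# + - ρ q + κ q ≈ α q * ζ q
      density-factor = sym (trans (S.solve 3 (λ a h v → a S.:* (S.con (1 , 0) S.:+ h S.:* v) S.:= a S.:+ h S.:* (a S.:* v)) refl (α q) ½ (v q)) (+-congˡ (*-congˡ αv)))

      tail≤ : 1# + κ q + ι 4 * ρ q ≤ β q ^ 8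
      tail≤ = ≤-reflexive (+-assoc _ _ _) ⋙ tail-bound (+-mono-≤ κ≤ (*-monoʳ (ι-nonneg 4) u≤v) ⋙ ≤-reflexive (sym (distribˡ _ _ _)) ⋙ *-monoʳ (ι-nonneg 4) (≤-+ʳ (*-nonneg ½≥0 (*-nonneg v≥0 v≥0))))
        where
        κ≤ : ½ * inv q ≤ ι 4 * v q
        κ≤ = *-mono ½≥0 (½≤1 ⋙ (≤-+ʳ (ι-nonneg 3))) (inv-nonneg q) u≤v

    module Products {qs : List ℕ} (large : All (2 N.≤_) qs) where
      A≥0 : 0# ≤ Π qs α
      A≥0 = Π-nonneg (All.map (λ {q} l → Factor.α≥0 q l) large)

      AV : Π qs α * Π qs β ≈ 1#
      AV = trans (sym (Π-* qs α β)) (trans (Π-≈ (All.map (λ {q} l → Factor.αβ q l) large)) (Π-^ qs α 0))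

      1≤V : 1# ≤ Π qs β
      1≤V = ≤-reflexive (sym (Π-^ qs β 0)) ⋙ Π-mono (All.map (λ {q} l → 0≤1 , Factor.1≤β q l) large)

      1≤Z : 1# ≤ Π qs ζ
      1≤Z = ≤-reflexive (sym (Π-^ qs ζ 0)) ⋙ Π-mono (All.map (λ {q} l → 0≤1 , Factor.1≤ζ q l) large)

      Z≤V : Π qs ζ ≤ Π qs β
      Z≤V = Π-mono (All.map (λ {q} l → 0≤1 ⋙ Factor.1≤ζ q l , Factor.ζ≤β q l) large)

      V≤Z² : Π qs β ≤ Π qs ζ * Π qs ζ
      V≤Z² = Π-mono (All.map (λ {q} l → 0≤1 ⋙ Factor.1≤β q l , Factor.β≤ζ² q l) large) ⋙ ≤-reflexive (Π-* qs ζ ζ)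

    module PairProducts (d : ℕ) where
      open PairPattern d

      tail≤V⁸ : ∀ {qs} → All Local qs → All (2 N.≤_) qs → tail qs ≤ Π qs β ^ 8
      tail≤V⁸ {qs} ls large = go ls large ⋙ ≤-reflexive (Π-^ qs β 8)
        where
        go : ∀ {qs} → All Local qs → All (2 N.≤_) qs → tail qs ≤ Π qs (λ q → β q ^ 8)
        go [] [] = ≤-refl
        go {q ∷ qs} (l ∷ ls) (g ∷ gs) = *-mono (0≤1 ⋙ (≤-+ʳ (Per.0≤μ (Local.hits l))) ⋙ (≤-+ʳ (*-nonneg (ι-nonneg 4) (Per.0≤μ (Local.removed l)))))
          (PairFactor.tail≤ d q g (Per.0≤μ (Local.removed l))) (tail-nonneg ls) (go ls gs)

      -- By `telescope` the factor at q of the density times β ζ² is at most α(q)/α(q - 1). These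
      -- quotients telescope over consecutive integers, skipped integers only helping, from α(2) =
      -- ½; this is the origin of the factor 2.
      density-bound : ∀ n → density (sieving d n) * (Π (sieving d n) ζ * Π (sieving d n) ζ) ≤ ι 2 * Π (sieving d n) α
      density-bound n = divide large (sieving-ind₀ d (λ n qs → density qs * G qs * ½ ≤ 1# + - inv (2 N.+ n)) base (λ n {qs} a → take n {qs} (admissible a)) (λ n {qs} → skip n {qs}) n ⋙ (+-monoʳ 1# (-‿mono (inv-nonneg (2 N.+ n)) ⋙ ≤-reflexive -0#≈0#)) ⋙ ≤-reflexive (+-identityʳ 1#))
        where
        large : All (2 N.≤_) (sieving d n)
        large = All.map (λ (a , _) → N.<⇒≤ a) (sieving-range d n)
        g : ℕ → Carrier
        g q = β q * (ζ q * ζ q)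
        G : List ℕ → Carrier
        G qs = Π qs g
        base : density [] * G [] * ½ ≤ 1# + - inv 2
        base = ≤-reflexive (trans (*-congʳ (*-identityʳ 1#)) (trans (*-identityˡ ½) (trans (S.solve 1 (λ h → h S.:= h S.:+ h S.:+ S.:- h) refl ½) (+-congʳ ½+½))))
        next : ∀ n → 1# + - inv (2 N.+ n) ≤ 1# + - inv (3 N.+ n)
        next n = +-monoʳ 1# (-‿mono (inv-antitone {2 N.+ n} {3 N.+ n} (s≤s z≤n) (N.n≤1+n _)))
        skip : ∀ n {qs} → density qs * G qs * ½ ≤ 1# + - inv (2 N.+ n) → density qs * G qs * ½ ≤ 1# + - inv (3 N.+ n)
        skip n h = h ⋙ next n
        take : ∀ n {qs} → Local (3 N.+ n) → density qs * G qs * ½ ≤ 1# + - inv (2 N.+ n) → density (3 N.+ n ∷ qs) * G (3 N.+ n ∷ qs) * ½ ≤ 1# + - inv (3 N.+ n)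
        take n {qs} l h = ≤-trans (≤-reflexive (S.solve 5 (λ f D g G h → f S.:* D S.:* (g S.:* G) S.:* h S.:= f S.:* g S.:* (D S.:* G S.:* h)) refl (1# + - ρ q + κ q) (density qs) (g q) (G qs) ½))
            (*-monoʳ (*-nonneg (+-nonneg (1-nonneg (Per.μ≤1 (Local.removed l))) (Per.0≤μ (Local.hits l))) (*-nonneg β≥0 (*-nonneg ζ≥0 ζ≥0))) h ⋙ PairFactor.telescope d q q≥2)
          where
          q : ℕ
          q = 3 N.+ n
          q≥2 : 2 N.≤ q
          q≥2 = s≤s (s≤s z≤n)
          β≥0 : 0# ≤ β q
          β≥0 = 0≤1 ⋙ Factor.1≤β q q≥2
          ζ≥0 : 0# ≤ ζ q
          ζ≥0 = 0≤1 ⋙ Factor.1≤ζ q q≥2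
        divide : ∀ {qs} → All (2 N.≤_) qs → density qs * G qs * ½ ≤ 1# → density qs * (Π qs ζ * Π qs ζ) ≤ ι 2 * Π qs α
        divide {qs} large h = begin
          density qs * (Z * Z) ≈⟨ trans (sym (*-identityˡ _)) (*-congʳ (sym (trans (*-cong (inv-spec 1) (Products.AV large)) (*-identityʳ 1#)))) ⟩
          (ι 2 * ½) * (A * V) * (density qs * (Z * Z)) ≈⟨ S.solve 6 (λ t h A V D Z → (t S.:* h) S.:* (A S.:* V) S.:* (D S.:* (Z S.:* Z)) S.:= (t S.:* A) S.:* (D S.:* (V S.:* (Z S.:* Z)) S.:* h)) refl (ι 2) ½ A V (density qs) Z ⟩
          (ι 2 * A) * (density qs * (V * (Z * Z)) * ½) ≈⟨ *-congˡ (*-congʳ (*-congˡ (sym (trans (Π-* qs β (λ q → ζ q * ζ q)) (*-congˡ (Π-* qs ζ ζ)))))) ⟩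
          (ι 2 * A) * (density qs * G qs * ½) ≲⟨ *-monoʳ (*-nonneg (ι-nonneg 2) (Products.A≥0 large)) h ⟩
          (ι 2 * A) * 1# ≈⟨ *-identityʳ _ ⟩
          ι 2 * A ∎
          where
          open ≤R
          A V Z : Carrier
          A = Π qs α
          V = Π qs β
          Z = Π qs ζ

    module ProductProducts (d : ℕ) where
      open ProductPattern d

      tail≤V⁸ : ∀ {qs} → All Local qs → All (2 N.≤_) qs → tail qs ≤ Π qs β ^ 8
      tail≤V⁸ {qs} ls large = go ls large ⋙ ≤-reflexive (Π-^ qs β 8)
        where
        go : ∀ {qs} → All Local qs → All (2 N.≤_) qs → tail qs ≤ Π qs (λ q → β q ^ 8)
        go [] [] = ≤-refl
        go {q ∷ qs} (l ∷ ls) (g ∷ gs) = *-mono (0≤1 ⋙ (≤-+ʳ (Per.0≤μ (Local.hits l))) ⋙ (≤-+ʳ (*-nonneg (ι-nonneg 4) (Per.0≤μ (Local.removed l)))))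
          (ProductFactor.tail≤ d q g) (tail-nonneg ls) (go ls gs)

      -- The identity 1 - 1/q + 1/(2 q) = α (1 + v/2) is exact, because α v = 1/q.
      density≈ : ∀ {qs} → All (2 N.≤_) qs → density qs ≈ Π qs α * Π qs ζ
      density≈ {qs} large = trans (go large) (Π-* qs α ζ)
        where
        go : ∀ {qs} → All (2 N.≤_) qs → density qs ≈ Π qs (λ q → α q * ζ q)
        go [] = refl
        go {q ∷ qs} (g ∷ gs) = *-cong (ProductFactor.density-factor d q g) (go gs)

  prime-divisor : ∀ n → 2 N.≤ n → ∃[ p ] (Prime p × p ∣ n)
  prime-divisor n@(suc _) n≥2 = go (PrimeFactorisation.factors f) (PrimeFactorisation.isFactorisation f) (PrimeFactorisation.factorsPrime f)
    where
    f : PrimeFactorisation n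
    f = factorise n
    go : ∀ ps → n ≡ product ps → All Prime ps → ∃[ p ] (Prime p × p ∣ n)
    go [] e _ = ⊥-elim (N.<⇒≢ n≥2 (≡.sym e))
    go (p ∷ ps) e (pr ∷ _) = p , pr , ≡.subst (p ∣_) (≡.sym e) (m∣m*n (product ps))

  prime≥2 : ∀ {p} → Prime p → 2 N.≤ p
  prime≥2 {p} pr = N.nonTrivial⇒n>1 p {{prime⇒nonTrivial pr}}

  2∣n⊎2∣1+n : ∀ n → 2 ∣ n ⊎ 2 ∣ suc n
  2∣n⊎2∣1+n zero = inj₁ (2 ∣0)
  2∣n⊎2∣1+n (suc n) = step (2∣n⊎2∣1+n n)
    where
    step : 2 ∣ n ⊎ 2 ∣ suc n → 2 ∣ suc n ⊎ 2 ∣ suc (suc n)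
    step (inj₁ (divides k e)) = inj₂ (divides (suc k) (≡.cong (2 N.+_) e))
    step (inj₂ h) = inj₁ h

  from2 : ℕ → List ℕ
  from2 zero = []
  from2 (suc e) = 2 N.+ e ∷ from2 e

  from2-complete : ∀ e {p} → 2 N.≤ p → p N.≤ suc e → p ∈ from2 e
  from2-complete zero l u = ⊥-elim (N.<⇒≱ l u)
  from2-complete (suc e) {p} l u = cases (N.m≤n⇒m<n∨m≡n u)
    where
    cases : p N.< 2 N.+ e ⊎ p ≡ 2 N.+ e → p ∈ from2 (suc e)
    cases (inj₁ lt) = there (from2-complete e l (N.≤-pred lt))
    cases (inj₂ eq) = here eq

  from2-large : ∀ e → All (2 N.≤_) (from2 e)
  from2-large zero = []
  from2-large (suc e) = s≤s (s≤s z≤n) ∷ from2-large e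

  -- Sifting the harmonic sum: an upper bound for the product of 1 - 1/q

  module HarmonicTheory (O : OrderedField) where
    open OrderTheory O
    open SieveTheory O
    open BrunTheory O
    open PatternTheory O
    open EulerTheory O

    inv-unique : ∀ n {x} → ι (suc n) * x ≈ 1# → x ≈ inv (suc n)
    inv-unique n e = ≈-cancel (ι (suc n)) (inv (suc n)) (inv-spec n) (trans e (sym (inv-spec n)))

    inv-* : ∀ a j → inv (suc a N.* suc j) ≈ inv (suc j) * inv (suc a)
    inv-* a j = sym (inv-unique (j N.+ a N.* suc j) (trans (*-congʳ (ι-* (suc a) (suc j))) (trans (S.solve 4 (λ a j x y → a S.:* j S.:* (x S.:* y) S.:= (j S.:* x) S.:* (a S.:* y)) refl (ι (suc a)) (ι (suc j)) (inv (suc j)) (inv (suc a)))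
      (trans (*-cong (inv-spec j) (inv-spec a)) (*-identityʳ 1#)))))

    -- The indicator of having no divisor in the list, built factor by factor so that
    -- `remove-multiples` can sift by one entry at a time.
    survive : List ℕ → ℕ → Carrier
    survive [] n = 1#
    survive (j ∷ js) n = survive js n * (1# + - div j n)

    1-div≥0 : ∀ j n → 0# ≤ 1# + - div j n
    1-div≥0 j n = sub-nonneg (div≤1 j n)

    survive-nonneg : ∀ js n → 0# ≤ survive js n
    survive-nonneg [] n = 0≤1
    survive-nonneg (j ∷ js) n = *-nonneg (survive-nonneg js n) (1-div≥0 j n)

    survive≤1 : ∀ js n → survive js n ≤ 1#
    survive≤1 [] n = ≤-refl
    survive≤1 (j ∷ js) n = *-mono (survive-nonneg js n) (survive≤1 js n) (1-div≥0 j n) ((+-monoʳ 1# (-‿mono (div-nonneg j n) ⋙ ≤-reflexive -0#≈0#)) ⋙ ≤-reflexive (+-identityʳ 1#)) ⋙ ≤-reflexive (*-identityʳ 1#)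

    survive-zero : ∀ {js j} n → j ∈ js → j ∣ n → survive js n ≈ 0#
    survive-zero {j ∷ js} n (here ≡.refl) h = trans (*-congˡ (trans (+-congˡ (-‿cong (div-yes {j} h))) (-‿inverseʳ 1#))) (zeroʳ _)
    survive-zero {j ∷ js} n (there m) h = trans (*-congʳ (survive-zero n m h)) (zeroˡ _)

    survive-multiple : ∀ js k n → survive js (n N.* k) ≤ survive js n
    survive-multiple [] k n = ≤-refl
    survive-multiple (j ∷ js) k n = *-mono (survive-nonneg js (n N.* k)) (survive-multiple js k n) (1-div≥0 j (n N.* k))
      (+-monoʳ 1# (-‿mono (ι-mono (⟦⟧-mono (j ∣? n) (j ∣? (n N.* k)) (λ h → ∣-trans h (m∣m*n k))))))

    -- The multiples of j carry at most 1/j of the sum.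
    remove-multiples : ∀ N js j → 1 N.≤ j → α j * ∑ N (λ n → survive js n * inv n) ≤ ∑ N (λ n → survive (j ∷ js) n * inv n)
    remove-multiples N js j@(suc j-1) j≥1 = ≤-trans (≤-reflexive (trans (distribʳ _ 1# (- inv j)) (+-congʳ (*-identityˡ _))))
        (+-monoˡ (- inv j * total) split ⋙ +-monoˡ (- inv j * total) (+-monoʳ kept multiples) ⋙ ≤-reflexive (S.solve 3 (λ k u t → (k S.:+ u S.:* t) S.:+ S.:- u S.:* t S.:= k) refl kept (inv j) total))
      where
      f : ℕ → Carrier
      f n = survive js n * inv n
      f≥0 : ∀ n → 0# ≤ f n
      f≥0 n = *-nonneg (survive-nonneg js n) (inv-nonneg n)
      total kept : Carrier
      total = ∑ N f
      kept = ∑ N (λ n → survive (j ∷ js) n * inv n)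
      g : ℕ → Carrier
      g n = f n * div j n
      g≥0 : ∀ n → 0# ≤ g n
      g≥0 n = *-nonneg (f≥0 n) (div-nonneg j n)
      split : total ≤ kept + ∑ N g
      split = ≤-reflexive (trans (∑-cong N (λ n → S.solve 3 (λ s i e → s S.:* i S.:= s S.:* (S.con (1 , 0) S.:+ S.:- e) S.:* i S.:+ s S.:* i S.:* e) refl (survive js n) (inv n) (div j n))) (∑-+ N (λ n → survive (j ∷ js) n * inv n) g))
      multiples : ∑ N g ≤ inv j * total
      multiples = begin
        ∑ N g ≲⟨ ∑-extend g g≥0 (N.m≤m*n N j) ⟩
        ∑ (N N.* j) g ≈⟨ ∑-blocks N j g ⟩
        ∑ N (λ a → ∑ j (λ b → g (a N.* j N.+ b))) ≲⟨ ∑-mono N (λ a _ → one a) ⟩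
        ∑ N (λ a → inv j * f a) ≈⟨ ∑-*ˡ N (inv j) f ⟩
        inv j * total ∎
        where
        open ≤R
        one : ∀ a → ∑ j (λ b → g (a N.* j N.+ b)) ≤ inv j * f a
        one a = ≤-trans (≤-reflexive (trans (+-cong (trans (reflexive (≡.cong g (N.+-identityʳ (a N.* j)))) (trans (*-congˡ (div-yes {j} (n∣m*n a))) (*-identityʳ _)))
            (∑-zero j-1 (λ i i< → trans (*-congˡ (div-no {j} {a N.* j N.+ suc i} (λ h → N.<⇒≱ (s≤s i<) (∣⇒≤ (∣m+n∣m⇒∣n h (n∣m*n a)))))) (zeroʳ _)))) (+-identityʳ _)))
          (*-mono (survive-nonneg js (a N.* j)) (survive-multiple js j a) (inv-nonneg (a N.* j)) (≤-reflexive (inv-multiple a)) ⋙ ≤-reflexive (S.solve 3 (λ s u i → s S.:* (u S.:* i) S.:= u S.:* (s S.:* i)) refl (survive js a) (inv j) (inv a)))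
          where
          inv-multiple : ∀ a → inv (a N.* j) ≈ inv j * inv a
          inv-multiple zero = sym (zeroʳ _)
          inv-multiple (suc a) = inv-* a j-1

    remove-all : ∀ N js → All (2 N.≤_) js → Π js α * ∑ N (λ n → inv n) ≤ ∑ N (λ n → survive js n * inv n)
    remove-all N [] [] = ≤-reflexive (trans (*-identityˡ _) (∑-cong N (λ n → sym (*-identityˡ _))))
    remove-all N (j ∷ js) (l ∷ ls) = ≤-reflexive (*-assoc _ _ _) ⋙ *-monoʳ (Factor.α≥0 j l) (remove-all N js ls) ⋙ remove-multiples N js j (N.<⇒≤ l)

    -- Only n = 1 survives; n = 0 carries no weight since `inv 0` is 0.
    ∑-survive≤1 : ∀ N js → (∀ n → 2 N.≤ n → n N.< N → ∃[ j ] (j ∈ js × j ∣ n)) → ∑ N (λ n → survive js n * inv n) ≤ 1#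
    ∑-survive≤1 zero js h = 0≤1
    ∑-survive≤1 (suc zero) js h = ≤-reflexive (trans (+-identityʳ _) (zeroʳ _)) ⋙ 0≤1
    ∑-survive≤1 (suc (suc N)) js h = ≤-trans (+-mono-≤ (≤-reflexive (zeroʳ _)) (+-mono-≤ (*-mono (survive-nonneg js 1) (survive≤1 js 1) (inv-nonneg 1) (inv≤1 1))
        (≤-reflexive (∑-zero N (λ i i< → trans (*-congʳ (dead i (h (suc (suc i)) (s≤s (s≤s z≤n)) (s≤s (s≤s i<))))) (zeroˡ _))))))
        (≤-reflexive (trans (+-identityˡ _) (trans (+-identityʳ _) (*-identityʳ 1#))))
      where
      dead : ∀ i → ∃[ j ] (j ∈ js × j ∣ suc (suc i)) → survive js (suc (suc i)) ≈ 0#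
      dead i (j , m , d) = survive-zero (suc (suc i)) m d

    Π-from2 : ∀ e → Π (from2 e) α ≈ inv (suc e)
    Π-from2 zero = inv-unique 0 (trans (*-identityʳ _) ι-1)
    Π-from2 (suc e) = trans (*-congˡ (Π-from2 e)) (Factor.αv (2 N.+ e) (s≤s (s≤s z≤n)))

    harmonic : ∀ c → ι c ≤ ι 2 * ∑ (suc (2 N.^ c)) (λ n → inv n)
    harmonic zero = *-nonneg (ι-nonneg 2) (∑-nonneg (suc (2 N.^ 0)) inv-nonneg)
    harmonic (suc c) = begin
      1# + ι c ≲⟨ +-mono-≤ (≤-reflexive (sym unit)) (harmonic c) ⟩
      ι 2 * (ι M * inv (2 N.* M)) + ι 2 * ∑ (suc M) inv ≈⟨ trans (sym (distribˡ (ι 2) _ _)) (*-congˡ (+-comm _ _)) ⟩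
      ι 2 * (∑ (suc M) inv + ι M * inv (2 N.* M)) ≲⟨ *-monoʳ (ι-nonneg 2) (+-monoʳ _ (≤-reflexive (sym (∑-const M _)) ⋙ ∑-mono M (λ i i< → inv-antitone (s≤s z≤n) (bound i i<)))) ⟩
      ι 2 * (∑ (suc M) inv + ∑ M (λ i → inv (suc M N.+ i))) ≈⟨ *-congˡ (trans (sym (∑-append (suc M) M inv)) (reflexive (≡.cong (λ t → ∑ t inv) (≡.cong suc (≡.cong (M N.+_) (≡.sym (N.+-identityʳ M))))))) ⟩
      ι 2 * ∑ (suc (2 N.^ suc c)) inv ∎
      where
      open ≤R
      M : ℕ
      M = 2 N.^ c
      unit : ι 2 * (ι M * inv (2 N.* M)) ≈ 1#
      unit = trans (sym (*-assoc _ _ _)) (trans (*-congʳ (sym (ι-* 2 M))) (ι*inv (N.*-mono-≤ (s≤s (z≤n {1})) (N.m^n>0 2 c))))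
      bound : ∀ i → i N.< M → suc M N.+ i N.≤ 2 N.* M
      bound i i< = N.≤-reflexive (≡.sym (N.+-suc M i)) ⟫ N.+-monoʳ-≤ M (i< ⟫ N.≤-reflexive (≡.sym (N.+-identityʳ M)))

    sifted-divisor : ∀ d → 1 N.≤ d → ∀ n₀ n → 2 N.≤ n → n N.< 3 N.+ n₀ → ∃[ j ] (j ∈ sieving d n₀ ++ from2 d × j ∣ n)
    sifted-divisor d d≥1 n₀ n n≥2 n< = pick (prime-divisor n n≥2)
      where
      pick : ∃[ p ] (Prime p × p ∣ n) → ∃[ j ] (j ∈ sieving d n₀ ++ from2 d × j ∣ n)
      pick (p , pr , p∣n) = p , place (p ∣? d) (p ∣? suc d) , p∣n
        where
        small : p N.≤ suc d → p ∈ sieving d n₀ ++ from2 d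
        small le = ∈-++⁺ʳ (sieving d n₀) (from2-complete d (prime≥2 pr) le)
        not2 : ¬ p ∣ d → ¬ p ∣ suc d → 2 ≢ p
        not2 a b ≡.refl = refute (2∣n⊎2∣1+n d)
          where
          refute : ¬ (2 ∣ d ⊎ 2 ∣ suc d)
          refute (inj₁ x) = a x
          refute (inj₂ y) = b y
        place : Dec (p ∣ d) → Dec (p ∣ suc d) → p ∈ sieving d n₀ ++ from2 d
        place (yes a) _ = small (N.m≤n⇒m≤1+n (∣⇒≤ {{N.>-nonZero d≥1}} a))
        place (no _) (yes b) = small (∣⇒≤ b)
        place (no a) (no b) = ∈-++⁺ˡ (sieving-complete d n₀ (pr , a , b) (N.≤∧≢⇒< (prime≥2 pr) (not2 a b)) ((∣⇒≤ {{N.>-nonZero (N.<⇒≤ n≥2)}} p∣n) ⟫ N.≤-pred n<))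

    sieving-large : ∀ d n → All (2 N.≤_) (sieving d n)
    sieving-large d n = All.map (λ (a , _) → N.<⇒≤ a) (sieving-range d n)

    -- The harmonic sum up to 2^c is at least c/2, and sifting it by the sieving primes and by all
    -- of 2, ..., d + 1 leaves only the term 1. The extra integers stand in for 2 and the primes
    -- dividing d (d + 1); their product telescopes to 1/(d + 1).
    mertens-lower : ∀ d → 1 N.≤ d → ∀ c n₀ → 2 N.^ c ≡ 2 N.+ n₀ → Π (sieving d n₀) α * ι c ≤ ι (2 N.* suc d)
    mertens-lower d d≥1 c n₀ e = ι-cancel-inv (begin
      inv (suc d) * (A * ι c) ≲⟨ *-monoʳ (inv-nonneg (suc d)) (*-monoʳ A≥0 (harmonic c)) ⟩
      inv (suc d) * (A * (ι 2 * ∑ (suc (2 N.^ c)) inv)) ≡⟨ ≡.cong (λ t → inv (suc d) * (A * (ι 2 * ∑ (suc t) inv))) e ⟩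
      inv (suc d) * (A * (ι 2 * H)) ≈⟨ S.solve 4 (λ u a t h → u S.:* (a S.:* (t S.:* h)) S.:= t S.:* ((a S.:* u) S.:* h)) refl (inv (suc d)) A (ι 2) H ⟩
      ι 2 * ((A * inv (suc d)) * H) ≈⟨ *-congˡ (*-congʳ (trans (*-congˡ (sym (Π-from2 d))) (sym (Π-++ (sieving d n₀) (from2 d) α)))) ⟩
      ι 2 * (Π (sieving d n₀ ++ from2 d) α * H) ≲⟨ *-monoʳ (ι-nonneg 2) (remove-all (3 N.+ n₀) (sieving d n₀ ++ from2 d) (AllP.++⁺ (sieving-large d n₀) (from2-large d)) ⋙ (∑-survive≤1 (3 N.+ n₀) _ (sifted-divisor d d≥1 n₀))) ⟩
      ι 2 * 1# ≈⟨ *-identityʳ _ ⟩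
      ι 2 ∎)
      where
      open ≤R
      A H : Carrier
      A = Π (sieving d n₀) α
      H = ∑ (3 N.+ n₀) inv
      A≥0 : 0# ≤ A
      A≥0 = Products.A≥0 (sieving-large d n₀)
      ι-cancel-inv : ∀ {x} → inv (suc d) * x ≤ ι 2 → x ≤ ι (2 N.* suc d)
      ι-cancel-inv {x} h = ≤-reflexive (sym (trans (sym (*-assoc _ _ _)) (trans (*-congʳ (inv-spec d)) (*-identityˡ x)))) ⋙ *-monoʳ (ι-nonneg (suc d)) h ⋙ ≤-reflexive (trans (*-comm _ _) (sym (ι-* 2 (suc d))))

  -- Chebyshev bounds from binomial coefficients

  module Binomial where
    open import Data.Nat using (_+_; _*_; _∸_; _^_; _≤_; _<_; _!)
    open import Data.Nat.Properties using (_!≢0; _!*_!≢0)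
    open import Data.Nat.Combinatorics using (_C_; nCk≡n!/k![n-k]!; k![n∸k]!∣n!; nCk+nC[k+1]≡[n+1]C[k+1]; nC1≡n)
    open import Relation.Binary.PropositionalEquality using (refl; sym; trans; cong; subst)

    C-factorials : ∀ k j → ((k + j) C k) * (k ! * j !) ≡ (k + j) !
    C-factorials k j = trans (cong (_* (k ! * j !)) (nCk≡n!/k![n-k]! (N.m≤m+n k j))) (go (k + j ∸ k) (N.m+n∸m≡n k j) (k![n∸k]!∣n! (N.m≤m+n k j)))
      where
      go : ∀ i → i ≡ j → k ! * i ! ∣ (k + j) ! → ((k + j) ! N./ (k ! * i !)) {{k !* i !≢0}} * (k ! * j !) ≡ (k + j) !
      go i refl h = N.m/n*n≡m {{k !* i !≢0}} h

    C≤2^ : ∀ n k → n C k ≤ 2 ^ n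
    C≤2^ zero zero = N.≤-refl
    C≤2^ zero (suc k) = z≤n
    C≤2^ (suc n) zero = N.≤-reflexive (one (suc n)) ⟫ N.m^n>0 2 (suc n)
      where
      one : ∀ n → n C 0 ≡ 1
      one n = N.*-cancelʳ-≡ (n C 0) 1 (1 * n !) {{0 !* n !≢0}} (trans (C-factorials 0 n) (lem (n !)))
        where
        lem : ∀ x → x ≡ 1 * (1 * x)
        lem = solve-∀
    C≤2^ (suc n) (suc k) = N.≤-reflexive (sym (nCk+nC[k+1]≡[n+1]C[k+1] n k)) ⟫ N.+-mono-≤ (C≤2^ n k) (C≤2^ n (suc k)) ⟫ N.≤-reflexive (cong (2 ^ n +_) (sym (N.+-identityʳ _)))

    2^≤C : ∀ n → 2 ^ n ≤ (n + n) C n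
    2^≤C zero = N.≤-refl
    2^≤C (suc n) = subst (λ m → 2 ^ suc n ≤ m C suc n) (cong suc (sym (N.+-suc n n)))
      (N.+-mono-≤ ((2^≤C n) ⟫ left n) (N.≤-reflexive (N.+-identityʳ _) ⟫ (2^≤C n) ⟫ right) ⟫ N.≤-reflexive (nCk+nC[k+1]≡[n+1]C[k+1] (suc (n + n)) n))
      where
      left : ∀ n → (n + n) C n ≤ suc (n + n) C n
      left zero = N.≤-refl
      left (suc n) = N.m≤n+m ((suc n + suc n) C suc n) ((suc n + suc n) C n) ⟫ N.≤-reflexive (nCk+nC[k+1]≡[n+1]C[k+1] (suc n + suc n) n)
      right : (n + n) C n ≤ suc (n + n) C suc n
      right = (N.m≤m+n _ ((n + n) C suc n)) ⟫ N.≤-reflexive (nCk+nC[k+1]≡[n+1]C[k+1] (n + n) n)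

    -- The reciprocals of k C(k+j, k) are the entries of Leibniz's harmonic triangle, each the difference of two
    -- entries of the previous column; so a common multiple of the first column is one of all.
    leibniz : ∀ L n → (∀ m → 1 ≤ m → m ≤ n → m ∣ L) → ∀ k j → suc k + j ≤ n → suc k * ((suc k + j) C suc k) ∣ L
    leibniz L n h zero j le = subst (_∣ L) (sym (trans (N.+-identityʳ _) (nC1≡n (suc j)))) (h (suc j) (s≤s z≤n) le)
    leibniz L n h (suc k) j le = combine (leibniz L n h k j ((N.n≤1+n _) ⟫ le)) (leibniz L n h k (suc j) (N.≤-reflexive (N.+-suc (suc k) j) ⟫ le))
      where
      k′ : ℕ
      k′ = suc k
      combine : k′ * ((k′ + j) C k′) ∣ L → k′ * ((k′ + suc j) C k′) ∣ L → suc k′ * ((suc k′ + j) C suc k′) ∣ L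
      combine (divides x ex) (divides y ey) = algebra {(suc (k′ + j)) C k′} {(k′ + j) C k′} {(suc k′ + j) C suc k′} (subst (λ t → (t C k′) * (k′ ! * suc j !) ≡ t !) (N.+-suc k′ j) (C-factorials k′ (suc j))) (C-factorials k′ j) (C-factorials (suc k′) j)
          ex (trans ey (cong (λ t → y * (k′ * (t C k′))) (N.+-suc k′ j)))
        where
        algebra : ∀ {P P′ Q} → P * (k′ ! * suc j !) ≡ suc (k′ + j) ! → P′ * (k′ ! * j !) ≡ (k′ + j) ! → Q * (suc k′ ! * j !) ≡ suc (k′ + j) ! → L ≡ x * (k′ * P′) → L ≡ y * (k′ * P) → suc k′ * Q ∣ L
        algebra {P} {P′} {Q} eP eP′ eQ ex ey = ∣m+n∣m⇒∣n (divides x (trans (N.+-comm (y * (suc k′ * Q)) L) (sym key))) (n∣m*n y)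
          where
          f : ℕ
          f = k′ ! * j !
          instance _ = k′ !* j !≢0
          PP′ : suc (k′ + j) * P′ ≡ suc j * P
          PP′ = N.*-cancelʳ-≡ _ _ f (trans (N.*-assoc (suc (k′ + j)) P′ f) (trans (cong (suc (k′ + j) *_) eP′) (trans (sym eP) (lem P (k′ !) (suc j) (j !)))))
            where
            lem : ∀ P a s b → P * (a * (s * b)) ≡ s * P * (a * b)
            lem = solve-∀
          PQ : suc j * P ≡ suc k′ * Q
          PQ = N.*-cancelʳ-≡ _ _ f (trans (lem P (k′ !) (suc j) (j !)) (trans eP (trans (sym eQ) (lem′ Q (suc k′) (k′ !) (j !)))))
            where
            lem : ∀ P a s b → s * P * (a * b) ≡ P * (a * (s * b))
            lem = solve-∀
            lem′ : ∀ Q k a b → Q * (k * a * b) ≡ k * Q * (a * b)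
            lem′ = solve-∀
          key : x * (suc k′ * Q) ≡ L + y * (suc k′ * Q)
          key = N.*-cancelˡ-≡ _ _ k′ (trans (lem₁ k′ x (suc k′ * Q)) (trans (cong (x * k′ *_) (trans (sym PQ) (sym PP′))) (trans (lem₂ x k′ (suc (k′ + j)) P′) (trans (cong (suc (k′ + j) *_) (sym ex))
              (trans (lem₃ k′ j L) (trans (cong (λ t → k′ * L + suc j * t) ey) (trans (lem₄ k′ L (suc j) y P) (cong (λ t → k′ * (L + y * t)) PQ))))))))
            where
            lem₁ : ∀ k x q → k * (x * q) ≡ x * k * q
            lem₁ = solve-∀
            lem₂ : ∀ x k n P → x * k * (n * P) ≡ n * (x * (k * P))
            lem₂ = solve-∀
            lem₃ : ∀ k j L → suc (k + j) * L ≡ k * L + suc j * L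
            lem₃ = solve-∀
            lem₄ : ∀ k L s y P → k * L + s * (y * (k * P)) ≡ k * (L + y * (s * P))
            lem₄ = solve-∀

    prime∤! : ∀ {p} → Prime p → ∀ n → n < p → ¬ p ∣ n !
    prime∤! pr zero lt h = N.<⇒≱ (prime≥2 pr) (∣⇒≤ h)
    prime∤! {p} pr (suc n) lt h = split (euclidsLemma (suc n) (n !) pr h)
      where
      split : ¬ (p ∣ suc n ⊎ p ∣ n !)
      split (inj₁ a) = N.<⇒≱ lt (∣⇒≤ a)
      split (inj₂ b) = prime∤! pr n (N.<-trans (N.n<1+n n) lt) b

    ∣! : ∀ {p} n → 1 ≤ p → p ≤ n → p ∣ n !
    ∣! zero a b = ⊥-elim (N.<⇒≱ a b)
    ∣! {p} (suc n) a b = cases (N.m≤n⇒m<n∨m≡n b)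
      where
      cases : p < suc n ⊎ p ≡ suc n → p ∣ suc n * n !
      cases (inj₁ lt) = ∣-trans (∣! n a (N.≤-pred lt)) (n∣m*n (suc n))
      cases (inj₂ refl) = m∣m*n (n !)

    prime∣C : ∀ {p} M → Prime p → M < p → p ≤ M + M → p ∣ (M + M) C M
    prime∣C {p} M pr lt le = first (euclidsLemma _ _ pr (subst (p ∣_) (sym (C-factorials M M)) (∣! (M + M) (N.<⇒≤ (prime≥2 pr)) le)))
      where
      first : p ∣ (M + M) C M ⊎ p ∣ M ! * M ! → p ∣ (M + M) C M
      first (inj₁ a) = a
      first (inj₂ b) = ⊥-elim (second (euclidsLemma _ _ pr b))
        where
        second : ¬ (p ∣ M ! ⊎ p ∣ M !)
        second (inj₁ a) = prime∤! pr M lt a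
        second (inj₂ b) = prime∤! pr M lt b

    coprime-*∣ : ∀ {m n B} → Coprime m n → m ∣ B → n ∣ B → m * n ∣ B
    coprime-*∣ {m} {n} {B} c (divides k e) n∣B = subst (m * n ∣_) (trans (N.*-comm m k) (sym e)) (*-monoʳ-∣ m (coprime-divisor {n} {m} {k} (λ { (a , b) → c (b , a) }) (subst (n ∣_) (trans e (N.*-comm k m)) n∣B)))

    primes-product∣ : ∀ {B} ys → All Prime ys → AllPairs _≢_ ys → All (_∣ B) ys → product ys ∣ B
    primes-product∣ [] _ _ _ = 1∣ _
    primes-product∣ {B} (y ∷ ys) (p ∷ ps) (x ∷ xs) (d ∷ ds) = coprime-*∣ (λ { (a , b) → prime-coprime {y} {product ys} p (λ h → AllP.All¬⇒¬Any x (factorisationHasAllPrimeFactors p h ps)) (b , a) }) d (primes-product∣ ys ps xs ds)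

    ^≤product : ∀ {M} ys → All (M ≤_) ys → M ^ length ys ≤ product ys
    ^≤product [] [] = N.≤-refl
    ^≤product (y ∷ ys) (l ∷ ls) = N.*-mono-≤ l (^≤product ys ls)

    -- Primes between M and 2M divide the central binomial coefficient.
    primes-in-block : ∀ c ys → All (λ q → Prime q × 2 ^ c < q × q ≤ 2 ^ suc c) ys → AllPairs _≢_ ys → length ys * c ≤ 2 ^ suc c
    primes-in-block c ys h ap = N.≮⇒≥ (λ lt → N.<⇒≱ (N.<-≤-trans (N.^-monoʳ-< 2 (s≤s (s≤s z≤n)) lt) bound′) N.≤-refl)
      where
      M : ℕ
      M = 2 ^ c
      MM : M + M ≡ 2 ^ suc c
      MM = cong (M +_) (sym (N.+-identityʳ M))
      positive : 1 ≤ (M + M) C M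
      positive = N.m^n>0 2 M ⟫ (2^≤C M)
      bound′ : 2 ^ (length ys * c) ≤ 2 ^ (2 ^ suc c)
      bound′ = N.≤-trans (N.≤-reflexive (trans (cong (2 ^_) (N.*-comm (length ys) c)) (sym (N.^-*-assoc 2 c (length ys)))))
        (N.≤-trans (^≤product ys (All.map (λ { (_ , a , _) → N.<⇒≤ a }) h))
        (N.≤-trans (∣⇒≤ {{N.>-nonZero positive}} (primes-product∣ ys (All.map proj₁ h) ap (All.map (λ { {q} (p , a , b) → prime∣C M p a (subst (q ≤_) (sym MM) b) }) h)))
        (C≤2^ (M + M) M ⟫ N.≤-reflexive (cong (2 ^_) MM))))

    primes : ℕ → List ℕ
    primes n = filter prime? (upTo (suc n))

    power-below : ∀ p n → 2 ≤ p → 1 ≤ n → ∃[ f ] (p ^ f ≤ n × n < p ^ suc f)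
    power-below p n p≥2 n≥1 = go n (n<p^n n ⟫ N.≤-reflexive refl)
      where
      n<p^n : ∀ n → n < p ^ n
      n<p^n zero = s≤s z≤n
      n<p^n (suc n) = N.+-mono-≤ (s≤s z≤n ⟫ n<p^n n) (n<p^n n) ⟫ N.≤-reflexive (cong (p ^ n +_) (sym (N.+-identityʳ _))) ⟫ N.*-monoˡ-≤ (p ^ n) p≥2
      go : ∀ f → n < p ^ f → ∃[ f ] (p ^ f ≤ n × n < p ^ suc f)
      go zero lt = ⊥-elim (N.<⇒≱ lt n≥1)
      go (suc f) lt = cases (N.≤-<-connex (p ^ f) n)
        where
        cases : p ^ f ≤ n ⊎ n < p ^ f → ∃[ f ] (p ^ f ≤ n × n < p ^ suc f)
        cases (inj₁ le) = f , le , lt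
        cases (inj₂ lt′) = go f lt′

    split-power : ∀ p m → 2 ≤ p → 1 ≤ m → ∃[ e ] ∃[ m′ ] (m ≡ p ^ e * m′ × ¬ p ∣ m′)
    split-power p m p≥2 m≥1 = go m m m≥1 N.≤-refl
      where
      go : ∀ fuel m → 1 ≤ m → m ≤ fuel → ∃[ e ] ∃[ m′ ] (m ≡ p ^ e * m′ × ¬ p ∣ m′)
      go zero m m≥1 le = ⊥-elim (N.<⇒≱ m≥1 le)
      go (suc fuel) m m≥1 le = cases (p ∣? m)
        where
        cases : Dec (p ∣ m) → ∃[ e ] ∃[ m′ ] (m ≡ p ^ e * m′ × ¬ p ∣ m′)
        cases (no z) = 0 , m , sym (N.+-identityʳ m) , z
        cases (yes (divides zero e)) = ⊥-elim (N.<⇒≢ m≥1 (sym e))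
        cases (yes (divides (suc k) e)) = raise (go fuel (suc k) (s≤s z≤n) (N.≤-pred ((N.m<m*n (suc k) p p≥2 ⟫ N.≤-reflexive (sym e)) ⟫ le)))
          where
          raise : ∃[ e ] ∃[ m′ ] (suc k ≡ p ^ e * m′ × ¬ p ∣ m′) → ∃[ e ] ∃[ m′ ] (m ≡ p ^ e * m′ × ¬ p ∣ m′)
          raise (f , m′ , e′ , z) = suc f , m′ , trans e (trans (cong (_* p) e′) (lem (p ^ f) m′ p)) , z
            where
            lem : ∀ a b p → a * b * p ≡ p * a * b
            lem = solve-∀

    -- The product of the largest powers ≤ n of the given primes.
    powers : ∀ n → 1 ≤ n → ∀ ps → All Prime ps → ∃[ K ] (1 ≤ K × K ≤ n ^ length ps × (∀ m → 1 ≤ m → m ≤ n → (∀ p → Prime p → p ∣ m → p ∈ ps) → m ∣ K))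
    powers n n≥1 [] [] = 1 , s≤s z≤n , N.≤-refl , base
      where
      base : ∀ m → 1 ≤ m → m ≤ n → (∀ p → Prime p → p ∣ m → p ∈ []) → m ∣ 1
      base (suc zero) _ _ h = ∣-refl
      base m@(suc (suc _)) _ _ h = ⊥-elim (none (prime-divisor m (s≤s (s≤s z≤n))))
        where
        none : ¬ (∃[ p ] (Prime p × p ∣ m))
        none (p , pr , d) with () ← h p pr d
    powers n n≥1 (p ∷ ps) (pr ∷ prs) = step (power-below p n (prime≥2 pr) n≥1) (powers n n≥1 ps prs)
      where
      step : ∃[ f ] (p ^ f ≤ n × n < p ^ suc f) → ∃[ K ] (1 ≤ K × K ≤ n ^ length ps × (∀ m → 1 ≤ m → m ≤ n → (∀ p → Prime p → p ∣ m → p ∈ ps) → m ∣ K)) →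
             ∃[ K ] (1 ≤ K × K ≤ n * n ^ length ps × (∀ m → 1 ≤ m → m ≤ n → (∀ q → Prime q → q ∣ m → q ∈ p ∷ ps) → m ∣ K))
      step (f , lo , hi) (K , K≥1 , K≤ , H) = p ^ f * K , N.*-mono-≤ (N.m^n>0 p {{prime⇒nonZero pr}} f) K≥1 , N.*-mono-≤ lo K≤ , λ m m≥1 m≤n h → decompose m m≥1 m≤n h (split-power p m (prime≥2 pr) m≥1)
        where
        decompose : ∀ m → 1 ≤ m → m ≤ n → (∀ q → Prime q → q ∣ m → q ∈ p ∷ ps) → ∃[ e ] ∃[ m′ ] (m ≡ p ^ e * m′ × ¬ p ∣ m′) → m ∣ p ^ f * K
        decompose m m≥1 m≤n h (e , zero , eq , z) = ⊥-elim (z (p ∣0))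
        decompose m m≥1 m≤n h (e , m′@(suc _) , eq , z) = subst (_∣ p ^ f * K) (sym eq) (∣-trans (*-monoˡ-∣ m′ pe∣) (*-monoʳ-∣ (p ^ f) (H m′ (s≤s z≤n) (m′≤m ⟫ m≤n) primes-of)))
          where
          instance _ = prime⇒nonZero pr
          m′≤m : m′ ≤ m
          m′≤m = N.m≤n*m m′ (p ^ e) {{N.m^n≢0 p e}} ⟫ N.≤-reflexive (sym eq)
          pe≤ : p ^ e ≤ n
          pe≤ = N.m≤m*n (p ^ e) m′ ⟫ N.≤-reflexive (sym eq) ⟫ m≤n
          e≤f : e ≤ f
          e≤f = N.≮⇒≥ (λ lt → N.<⇒≱ hi (N.^-monoʳ-≤ p lt ⟫ pe≤))
          pe∣ : p ^ e ∣ p ^ f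
          pe∣ = subst (p ^ e ∣_) (trans (sym (N.^-distribˡ-+-* p e (f ∸ e))) (cong (p ^_) (N.m+[n∸m]≡n e≤f))) (m∣m*n (p ^ (f ∸ e)))
          primes-of : ∀ q → Prime q → q ∣ m′ → q ∈ ps
          primes-of q pq q∣ = away (h q pq (subst (q ∣_) (sym eq) (∣-trans q∣ (n∣m*n (p ^ e)))))
            where
            away : q ∈ p ∷ ps → q ∈ ps
            away (here refl) = ⊥-elim (z q∣)
            away (there x) = x

    -- Nair's argument. The product K of the largest prime powers up to x is at most x^π(x); every m
    -- ≤ x divides it, so by `leibniz` it is a multiple of N C(2 N, N) for N = ⌊x/2⌋, and hence at
    -- least 2^N.
    π-lower : ∀ a x → 1 ≤ x → x ≤ 2 ^ a → x ≤ 1 + 2 * (a * π x)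
    π-lower a x x≥1 x≤ = conclude (powers x x≥1 (primes x) (AllP.all-filter prime? (upTo (suc x))))
      where
      N : ℕ
      N = x N./ 2
      x≡ : x ≡ x N.% 2 + N * 2
      x≡ = N.m≡m%n+[m/n]*n x 2
      x≤1+2N : x ≤ 1 + 2 * N
      x≤1+2N = N.≤-reflexive x≡ ⟫ N.+-mono-≤ (N.≤-pred (N.m%n<n x 2)) (N.≤-reflexive (N.*-comm N 2))
      NN≤x : N + N ≤ x
      NN≤x = N.≤-reflexive (lem N) ⟫ N.m≤n+m (N * 2) (x N.% 2) ⟫ N.≤-reflexive (sym x≡)
        where
        lem : ∀ n → n + n ≡ n * 2
        lem = solve-∀
      conclude : ∃[ K ] (1 ≤ K × K ≤ x ^ length (primes x) × (∀ m → 1 ≤ m → m ≤ x → (∀ p → Prime p → p ∣ m → p ∈ primes x) → m ∣ K)) → x ≤ 1 + 2 * (a * π x)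
      conclude (K , K≥1 , K≤ , H) = x≤1+2N ⟫ s≤s (N.*-monoʳ-≤ 2 (N.≮⇒≥ {a * π x} {N} (λ lt → N.<⇒≱ (N.^-monoʳ-< 2 (s≤s (s≤s z≤n)) {a * π x} {N} lt) (power N NN≤x))))
        where
        divides-K : ∀ m → 1 ≤ m → m ≤ x → m ∣ K
        divides-K m m≥1 m≤x = H m m≥1 m≤x (λ p pr p∣m → ∈-filter⁺ prime? (∈-upTo⁺ (s≤s ((∣⇒≤ {{N.>-nonZero m≥1}} p∣m) ⟫ m≤x))) pr)
        K≤2^ : K ≤ 2 ^ (a * π x)
        K≤2^ = K≤ ⟫ N.^-monoˡ-≤ (π x) x≤ ⟫ N.≤-reflexive (N.^-*-assoc 2 a (π x))
        power : ∀ N → N + N ≤ x → 2 ^ N ≤ 2 ^ (a * π x)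
        power zero le = N.m^n>0 2 (a * π x)
        power (suc N) le = (2^≤C (suc N)) ⟫ N.m≤n*m ((suc N + suc N) C suc N) (suc N) ⟫ (∣⇒≤ {{N.>-nonZero K≥1}} (leibniz K x divides-K N (suc N) le)) ⟫ K≤2^

  open Binomial

  -- Dyadic blocks of primes: a lower bound for the product of 1 - 1/q

  record Block (M s : ℕ) (base : List ℕ) (n : ℕ) (qs : List ℕ) : Set where
    constructor block
    field
      new : List ℕ
      split : qs ≡ new ++ base
      range : All (λ q → Prime q × M N.< q × q N.≤ 2 N.+ n) new
      distinct : AllPairs _≢_ new
      later : s N.≤ n

  sieving-block : ∀ d s k → Block (2 N.+ s) s (sieving d s) (k N.+ s) (sieving d (k N.+ s))
  sieving-block d s = sieving-ind d (Block (2 N.+ s) s (sieving d s)) s (block [] ≡.refl [] [] N.≤-refl) take skip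
    where
    up : ∀ {n q} → Prime q × 2 N.+ s N.< q × q N.≤ 2 N.+ n → Prime q × 2 N.+ s N.< q × q N.≤ 3 N.+ n
    up (p , a , b) = p , a , N.m≤n⇒m≤1+n b
    take : ∀ n {qs} → Admissible d (3 N.+ n) → Block (2 N.+ s) s (sieving d s) n qs → Block (2 N.+ s) s (sieving d s) (suc n) (3 N.+ n ∷ qs)
    take n a (block new e r u l) = block (3 N.+ n ∷ new) (≡.cong (3 N.+ n ∷_) e) ((proj₁ a , s≤s (s≤s (s≤s l)) , N.≤-refl) ∷ All.map up r)
      (All.map (λ { (_ , _ , b) e → N.<⇒≢ (s≤s b) (≡.sym e) }) r ∷ u) (N.m≤n⇒m≤1+n l)
    skip : ∀ n {qs} → Block (2 N.+ s) s (sieving d s) n qs → Block (2 N.+ s) s (sieving d s) (suc n) qs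
    skip n (block new e r u l) = block new e (All.map up r) u (N.m≤n⇒m≤1+n l)

  module BlockTheory (O : OrderedField) where
    open OrderTheory O
    open PatternTheory O
    open EulerTheory O
    open HarmonicTheory O

    α-block : ∀ {M} ys → 1 N.≤ M → All (M N.≤_) ys → (1# + - inv M) ^ length ys ≤ Π ys α
    α-block [] _ [] = ≤-refl
    α-block {M} (y ∷ ys) M≥1 (l ∷ ls) = *-mono (sub-nonneg (inv≤1 M)) (+-monoʳ 1# (-‿mono (inv-antitone M≥1 l))) (^-nonneg (length ys) (sub-nonneg (inv≤1 M))) (α-block ys M≥1 ls)

    half-power : ∀ c → ½ ≤ (1# + - inv (2 N.^ suc c)) ^ (2 N.^ c)
    half-power c = ≤-reflexive eq ⋙ bernoulli⁻ M (inv-nonneg (2 N.* M)) (inv≤1 (2 N.* M))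
      where
      M : ℕ
      M = 2 N.^ c
      half : ι M * inv (2 N.* M) ≈ ½
      half = ≈-cancel (ι 2) ½ (inv-spec 1) (trans (sym (*-assoc _ _ _)) (trans (*-congʳ (sym (ι-* 2 M))) (trans (ι*inv (N.*-mono-≤ (s≤s (z≤n {1})) (N.m^n>0 2 c))) (sym (inv-spec 1)))))
      eq : ½ ≈ 1# + - (ι M * inv (2 N.* M))
      eq = trans (S.solve 1 (λ h → h S.:= h S.:+ h S.:+ S.:- h) refl ½) (+-cong ½+½ (-‿cong (sym half)))

    -- Both factors are compared after raising to the power c, where Bernoulli applies.
    block-bound : ∀ c ys → All (λ q → Prime q × 2 N.^ suc c N.< q × q N.≤ 2 N.^ suc (suc c)) ys → AllPairs _≢_ ys →
                  1# ≤ Π ys α * (1# + inv (suc c)) ^ 4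
    block-bound c ys r u = root (suc c) (s≤s z≤n) (*-nonneg P≥0 (^-nonneg 4 e≥0)) (begin
        1# ≈⟨ trans (sym (*-identityʳ 1#)) (sym ones) ⟩
        ½ ^ 4 * ι 2 ^ 4 ≲⟨ *-mono (^-nonneg 4 ½≥0) left (^-nonneg 4 (ι-nonneg 2)) (^-mono 4 (ι-nonneg 2) right) ⟩
        P ^ suc c * (e ^ suc c) ^ 4 ≈⟨ *-congˡ (trans (^-assocʳ e (suc c) 4) (trans (reflexive (≡.cong (e ^_) (N.*-comm (suc c) 4))) (sym (^-assocʳ e 4 (suc c))))) ⟩
        P ^ suc c * (e ^ 4) ^ suc c ≈⟨ sym (power-* P (e ^ 4) (suc c)) ⟩
        (P * e ^ 4) ^ suc c ∎)
      where
      open ≤R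
      M : ℕ
      M = 2 N.^ suc c
      P e : Carrier
      P = Π ys α
      e = 1# + inv (suc c)
      e≥0 : 0# ≤ e
      e≥0 = +-nonneg 0≤1 (inv-nonneg (suc c))
      M≥1 : 1 N.≤ M
      M≥1 = N.m^n>0 2 (suc c)
      x : Carrier
      x = 1# + - inv M
      x≥0 : 0# ≤ x
      x≥0 = sub-nonneg (inv≤1 M)
      x≤1 : x ≤ 1#
      x≤1 = (+-monoʳ 1# (-‿mono (inv-nonneg M) ⋙ ≤-reflexive -0#≈0#)) ⋙ ≤-reflexive (+-identityʳ 1#)
      above : x ^ length ys ≤ P
      above = α-block ys M≥1 (All.map (λ { (_ , a , _) → N.<⇒≤ a }) r)
      P≥0 : 0# ≤ P
      P≥0 = ^-nonneg (length ys) x≥0 ⋙ above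
      power-* : ∀ a b n → (a * b) ^ n ≈ a ^ n * b ^ n
      power-* a b zero = sym (*-identityʳ 1#)
      power-* a b (suc n) = trans (*-congˡ (power-* a b n)) (S.solve 4 (λ a b p q → a S.:* b S.:* (p S.:* q) S.:= a S.:* p S.:* (b S.:* q)) refl a b (a ^ n) (b ^ n))
      ones : ½ ^ 4 * ι 2 ^ 4 ≈ 1# * 1#
      ones = trans (sym (power-* ½ (ι 2) 4)) (trans (^-congˡ 4 (trans (*-comm _ _) (inv-spec 1))) (trans (lem 4) (sym (*-identityʳ 1#))))
        where
        lem : ∀ n → 1# ^ n ≈ 1#
        lem zero = refl
        lem (suc n) = trans (*-identityˡ _) (lem n)
      -- A block holds at most 4 · 2^c / (c + 1) primes. Since 2^c factors cost at most ½ by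
      -- `half-power`, the whole block raised to the power c + 1 costs at most ½^4, which is the
      -- origin of the exponent 4.
      count : length ys N.* suc c N.≤ 2 N.^ c N.* 4
      count = primes-in-block (suc c) ys r u ⟫ N.≤-reflexive (lem (2 N.^ c))
        where
        lem : ∀ t → 2 N.* (2 N.* t) ≡ t N.* 4
        lem = solve-∀
      left : ½ ^ 4 ≤ P ^ suc c
      left = begin
        ½ ^ 4 ≲⟨ ^-mono 4 ½≥0 (half-power c) ⟩
        (x ^ (2 N.^ c)) ^ 4 ≈⟨ ^-assocʳ x (2 N.^ c) 4 ⟩
        x ^ (2 N.^ c N.* 4) ≲⟨ ^-antitone x≥0 x≤1 count ⟩
        x ^ (length ys N.* suc c) ≈⟨ sym (^-assocʳ x (length ys) (suc c)) ⟩
        (x ^ length ys) ^ suc c ≲⟨ ^-mono (suc c) (^-nonneg (length ys) x≥0) above ⟩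
        P ^ suc c ∎
      right : ι 2 ≤ e ^ suc c
      right = ≤-reflexive (trans (+-congˡ (+-identityʳ 1#)) (+-congˡ (sym (inv-spec c)))) ⋙ bernoulli (suc c) (inv-nonneg (suc c))

    -- Induction over dyadic blocks: each one is paid for by a factor (1 + 1/c)^4, and these
    -- telescope to a fourth power.
    mertens-upper : ∀ d c n₀ → 2 N.^ suc c ≡ 2 N.+ n₀ → 1# ≤ ι (suc c) ^ 4 * Π (sieving d n₀) α
    mertens-upper d zero zero e = (1≤^ 4 (≤-reflexive (sym ι-1))) ⋙ ≤-reflexive (sym (*-identityʳ _))
    mertens-upper d (suc c) n₀ e = step (sieving-block d s M)
      where
      M s : ℕ
      M = 2 N.^ suc c
      s = M N.∸ 2
      M≡ : M ≡ 2 N.+ s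
      M≡ = ≡.sym (N.m+[n∸m]≡n (N.*-monoʳ-≤ 2 (N.m^n>0 2 c)))
      n₀≡ : M N.+ s ≡ n₀
      n₀≡ = N.+-cancelˡ-≡ 2 _ _ (≡.trans (lem M s) (≡.trans (≡.cong (M N.+_) (≡.sym M≡)) (≡.trans (≡.cong (M N.+_) (≡.sym (N.+-identityʳ M))) e)))
        where
        lem : ∀ M s → 2 N.+ (M N.+ s) ≡ M N.+ (2 N.+ s)
        lem = solve-∀
      top : 2 N.+ (M N.+ s) ≡ 2 N.^ suc (suc c)
      top = ≡.trans (≡.cong (2 N.+_) n₀≡) (≡.sym e)
      step : Block (2 N.+ s) s (sieving d s) (M N.+ s) (sieving d (M N.+ s)) → 1# ≤ ι (suc (suc c)) ^ 4 * Π (sieving d n₀) α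
      step (block new split range distinct later) = begin
        1# ≈⟨ sym (*-identityʳ 1#) ⟩
        1# * 1# ≲⟨ *-mono 0≤1 (mertens-upper d c s M≡) 0≤1 (block-bound c new (All.map (λ { {q} (p , a , b) → p , ≡.subst (N._< q) (≡.sym M≡) a , ≡.subst (q N.≤_) top b }) range) distinct) ⟩
        (ι (suc c) ^ 4 * A) * (Π new α * e′ ^ 4) ≈⟨ S.solve 4 (λ i A B e → (i S.:^ 4 S.:* A) S.:* (B S.:* e S.:^ 4) S.:= (i S.:* e) S.:^ 4 S.:* (B S.:* A)) refl (ι (suc c)) A (Π new α) e′ ⟩
        (ι (suc c) * e′) ^ 4 * (Π new α * A) ≈⟨ *-cong (^-congˡ 4 ιe) (trans (sym (Π-++ new (sieving d s) α)) (reflexive (≡.cong (λ qs → Π qs α) (≡.trans (≡.sym split) (≡.cong (sieving d) n₀≡))))) ⟩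
        ι (suc (suc c)) ^ 4 * Π (sieving d n₀) α ∎
        where
        open ≤R
        A e′ : Carrier
        A = Π (sieving d s) α
        e′ = 1# + inv (suc c)
        ιe : ι (suc c) * e′ ≈ ι (suc (suc c))
        ιe = trans (distribˡ _ _ _) (trans (+-cong (*-identityʳ _) (inv-spec c)) (+-comm _ _))

  open import Relation.Nullary.Decidable using (_×-dec_; ¬?)

  -- Choice of parameters and the two sieve bounds

  module _ {A : Set} where
    gather : ℕ → (ℕ → List A) → List A
    gather zero f = []
    gather (suc n) f = f 0 ++ gather n (λ i → f (suc i))

    gather-∈ : ∀ {n f x} i → i N.< n → x ∈ f i → x ∈ gather n f
    gather-∈ {suc n} {f} zero _ h = ∈-++⁺ˡ h
    gather-∈ {suc n} {f} (suc i) (s≤s lt) h = ∈-++⁺ʳ (f 0) (gather-∈ i lt h)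

    single : {P : Set} → Dec P → A → List A
    single (yes _) x = x ∷ []
    single (no _) x = []

    single-∈ : {P : Set} (p? : Dec P) {x : A} → P → x ∈ single p? x
    single-∈ (yes _) p = here ≡.refl
    single-∈ (no n) p = ⊥-elim (n p)

    length-single : {P : Set} (p? : Dec P) (x : A) → length (single p? x) ≡ ⟦ p? ⟧
    length-single (yes _) x = ≡.refl
    length-single (no _) x = ≡.refl

  rough? : ∀ qs t → Dec (Rough qs t)
  rough? qs t = All.all? (λ q → ¬? (q ∣? t)) qs

  FewHits : ℕ → List ℕ → ℕ → ℕ → ℕ → Set
  FewHits d qs T n m = Rough qs (d N.* (n N.* m) N.+ suc d) × hits qs (n N.* m) N.≤ T

  fewHits? : ∀ d qs T n m → Dec (FewHits d qs T n m)
  fewHits? d qs T n m = rough? qs _ ×-dec (hits qs (n N.* m) N.≤? T)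

  ManyHits : ℕ → List ℕ → ℕ → ℕ → Set
  ManyHits d qs T n = Rough qs (d N.* n N.+ suc d) × T N.≤ hits qs n

  manyHits? : ∀ d qs T n → Dec (ManyHits d qs T n)
  manyHits? d qs T n = rough? qs _ ×-dec (T N.≤? hits qs n)

  -- An explicit list of values in place of a count, because each prime must later be located in it.
  fewHitsList : ℕ → List ℕ → ℕ → ℕ → ℕ → List ℕ
  fewHitsList d qs T X Y = gather X (λ n → gather Y (λ m → single (fewHits? d qs T n m) (d N.* (n N.* m) N.+ suc d)))

  manyHitsList : ℕ → List ℕ → ℕ → ℕ → List ℕ
  manyHitsList d qs T X = gather X (λ n → single (manyHits? d qs T n) (d N.* n N.+ suc d))

  -- This fixes the depth r = 22 e. There are 41 factors c to beat: 8 from x = 9^κ, one from c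
  -- itself and 32 from V^8 ≤ (c^4)^8; and 41 e ≤ 2 (22 e + 1).
  tail-exponents : ∀ c e r x → x N.≤ c N.^ 8 → c N.≤ 2 N.^ e → e N.* 22 ≡ r → x N.* c N.* (c N.^ 4) N.^ 8 N.≤ 4 N.^ suc r
  tail-exponents c e r x x≤ c≤ eq = N.*-monoˡ-≤ ((c N.^ 4) N.^ 8) (N.*-monoˡ-≤ c x≤) ⟫ N.≤-reflexive collect ⟫ N.^-monoˡ-≤ 41 c≤ ⟫ (N.≤-trans (N.≤-reflexive (N.^-*-assoc 2 e 41))
      (N.^-monoʳ-≤ 2 exponent ⟫ N.≤-reflexive (≡.sym (N.^-*-assoc 2 2 (suc r)))))
    where
    collect : c N.^ 8 N.* c N.* (c N.^ 4) N.^ 8 ≡ c N.^ 41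
    collect = ≡.trans (≡.cong₂ N._*_ (N.*-comm (c N.^ 8) c) (N.^-*-assoc c 4 8)) (≡.sym (N.^-distribˡ-+-* c 9 32))
    exponent : e N.* 41 N.≤ 2 N.* suc r
    exponent = N.*-monoʳ-≤ e (N.m≤m+n 41 3) ⟫ N.≤-reflexive (≡.trans (lem e) (≡.cong (2 N.*_) eq)) ⟫ N.*-monoʳ-≤ 2 (N.n≤1+n r)
      where
      lem : ∀ b → b N.* 44 ≡ 2 N.* (b N.* 22)
      lem = solve-∀

  opaque
    -- The main term takes 6 (d + 1), the tail of the expansion 1 and the box errors 3.
    sieveConstant : ℕ → ℕ
    sieveConstant d = 6 N.* suc d N.+ 4

  module Bounds (O : OrderedField) where
    open OrderTheory O
    open SieveTheory O
    open BrunTheory O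
    open PatternTheory O
    open EulerTheory O
    open HarmonicTheory O
    open BlockTheory O

    ι-length-gather : ∀ {A : Set} n (f : ℕ → List A) → ι (length (gather n f)) ≈ ∑ n (λ i → ι (length (f i)))
    ι-length-gather zero f = refl
    ι-length-gather (suc n) f = trans (reflexive (≡.cong ι (length-++ (f 0)))) (trans (ι-+ (length (f 0)) _) (+-congˡ (ι-length-gather n (λ i → f (suc i)))))

    within-even : ∀ s {x y e} → Within (s N.+ s) x y e → x ≤ y + e
    within-even zero h = h
    within-even (suc s) {x} {y} {e} h = within-even s (≡.subst (λ r → Within (suc r) x y e) (N.+-suc s s) h)

    ^-cancelᵉ : ∀ {m n} → 2 N.^ m N.≤ 2 N.^ n → m N.≤ n
    ^-cancelᵉ {m} {n} h = N.≮⇒≥ (λ lt → N.<⇒≱ (N.^-monoʳ-< 2 (s≤s (s≤s z≤n)) lt) h)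

    3-power : ∀ {z} → 1# ≤ z → ∀ f → z ≤ ι (3 N.^ f) → ∃[ κ ] (ι (3 N.^ κ) ≤ z × z ≤ ι (3 N.^ suc κ))
    3-power z≥1 zero h = 0 , ≤-reflexive ι-1 ⋙ z≥1 , h ⋙ ι-mono {1} {3} (s≤s z≤n)
    3-power {z} z≥1 (suc f) h = cases (≤-total (ι (3 N.^ f)) z)
      where
      cases : ι (3 N.^ f) ≤ z ⊎ z ≤ ι (3 N.^ f) → ∃[ κ ] (ι (3 N.^ κ) ≤ z × z ≤ ι (3 N.^ suc κ))
      cases (inj₁ le) = f , le , h
      cases (inj₂ le) = 3-power z≥1 f le

    module _ (d : ℕ) (d≥1 : 1 N.≤ d) (c b w n₀ : ℕ) (c≥1 : 1 N.≤ c) (c≤ : c N.≤ 2 N.^ suc b) (w≡2^c : w ≡ 2 N.^ c) (w≡ : w ≡ 2 N.+ n₀) where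
      w≥1 : 1 N.≤ w
      w≥1 = ≡.subst (1 N.≤_) (≡.sym w≡) (s≤s z≤n)
      qs : List ℕ
      qs = sieving d n₀
      large : All (2 N.≤_) qs
      large = sieving-large d n₀
      open Products large
      A V Z : Carrier
      A = Π qs α
      V = Π qs β
      Z = Π qs ζ

      V≥0 : 0# ≤ V
      V≥0 = 0≤1 ⋙ 1≤V
      Z≥0 : 0# ≤ Z
      Z≥0 = 0≤1 ⋙ 1≤Z

      mertens-upper′ : ∀ c → 1 N.≤ c → 2 N.^ c ≡ 2 N.+ n₀ → 1# ≤ ι c ^ 4 * A
      mertens-upper′ (suc c) _ = mertens-upper d c n₀

      V≤c⁴ : V ≤ ι (c N.^ 4)
      V≤c⁴ = begin
        V ≈⟨ sym (*-identityˡ V) ⟩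
        1# * V ≲⟨ *-monoˡ V≥0 (mertens-upper′ c c≥1 (≡.trans (≡.sym w≡2^c) w≡)) ⟩
        ι c ^ 4 * A * V ≈⟨ trans (*-assoc _ _ _) (trans (*-congˡ AV) (*-identityʳ _)) ⟩
        ι c ^ 4 ≈⟨ sym (ι-^ c 4) ⟩
        ι (c N.^ 4) ∎
        where open ≤R

      Ac≤ : A * ι c ≤ ι (2 N.* suc d)
      Ac≤ = mertens-lower d d≥1 c n₀ (≡.trans (≡.sym w≡2^c) w≡)

      choice : ∃[ κ ] (ι (3 N.^ κ) ≤ Z × Z ≤ ι (3 N.^ suc κ))
      choice = 3-power 1≤Z (c N.^ 4) (Z≤V ⋙ V≤c⁴ ⋙ ι-mono (n≤3^n (c N.^ 4)))
        where
        n≤3^n : ∀ n → n N.≤ 3 N.^ n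
        n≤3^n zero = z≤n
        n≤3^n (suc n) = N.+-mono-≤ (N.m^n>0 3 n) (n≤3^n n ⟫ (N.m≤m+n (3 N.^ n) _))

      κ T : ℕ
      κ = proj₁ choice
      T = 3 N.* κ

      opaque
        -- The depth r = R₀ + R₀ is even, so that `Within r` is an upper bound; it equals 22 (b +
        -- 1), as `tail-exponents` requires.
        R₀ : ℕ
        R₀ = 11 N.* suc b

        22[1+b]≡ : suc b N.* 22 ≡ R₀ N.+ R₀
        22[1+b]≡ = lem (suc b)
          where
          lem : ∀ b → b N.* 22 ≡ 11 N.* b N.+ 11 N.* b
          lem = solve-∀

      r R : ℕ
      r = R₀ N.+ R₀
      R = T N.+ r

      3^κ≤Z : ι (3 N.^ κ) ≤ Z
      3^κ≤Z = proj₁ (proj₂ choice)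
      Z≤3^κ : Z ≤ ι (3 N.^ suc κ)
      Z≤3^κ = proj₂ (proj₂ choice)

      9^ : ∀ κ → 9 N.^ κ ≡ 3 N.^ κ N.* 3 N.^ κ
      9^ κ = ≡.trans (N.^-*-assoc 3 2 κ) (≡.trans (≡.cong (3 N.^_) (lem κ)) (N.^-distribˡ-+-* 3 κ κ))
        where
        lem : ∀ κ → 2 N.* κ ≡ κ N.+ κ
        lem = solve-∀

      κ≤ : κ N.≤ 4 N.* suc b
      κ≤ = ^-cancelᵉ (N.^-monoˡ-≤ κ (s≤s (s≤s (z≤n {1}))) ⟫ (N.≤-trans (ι-reflect (3^κ≤Z ⋙ Z≤V ⋙ V≤c⁴))
        (N.^-monoˡ-≤ 4 c≤ ⟫ N.≤-reflexive (≡.trans (N.^-*-assoc 2 (suc b) 4) (≡.cong (2 N.^_) (N.*-comm (suc b) 4))))))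

      9^κ≤Z² : ι (9 N.^ κ) ≤ Z * Z
      9^κ≤Z² = ≤-reflexive (trans (reflexive (≡.cong ι (9^ κ))) (ι-* (3 N.^ κ) (3 N.^ κ))) ⋙ (*-mono (ι-nonneg (3 N.^ κ)) 3^κ≤Z (ι-nonneg (3 N.^ κ)) 3^κ≤Z)

      9^κ≤c⁸ : 9 N.^ κ N.≤ c N.^ 8
      9^κ≤c⁸ = ι-reflect (9^κ≤Z² ⋙ *-mono Z≥0 (Z≤V ⋙ V≤c⁴) Z≥0 (Z≤V ⋙ V≤c⁴) ⋙ ≤-reflexive (trans (sym (ι-* (c N.^ 4) (c N.^ 4))) (reflexive (≡.cong ι (≡.sym (N.^-distribˡ-+-* c 4 4))))))

      -- Mertens gives c ≤ 2 (d + 1) V, and V ≤ Z² ≤ 9 · 9^κ. So κ grows with c, and with it the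
      -- saving (8/9)^κ.
      c≤9^κ : c N.≤ 18 N.* suc d N.* 9 N.^ κ
      c≤9^κ = ι-reflect (begin
        ι c ≈⟨ trans (sym (*-identityˡ _)) (*-congʳ (sym (trans (*-comm V A) AV))) ⟩
        V * A * ι c ≈⟨ *-assoc _ _ _ ⟩
        V * (A * ι c) ≲⟨ *-mono V≥0 V≤Z² (*-nonneg A≥0 (ι-nonneg c)) Ac≤ ⟩
        Z * Z * ι (2 N.* suc d) ≲⟨ *-monoˡ (ι-nonneg (2 N.* suc d)) (*-mono Z≥0 Z≤3^κ Z≥0 Z≤3^κ) ⟩
        ι (3 N.^ suc κ) * ι (3 N.^ suc κ) * ι (2 N.* suc d) ≈⟨ trans (*-congʳ (sym (ι-* (3 N.^ suc κ) (3 N.^ suc κ)))) (sym (ι-* (3 N.^ suc κ N.* 3 N.^ suc κ) (2 N.* suc d))) ⟩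
        ι (3 N.^ suc κ N.* 3 N.^ suc κ N.* (2 N.* suc d)) ≡⟨ ≡.cong ι (≡.trans (lem (3 N.^ κ) (suc d)) (≡.cong (18 N.* suc d N.*_) (≡.sym (9^ κ)))) ⟩
        ι (18 N.* suc d N.* 9 N.^ κ) ∎)
        where
        open ≤R
        lem : ∀ t d → 3 N.* t N.* (3 N.* t) N.* (2 N.* d) ≡ 18 N.* d N.* (t N.* t)
        lem = solve-∀

      R≤ : R N.≤ 34 N.* suc b
      R≤ = N.+-monoˡ-≤ r (N.*-monoʳ-≤ 3 κ≤) ⟫ N.≤-reflexive (≡.trans (≡.cong (3 N.* (4 N.* suc b) N.+_) (≡.sym 22[1+b]≡)) (lem (suc b)))
        where
        lem : ∀ b → 3 N.* (4 N.* b) N.+ b N.* 22 ≡ 34 N.* b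
        lem = solve-∀

      -- S bounds the moduli, and S² the number of terms. When both sides are at least H, the box
      -- errors times Q, the scale of the bounds to be proved, stay below 3 X Y.
      Q S H : ℕ
      Q = 9 N.^ κ N.* c
      S = w N.^ R
      H = Q N.* (S N.* (S N.* S))

      -- From Q ≤ w^9 and R ≤ 34 (b + 1): 9 + 3 · 34 = 111. This exponent decides how small log w
      -- has to be compared with log x.
      H≤ : H N.≤ w N.^ (111 N.* suc b)
      H≤ = N.*-monoˡ-≤ (S N.* (S N.* S)) Q≤ ⟫ N.≤-reflexive combine ⟫ N.^-monoʳ-≤ w {{N.>-nonZero w≥1}} (N.+-monoʳ-≤ 9 (N.*-monoʳ-≤ 3 R≤) ⟫ (N.+-monoˡ-≤ _ (N.m≤m*n 9 (suc b))) ⟫ N.≤-reflexive (lem (suc b)))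
        where
        lem : ∀ b → 9 N.* b N.+ 3 N.* (34 N.* b) ≡ 111 N.* b
        lem = solve-∀
        c≤w : c N.≤ w
        c≤w = n≤2^n c ⟫ N.≤-reflexive (≡.sym w≡2^c)
          where
          n≤2^n : ∀ n → n N.≤ 2 N.^ n
          n≤2^n zero = z≤n
          n≤2^n (suc n) = N.+-mono-≤ (N.m^n>0 2 n) (n≤2^n n ⟫ (N.m≤m+n (2 N.^ n) _))
        Q≤ : Q N.≤ w N.^ 9
        Q≤ = N.*-mono-≤ (9^κ≤c⁸ ⟫ N.^-monoˡ-≤ 8 c≤w) c≤w ⟫ N.≤-reflexive (N.*-comm (w N.^ 8) w)
        combine : w N.^ 9 N.* (S N.* (S N.* S)) ≡ w N.^ (9 N.+ 3 N.* R)
        combine = ≡.sym (≡.trans (N.^-distribˡ-+-* w 9 (3 N.* R)) (≡.cong (w N.^ 9 N.*_) (≡.trans (N.^-distribˡ-+-* w R (R N.+ (R N.+ 0))) (≡.cong (S N.*_)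
          (≡.trans (N.^-distribˡ-+-* w R (R N.+ 0)) (≡.cong (λ t → S N.* w N.^ t) (N.+-identityʳ R)))))))

      module Remainder (k h : ℕ → ℕ → ℕ → Carrier) (κ′ ρ : ℕ → Carrier) where
        open Weights k h κ′ ρ

        remainder : ℕ → ℕ → ℕ → Carrier
        remainder t X Y = ι X * ι Y * (δ r * tail qs) + ι (error X Y S) * ι (terms qs t r)

        box-bound : All Local qs → ∀ X Y t → t N.≤ T → Box X Y (λ n m → weight qs t n m) ≤ ι X * ι Y * density qs + remainder t X Y
        box-bound ls X Y t t≤T = begin
          Box X Y (λ n m → weight qs t n m) ≈⟨ Box-cong {X} {Y} (λ n m → sym (*-identityˡ _)) ⟩
          Box X Y (λ n m → 1# * weight qs t n m)
            ≲⟨ within-even R₀ (sieve X Y w S {D = 1} {μ = 1#} {F = λ _ _ → 1#} qs ls (All.map (λ { {q} (_ , u) → ≡.subst (q N.≤_) (≡.sym w≡) u }) (sieving-range d n₀)) (sieving-coprime d n₀)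
                 (All.universal (λ q {i} → 1-coprimeTo q {i}) qs) (s≤s z≤n) w≥1 Per-one t r (N.≤-reflexive (N.+-identityʳ _) ⟫ N.^-monoʳ-≤ w {{N.>-nonZero w≥1}} (N.+-monoˡ-≤ r t≤T))) ⟩
          ι X * ι Y * 1# * mean qs t + (ι X * ι Y * 1# * (δ r * tail qs) + ι (error X Y S) * ι (terms qs t r))
            ≲⟨ +-mono-≤ (*-monoʳ (*-nonneg (*-nonneg (ι-nonneg X) (ι-nonneg Y)) 0≤1) (mean≤density ls t) ⋙ ≤-reflexive (*-congʳ (*-identityʳ _))) (≤-reflexive (+-congʳ (*-congʳ (*-identityʳ _)))) ⟩
          ι X * ι Y * density qs + remainder t X Y ∎
          where open ≤R

        tail-part : tail qs ≤ V ^ 8 → ι Q * (δ r * tail qs) ≤ 1#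
        tail-part h = begin
          ι Q * (δ r * tail qs) ≲⟨ *-monoʳ (ι-nonneg Q) (*-monoʳ (δ-nonneg r) (h ⋙ ^-mono 8 V≥0 V≤c⁴ ⋙ ≤-reflexive (sym (ι-^ (c N.^ 4) 8)))) ⟩
          ι Q * (δ r * ι ((c N.^ 4) N.^ 8)) ≈⟨ S′.solve 3 (λ q d c → q S′.:* (d S′.:* c) S′.:= (q S′.:* c) S′.:* d) refl (ι Q) (δ r) (ι ((c N.^ 4) N.^ 8)) ⟩
          ι Q * ι ((c N.^ 4) N.^ 8) * δ r ≲⟨ *-monoˡ (δ-nonneg r) (≤-reflexive (sym (ι-* Q _)) ⋙ ι-mono powers≤) ⟩
          ι (4 N.^ suc r) * δ r ≈⟨ unit (suc r) ⟩
          1# ∎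
          where
          open ≤R
          module S′ = OrderTheory.S O
          powers≤ : Q N.* (c N.^ 4) N.^ 8 N.≤ 4 N.^ suc r
          powers≤ = tail-exponents c (suc b) r (9 N.^ κ) 9^κ≤c⁸ c≤ 22[1+b]≡
          unit : ∀ n → ι (4 N.^ n) * inv 4 ^ n ≈ 1#
          unit zero = trans (*-identityʳ _) ι-1
          unit (suc n) = trans (*-congʳ (ι-* 4 (4 N.^ n))) (trans (S′.solve 4 (λ f p i q → f S′.:* p S′.:* (i S′.:* q) S′.:= (f S′.:* i) S′.:* (p S′.:* q)) refl (ι 4) (ι (4 N.^ n)) (inv 4) (inv 4 ^ n)) (trans (*-cong (inv-spec 3) (unit n)) (*-identityʳ 1#)))

        error-part : ∀ X Y t → t N.≤ T → H N.≤ X → H N.≤ Y → Q N.* (error X Y S N.* terms qs t r) N.≤ 3 N.* (X N.* Y)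
        error-part X Y t t≤T H≤X H≤Y = N.*-monoʳ-≤ Q (N.*-monoʳ-≤ (error X Y S) terms≤) ⟫ N.≤-reflexive (lem₁ Q S X Y) ⟫ N.+-mono-≤ (N.+-mono-≤ (N.*-monoˡ-≤ X H≤Y) (N.*-monoˡ-≤ Y H≤X)) (N.*-mono-≤ H≤X S≤Y) ⟫ N.≤-reflexive (lem₂ X Y)
          where
          lem₁ : ∀ Q S X Y → Q N.* (S N.* (X N.+ Y N.+ S) N.* (S N.* S)) ≡ Q N.* (S N.* (S N.* S)) N.* X N.+ Q N.* (S N.* (S N.* S)) N.* Y N.+ Q N.* (S N.* (S N.* S)) N.* S
          lem₁ = solve-∀
          lem₂ : ∀ X Y → Y N.* X N.+ X N.* Y N.+ X N.* Y ≡ 3 N.* (X N.* Y)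
          lem₂ = solve-∀
          S≥1 : 1 N.≤ S
          S≥1 = N.m^n>0 w {{N.>-nonZero w≥1}} R
          S≤Y : S N.≤ Y
          S≤Y = ((N.m≤m*n S (S N.* S) {{N.>-nonZero (N.*-mono-≤ S≥1 S≥1)}} ⟫ N.≤-reflexive (≡.sym (N.*-identityˡ _))) ⟫ N.*-monoˡ-≤ (S N.* (S N.* S)) (N.*-mono-≤ (N.m^n>0 9 κ) c≥1)) ⟫ H≤Y
          terms≤ : terms qs t r N.≤ S N.* S
          terms≤ = terms-bound qs t r ⟫ N.^-monoˡ-≤ (t N.+ r) base ⟫ N.≤-reflexive (N.^-*-assoc w 2 (t N.+ r)) ⟫ (N.≤-trans (N.^-monoʳ-≤ w {{N.>-nonZero w≥1}} (N.*-monoʳ-≤ 2 (N.+-monoˡ-≤ r t≤T)))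
              (N.≤-reflexive (≡.trans (≡.cong (w N.^_) (≡.cong (R N.+_) (N.+-identityʳ R))) (N.^-distribˡ-+-* w R R))))
            where
            base : 1 N.+ 2 N.* length qs N.≤ w N.^ 2
            base = N.+-monoʳ-≤ 1 (N.*-monoʳ-≤ 2 (sieving-length d n₀)) ⟫ ((N.m≤m+n _ (3 N.+ 2 N.* n₀ N.+ n₀ N.* n₀)) ⟫ N.≤-reflexive (lem n₀)) ⟫ N.≤-reflexive (≡.cong (N._^ 2) (≡.sym w≡))
              where
              lem : ∀ n → 1 N.+ 2 N.* n N.+ (3 N.+ 2 N.* n N.+ n N.* n) ≡ (2 N.+ n) N.* ((2 N.+ n) N.* 1)
              lem = solve-∀

        remainder-bound : tail qs ≤ V ^ 8 → ∀ X Y t → t N.≤ T → H N.≤ X → H N.≤ Y → ι Q * remainder t X Y ≤ ι 4 * (ι X * ι Y)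
        remainder-bound h X Y t t≤T H≤X H≤Y = ≤-trans (≤-reflexive (trans (distribˡ _ _ _) (+-cong (S′.solve 3 (λ q m d → q S′.:* (m S′.:* d) S′.:= m S′.:* (q S′.:* d)) refl (ι Q) (ι X * ι Y) (δ r * tail qs))
              (trans (*-congˡ (sym (ι-* (error X Y S) (terms qs t r)))) (sym (ι-* Q (error X Y S N.* terms qs t r)))))))
            (+-mono-≤ (*-monoʳ (*-nonneg (ι-nonneg X) (ι-nonneg Y)) (tail-part h)) (ι-mono (error-part X Y t t≤T H≤X H≤Y)) ⋙ ≤-reflexive (trans (+-cong (trans (*-identityʳ _) (sym (*-identityˡ _))) (trans (ι-* 3 (X N.* Y)) (*-congˡ (ι-* X Y)))) (sym (distribʳ (ι X * ι Y) 1# (ι 3)))))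
          where module S′ = OrderTheory.S O

      C : ℕ
      C = sieveConstant d

      opaque
        unfolding sieveConstant
        ι-C : ι C ≈ ι (6 N.* suc d) + ι 4
        ι-C = ι-+ (6 N.* suc d) 4

      -- A listed pair has at most T hits, so 2^T = 8^κ times its weight is at least 1. The density
      -- is at most 2 A / Z²: here Z² pays for the factor 9^κ of Q and A for the factor c.
      fewHits-bound : ∀ X Y → H N.≤ X → H N.≤ Y → Q N.* length (fewHitsList d qs T X Y) N.≤ 8 N.^ κ N.* (C N.* (X N.* Y))
      fewHits-bound X Y H≤X H≤Y = ι-reflect (begin
          ι (Q N.* length (fewHitsList d qs T X Y)) ≈⟨ trans (ι-* Q (length (fewHitsList d qs T X Y))) (*-congˡ counted) ⟩
          ι Q * Box X Y (λ n m → ι ⟦ fewHits? d qs T n m ⟧) ≲⟨ *-monoʳ (ι-nonneg Q) (∑-mono X (λ n _ → ∑-mono Y (λ m _ → pointwise n m (fewHits? d qs T n m))) ⋙ ≤-reflexive (Box-*ˡ X Y (ι (8 N.^ κ)) (weight qs 0))) ⟩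
          ι Q * (ι (8 N.^ κ) * Box X Y (weight qs 0)) ≲⟨ *-monoʳ (ι-nonneg Q) (*-monoʳ (ι-nonneg (8 N.^ κ)) (box-bound ls X Y 0 z≤n)) ⟩
          ι Q * (ι (8 N.^ κ) * (ι X * ι Y * density qs + remainder 0 X Y))
            ≈⟨ S′.solve 5 (λ q e M d r → q S′.:* (e S′.:* (M S′.:* d S′.:+ r)) S′.:= e S′.:* (M S′.:* (q S′.:* d) S′.:+ q S′.:* r)) refl (ι Q) (ι (8 N.^ κ)) (ι X * ι Y) (density qs) (remainder 0 X Y) ⟩
          ι (8 N.^ κ) * (ι X * ι Y * (ι Q * density qs) + ι Q * remainder 0 X Y)
            ≲⟨ *-monoʳ (ι-nonneg (8 N.^ κ)) (+-mono-≤ (*-monoʳ (*-nonneg (ι-nonneg X) (ι-nonneg Y)) main) (remainder-bound (PairProducts.tail≤V⁸ d ls large) X Y 0 z≤n H≤X H≤Y)) ⟩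
          ι (8 N.^ κ) * (ι X * ι Y * ι (6 N.* suc d) + ι 4 * (ι X * ι Y))
            ≈⟨ *-congˡ (trans (S′.solve 3 (λ M a b → M S′.:* a S′.:+ b S′.:* M S′.:= (a S′.:+ b) S′.:* M) refl (ι X * ι Y) (ι (6 N.* suc d)) (ι 4)) (sym (trans (ι-* C (X N.* Y)) (*-cong ι-C (ι-* X Y))))) ⟩
          ι (8 N.^ κ) * ι (C N.* (X N.* Y)) ≈⟨ sym (ι-* (8 N.^ κ) _) ⟩
          ι (8 N.^ κ N.* (C N.* (X N.* Y))) ∎)
        where
        open ≤R
        module S′ = OrderTheory.S O
        open PairPattern d using (k; h; Local; weight; density; weight-nonneg; weight-rough; density-nonneg) renaming (κ to κ₁; ρ to ρ₁; admissible to local)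
        open Remainder k h κ₁ ρ₁ using (remainder; box-bound; remainder-bound)
        ls : All Local qs
        ls = All.map local (sieving-admissible d n₀)
        counted : ι (length (fewHitsList d qs T X Y)) ≈ Box X Y (λ n m → ι ⟦ fewHits? d qs T n m ⟧)
        counted = trans (ι-length-gather X _) (∑-cong X (λ n → trans (ι-length-gather Y (λ m → single (fewHits? d qs T n m) _)) (∑-cong Y (λ m → reflexive (≡.cong ι (length-single (fewHits? d qs T n m) _))))))
        pointwise : ∀ n m (x : Dec (FewHits d qs T n m)) → ι ⟦ x ⟧ ≤ ι (8 N.^ κ) * weight qs 0 n m
        pointwise n m (no _) = *-nonneg (ι-nonneg (8 N.^ κ)) (weight-nonneg ls 0 n m)
        pointwise n m (yes (rough , few)) = ≤-reflexive ι-1 ⋙ weight-rough (sieving-admissible d n₀) n m rough ⋙ (*-monoˡ (weight-nonneg ls 0 n m)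
          (≤-reflexive (sym (ι-^ 2 (hits qs (n N.* m)))) ⋙ ι-mono (N.^-monoʳ-≤ 2 few ⟫ N.≤-reflexive (≡.sym (N.^-*-assoc 2 3 κ)))))
        main : ι Q * density qs ≤ ι (6 N.* suc d)
        main = begin
          ι Q * density qs ≈⟨ trans (*-congʳ (ι-* (9 N.^ κ) c)) (S′.solve 3 (λ n c d → n S′.:* c S′.:* d S′.:= d S′.:* n S′.:* c) refl (ι (9 N.^ κ)) (ι c) (density qs)) ⟩
          density qs * ι (9 N.^ κ) * ι c ≲⟨ *-monoˡ (ι-nonneg c) ((*-monoʳ (density-nonneg ls) 9^κ≤Z²) ⋙ PairProducts.density-bound d n₀) ⟩
          ι 2 * A * ι c ≲⟨ ≤-reflexive (*-assoc _ _ _) ⋙ *-monoʳ (ι-nonneg 2) Ac≤ ⟩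
          ι 2 * ι (2 N.* suc d) ≲⟨ ≤-reflexive (sym (ι-* 2 (2 N.* suc d))) ⋙ ι-mono (N.m≤m+n (2 N.* (2 N.* suc d)) (2 N.* suc d) ⟫ N.≤-reflexive (lem (suc d))) ⟩
          ι (6 N.* suc d) ∎
          where
          lem : ∀ d → 2 N.* (2 N.* d) N.+ 2 N.* d ≡ 6 N.* d
          lem = solve-∀

      -- A listed N has 3^T = 27^κ ≤ 8^κ times its weight. The density A Z gives back one factor
      -- 3^κ, which leaves 9^κ. The dummy variable contributes a factor X on both sides.
      manyHits-bound : ∀ X → H N.≤ X → Q N.* length (manyHitsList d qs T X) N.≤ 8 N.^ κ N.* (C N.* X)
      manyHits-bound X H≤X = N.*-cancelʳ-≤ _ _ X {{N.>-nonZero X≥1}} (N.*-cancelˡ-≤ (3 N.^ κ) {{N.m^n≢0 3 κ}} (ι-reflect (begin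
          ι (3 N.^ κ N.* (Q N.* N N.* X)) ≡⟨ ≡.cong ι (≡.trans (lem₁ (3 N.^ κ) (9 N.^ κ) c N X) (≡.cong (λ t → t N.* c N.* (X N.* N)) 27^)) ⟩
          ι (3 N.^ T N.* c N.* (X N.* N)) ≈⟨ trans (ι-* (3 N.^ T N.* c) (X N.* N)) (*-cong (trans (ι-* (3 N.^ T) c) (*-comm _ _)) counted) ⟩
          ι c * ι (3 N.^ T) * Box X X (λ n m → ι ⟦ manyHits? d qs T n ⟧)
            ≈⟨ trans (*-assoc _ _ _) (*-congˡ (sym (Box-*ˡ X X (ι (3 N.^ T)) (λ n m → ι ⟦ manyHits? d qs T n ⟧)))) ⟩
          ι c * Box X X (λ n m → ι (3 N.^ T) * ι ⟦ manyHits? d qs T n ⟧)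
            ≲⟨ *-monoʳ (ι-nonneg c) (∑-mono X (λ n _ → ∑-mono X (λ m _ → pointwise n m (manyHits? d qs T n))) ⋙ ≤-reflexive (Box-*ˡ X X (ι (8 N.^ κ)) (weight qs T))) ⟩
          ι c * (ι (8 N.^ κ) * Box X X (weight qs T)) ≲⟨ *-monoʳ (ι-nonneg c) (*-monoʳ (ι-nonneg (8 N.^ κ)) (box-bound ls X X T N.≤-refl)) ⟩
          ι c * (ι (8 N.^ κ) * (ι X * ι X * density qs + remainder T X X))
            ≈⟨ S′.solve 5 (λ q e M d r → q S′.:* (e S′.:* (M S′.:* d S′.:+ r)) S′.:= e S′.:* (M S′.:* (q S′.:* d) S′.:+ q S′.:* r)) refl (ι c) (ι (8 N.^ κ)) (ι X * ι X) (density qs) (remainder T X X) ⟩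
          ι (8 N.^ κ) * (ι X * ι X * (ι c * density qs) + ι c * remainder T X X)
            ≲⟨ *-monoʳ (ι-nonneg (8 N.^ κ)) (+-mono-≤ (*-monoʳ (*-nonneg (ι-nonneg X) (ι-nonneg X)) main) rest) ⟩
          ι (8 N.^ κ) * (ι X * ι X * ι (3 N.^ κ N.* (6 N.* suc d)) + ι (3 N.^ κ) * (ι 4 * (ι X * ι X)))
            ≈⟨ *-congˡ (trans (trans (+-congʳ (*-congˡ (ι-* (3 N.^ κ) (6 N.* suc d)))) (S′.solve 4 (λ M a b t → M S′.:* (t S′.:* a) S′.:+ t S′.:* (b S′.:* M) S′.:= t S′.:* ((a S′.:+ b) S′.:* M)) refl (ι X * ι X) (ι (6 N.* suc d)) (ι 4) (ι (3 N.^ κ))))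
                 (sym (trans (ι-* (3 N.^ κ) (C N.* (X N.* X))) (*-congˡ (trans (ι-* C (X N.* X)) (*-cong ι-C (ι-* X X))))))) ⟩
          ι (8 N.^ κ) * ι (3 N.^ κ N.* (C N.* (X N.* X))) ≈⟨ sym (ι-* (8 N.^ κ) _) ⟩
          ι (8 N.^ κ N.* (3 N.^ κ N.* (C N.* (X N.* X)))) ≡⟨ ≡.cong ι (lem₂ (8 N.^ κ) (3 N.^ κ) C X) ⟩
          ι (3 N.^ κ N.* (8 N.^ κ N.* (C N.* X) N.* X)) ∎)))
        where
        open ≤R
        module S′ = OrderTheory.S O
        open ProductPattern d using (k; h; Local; weight; density; weight-nonneg; weight-hits; density-nonneg; tail-nonneg; terms) renaming (κ to κ₁; ρ to ρ₁; admissible to local)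
        open Remainder k h κ₁ ρ₁ using (remainder; box-bound; remainder-bound)
        N : ℕ
        N = length (manyHitsList d qs T X)
        ls : All Local qs
        ls = All.map local (sieving-admissible d n₀)
        X≥1 : 1 N.≤ X
        X≥1 = N.*-mono-≤ (N.*-mono-≤ (N.m^n>0 9 κ) c≥1) (N.*-mono-≤ S≥1 (N.*-mono-≤ S≥1 S≥1)) ⟫ H≤X
          where
          S≥1 : 1 N.≤ S
          S≥1 = N.m^n>0 w {{N.>-nonZero w≥1}} R
        lem₁ : ∀ t n c N X → t N.* (n N.* c N.* N N.* X) ≡ t N.* n N.* c N.* (X N.* N)
        lem₁ = solve-∀
        lem₂ : ∀ e t C X → e N.* (t N.* (C N.* (X N.* X))) ≡ t N.* (e N.* (C N.* X) N.* X)
        lem₂ = solve-∀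
        27^ : 3 N.^ κ N.* 9 N.^ κ ≡ 3 N.^ T
        27^ = ≡.sym (≡.trans (N.^-distribˡ-+-* 3 κ (2 N.* κ)) (≡.cong (3 N.^ κ N.*_) (≡.sym (N.^-*-assoc 3 2 κ))))
        counted : ι (X N.* N) ≈ Box X X (λ n m → ι ⟦ manyHits? d qs T n ⟧)
        counted = trans (ι-* X N) (trans (*-congˡ (trans (ι-length-gather X _) (∑-cong X (λ n → reflexive (≡.cong ι (length-single (manyHits? d qs T n) _))))))
          (sym (trans (∑-cong X (λ n → ∑-const X _)) (∑-*ˡ X (ι X) (λ n → ι ⟦ manyHits? d qs T n ⟧)))))
        pointwise : ∀ n m (x : Dec (ManyHits d qs T n)) → ι (3 N.^ T) * ι ⟦ x ⟧ ≤ ι (8 N.^ κ) * weight qs T n m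
        pointwise n m (no _) = ≤-reflexive (zeroʳ _) ⋙ *-nonneg (ι-nonneg (8 N.^ κ)) (weight-nonneg ls T n m)
        pointwise n m (yes (rough , many)) = ≤-reflexive (trans (*-congˡ ι-1) (trans (*-identityʳ _) (ι-^ 3 T))) ⋙ (≤-trans (weight-hits (sieving-admissible d n₀) T n m rough many)
          (≤-reflexive (*-congʳ (trans (sym (ι-^ 2 T)) (reflexive (≡.cong ι (≡.sym (N.^-*-assoc 2 3 κ))))))))
        main : ι c * density qs ≤ ι (3 N.^ κ N.* (6 N.* suc d))
        main = begin
          ι c * density qs ≈⟨ trans (*-congˡ (ProductProducts.density≈ d large)) (S′.solve 3 (λ c a z → c S′.:* (a S′.:* z) S′.:= z S′.:* (a S′.:* c)) refl (ι c) A Z) ⟩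
          Z * (A * ι c) ≲⟨ *-mono Z≥0 Z≤3^κ (*-nonneg A≥0 (ι-nonneg c)) Ac≤ ⟩
          ι (3 N.^ suc κ) * ι (2 N.* suc d) ≈⟨ trans (sym (ι-* (3 N.^ suc κ) (2 N.* suc d))) (reflexive (≡.cong ι (lem (3 N.^ κ) (suc d)))) ⟩
          ι (3 N.^ κ N.* (6 N.* suc d)) ∎
          where
          lem : ∀ t d → 3 N.* t N.* (2 N.* d) ≡ t N.* (6 N.* d)
          lem = solve-∀
        remainder≥0 : 0# ≤ remainder T X X
        remainder≥0 = +-nonneg (*-nonneg (*-nonneg (ι-nonneg X) (ι-nonneg X)) (*-nonneg (δ-nonneg r) (tail-nonneg ls))) (*-nonneg (ι-nonneg (error X X S)) (ι-nonneg (terms qs T r)))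
        rest : ι c * remainder T X X ≤ ι (3 N.^ κ) * (ι 4 * (ι X * ι X))
        rest = ≤-trans (*-monoˡ remainder≥0 (ι-mono (N.≤-reflexive (≡.sym (N.*-identityˡ c)) ⟫ N.*-monoˡ-≤ c (N.m^n>0 9 κ))))
          (remainder-bound (ProductProducts.tail≤V⁸ d ls large) X X T N.≤-refl H≤X H≤X ⋙ ≤-reflexive (sym (*-identityˡ _)) ⋙ *-monoˡ (*-nonneg (ι-nonneg 4) (*-nonneg (ι-nonneg X) (ι-nonneg X))) (≤-reflexive (sym ι-1) ⋙ ι-mono (N.m^n>0 3 κ)))

  -- The outcome of the sieve with w = 2^c, in natural numbers only; the field of densities does not
  -- occur in it.
  record SieveData (d c b : ℕ) : Set where
    field
      n₀ κ H : ℕ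
      w≡ : 2 N.^ c ≡ 2 N.+ n₀
      H≤ : H N.≤ (2 N.^ c) N.^ (111 N.* suc b)
      c≤9^κ : c N.≤ 18 N.* suc d N.* 9 N.^ κ
      few : ∀ X Y → H N.≤ X → H N.≤ Y → 9 N.^ κ N.* c N.* length (fewHitsList d (sieving d n₀) (3 N.* κ) X Y) N.≤ 8 N.^ κ N.* (sieveConstant d N.* (X N.* Y))
      many : ∀ X → H N.≤ X → 9 N.^ κ N.* c N.* length (manyHitsList d (sieving d n₀) (3 N.* κ) X) N.≤ 8 N.^ κ N.* (sieveConstant d N.* X)

  sieve-data : ∀ d → 1 N.≤ d → ∀ c b → 1 N.≤ c → c N.≤ 2 N.^ suc b → SieveData d c b
  sieve-data d d≥1 c b c≥1 c≤ = record
    { n₀ = n ; w≡ = eq ; κ = B.κ d d≥1 c b w n c≥1 c≤ ≡.refl eq ; H = B.H d d≥1 c b w n c≥1 c≤ ≡.refl eq ; H≤ = B.H≤ d d≥1 c b w n c≥1 c≤ ≡.refl eq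
    ; c≤9^κ = B.c≤9^κ d d≥1 c b w n c≥1 c≤ ≡.refl eq ; few = B.fewHits-bound d d≥1 c b w n c≥1 c≤ ≡.refl eq ; many = B.manyHits-bound d d≥1 c b w n c≥1 c≤ ≡.refl eq }
    where
    module B = Bounds ℚ-field
    w n : ℕ
    w = 2 N.^ c
    n = w N.∸ 2
    eq : w ≡ 2 N.+ n
    eq = ≡.sym (N.m+[n∸m]≡n (N.^-monoʳ-≤ 2 c≥1))

-- Polynomials over a prime field

module Poly (R : CommutativeRing 0ℓ 0ℓ) where
  open CommutativeRing R
  open import Algebra.Properties.Ring ring using (-0#≈0#)
  open import Algebra.Properties.Semiring.Mult semiring using () renaming (_×_ to _×ₙ_)
  open import Algebra.Properties.Semiring.Exp semiring using (_^_)
  open PSolver R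

  Series : Set
  Series = ℕ → Carrier

  conv : Series → Series → Series
  conv f g zero = f 0 * g 0
  conv f g (suc n) = f 0 * g (suc n) + conv (λ i → f (suc i)) g n

  conv-cong : ∀ {f f′ g g′} → (∀ i → f i ≈ f′ i) → (∀ i → g i ≈ g′ i) → ∀ n → conv f g n ≈ conv f′ g′ n
  conv-cong p q zero = *-cong (p 0) (q 0)
  conv-cong p q (suc n) = +-cong (*-cong (p 0) (q (suc n))) (conv-cong (λ i → p (suc i)) q n)

  conv-distribʳ : ∀ f g h n → conv (λ i → f i + g i) h n ≈ conv f h n + conv g h n
  conv-distribʳ f g h zero = distribʳ (h 0) (f 0) (g 0)
  conv-distribʳ f g h (suc n) = trans (+-congˡ (conv-distribʳ (λ i → f (suc i)) (λ i → g (suc i)) h n))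
    (solve 5 (λ a b c u v → (a :+ b) :* c :+ (u :+ v) := (a :* c :+ u) :+ (b :* c :+ v)) refl (f 0) (g 0) (h (suc n)) _ _)

  conv-scaleˡ : ∀ a f g n → conv (λ i → a * f i) g n ≈ a * conv f g n
  conv-scaleˡ a f g zero = *-assoc a (f 0) (g 0)
  conv-scaleˡ a f g (suc n) = trans (+-congˡ (conv-scaleˡ a (λ i → f (suc i)) g n))
    (solve 4 (λ a b c u → a :* b :* c :+ a :* u := a :* (b :* c :+ u)) refl a (f 0) (g (suc n)) _)

  conv-sucʳ : ∀ f g n → conv f g (suc n) ≈ conv f (λ i → g (suc i)) n + f (suc n) * g 0
  conv-sucʳ f g zero = refl
  conv-sucʳ f g (suc n) = trans (+-congˡ (conv-sucʳ (λ i → f (suc i)) g n)) (sym (+-assoc (f 0 * g (suc (suc n))) _ _))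

  conv-comm : ∀ f g n → conv f g n ≈ conv g f n
  conv-comm f g zero = *-comm (f 0) (g 0)
  conv-comm f g (suc n) = trans (+-congˡ (conv-comm (λ i → f (suc i)) g n))
    (trans (trans (+-comm _ _) (+-congˡ (*-comm (f 0) (g (suc n))))) (sym (conv-sucʳ g f n)))

  conv-assoc : ∀ f g h n → conv (conv f g) h n ≈ conv f (conv g h) n
  conv-assoc f g h zero = *-assoc (f 0) (g 0) (h 0)
  conv-assoc f g h (suc n) = begin
    f 0 * g 0 * h (suc n) + conv (λ i → f 0 * g (suc i) + conv f′ g i) h n
      ≈⟨ +-congˡ (conv-distribʳ (λ i → f 0 * g (suc i)) (conv f′ g) h n) ⟩
    f 0 * g 0 * h (suc n) + (conv (λ i → f 0 * g (suc i)) h n + conv (conv f′ g) h n)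
      ≈⟨ +-congˡ (+-cong (conv-scaleˡ (f 0) (λ i → g (suc i)) h n) (conv-assoc f′ g h n)) ⟩
    f 0 * g 0 * h (suc n) + (f 0 * conv (λ i → g (suc i)) h n + conv f′ (conv g h) n)
      ≈⟨ solve 5 (λ f g h u v → f :* g :* h :+ (f :* u :+ v) := f :* (g :* h :+ u) :+ v) refl (f 0) (g 0) (h (suc n)) _ _ ⟩
    f 0 * (g 0 * h (suc n) + conv (λ i → g (suc i)) h n) + conv f′ (conv g h) n ∎
    where
    open Reasoning setoid
    f′ : Series
    f′ i = f (suc i)

  conv-zeroˡ : ∀ g n → conv (λ _ → 0#) g n ≈ 0#
  conv-zeroˡ g zero = zeroˡ (g 0)
  conv-zeroˡ g (suc n) = trans (+-cong (zeroˡ _) (conv-zeroˡ g n)) (+-identityʳ 0#)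

  Poly : Set
  Poly = List Carrier

  coeff : Poly → Series
  coeff [] _ = 0#
  coeff (a ∷ f) zero = a
  coeff (a ∷ f) (suc i) = coeff f i

  infix 4 _≋_
  -- Coefficient lists may end in zeros, so equality compares coefficients; accordingly degree
  -- bounds are a predicate, `Deg`, and not a length.
  record _≋_ (f g : Poly) : Set where
    constructor mk≋
    field at : ∀ i → coeff f i ≈ coeff g i
  open _≋_ public

  ≋-refl : ∀ {f} → f ≋ f
  ≋-refl = mk≋ λ _ → refl

  ≋-sym : ∀ {f g} → f ≋ g → g ≋ f
  ≋-sym e = mk≋ λ i → sym (at e i)

  ≋-trans : ∀ {f g h} → f ≋ g → g ≋ h → f ≋ h
  ≋-trans e e′ = mk≋ λ i → trans (at e i) (at e′ i)

  ∷-cong : ∀ {a b f g} → a ≈ b → f ≋ g → (a ∷ f) ≋ (b ∷ g)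
  ∷-cong e e′ = mk≋ λ { zero → e ; (suc i) → at e′ i }

  infixl 6 _⊕_
  infixl 7 _⊗_
  infix 8 ⊖_

  via : ∀ {f g} (p q : Series) → (∀ i → coeff f i ≈ p i) → (∀ i → coeff g i ≈ q i) → (∀ i → p i ≈ q i) → f ≋ g
  via p q a b c = mk≋ λ i → trans (a i) (trans (c i) (sym (b i)))

  opaque
    _⊕_ : Poly → Poly → Poly
    [] ⊕ g = g
    (a ∷ f) ⊕ [] = a ∷ f
    (a ∷ f) ⊕ (b ∷ g) = (a + b) ∷ (f ⊕ g)

    ⊖_ : Poly → Poly
    ⊖_ = map (-_)

    scale : Carrier → Poly → Poly
    scale a = map (a *_)

    _⊗_ : Poly → Poly → Poly
    [] ⊗ g = []
    (a ∷ f) ⊗ g = scale a g ⊕ (0# ∷ (f ⊗ g))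

    C : Carrier → Poly
    C a = a ∷ []

    X : Poly
    X = 0# ∷ 1# ∷ []

    D : Poly → Poly
    D [] = []
    D (a ∷ f) = f ⊕ (0# ∷ D f)

    eval : Poly → Carrier → Carrier
    eval [] x = 0#
    eval (a ∷ f) x = a + x * eval f x

  opaque
    unfolding _⊕_

    coeff-⊕ : ∀ f g i → coeff (f ⊕ g) i ≈ coeff f i + coeff g i
    coeff-⊕ [] g i = sym (+-identityˡ _)
    coeff-⊕ (a ∷ f) [] i = sym (+-identityʳ _)
    coeff-⊕ (a ∷ f) (b ∷ g) zero = refl
    coeff-⊕ (a ∷ f) (b ∷ g) (suc i) = coeff-⊕ f g i

    coeff-⊖ : ∀ f i → coeff (⊖ f) i ≈ - coeff f i
    coeff-⊖ [] i = sym -0#≈0#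
    coeff-⊖ (a ∷ f) zero = refl
    coeff-⊖ (a ∷ f) (suc i) = coeff-⊖ f i

    coeff-scale : ∀ a f i → coeff (scale a f) i ≈ a * coeff f i
    coeff-scale a [] i = sym (zeroʳ a)
    coeff-scale a (b ∷ f) zero = refl
    coeff-scale a (b ∷ f) (suc i) = coeff-scale a f i

    coeff-⊗ : ∀ f g i → coeff (f ⊗ g) i ≈ conv (coeff f) (coeff g) i
    coeff-⊗ [] g i = sym (conv-zeroˡ (coeff g) i)
    coeff-⊗ (a ∷ f) g zero = trans (coeff-⊕ (scale a g) (0# ∷ (f ⊗ g)) 0) (trans (+-identityʳ _) (coeff-scale a g 0))
    coeff-⊗ (a ∷ f) g (suc i) = trans (coeff-⊕ (scale a g) (0# ∷ (f ⊗ g)) (suc i)) (+-cong (coeff-scale a g (suc i)) (coeff-⊗ f g i))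

    coeff-C-suc : ∀ a i → coeff (C a) (suc i) ≈ 0#
    coeff-C-suc a i = refl

    coeff-C-0 : ∀ a → coeff (C a) 0 ≈ a
    coeff-C-0 a = refl

    scale-≋ : ∀ a f → scale a f ≋ C a ⊗ f
    scale-≋ a f = mk≋ λ i → sym (trans (coeff-⊕ (scale a f) (0# ∷ []) i) (trans (+-congˡ (z i)) (+-identityʳ _)))
      where
      z : ∀ i → coeff (0# ∷ []) i ≈ 0#
      z zero = refl
      z (suc i) = refl

    coeff-D : ∀ f i → coeff (D f) i ≈ (suc i ×ₙ 1#) * coeff f (suc i)
    coeff-D [] i = sym (zeroʳ _)
    coeff-D (a ∷ f) zero = trans (coeff-⊕ f (0# ∷ D f) 0) (trans (+-identityʳ _)
      (sym (trans (*-congʳ (+-identityʳ 1#)) (*-identityˡ _))))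
    coeff-D (a ∷ f) (suc i) = trans (coeff-⊕ f (0# ∷ D f) (suc i)) (trans (+-congˡ (coeff-D f i))
      (sym (trans (distribʳ _ 1# _) (+-congʳ (*-identityˡ _)))))

  ⊕-cong : ∀ {f f′ g g′} → f ≋ f′ → g ≋ g′ → f ⊕ g ≋ f′ ⊕ g′
  ⊕-cong {f} {f′} {g} {g′} e e′ = via _ _ (coeff-⊕ f g) (coeff-⊕ f′ g′) (λ i → +-cong (at e i) (at e′ i))

  ⊗-cong : ∀ {f f′ g g′} → f ≋ f′ → g ≋ g′ → f ⊗ g ≋ f′ ⊗ g′
  ⊗-cong {f} {f′} {g} {g′} e e′ = via _ _ (coeff-⊗ f g) (coeff-⊗ f′ g′) (conv-cong (at e) (at e′))

  ⊖-cong : ∀ {f g} → f ≋ g → ⊖ f ≋ ⊖ g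
  ⊖-cong {f} {g} e = via _ _ (coeff-⊖ f) (coeff-⊖ g) (λ i → -‿cong (at e i))

  ⊕-assoc : ∀ f g h → (f ⊕ g) ⊕ h ≋ f ⊕ (g ⊕ h)
  ⊕-assoc f g h = via _ _ (λ i → trans (coeff-⊕ (f ⊕ g) h i) (+-congʳ (coeff-⊕ f g i)))
    (λ i → trans (coeff-⊕ f (g ⊕ h) i) (+-congˡ (coeff-⊕ g h i))) (λ i → +-assoc _ _ _)

  ⊕-comm : ∀ f g → f ⊕ g ≋ g ⊕ f
  ⊕-comm f g = via _ _ (coeff-⊕ f g) (coeff-⊕ g f) (λ i → +-comm _ _)

  ⊕-identityʳ : ∀ f → f ⊕ [] ≋ f
  ⊕-identityʳ f = via _ _ (coeff-⊕ f []) (λ _ → refl) (λ i → +-identityʳ _)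

  ⊖-inverseʳ : ∀ f → f ⊕ ⊖ f ≋ []
  ⊖-inverseʳ f = via _ _ (λ i → trans (coeff-⊕ f (⊖ f) i) (+-congˡ (coeff-⊖ f i))) (λ _ → refl) (λ i → -‿inverseʳ _)

  ⊗-comm : ∀ f g → f ⊗ g ≋ g ⊗ f
  ⊗-comm f g = via _ _ (coeff-⊗ f g) (coeff-⊗ g f) (conv-comm (coeff f) (coeff g))

  ⊗-assoc : ∀ f g h → (f ⊗ g) ⊗ h ≋ f ⊗ (g ⊗ h)
  ⊗-assoc f g h = via _ _
    (λ i → trans (coeff-⊗ (f ⊗ g) h i) (conv-cong (coeff-⊗ f g) (λ _ → refl) i))
    (λ i → trans (coeff-⊗ f (g ⊗ h) i) (conv-cong {coeff f} (λ _ → refl) (coeff-⊗ g h) i))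
    (conv-assoc (coeff f) (coeff g) (coeff h))

  ⊗-distribʳ : ∀ h f g → (f ⊕ g) ⊗ h ≋ f ⊗ h ⊕ g ⊗ h
  ⊗-distribʳ h f g = via _ _
    (λ i → trans (coeff-⊗ (f ⊕ g) h i) (conv-cong (coeff-⊕ f g) (λ _ → refl) i))
    (λ i → trans (coeff-⊕ (f ⊗ h) (g ⊗ h) i) (+-cong (coeff-⊗ f h i) (coeff-⊗ g h i)))
    (conv-distribʳ (coeff f) (coeff g) (coeff h))

  ⊗-distribˡ : ∀ h f g → h ⊗ (f ⊕ g) ≋ h ⊗ f ⊕ h ⊗ g
  ⊗-distribˡ h f g = ≋-trans (⊗-comm h (f ⊕ g)) (≋-trans (⊗-distribʳ h f g) (⊕-cong (⊗-comm f h) (⊗-comm g h)))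

  ⊗-identityˡ : ∀ f → C 1# ⊗ f ≋ f
  ⊗-identityˡ f = ≋-trans (≋-sym (scale-≋ 1# f)) (mk≋ λ i → trans (coeff-scale 1# f i) (*-identityˡ _))

  polyRing : CommutativeRing 0ℓ 0ℓ
  polyRing = record
    { Carrier = Poly ; _≈_ = _≋_ ; _+_ = _⊕_ ; _*_ = _⊗_ ; -_ = ⊖_ ; 0# = [] ; 1# = C 1#
    ; isCommutativeRing = record
      { isRing = record
        { +-isAbelianGroup = record
          { isGroup = record
            { isMonoid = record
              { isSemigroup = record
                { isMagma = record
                  { isEquivalence = record { refl = ≋-refl ; sym = ≋-sym ; trans = ≋-trans }
                  ; ∙-cong = ⊕-cong }
                ; assoc = ⊕-assoc }
              ; identity = (λ f → ≋-trans (⊕-comm [] f) (⊕-identityʳ f)) , ⊕-identityʳ }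
            ; inverse = (λ f → ≋-trans (⊕-comm (⊖ f) f) (⊖-inverseʳ f)) , ⊖-inverseʳ
            ; ⁻¹-cong = ⊖-cong }
          ; comm = ⊕-comm }
        ; *-cong = ⊗-cong
        ; *-assoc = ⊗-assoc
        ; *-identity = ⊗-identityˡ , (λ f → ≋-trans (⊗-comm f (C 1#)) (⊗-identityˡ f))
        ; distrib = ⊗-distribˡ , ⊗-distribʳ }
      ; *-comm = ⊗-comm } }

  module P where
    open CommutativeRing polyRing public
    open PSolver polyRing public
    open import Algebra.Properties.Semiring.Exp (CommutativeRing.semiring polyRing) public using (^-homo-*; ^-congˡ; ^-assocʳ) renaming (_^_ to _^ᵖ_)

  open P using (_^ᵖ_) public

  opaque
    unfolding _⊕_
    shift-≋ : ∀ f → (0# ∷ f) ≋ X ⊗ f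
    shift-≋ f = mk≋ λ
      { zero → sym (trans (coeff-⊗ X f 0) (zeroˡ _))
      ; (suc i) → sym (trans (coeff-⊗ X f (suc i)) (trans (+-congʳ (zeroˡ _))
          (trans (+-identityˡ _) (trans (sym (coeff-⊗ (C 1#) f i)) (at (⊗-identityˡ f) i))))) }

    ∷-≋ : ∀ a f → (a ∷ f) ≋ C a ⊕ X ⊗ f
    ∷-≋ a f = ≋-trans {g = C a ⊕ (0# ∷ f)} (mk≋ λ { zero → sym (+-identityʳ a) ; (suc i) → refl }) (⊕-cong {C a} ≋-refl (shift-≋ f))

    D-∷ : ∀ a f → D (a ∷ f) ≋ f ⊕ X ⊗ D f
    D-∷ a f = ⊕-cong {f} ≋-refl (shift-≋ (D f))

    ∷-⊗ : ∀ a f g → (a ∷ f) ⊗ g ≋ C a ⊗ g ⊕ X ⊗ (f ⊗ g)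
    ∷-⊗ a f g = ⊕-cong {scale a g} (scale-≋ a g) (shift-≋ (f ⊗ g))

    D-[] : D [] ≋ []
    D-[] = ≋-refl

    eval-[] : ∀ x → eval [] x ≈ 0#
    eval-[] x = refl

    eval-⊕ : ∀ f g x → eval (f ⊕ g) x ≈ eval f x + eval g x
    eval-⊕ [] g x = sym (+-identityˡ _)
    eval-⊕ (a ∷ f) [] x = sym (+-identityʳ _)
    eval-⊕ (a ∷ f) (b ∷ g) x = trans (+-congˡ (*-congˡ (eval-⊕ f g x)))
      (solve 5 (λ a b x u v → (a :+ b) :+ x :* (u :+ v) := (a :+ x :* u) :+ (b :+ x :* v)) refl a b x _ _)

    eval-scale : ∀ a f x → eval (scale a f) x ≈ a * eval f x
    eval-scale a [] x = sym (zeroʳ a)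
    eval-scale a (b ∷ f) x = trans (+-congˡ (*-congˡ (eval-scale a f x)))
      (solve 4 (λ a b x u → a :* b :+ x :* (a :* u) := a :* (b :+ x :* u)) refl a b x _)

    eval-⊖ : ∀ f x → eval (⊖ f) x ≈ - eval f x
    eval-⊖ [] x = sym -0#≈0#
    eval-⊖ (a ∷ f) x = trans (+-congˡ (*-congˡ (eval-⊖ f x)))
      (solve 3 (λ a x u → :- a :+ x :* (:- u) := :- (a :+ x :* u)) refl a x _)

    eval-⊗ : ∀ f g x → eval (f ⊗ g) x ≈ eval f x * eval g x
    eval-⊗ [] g x = sym (zeroˡ (eval g x))
    eval-⊗ (a ∷ f) g x = trans (eval-⊕ (scale a g) (0# ∷ (f ⊗ g)) x)
      (trans (+-cong (eval-scale a g x) (trans (+-identityˡ _) (*-congˡ (eval-⊗ f g x))))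
      (solve 4 (λ a x u v → a :* v :+ x :* (u :* v) := (a :+ x :* u) :* v) refl a x (eval f x) (eval g x)))

    eval-C : ∀ a x → eval (C a) x ≈ a
    eval-C a x = trans (+-congˡ (zeroʳ x)) (+-identityʳ a)

    eval-X : ∀ x → eval X x ≈ x
    eval-X x = trans (+-identityˡ _) (trans (*-congˡ (eval-C 1# x)) (*-identityʳ x))

    eval-zero : ∀ f x → (∀ i → coeff f i ≈ 0#) → eval f x ≈ 0#
    eval-zero [] x z = refl
    eval-zero (a ∷ f) x z = trans (+-cong (z 0) (trans (*-congˡ (eval-zero f x (λ i → z (suc i)))) (zeroʳ x))) (+-identityʳ 0#)

    eval-at-0 : ∀ f → eval f 0# ≈ coeff f 0
    eval-at-0 [] = refl
    eval-at-0 (a ∷ f) = trans (+-congˡ (zeroˡ _)) (+-identityʳ a)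

    D-C : ∀ a → D (C a) ≋ []
    D-C a = mk≋ λ { zero → refl ; (suc i) → refl }

    D-X : D X ≋ C 1#
    D-X = mk≋ λ { zero → +-identityʳ 1# ; (suc zero) → refl ; (suc (suc i)) → refl }

    C-cong : ∀ {a b} → a ≈ b → C a ≋ C b
    C-cong e = ∷-cong e ≋-refl

    C-⊕ : ∀ a b → C (a + b) ≋ C a ⊕ C b
    C-⊕ a b = ≋-refl

    C-⊗ : ∀ a b → C (a * b) ≋ C a ⊗ C b
    C-⊗ a b = scale-≋ a (C b)

    C-⊖ : ∀ a → C (- a) ≋ ⊖ C a
    C-⊖ a = ≋-refl

    coeff-X : ∀ i → 2 N.≤ i → coeff X i ≈ 0#
    coeff-X (suc (suc i)) (s≤s (s≤s h)) = refl

    C-0 : C 0# ≋ []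
    C-0 = mk≋ λ { zero → refl ; (suc i) → refl }

  coeff-X⊗ : ∀ f i → coeff (X ⊗ f) (suc i) ≈ coeff f i
  coeff-X⊗ f i = sym (at (shift-≋ f) (suc i))

  D-cong : ∀ {f g} → f ≋ g → D f ≋ D g
  D-cong {f} {g} e = via _ _ (coeff-D f) (coeff-D g) (λ i → *-congˡ (at e (suc i)))

  D-⊕ : ∀ f g → D (f ⊕ g) ≋ D f ⊕ D g
  D-⊕ f g = via _ _ (λ i → trans (coeff-D (f ⊕ g) i) (*-congˡ (coeff-⊕ f g (suc i))))
    (λ i → trans (coeff-⊕ (D f) (D g) i) (+-cong (coeff-D f i) (coeff-D g i)))
    (λ i → distribˡ _ _ _)

  coeff-C⊗ : ∀ a f i → coeff (C a ⊗ f) i ≈ a * coeff f i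
  coeff-C⊗ a f i = trans (sym (at (scale-≋ a f) i)) (coeff-scale a f i)

  D-C⊗ : ∀ a f → D (C a ⊗ f) ≋ C a ⊗ D f
  D-C⊗ a f = via _ _ (λ i → trans (coeff-D (C a ⊗ f) i) (*-congˡ (coeff-C⊗ a f (suc i))))
    (λ i → trans (coeff-C⊗ a (D f) i) (*-congˡ (coeff-D f i)))
    (λ i → solve 3 (λ n a c → n :* (a :* c) := a :* (n :* c)) refl _ a _)

  D-X⊗ : ∀ f → D (X ⊗ f) ≋ f ⊕ X ⊗ D f
  D-X⊗ f = ≋-trans (D-cong (≋-sym (shift-≋ f))) (D-∷ 0# f)

  D-⊗ : ∀ f g → D (f ⊗ g) ≋ D f ⊗ g ⊕ f ⊗ D g
  D-⊗ [] g = ≋-trans (≋-trans (D-cong (P.zeroˡ g)) D-[]) (≋-sym (≋-trans (⊕-cong (⊗-cong D-[] ≋-refl) (P.zeroˡ (D g)))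
     (≋-trans (⊕-identityʳ ([] ⊗ g)) (P.zeroˡ g))))
  D-⊗ (a ∷ f) g = begin
    D ((a ∷ f) ⊗ g) ≈⟨ D-cong (∷-⊗ a f g) ⟩
    D (C a ⊗ g ⊕ X ⊗ (f ⊗ g)) ≈⟨ D-⊕ _ _ ⟩
    D (C a ⊗ g) ⊕ D (X ⊗ (f ⊗ g)) ≈⟨ ⊕-cong (D-C⊗ a g) (≋-trans (D-X⊗ (f ⊗ g)) (⊕-cong ≋-refl (⊗-cong ≋-refl (D-⊗ f g)))) ⟩
    C a ⊗ D g ⊕ (f ⊗ g ⊕ X ⊗ (D f ⊗ g ⊕ f ⊗ D g))
      ≈⟨ P.solve 6 (λ x a f g df dg → a P.:* dg P.:+ (f P.:* g P.:+ x P.:* (df P.:* g P.:+ f P.:* dg))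
           P.:= (f P.:+ x P.:* df) P.:* g P.:+ (a P.:+ x P.:* f) P.:* dg) ≋-refl X (C a) f g (D f) (D g) ⟩
    (f ⊕ X ⊗ D f) ⊗ g ⊕ (C a ⊕ X ⊗ f) ⊗ D g ≈⟨ ⊕-cong (⊗-cong (≋-sym (D-∷ a f)) ≋-refl) (⊗-cong (≋-sym (∷-≋ a f)) ≋-refl) ⟩
    D (a ∷ f) ⊗ g ⊕ (a ∷ f) ⊗ D g ∎
    where open Reasoning P.setoid

  eval-cong : ∀ {f g} → f ≋ g → ∀ x → eval f x ≈ eval g x
  eval-cong {f} {g} e x = begin
    eval f x ≈⟨ solve 2 (λ a b → a := a :+ :- b :+ b) refl (eval f x) (eval g x) ⟩
    eval f x + - eval g x + eval g x ≈⟨ +-congʳ (trans (+-congˡ (sym (eval-⊖ g x))) (sym (eval-⊕ f (⊖ g) x))) ⟩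
    eval (f ⊕ ⊖ g) x + eval g x ≈⟨ +-congʳ (eval-zero (f ⊕ ⊖ g) x (at (≋-trans (⊕-cong e ≋-refl) (⊖-inverseʳ g)))) ⟩
    0# + eval g x ≈⟨ +-identityˡ _ ⟩
    eval g x ∎
    where open Reasoning setoid

  eval-^ : ∀ f n x → eval (f ^ᵖ n) x ≈ eval f x ^ n
  eval-^ f zero x = eval-C 1# x
  eval-^ f (suc n) x = trans (eval-⊗ f (f ^ᵖ n) x) (*-congˡ (eval-^ f n x))

  D-^ : ∀ f n → D (f ^ᵖ suc n) ≋ (C (suc n ×ₙ 1#) ⊗ f ^ᵖ n) ⊗ D f
  D-^ f zero = ≋-trans (D-⊗ f (C 1#)) (≋-trans (⊕-cong (≋-trans (⊗-comm _ _) (⊗-identityˡ _)) (≋-trans (⊗-cong {f} ≋-refl (D-C 1#)) (P.zeroʳ f)))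
    (≋-trans (⊕-identityʳ _) (≋-sym (≋-trans (⊗-cong (≋-trans (⊗-comm _ _) (≋-trans (⊗-identityˡ _) (C-cong (+-identityʳ 1#)))) ≋-refl) (⊗-identityˡ (D f))))))
  D-^ f (suc n) = ≋-trans (D-⊗ f (f ^ᵖ suc n)) (≋-trans (⊕-cong (≋-sym (⊗-identityˡ _)) (⊗-cong {f} ≋-refl (D-^ f n)))
    (≋-trans (P.solve 5 (λ o f df g n → o P.:* (df P.:* (f P.:* g)) P.:+ f P.:* ((n P.:* g) P.:* df) P.:= ((o P.:+ n) P.:* (f P.:* g)) P.:* df) ≋-refl
        (C 1#) f (D f) (f ^ᵖ n) (C (suc n ×ₙ 1#)))
      (⊗-cong (⊗-cong (≋-sym (C-⊕ 1# (suc n ×ₙ 1#))) ≋-refl) ≋-refl)))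

  -- Synthetic division by X - b in Horner's scheme: quotient and remainder.
  divLin : Poly → Carrier → Poly × Carrier
  divLin [] b = [] , 0#
  divLin (a ∷ f) b = proj₂ (divLin f b) ∷ proj₁ (divLin f b) , a + b * proj₂ (divLin f b)

  divLin-spec : ∀ f b → f ≋ (X ⊕ ⊖ C b) ⊗ proj₁ (divLin f b) ⊕ C (proj₂ (divLin f b))
  divLin-spec [] b = ≋-sym (≋-trans (⊕-cong (P.zeroʳ _) C-0) (⊕-identityʳ []))
  divLin-spec (a ∷ f) b = ≋-trans (∷-≋ a f) (≋-trans (⊕-cong ≋-refl (⊗-cong ≋-refl (divLin-spec f b)))
    (≋-trans (P.solve 5 (λ x b q r a → a P.:+ x P.:* ((x P.:+ P.:- b) P.:* q P.:+ r) P.:= (x P.:+ P.:- b) P.:* (r P.:+ x P.:* q) P.:+ (a P.:+ b P.:* r)) ≋-refl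
       X (C b) (proj₁ (divLin f b)) (C (proj₂ (divLin f b))) (C a))
    (⊕-cong (⊗-cong ≋-refl (≋-sym (∷-≋ _ _))) (≋-sym (≋-trans (C-⊕ a _) (⊕-cong ≋-refl (C-⊗ b _)))))))

open import Data.Nat using (_≤_; _<_)

-- Prime fields, orders of vanishing and counting roots

record PrimeField (p : ℕ) : Set₁ where
  field
    commutativeRing : CommutativeRing 0ℓ 0ℓ
  open CommutativeRing commutativeRing public hiding (zero)
  open Mult semiring public using (×-homo-+; ×1-homo-*) renaming (_×_ to _×ₙ_)
  open Exp semiring public using (_^_; ^-congˡ)
  field
    _≟_ : ∀ x y → Dec (x ≈ y)
    inverse : ∀ x → ¬ x ≈ 0# → ∃[ y ] x * y ≈ 1#
    1≉0 : ¬ 1# ≈ 0#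
    char : p ×ₙ 1# ≈ 0#
    char-∣ : ∀ n → n ×ₙ 1# ≈ 0# → p ∣ n
    generated : ∀ x → ∃[ n ] n ×ₙ 1# ≈ x
    p>0 : 0 < p

module FieldTheory {p : ℕ} (F : PrimeField p) where
  open PrimeField F public
  open RingProps ring public using (-0#≈0#)
  open Poly commutativeRing public
  module S = PSolver commutativeRing

  x-y≈0⇒x≈y : ∀ x y → x + - y ≈ 0# → x ≈ y
  x-y≈0⇒x≈y x y e = trans (S.solve 2 (λ x y → x S.:= x S.:+ S.:- y S.:+ y) refl x y) (trans (+-congʳ e) (+-identityˡ y))

  x≈y⇒x-y≈0 : ∀ x y → x ≈ y → x + - y ≈ 0#
  x≈y⇒x-y≈0 x y e = trans (+-congʳ e) (-‿inverseʳ y)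

  integral : ∀ {x y} → x * y ≈ 0# → x ≉ 0# → y ≈ 0#
  integral {x} {y} e n with inverse x n
  ... | z , xz = begin
    y ≈⟨ *-identityˡ y ⟨
    1# * y ≈⟨ *-congʳ xz ⟨
    x * z * y ≈⟨ S.solve 3 (λ x y z → x S.:* z S.:* y S.:= z S.:* (x S.:* y)) refl x y z ⟩
    z * (x * y) ≈⟨ *-congˡ e ⟩
    z * 0# ≈⟨ zeroʳ z ⟩
    0# ∎
    where open Reasoning setoid

  *-≉0 : ∀ {x y} → x ≉ 0# → y ≉ 0# → x * y ≉ 0#
  *-≉0 nx ny e = ny (integral e nx)

  ^-≉0 : ∀ {x} n → x ≉ 0# → x ^ n ≉ 0#
  ^-≉0 zero nx = 1≉0
  ^-≉0 (suc n) nx = *-≉0 nx (^-≉0 n nx)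

  *-cancelˡ : ∀ {x y z} → x ≉ 0# → x * y ≈ x * z → y ≈ z
  *-cancelˡ {x} {y} {z} nx e = x-y≈0⇒x≈y y z (integral (trans (S.solve 3 (λ x y z → x S.:* (y S.:+ S.:- z) S.:= x S.:* y S.:+ S.:- (x S.:* z)) refl x y z) (x≈y⇒x-y≈0 _ _ e)) nx)

  ×≉0 : ∀ {l} → 0 < l → l < p → l ×ₙ 1# ≉ 0#
  ×≉0 {l} 0<l l<p e with char-∣ l e
  ... | d = N.<⇒≱ l<p (∣⇒≤ {{N.>-nonZero 0<l}} d)

  -- The degree is strictly below N, so that `Deg 0` means zero; this convention is behind the `suc`
  -- in the bounds for products and derivatives.
  record Deg (N : ℕ) (f : Poly) : Set where
    constructor mkDeg
    field above : ∀ i → N ≤ i → coeff f i ≈ 0#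
  open Deg public

  zero? : ∀ f → Dec (f ≋ [])
  zero? [] = yes ≋-refl
  zero? (a ∷ f) with a ≟ 0# | zero? f
  ... | yes e | yes e′ = yes (mk≋ λ { zero → e ; (suc i) → at e′ i })
  ... | no n | _ = no λ e → n (at e 0)
  ... | _ | no n = no λ e → n (mk≋ λ i → at e (suc i))

  deg-length : ∀ f → Deg (length f) f
  deg-length [] = mkDeg λ i _ → refl
  deg-length (a ∷ f) = mkDeg λ { (suc i) (s≤s h) → above (deg-length f) i h }

  deg-resp : ∀ {N f g} → f ≋ g → Deg N f → Deg N g
  deg-resp e d = mkDeg λ i h → trans (sym (at e i)) (above d i h)

  deg-mono : ∀ {M N f} → M ≤ N → Deg M f → Deg N f
  deg-mono m d = mkDeg λ i h → above d i (m ⟫ h)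

  deg-⊕ : ∀ {N f g} → Deg N f → Deg N g → Deg N (f ⊕ g)
  deg-⊕ {N} {f} {g} d e = mkDeg λ i h → trans (coeff-⊕ f g i) (trans (+-cong (above d i h) (above e i h)) (+-identityʳ 0#))

  deg-⊖ : ∀ {N f} → Deg N f → Deg N (⊖ f)
  deg-⊖ {N} {f} d = mkDeg λ i h → trans (coeff-⊖ f i) (trans (-‿cong (above d i h)) -0#≈0#)

  deg-C : ∀ a → Deg 1 (C a)
  deg-C a = mkDeg λ { (suc i) _ → coeff-C-suc a i }

  deg-[] : ∀ {N} → Deg N []
  deg-[] = mkDeg λ i _ → refl

  deg-C⊗ : ∀ {N f} a → Deg N f → Deg N (C a ⊗ f)
  deg-C⊗ {f = f} a d = mkDeg λ i h → trans (coeff-C⊗ a f i) (trans (*-congˡ (above d i h)) (zeroʳ a))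

  deg-D : ∀ {N f} → Deg (suc N) f → Deg N (D f)
  deg-D {f = f} d = mkDeg λ i h → trans (coeff-D f i) (trans (*-congˡ (above d (suc i) (s≤s h))) (zeroʳ _))

  private
    conv-deg : ∀ M N f g → (∀ i → M ≤ i → f i ≈ 0#) → (∀ i → N ≤ i → g i ≈ 0#) → ∀ i → M N.+ N ≤ suc i → conv f g i ≈ 0#
    conv-deg zero N f g df dg i h = trans (conv-cong {f} {λ _ → 0#} {g} (λ j → df j z≤n) (λ _ → refl) i) (conv-zeroˡ g i)
    conv-deg (suc M) N f g df dg zero (s≤s h) = trans (*-congˡ (dg 0 (N.m≤n+m N M ⟫ h))) (zeroʳ _)
    conv-deg (suc M) N f g df dg (suc i) (s≤s h) = trans (+-cong (trans (*-congˡ (dg (suc i) (N.m≤n+m N M ⟫ h))) (zeroʳ _))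
      (conv-deg M N _ g (λ j q → df (suc j) (s≤s q)) dg i h)) (+-identityʳ 0#)

  deg-⊗ : ∀ {M N f g} → Deg (suc M) f → Deg N g → Deg (M N.+ N) (f ⊗ g)
  deg-⊗ {M} {N} {f} {g} d e = mkDeg λ i h → trans (coeff-⊗ f g i) (conv-deg (suc M) N (coeff f) (coeff g) (above d) (above e) i (s≤s h))

  deg-^ : ∀ {M f} → Deg (suc M) f → ∀ n → Deg (suc (n N.* M)) (f ^ᵖ n)
  deg-^ d zero = deg-C 1#
  deg-^ {M} {f} d (suc n) = deg-mono (N.≤-reflexive (N.+-suc M (n N.* M))) (deg-⊗ {M} {suc (n N.* M)} {f} {f ^ᵖ n} d (deg-^ d n))

  deg-X : Deg 2 X
  deg-X = mkDeg coeff-X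

  opaque
    X- : Carrier → Poly
    X- b = X ⊕ ⊖ C b

    X-≋ : ∀ b → X- b ≋ X ⊕ ⊖ C b
    X-≋ b = ≋-refl

  deg-X- : ∀ b → Deg 2 (X- b)
  deg-X- b = deg-resp (≋-sym (X-≋ b)) (deg-⊕ deg-X (deg-⊖ (deg-mono (s≤s z≤n) (deg-C b))))

  eval-X- : ∀ b x → eval (X- b) x ≈ x + - b
  eval-X- b x = trans (eval-cong (X-≋ b) x) (trans (eval-⊕ X (⊖ C b) x) (+-cong (eval-X x) (trans (eval-⊖ (C b) x) (-‿cong (eval-C b x)))))

  coeff-X- : ∀ b g i → coeff (X- b ⊗ g) (suc i) ≈ coeff g i + - (b * coeff g (suc i))
  coeff-X- b g i = begin
    coeff (X- b ⊗ g) (suc i) ≈⟨ at (≋-trans (⊗-cong (X-≋ b) ≋-refl) (P.solve 3 (λ x b g → (x P.:+ P.:- b) P.:* g P.:= x P.:* g P.:+ P.:- (b P.:* g)) ≋-refl X (C b) g)) (suc i) ⟩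
    coeff (X ⊗ g ⊕ ⊖ (C b ⊗ g)) (suc i) ≈⟨ coeff-⊕ (X ⊗ g) _ (suc i) ⟩
    coeff (X ⊗ g) (suc i) + coeff (⊖ (C b ⊗ g)) (suc i) ≈⟨ +-cong (coeff-X⊗ g i) (trans (coeff-⊖ (C b ⊗ g) (suc i)) (-‿cong (coeff-C⊗ b g (suc i)))) ⟩
    coeff g i + - (b * coeff g (suc i)) ∎
    where open Reasoning setoid

  deg-X-cancel : ∀ {N b g} → Deg (suc N) (X- b ⊗ g) → Deg N g
  deg-X-cancel {N} {b} {g} d = mkDeg λ i h → go (length g) i h (above (deg-length g) (length g N.+ i) (N.m≤m+n _ i))
    where
    go : ∀ k i → N ≤ i → coeff g (k N.+ i) ≈ 0# → coeff g i ≈ 0#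
    go zero i h e = e
    go (suc k) i h e = go k i h (begin
      coeff g (k N.+ i) ≈⟨ x-y≈0⇒x≈y _ _ (trans (sym (coeff-X- b g (k N.+ i))) (above d (suc (k N.+ i)) (s≤s (h ⟫ N.m≤n+m i k)))) ⟩
      b * coeff g (suc (k N.+ i)) ≈⟨ *-congˡ e ⟩
      b * 0# ≈⟨ zeroʳ b ⟩
      0# ∎)
      where open Reasoning setoid

  deg-0 : ∀ {f} → Deg 0 f → f ≋ []
  deg-0 d = mk≋ λ i → above d i z≤n

  X-integral : ∀ {b g} → X- b ⊗ g ≋ [] → g ≋ []
  X-integral {b} {g} e = deg-0 (deg-X-cancel {0} {b} (mkDeg λ i _ → at e i))

  poly-sub : ∀ {f g} → f ⊕ ⊖ g ≋ [] → f ≋ g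
  poly-sub {f} {g} e = ≋-trans (P.solve 2 (λ x y → x P.:= x P.:+ P.:- y P.:+ y) ≋-refl f g) (≋-trans (⊕-cong e ≋-refl) (P.+-identityˡ g))

  X-cancel : ∀ {b f g} → X- b ⊗ f ≋ X- b ⊗ g → f ≋ g
  X-cancel {b} {f} {g} e = poly-sub (X-integral {b} (≋-trans
    (P.solve 3 (λ x f g → x P.:* (f P.:+ P.:- g) P.:= x P.:* f P.:+ P.:- (x P.:* g)) ≋-refl (X- b) f g)
    (≋-trans (⊕-cong e ≋-refl) (⊖-inverseʳ _))))

  X-cancel^ : ∀ {b f g} n → X- b ^ᵖ n ⊗ f ≋ X- b ^ᵖ n ⊗ g → f ≋ g
  X-cancel^ zero e = ≋-trans (≋-sym (⊗-identityˡ _)) (≋-trans e (⊗-identityˡ _))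
  X-cancel^ (suc n) e = X-cancel^ n (X-cancel (≋-trans (≋-sym (⊗-assoc _ _ _)) (≋-trans e (⊗-assoc _ _ _))))

  factor : ∀ {f b} → eval f b ≈ 0# → ∃[ g ] f ≋ X- b ⊗ g
  factor {f} {b} e = proj₁ (divLin f b) , ≋-trans spec (≋-trans (⊕-cong ≋-refl (≋-trans (C-cong r≈0) C-0)) (⊕-identityʳ _))
    where
    open Reasoning setoid
    spec : f ≋ X- b ⊗ proj₁ (divLin f b) ⊕ C (proj₂ (divLin f b))
    spec = ≋-trans (divLin-spec f b) (⊕-cong (⊗-cong (≋-sym (X-≋ b)) ≋-refl) ≋-refl)
    r≈0 : proj₂ (divLin f b) ≈ 0#
    r≈0 = begin
      proj₂ (divLin f b) ≈⟨ eval-C _ b ⟨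
      eval (C (proj₂ (divLin f b))) b ≈⟨ +-identityˡ _ ⟨
      0# + eval (C (proj₂ (divLin f b))) b ≈⟨ +-congʳ (trans (*-congʳ (trans (eval-X- b b) (-‿inverseʳ b))) (zeroˡ _)) ⟨
      eval (X- b) b * eval (proj₁ (divLin f b)) b + eval (C (proj₂ (divLin f b))) b ≈⟨ trans (eval-⊕ _ _ b) (+-congʳ (eval-⊗ _ _ b)) ⟨
      eval (X- b ⊗ proj₁ (divLin f b) ⊕ C (proj₂ (divLin f b))) b ≈⟨ eval-cong spec b ⟨
      eval f b ≈⟨ e ⟩
      0# ∎

  eval-X-⊗ : ∀ b g → eval (X- b ⊗ g) b ≈ 0#
  eval-X-⊗ b g = trans (eval-⊗ (X- b) g b) (trans (*-congʳ (trans (eval-X- b b) (-‿inverseʳ b))) (zeroˡ _))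

  -- Divisibility by (X - b)^h with an explicit cofactor. In characteristic p the first h
  -- derivatives vanishing at b would be weaker once h exceeds p.
  record Van (b : Carrier) (h : ℕ) (f : Poly) : Set where
    constructor mkVan
    field
      quot : Poly
      eq : f ≋ X- b ^ᵖ h ⊗ quot
  open Van public

  van-resp : ∀ {b h f g} → f ≋ g → Van b h f → Van b h g
  van-resp e v = mkVan (quot v) (≋-trans (≋-sym e) (eq v))

  van-⊕ : ∀ {b h f g} → Van b h f → Van b h g → Van b h (f ⊕ g)
  van-⊕ v w = mkVan (quot v ⊕ quot w) (≋-trans (⊕-cong (eq v) (eq w)) (≋-sym (⊗-distribˡ _ (quot v) (quot w))))

  van-⊗ : ∀ {b h f} g → Van b h f → Van b h (g ⊗ f)
  van-⊗ {b} {h} g v = mkVan (g ⊗ quot v) (≋-trans (⊗-cong ≋-refl (eq v))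
    (P.solve 3 (λ g x q → g P.:* (x P.:* q) P.:= x P.:* (g P.:* q)) ≋-refl g (X- b ^ᵖ h) (quot v)))

  van-⊖ : ∀ {b h f} → Van b h f → Van b h (⊖ f)
  van-⊖ {b} {h} v = mkVan (⊖ quot v) (≋-trans (⊖-cong (eq v)) (P.solve 2 (λ x q → P.:- (x P.:* q) P.:= x P.:* P.:- q) ≋-refl (X- b ^ᵖ h) (quot v)))

  van-pred : ∀ {b h f} → Van b (suc h) f → Van b h f
  van-pred {b} {h} v = mkVan (X- b ⊗ quot v) (≋-trans (eq v)
    (P.solve 3 (λ x y q → (x P.:* y) P.:* q P.:= y P.:* (x P.:* q)) ≋-refl (X- b) (X- b ^ᵖ h) (quot v)))

  van-≤ : ∀ {b h h′ f} → h N.≤′ h′ → Van b h′ f → Van b h f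
  van-≤ N.≤′-refl v = v
  van-≤ (N.≤′-step l) v = van-≤ l (van-pred v)

  D-X- : ∀ b → D (X- b) ≋ C 1#
  D-X- b = ≋-trans (D-cong (X-≋ b)) (≋-trans (D-⊕ X (⊖ C b)) (≋-trans (⊕-cong D-X (≋-trans (D-cong (≋-sym (C-⊖ b))) (D-C (- b)))) (⊕-identityʳ _)))

  D-X-^ : ∀ b n g → D (X- b ^ᵖ suc n ⊗ g) ≋ X- b ^ᵖ n ⊗ (C (suc n ×ₙ 1#) ⊗ g ⊕ X- b ⊗ D g)
  D-X-^ b n g = ≋-trans (D-⊗ (X- b ^ᵖ suc n) g) (≋-trans (⊕-cong (⊗-cong (≋-trans (D-^ (X- b) n)
      (≋-trans (⊗-cong ≋-refl (D-X- b)) (P.*-identityʳ _))) ≋-refl) ≋-refl)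
    (P.solve 5 (λ n y x g dg → (n P.:* y) P.:* g P.:+ (x P.:* y) P.:* dg P.:= y P.:* (n P.:* g P.:+ x P.:* dg)) ≋-refl
      (C (suc n ×ₙ 1#)) (X- b ^ᵖ n) (X- b) g (D g)))

  van-D : ∀ {b h f} → Van b (suc h) f → Van b h (D f)
  van-D {b} {h} v = mkVan _ (≋-trans (D-cong (eq v)) (D-X-^ b h (quot v)))

  X-swap : ∀ x y g → x ⊗ (y ⊗ g) ≋ y ⊗ (x ⊗ g)
  X-swap = P.solve 3 (λ x y g → x P.:* (y P.:* g) P.:= y P.:* (x P.:* g)) ≋-refl

  van-coprime : ∀ {b g f} h → eval g b ≉ 0# → Van b h (g ⊗ f) → Van b h f
  van-coprime {f = f} zero n v = mkVan f (≋-sym (⊗-identityˡ f))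
  van-coprime {b} {c} {f} (suc h) n (mkVan q s) = divided (factor {f} {b} fb≈0)
    where
    s′ : c ⊗ f ≋ X- b ⊗ (X- b ^ᵖ h ⊗ q)
    s′ = ≋-trans s (⊗-assoc (X- b) (X- b ^ᵖ h) q)
    fb≈0 : eval f b ≈ 0#
    fb≈0 = integral {eval c b} (trans (sym (eval-⊗ c f b)) (trans (eval-cong s′ b) (eval-X-⊗ b (X- b ^ᵖ h ⊗ q)))) n
    divided : ∃[ g ] f ≋ X- b ⊗ g → Van b (suc h) f
    divided (g , e) = mkVan (quot v) (≋-trans e (≋-trans (⊗-cong ≋-refl (eq v)) (≋-sym (⊗-assoc (X- b) (X- b ^ᵖ h) (quot v)))))
      where
      v : Van b h g
      v = van-coprime {b} {c} {g} h n (mkVan q (X-cancel {b} (≋-trans (X-swap (X- b) c g) (≋-trans (⊗-cong ≋-refl (≋-sym e)) s′))))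

  X-≉0 : ∀ {b c} → c ≉ b → eval (X- c) b ≉ 0#
  X-≉0 {b} {c} n e = n (sym (x-y≈0⇒x≈y b c (trans (sym (eval-X- c b)) e)))

  van-coprime^ : ∀ {b c f} h k → c ≉ b → Van b h (X- c ^ᵖ k ⊗ f) → Van b h f
  van-coprime^ {f = f} h zero n v = van-resp (⊗-identityˡ f) v
  van-coprime^ {c = c} {f} h (suc k) n v = van-coprime^ h k n (van-coprime h (X-≉0 n) (van-resp (⊗-assoc (X- c) (X- c ^ᵖ k) f) v))

  ⊗-[] : ∀ f {g} → g ≋ [] → f ⊗ g ≋ []
  ⊗-[] f e = ≋-trans (⊗-cong {f} ≋-refl e) (P.zeroʳ f)

  strip : ∀ {b N f} L g → f ≋ X- b ^ᵖ L ⊗ g → Deg N f → ¬ f ≋ [] → ∃[ M ] (N ≡ L N.+ M × Deg M g)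
  strip {N = N} zero g e d n = N , ≡.refl , deg-resp (≋-trans e (⊗-identityˡ g)) d
  strip {b} {zero} (suc L) g e d n = ⊥-elim (n (deg-0 d))
  strip {b} {suc N} {f} (suc L) g e d n = shifted (strip {b} {N} {X- b ^ᵖ L ⊗ g} L g ≋-refl
       (deg-X-cancel {N} {b} (deg-resp e₁ d))
       (λ z → n (≋-trans e₁ (⊗-[] (X- b) z))))
    where
    e₁ : f ≋ X- b ⊗ (X- b ^ᵖ L ⊗ g)
    e₁ = ≋-trans e (⊗-assoc (X- b) (X- b ^ᵖ L) g)
    shifted : ∃[ M ] (N ≡ L N.+ M × Deg M g) → ∃[ M ] (suc N ≡ suc L N.+ M × Deg M g)
    shifted (M , q , d′) = M , ≡.cong suc q , d′

  root-count : ∀ {N f} L bs → AllPairs _≉_ bs → All (λ b → Van b L f) bs → Deg N f → ¬ f ≋ [] → length bs N.* L < N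
  root-count {zero} L bs ap vs d n = ⊥-elim (n (deg-0 d))
  root-count {suc N} L [] ap vs d n = s≤s z≤n
  root-count {suc N} {f} L (b ∷ bs) (nb ∷ ap) (mkVan g s ∷ vs) d n = rest (strip {b} L g s d n)
    where
    rest : ∃[ M ] (suc N ≡ L N.+ M × Deg M g) → L N.+ length bs N.* L < suc N
    rest (M , q , d′) = ≡.subst (L N.+ length bs N.* L <_) (≡.sym q) (N.+-monoʳ-< L
      (root-count {M} {g} L bs ap (All.zipWith (λ { (c , v) → van-coprime^ {f = g} L L c (van-resp s v) }) (nb , vs)) d′
        (λ z → n (≋-trans s (⊗-[] (X- b ^ᵖ L) z)))))

  iter : (Poly → Poly) → ℕ → Poly → Poly
  iter δ zero f = f
  iter δ (suc l) f = iter δ l (δ f)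

  -- If f = (X - b)^l g with 0 < l < p, then U D f is (X - b)^(l - 1) times a polynomial with value
  -- U(b) l g(b) at b. One more order of vanishing of U D f therefore forces g(b) = 0 and raises the
  -- order of f.
  van-iter : ∀ {U b f} L → L ≤ p → eval U b ≉ 0# → (∀ l → l < L → eval (iter (λ h → U ⊗ D h) l f) b ≈ 0#) → Van b L f
  van-iter {f = f} zero _ nU z = mkVan f (≋-sym (⊗-identityˡ f))
  van-iter {U} {b} {f} (suc zero) _ nU z = divided (factor {f} {b} (z 0 (s≤s z≤n)))
    where
    divided : ∃[ g ] f ≋ X- b ⊗ g → Van b 1 f
    divided (g , e) = mkVan g (≋-trans e (⊗-cong (≋-sym (P.*-identityʳ (X- b))) ≋-refl))
  van-iter {U} {b} {f} (suc (suc L)) le nU z =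
    lift (van-iter {U} {b} {f} (suc L) (N.<⇒≤ le) nU (λ l h → z l (N.m≤n⇒m≤1+n h)))
         (van-iter {U} {b} {U ⊗ D f} (suc L) (N.<⇒≤ le) nU (λ l h → z (suc l) (s≤s h)))
    where
    lift : Van b (suc L) f → Van b (suc L) (U ⊗ D f) → Van b (suc (suc L)) f
    lift (mkVan g e) (mkVan h e′) = divided (factor {g} {b} gb≈0)
      where
      w : Poly
      w = C (suc L ×ₙ 1#) ⊗ g ⊕ X- b ⊗ D g
      key : U ⊗ w ≋ X- b ⊗ h
      key = X-cancel^ {b} L (≋-trans (X-swap (X- b ^ᵖ L) U w)
        (≋-trans (⊗-cong ≋-refl (≋-sym (≋-trans (D-cong e) (D-X-^ b L g)))) (≋-trans e′
          (P.solve 3 (λ x y h → (x P.:* y) P.:* h P.:= y P.:* (x P.:* h)) ≋-refl (X- b) (X- b ^ᵖ L) h))))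
      open Reasoning setoid
      gb≈0 : eval g b ≈ 0#
      gb≈0 = integral {suc L ×ₙ 1#} (integral {eval U b} (begin
        eval U b * ((suc L ×ₙ 1#) * eval g b) ≈⟨ *-congˡ (trans (+-cong (eval-⊗ _ _ b) (eval-X-⊗ b (D g))) (trans (+-identityʳ _) (*-congʳ (eval-C _ b)))) ⟨
        eval U b * (eval (C (suc L ×ₙ 1#) ⊗ g) b + eval (X- b ⊗ D g) b) ≈⟨ *-congˡ (eval-⊕ _ _ b) ⟨
        eval U b * eval w b ≈⟨ eval-⊗ U w b ⟨
        eval (U ⊗ w) b ≈⟨ eval-cong key b ⟩
        eval (X- b ⊗ h) b ≈⟨ eval-X-⊗ b h ⟩
        0# ∎) nU) (×≉0 (s≤s z≤n) le)
      divided : ∃[ g₁ ] g ≋ X- b ⊗ g₁ → Van b (suc (suc L)) f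
      divided (g₁ , e₁) = mkVan g₁ (≋-trans e (≋-trans (⊗-cong ≋-refl e₁)
        (P.solve 3 (λ x y g → y P.:* (x P.:* g) P.:= (x P.:* y) P.:* g) ≋-refl (X- b) (X- b ^ᵖ suc L) g₁)))

  van-deg : ∀ {b R h f} → R ≤ h → Van b h f → Deg R f → f ≋ []
  van-deg {b} {R} {h} {f} le v d with zero? f
  ... | yes z = z
  ... | no nz = ⊥-elim (N.<⇒≱ (root-count {f = f} h (b ∷ []) ([] ∷ []) (v ∷ []) d nz) (le ⟫ N.m≤m+n h 0))

  order : ∀ {N f} b → Deg N f → ¬ f ≋ [] → ∃[ α ] ∃[ q ] (α < N × f ≋ X- b ^ᵖ α ⊗ q × eval q b ≉ 0#)
  order {zero} b d n = ⊥-elim (n (deg-0 d))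
  order {suc N} {f} b d n with eval f b ≟ 0#
  ... | no ne = 0 , f , s≤s z≤n , ≋-sym (⊗-identityˡ f) , ne
  ... | yes e = divided (factor {f} {b} e)
    where
    Ordered : Poly → ℕ → Set
    Ordered f N = ∃[ α ] ∃[ q ] (α < N × f ≋ X- b ^ᵖ α ⊗ q × eval q b ≉ 0#)
    divided : ∃[ g ] f ≋ X- b ⊗ g → Ordered f (suc N)
    divided (g , e₁) = raise (order {N} {g} b (deg-X-cancel {N} {b} (deg-resp e₁ d)) (λ z → n (≋-trans e₁ (⊗-[] (X- b) z))))
      where
      raise : Ordered g N → Ordered f (suc N)
      raise (α , q , lt , e₂ , ne) = suc α , q , s≤s lt , ≋-trans e₁ (≋-trans (⊗-cong ≋-refl e₂) (≋-sym (⊗-assoc (X- b) (X- b ^ᵖ α) q))) , ne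

  monic : ∀ b n → coeff (X- b ^ᵖ n) n ≈ 1#
  monic b zero = coeff-C-0 1#
  monic b (suc n) = trans (coeff-X- b (X- b ^ᵖ n) n) (trans (+-cong (monic b n)
      (trans (-‿cong (trans (*-congˡ (above (deg-^ (deg-X- b) n) (suc n) (s≤s (N.≤-reflexive (N.*-identityʳ n))))) (zeroʳ b))) -0#≈0#)) (+-identityʳ 1#))

  -- (X − b)^p − X^p has zero derivative and degree below p, so it is constant.
  frobenius-shift : ∀ b x → (x + - b) ^ p + - (x ^ p) ≈ (- b) ^ p + - (0# ^ p)
  frobenius-shift b x = trans (sym (value x x (trans (+-congˡ -0#≈0#) (+-identityʳ x))))
      (trans (eval-cong const x) (trans (eval-C _ x) (trans (sym (eval-at-0 g)) (trans (value 0# 0# (-‿inverseʳ 0#)) (+-congʳ (^-congˡ p (+-identityˡ _)))))))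
    where
    f g : Poly
    f = X- b ^ᵖ p
    g = f ⊕ ⊖ (X- 0# ^ᵖ p)
    value : ∀ x y → x + - 0# ≈ y → eval g x ≈ (x + - b) ^ p + - (y ^ p)
    value x y e = trans (eval-⊕ f _ x) (+-cong (trans (eval-^ (X- b) p x) (^-congˡ p (eval-X- b x)))
      (trans (eval-⊖ _ x) (-‿cong (trans (eval-^ (X- 0#) p x) (^-congˡ p (trans (eval-X- 0# x) e))))))
    D0 : ∀ c n → n ×ₙ 1# ≈ 0# → D (X- c ^ᵖ n) ≋ []
    D0 c zero e = D-C 1#
    D0 c (suc n) e = ≋-trans (D-^ (X- c) n) (≋-trans (⊗-cong (≋-trans (⊗-cong (≋-trans (C-cong e) C-0) ≋-refl) (P.zeroˡ _)) ≋-refl) (P.zeroˡ _))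
    low : ∀ c i → suc i < p → coeff (X- c ^ᵖ p) (suc i) ≈ 0#
    low c i h = integral (trans (sym (coeff-D (X- c ^ᵖ p) i)) (at (D0 c p char) i)) (×≉0 (s≤s z≤n) h)
    difference : ∀ {u v w} i → coeff f i ≈ u → coeff (X- 0# ^ᵖ p) i ≈ v → u + - v ≈ w → coeff g i ≈ w
    difference i e e′ e″ = trans (coeff-⊕ f _ i) (trans (+-cong e (trans (coeff-⊖ _ i) (-‿cong e′))) e″)
    high : ∀ i → Dec (i < p) → coeff g i ≈ coeff (C (coeff g 0)) i
    high zero _ = sym (coeff-C-0 _)
    high (suc i) (yes h) = trans (difference (suc i) (low b i h) (low 0# i h) (-‿inverseʳ 0#)) (sym (coeff-C-suc _ i))
    high (suc i) (no ¬h) with N.m≤n⇒m<n∨m≡n (N.≮⇒≥ ¬h)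
    ... | inj₁ p<i = trans (difference (suc i) (above (deg-^ (deg-X- b) p) (suc i) (le p<i)) (above (deg-^ (deg-X- 0#) p) (suc i) (le p<i)) (-‿inverseʳ 0#)) (sym (coeff-C-suc _ i))
      where
      le : p < suc i → suc (p N.* 1) ≤ suc i
      le h = ≡.subst (λ n → suc n ≤ suc i) (≡.sym (N.*-identityʳ p)) h
    ... | inj₂ p≡i = trans (difference (suc i) (≡.subst (λ n → coeff f n ≈ 1#) p≡i (monic b p)) (≡.subst (λ n → coeff (X- 0# ^ᵖ p) n ≈ 1#) p≡i (monic 0# p)) (-‿inverseʳ 1#)) (sym (coeff-C-suc _ i))
    const : g ≋ C (coeff g 0)
    const = mk≋ λ i → high i (i N.<? p)

  0^p : 0# ^ p ≈ 0#
  0^p = go p p>0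
    where
    go : ∀ n → 0 < n → 0# ^ n ≈ 0#
    go (suc n) _ = zeroˡ _

  1^ : ∀ n → 1# ^ n ≈ 1#
  1^ zero = refl
  1^ (suc n) = trans (*-identityˡ _) (1^ n)

  -- Induction over the multiples of 1, which exhaust the field, with `frobenius-shift` for b = -1
  -- as the step.
  fermat : ∀ x → x ^ p ≈ x
  fermat x with generated x
  ... | n , e = trans (^-congˡ p (sym e)) (trans (go n) e)
    where
    open Reasoning setoid
    go : ∀ n → (n ×ₙ 1#) ^ p ≈ n ×ₙ 1#
    go zero = 0^p
    go (suc n) = begin
      (1# + y) ^ p ≈⟨ ^-congˡ p (S.solve 2 (λ o y → o S.:+ y S.:= y S.:+ S.:- (S.:- o)) refl 1# y) ⟩
      (y + - (- 1#)) ^ p ≈⟨ S.solve 2 (λ a b → a S.:= (a S.:+ S.:- b) S.:+ b) refl _ (y ^ p) ⟩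
      (y + - (- 1#)) ^ p + - (y ^ p) + y ^ p ≈⟨ +-cong (frobenius-shift (- 1#) y) (go n) ⟩
      (- (- 1#)) ^ p + - (0# ^ p) + y ≈⟨ +-congʳ (+-cong (trans (^-congˡ p (S.solve 1 (λ o → S.:- (S.:- o) S.:= o) refl 1#)) (1^ p)) (trans (-‿cong 0^p) -0#≈0#)) ⟩
      1# + 0# + y ≈⟨ +-congʳ (+-identityʳ 1#) ⟩
      1# + y ∎
      where y = n ×ₙ 1#

-- Stepanov's method

module KernelTheory {p : ℕ} (F : PrimeField p) where
  open FieldTheory F
  open Sum commutativeRing
  open FinSum +-commutativeMonoid using (sum; sum-remove; sum-cong-≋)
  open SemiringSum semiring using (*-distribʳ-sum)
  open FinSum +-commutativeMonoid using (∑-distrib-+)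

  Solution : (n : ℕ) → List (Fin n → Carrier) → Set
  Solution n φs = Σ (Fin n → Carrier) λ c → (∃[ i ] c i ≉ 0#) × All (λ φ → sum (λ i → c i * φ i) ≈ 0#) φs

  Solutionℕ : (n : ℕ) → List (ℕ → Carrier) → Set
  Solutionℕ n φs = Σ (ℕ → Carrier) λ c → (∃[ i ] (i < n × c i ≉ 0#)) × All (λ φ → ∑ n (λ i → c i * φ i) ≈ 0#) φs

  -- Gaussian elimination: a functional with a nonzero entry `i₀` eliminates that unknown from the
  -- remaining functionals, while a zero functional imposes nothing.
  kernel-Fin : ∀ E {n} (φs : List (Fin n → Carrier)) → length φs ≡ E → E < n → Solution n φs
  kernel-Fin E {suc n} [] _ _ = (λ _ → 1#) , (zero , 1≉0) , []
  kernel-Fin (suc E) {suc n} (φ ∷ φs) l (s≤s h) with Fin.any? (λ i → ¬? (φ i ≟ 0#))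
  ... | no none with kernel-Fin E φs (N.suc-injective l) (N.m<n⇒m<1+n h)
  ... | c , nz , zs = c , nz , sum0 ∷ zs
    where
    vanish : ∀ i → c i * φ i ≈ 0#
    vanish i = trans (*-congˡ (decidable-stable (φ i ≟ 0#) (λ e → none (i , e)))) (zeroʳ _)
    all0 : ∀ {m} (t : Fin m → Carrier) → (∀ i → t i ≈ 0#) → sum t ≈ 0#
    all0 {zero} t z = refl
    all0 {suc m} t z = trans (+-cong (z zero) (all0 (λ i → t (suc i)) (λ i → z (suc i)))) (+-identityʳ 0#)
    sum0 : sum (λ i → c i * φ i) ≈ 0#
    sum0 = all0 _ vanish
  kernel-Fin (suc E) {suc n} (φ ∷ φs) l (s≤s h) | yes (i₀ , piv) = eliminate (kernel-Fin E (List.map elim φs) (≡.trans (length-map elim φs) (N.suc-injective l)) h)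
    where
    open import Data.List.Relation.Unary.All.Properties using (map⁻)
    a : Carrier
    a = φ i₀
    elim : (Fin (suc n) → Carrier) → Fin n → Carrier
    elim ψ i = a * ψ (punchIn i₀ i) + - (φ (punchIn i₀ i) * ψ i₀)
    eliminate : Solution n (List.map elim φs) → Solution (suc n) (φ ∷ φs)
    eliminate (c , (j , nz) , zs) = c′ , (punchIn i₀ j , λ e → *-≉0 nz piv (trans (sym (reflexive (insertAt-punchIn c₁ i₀ α j))) e)) ,
      trans (value φ) vanishφ ∷ All.map (λ {ψ} z → trans (value ψ) (trans (rearr ψ) z)) (map⁻ zs)
      where
      open Reasoning setoid
      α : Carrier
      α = - sum (λ i → c i * φ (punchIn i₀ i))
      c₁ : Fin n → Carrier
      c₁ i = c i * a
      c′ : Fin (suc n) → Carrier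
      c′ = insertAt c₁ i₀ α
      value : ∀ ψ → sum (λ i → c′ i * ψ i) ≈ α * ψ i₀ + sum (λ i → c₁ i * ψ (punchIn i₀ i))
      value ψ = trans (sum-remove {i = i₀} (λ i → c′ i * ψ i)) (+-cong (*-congʳ (reflexive (insertAt-lookup c₁ i₀ α)))
        (sum-cong-≋ (λ i → *-congʳ (reflexive (insertAt-punchIn c₁ i₀ α i)))))
      vanishφ : α * φ i₀ + sum (λ i → c₁ i * φ (punchIn i₀ i)) ≈ 0#
      vanishφ = begin
        α * a + sum (λ i → c₁ i * φ (punchIn i₀ i)) ≈⟨ +-congˡ (sum-cong-≋ (λ i → S.solve 3 (λ c a u → c S.:* a S.:* u S.:= (c S.:* u) S.:* a) refl (c i) a (φ (punchIn i₀ i)))) ⟩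
        α * a + sum (λ i → c i * φ (punchIn i₀ i) * a) ≈⟨ +-congˡ (sym (*-distribʳ-sum a (λ i → c i * φ (punchIn i₀ i)))) ⟩
        α * a + sum (λ i → c i * φ (punchIn i₀ i)) * a ≈⟨ sym (distribʳ a α _) ⟩
        (α + sum (λ i → c i * φ (punchIn i₀ i))) * a ≈⟨ *-congʳ (-‿inverseˡ _) ⟩
        0# * a ≈⟨ zeroˡ a ⟩
        0# ∎
      rearr : ∀ ψ → α * ψ i₀ + sum (λ i → c₁ i * ψ (punchIn i₀ i)) ≈ sum (λ i → c i * elim ψ i)
      rearr ψ = sym (begin
        sum (λ i → c i * elim ψ i)
          ≈⟨ sum-cong-≋ (λ i → S.solve 5 (λ c a u v w → c S.:* (a S.:* u S.:+ S.:- (v S.:* w)) S.:= (c S.:* v) S.:* (S.:- w) S.:+ c S.:* a S.:* u) refl (c i) a (ψ (punchIn i₀ i)) (φ (punchIn i₀ i)) (ψ i₀)) ⟩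
        sum (λ i → c i * φ (punchIn i₀ i) * (- ψ i₀) + c₁ i * ψ (punchIn i₀ i))
          ≈⟨ ∑-distrib-+ (λ i → c i * φ (punchIn i₀ i) * (- ψ i₀)) (λ i → c₁ i * ψ (punchIn i₀ i)) ⟩
        sum (λ i → c i * φ (punchIn i₀ i) * (- ψ i₀)) + sum (λ i → c₁ i * ψ (punchIn i₀ i))
          ≈⟨ +-congʳ (sym (*-distribʳ-sum (- ψ i₀) (λ i → c i * φ (punchIn i₀ i)))) ⟩
        sum (λ i → c i * φ (punchIn i₀ i)) * (- ψ i₀) + sum (λ i → c₁ i * ψ (punchIn i₀ i))
          ≈⟨ +-congʳ (S.solve 2 (λ s w → s S.:* (S.:- w) S.:= (S.:- s) S.:* w) refl _ (ψ i₀)) ⟩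
        α * ψ i₀ + sum (λ i → c₁ i * ψ (punchIn i₀ i)) ∎)

  extend : ∀ {n} → (Fin n → Carrier) → ℕ → Carrier
  extend {zero} c i = 0#
  extend {suc n} c zero = c zero
  extend {suc n} c (suc i) = extend (λ j → c (suc j)) i

  extend-toℕ : ∀ {n} (c : Fin n → Carrier) i → extend c (toℕ i) ≡ c i
  extend-toℕ c zero = ≡.refl
  extend-toℕ c (suc i) = extend-toℕ (λ j → c (suc j)) i

  ∑-Fin : ∀ n (f : ℕ → Carrier) → ∑ n f ≈ sum {n} (λ i → f (toℕ i))
  ∑-Fin zero f = refl
  ∑-Fin (suc n) f = +-congˡ (∑-Fin n (λ i → f (suc i)))

  kernel : ∀ n (φs : List (ℕ → Carrier)) → length φs < n → Solutionℕ n φs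
  kernel n φs h = fromFin (kernel-Fin (length φs) {n} (List.map (_∘ toℕ) φs) (length-map (_∘ toℕ) φs) h)
    where
    open import Data.List.Relation.Unary.All.Properties using (map⁻)
    fromFin : Solution n (List.map (_∘ toℕ) φs) → Solutionℕ n φs
    fromFin (c , (i , nz) , zs) = extend c , (toℕ i , Fin.toℕ<n i , λ e → nz (trans (reflexive (≡.sym (extend-toℕ c i))) e)) ,
      All.map (λ {φ} z → trans (∑-Fin n _) (trans (sum-cong-≋ (λ j → *-congʳ (reflexive (extend-toℕ c j)))) z)) (map⁻ zs)

open import Data.Vec using (sum)

open import Data.List.Relation.Unary.All.Properties using (map⁺; map⁻)

-- Independence of monomials in linear forms

module IndepTheory {p : ℕ} (F : PrimeField p) (M : ℕ) where
  open FieldTheory F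

  form : Carrier → Poly
  form a = C 1# ⊕ C a ⊗ X

  eval-form : ∀ a x → eval (form a) x ≈ 1# + a * x
  eval-form a x = trans (eval-⊕ _ _ x) (+-cong (eval-C 1# x) (trans (eval-⊗ _ _ x) (*-cong (eval-C a x) (eval-X x))))

  D-form : ∀ a → D (form a) ≋ C a
  D-form a = ≋-trans (D-⊕ _ _) (≋-trans (⊕-cong (D-C 1#) (≋-trans (D-C⊗ a X) (⊗-cong ≋-refl D-X)))
    (≋-trans (P.+-identityˡ _) (P.*-identityʳ _)))

  deg-form : ∀ a → Deg 2 (form a)
  deg-form a = deg-⊕ (deg-mono (s≤s z≤n) (deg-C 1#)) (deg-C⊗ a deg-X)

  U : ∀ {k} → Vec Carrier k → Poly
  U [] = C 1#
  U (a ∷ as) = form a ⊗ U as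

  omit : ∀ {k} → Vec Carrier k → Fin k → Poly
  omit (a ∷ as) zero = U as
  omit (a ∷ as) (suc i) = form a ⊗ omit as i

  U-omit : ∀ {k} (as : Vec Carrier k) i → U as ≋ form (lookup as i) ⊗ omit as i
  U-omit (a ∷ as) zero = ≋-refl
  U-omit (a ∷ as) (suc i) = ≋-trans (⊗-cong ≋-refl (U-omit as i)) (X-swap (form a) _ _)

  -- Later M = (p - 1)/d, so where no form vanishes the value of the monomial depends only on the
  -- d-th power classes of the forms.
  Mon : ∀ {k} → Vec Carrier k → Vec ℕ k → Poly
  Mon [] [] = C 1#
  Mon (a ∷ as) (c ∷ cs) = form a ^ᵖ (M N.* c) ⊗ Mon as cs

  weight : Carrier → ℕ → Poly
  weight a c = C ((M N.* c) ×ₙ 1#) ⊗ C a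

  -- U times the logarithmic derivative of Mon.
  Λ : ∀ {k} → Vec Carrier k → Vec ℕ k → Poly
  Λ [] [] = []
  Λ (a ∷ as) (c ∷ cs) = weight a c ⊗ U as ⊕ form a ⊗ Λ as cs

  Λ-omit : ∀ {k} (as : Vec Carrier k) cs i → ∃[ w ] Λ as cs ≋ weight (lookup as i) (lookup cs i) ⊗ omit as i ⊕ form (lookup as i) ⊗ w
  Λ-omit (a ∷ as) (c ∷ cs) zero = Λ as cs , ≋-refl
  Λ-omit (a ∷ as) (c ∷ cs) (suc i) = step (Λ-omit as cs i)
    where
    b = lookup as i
    step : ∃[ w ] Λ as cs ≋ weight b (lookup cs i) ⊗ omit as i ⊕ form b ⊗ w →
           ∃[ w ] weight a c ⊗ U as ⊕ form a ⊗ Λ as cs ≋ weight b (lookup cs i) ⊗ (form a ⊗ omit as i) ⊕ form b ⊗ w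
    step (w , e) = weight a c ⊗ omit as i ⊕ form a ⊗ w ,
      ≋-trans (⊕-cong (⊗-cong ≋-refl (U-omit as i)) (⊗-cong ≋-refl e))
        (P.solve 6 (λ ac fb o fa bc w → ac P.:* (fb P.:* o) P.:+ fa P.:* (bc P.:* o P.:+ fb P.:* w) P.:= bc P.:* (fa P.:* o) P.:+ fb P.:* (ac P.:* o P.:+ fa P.:* w))
          ≋-refl (weight a c) (form b) (omit as i) (form a) (weight b (lookup cs i)) w)

  u-D : ∀ a n → form a ⊗ D (form a ^ᵖ n) ≋ (C (n ×ₙ 1#) ⊗ C a) ⊗ form a ^ᵖ n
  u-D a zero = ≋-trans (⊗-cong ≋-refl (D-C 1#)) (≋-trans (P.zeroʳ _)
    (≋-sym (≋-trans (⊗-cong (≋-trans (⊗-cong C-0 ≋-refl) (P.zeroˡ _)) ≋-refl) (P.zeroˡ _))))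
  u-D a (suc n) = ≋-trans (⊗-cong ≋-refl (≋-trans (D-^ (form a) n) (⊗-cong ≋-refl (D-form a))))
    (P.solve 4 (λ f c y a → f P.:* ((c P.:* y) P.:* a) P.:= (c P.:* a) P.:* (f P.:* y)) ≋-refl (form a) (C (suc n ×ₙ 1#)) (form a ^ᵖ n) (C a))

  U-D-Mon : ∀ {k} (as : Vec Carrier k) cs → U as ⊗ D (Mon as cs) ≋ Λ as cs ⊗ Mon as cs
  U-D-Mon [] [] = ≋-trans (⊗-cong ≋-refl (D-C 1#)) (≋-trans (P.zeroʳ _) (≋-sym (P.zeroˡ _)))
  U-D-Mon (a ∷ as) (c ∷ cs) = ≋-trans (⊗-cong ≋-refl (D-⊗ y G))
    (≋-trans (P.solve 6 (λ f u dy g y dg → (f P.:* u) P.:* (dy P.:* g P.:+ y P.:* dg) P.:= (f P.:* dy) P.:* (u P.:* g) P.:+ (f P.:* y) P.:* (u P.:* dg)) ≋-refl (form a) (U as) (D y) G y (D G))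
    (≋-trans (⊕-cong (⊗-cong (u-D a (M N.* c)) ≋-refl) (⊗-cong ≋-refl (U-D-Mon as cs)))
    (P.solve 6 (λ w y u g f l → (w P.:* y) P.:* (u P.:* g) P.:+ (f P.:* y) P.:* (l P.:* g) P.:= (w P.:* u P.:+ f P.:* l) P.:* (y P.:* g)) ≋-refl (weight a c) y (U as) G (form a) (Λ as cs))))
    where
    y = form a ^ᵖ (M N.* c)
    G = Mon as cs

  -- The operator U D conjugated by the monomial: on multiples of `Mon` it acts on the cofactor
  -- alone, whose degree bound grows by k at each step.
  θ : ∀ {k} → Vec Carrier k → Vec ℕ k → Poly → Poly
  θ as cs Q = U as ⊗ D Q ⊕ Λ as cs ⊗ Q

  U-D-⊗Mon : ∀ {k} (as : Vec Carrier k) cs Q → U as ⊗ D (Q ⊗ Mon as cs) ≋ θ as cs Q ⊗ Mon as cs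
  U-D-⊗Mon as cs Q = ≋-trans (⊗-cong ≋-refl (D-⊗ Q G))
    (≋-trans (P.solve 5 (λ u dq g q dg → u P.:* (dq P.:* g P.:+ q P.:* dg) P.:= u P.:* dq P.:* g P.:+ q P.:* (u P.:* dg)) ≋-refl (U as) (D Q) G Q (D G))
    (≋-trans (⊕-cong ≋-refl (⊗-cong ≋-refl (U-D-Mon as cs)))
    (P.solve 5 (λ u dq g q l → u P.:* dq P.:* g P.:+ q P.:* (l P.:* g) P.:= (u P.:* dq P.:+ l P.:* q) P.:* g) ≋-refl (U as) (D Q) G Q (Λ as cs))))
    where G = Mon as cs

  deg-U : ∀ {k} (as : Vec Carrier k) → Deg (suc k) (U as)
  deg-U [] = deg-C 1#
  deg-U (a ∷ as) = deg-⊗ (deg-form a) (deg-U as)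

  deg-weight : ∀ a c → Deg 1 (weight a c)
  deg-weight a c = deg-C⊗ _ (deg-C a)

  deg-Λ : ∀ {k} (as : Vec Carrier k) cs → Deg k (Λ as cs)
  deg-Λ [] [] = deg-[]
  deg-Λ (a ∷ as) (c ∷ cs) = deg-⊕ (deg-⊗ (deg-weight a c) (deg-U as)) (deg-⊗ (deg-form a) (deg-Λ as cs))

  deg-θ : ∀ {k R Q} (as : Vec Carrier k) cs → Deg R Q → Deg (k N.+ R) (θ as cs Q)
  deg-θ {k} as cs d = deg-⊕ (deg-⊗ (deg-U as) (deg-D (deg-mono (N.n≤1+n _) d))) (deg-⊗ (deg-mono (N.n≤1+n k) (deg-Λ as cs)) d)

  deg-Mon : ∀ {k} (as : Vec Carrier k) cs → Deg (suc (M N.* sum cs)) (Mon as cs)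
  deg-Mon [] [] = deg-mono (s≤s z≤n) (deg-C 1#)
  deg-Mon (a ∷ as) (c ∷ cs) = deg-mono (N.≤-reflexive (lem M c (sum cs))) (deg-⊗ (deg-^ (deg-form a) (M N.* c)) (deg-Mon as cs))
    where
    lem : ∀ M c s → M N.* c N.* 1 N.+ suc (M N.* s) ≡ suc (M N.* (c N.+ s))
    lem = solve-∀

  U-≉0 : ∀ {k} (as : Vec Carrier k) x → (∀ j → 1# + lookup as j * x ≉ 0#) → eval (U as) x ≉ 0#
  U-≉0 [] x n e = 1≉0 (trans (sym (eval-C 1# x)) e)
  U-≉0 (a ∷ as) x n e = *-≉0 (λ z → n zero (trans (sym (eval-form a x)) z)) (U-≉0 as x (λ j → n (suc j))) (trans (sym (eval-⊗ _ _ x)) e)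

  omit-≉0 : ∀ {k} (as : Vec Carrier k) i x → (∀ j → j ≢ i → 1# + lookup as j * x ≉ 0#) → eval (omit as i) x ≉ 0#
  omit-≉0 (a ∷ as) zero x n = U-≉0 as x (λ j → n (suc j) (λ ()))
  omit-≉0 (a ∷ as) (suc i) x n e = *-≉0 (λ z → n zero (λ ()) (trans (sym (eval-form a x)) z))
    (omit-≉0 as i x (λ j ne → n (suc j) (λ { ≡.refl → ne ≡.refl }))) (trans (sym (eval-⊗ _ _ x)) e)

  Mon-0 : ∀ {k} (as : Vec Carrier k) cs → eval (Mon as cs) 0# ≉ 0#
  Mon-0 [] [] e = 1≉0 (trans (sym (eval-C 1# 0#)) e)
  Mon-0 (a ∷ as) (c ∷ cs) e = *-≉0 (λ z → ^-≉0 (M N.* c) 1≉0 (trans (sym (^-congˡ (M N.* c) (trans (eval-form a 0#) (trans (+-congˡ (zeroʳ a)) (+-identityʳ 1#))))) (trans (sym (eval-^ (form a) (M N.* c) 0#)) z)))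
    (Mon-0 as cs) (trans (sym (eval-⊗ _ _ 0#)) e)

  -- Exponent vectors which still differ at a coordinate after changing the order of vanishing there by less than H.
  Sep : ∀ {k} → ℕ → Vec ℕ k → Vec ℕ k → Set
  Sep H cs ds = ∃[ i ] (∀ α β → α < H → β < H → (β N.+ M N.* lookup ds i) ×ₙ 1# ≉ (α N.+ M N.* lookup cs i) ×ₙ 1#)

  record Distinct {k} (as : Vec Carrier k) : Set where
    field
      nonzero : ∀ i → lookup as i ≉ 0#
      distinct : ∀ i j → i ≢ j → lookup as i ≉ lookup as j

  open Distinct

  X-D : ∀ r n q → X- r ⊗ D (X- r ^ᵖ n ⊗ q) ≋ X- r ^ᵖ n ⊗ (C (n ×ₙ 1#) ⊗ q ⊕ X- r ⊗ D q)
  X-D r zero q = ≋-trans (⊗-cong ≋-refl (D-cong (⊗-identityˡ q))) (≋-sym (≋-trans (⊗-identityˡ _)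
    (≋-trans (⊕-cong (≋-trans (⊗-cong C-0 ≋-refl) (P.zeroˡ q)) ≋-refl) (P.+-identityˡ _))))
  X-D r (suc n) q = ≋-trans (⊗-cong ≋-refl (D-X-^ r n q)) (≋-sym (⊗-assoc (X- r) (X- r ^ᵖ n) _))

  -- This is U times the Wronskian of Q Mon(cs) and Q′ Mon(ds), with both monomials divided out. Let
  -- r = -1/a_i be the root of the form that separates the exponents, and α, β the orders of Q, Q′
  -- at r; the leading coefficient at r is a nonzero multiple of (β + M d_i) - (α + M c_i).
  wronskian : ∀ {k H Q Q′} (as : Vec Carrier k) cs ds → Distinct as → Sep H cs ds → Deg H Q → Deg H Q′ → ¬ Q ≋ [] → ¬ Q′ ≋ [] →
    ¬ Q ⊗ θ as ds Q′ ⊕ ⊖ (θ as cs Q ⊗ Q′) ≋ []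
  wronskian {k} {H} {Q} {Q′} as cs ds dist (i , sep) d d′ nz nz′ vanish = root (inverse a (nonzero dist i))
    where
    a = lookup as i
    w = omit as i
    root : ∃[ s ] a * s ≈ 1# → ⊥
    root (s , as≈1) = compare (order r d nz) (order r d′ nz′) (Λ-omit as cs i) (Λ-omit as ds i)
      where
      r = - s
      f = X- r
      1+ar : 1# + a * r ≈ 0#
      1+ar = trans (+-congʳ (sym as≈1)) (trans (S.solve 2 (λ a s → a S.:* s S.:+ a S.:* (S.:- s) S.:= a S.:* (s S.:+ S.:- s)) refl a s)
        (trans (*-congˡ (-‿inverseʳ s)) (zeroʳ a)))
      r≉0 : r ≉ 0#
      r≉0 e = 1≉0 (trans (trans (sym (+-identityʳ 1#)) (+-congˡ (sym (trans (*-congˡ e) (zeroʳ a))))) 1+ar)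
      w≉0 : eval w r ≉ 0#
      w≉0 = omit-≉0 as i r (λ j ne e → distinct dist j i ne (*-cancelˡ r≉0 (trans (*-comm r _) (trans
        (trans (S.solve 3 (λ o x y → x S.:= (o S.:+ x) S.:+ S.:- (o S.:+ y) S.:+ y) refl 1# (lookup as j * r) (a * r))
          (trans (+-congʳ (trans (+-cong e (-‿cong 1+ar)) (-‿inverseʳ 0#))) (+-identityˡ _))) (*-comm a r)))))
      form≋ : form a ≋ C a ⊗ f
      form≋ = ≋-trans (⊕-cong (≋-trans (C-cong (trans (sym as≈1) (S.solve 2 (λ a s → a S.:* s S.:= S.:- (a S.:* (S.:- s))) refl a s))) (≋-trans (C-⊖ _) (⊖-cong (C-⊗ a r)))) ≋-refl)
        (≋-trans (P.solve 3 (λ a r x → P.:- (a P.:* r) P.:+ a P.:* x P.:= a P.:* (x P.:+ P.:- r)) ≋-refl (C a) (C r) X) (⊗-cong ≋-refl (≋-sym (X-≋ r))))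
      U≋ : U as ≋ (C a ⊗ w) ⊗ f
      U≋ = ≋-trans (U-omit as i) (≋-trans (⊗-cong form≋ ≋-refl) (P.solve 3 (λ a f w → (a P.:* f) P.:* w P.:= (a P.:* w) P.:* f) ≋-refl (C a) f w))
      Ordered : Poly → Set
      Ordered Q = ∃[ α ] ∃[ q ] (α < H × Q ≋ X- r ^ᵖ α ⊗ q × eval q r ≉ 0#)
      Split : Vec ℕ k → Set
      Split cs = ∃[ v ] Λ as cs ≋ weight a (lookup cs i) ⊗ w ⊕ form a ⊗ v
      compare : Ordered Q → Ordered Q′ → Split cs → Split ds → ⊥
      compare (α , q , α<H , Q≋ , nq) (β , q′ , β<H , Q′≋ , nq′) (v , Λ≋) (v′ , Λ′≋) = sep α β α<H β<H equal
        where
        y = X- r ^ᵖ α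
        z = X- r ^ᵖ β
        nα = C (α ×ₙ 1#)
        nβ = C (β ×ₙ 1#)
        mc = C ((M N.* lookup cs i) ×ₙ 1#)
        md = C ((M N.* lookup ds i) ×ₙ 1#)
        θ≋ : ∀ n g mc v es R → R ≋ X- r ^ᵖ n ⊗ g → Λ as es ≋ (mc ⊗ C a) ⊗ w ⊕ form a ⊗ v →
          θ as es R ≋ X- r ^ᵖ n ⊗ ((C a ⊗ w) ⊗ (C (n ×ₙ 1#) ⊗ g ⊕ f ⊗ D g) ⊕ ((mc ⊗ C a) ⊗ w ⊕ (C a ⊗ f) ⊗ v) ⊗ g)
        θ≋ n g mc v es R e l = ≋-trans (⊕-cong (≋-trans (⊗-cong U≋ (D-cong e)) (≋-trans (⊗-assoc _ f _) (⊗-cong ≋-refl (X-D r n g))))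
            (⊗-cong (≋-trans l (⊕-cong ≋-refl (⊗-cong form≋ ≋-refl))) e))
          (P.solve 5 (λ aw y t l g → aw P.:* (y P.:* t) P.:+ l P.:* (y P.:* g) P.:= y P.:* (aw P.:* t P.:+ l P.:* g)) ≋-refl
            (C a ⊗ w) (X- r ^ᵖ n) (C (n ×ₙ 1#) ⊗ g ⊕ f ⊗ D g) ((mc ⊗ C a) ⊗ w ⊕ (C a ⊗ f) ⊗ v) g)
        -- B is what remains once (X - r)^(α + β) is cancelled; at r only `main` contributes, since
        -- `rest` comes with the factor X - r.
        B main rest : Poly
        B = q ⊗ ((C a ⊗ w) ⊗ (nβ ⊗ q′ ⊕ f ⊗ D q′) ⊕ ((md ⊗ C a) ⊗ w ⊕ (C a ⊗ f) ⊗ v′) ⊗ q′)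
          ⊕ ⊖ (((C a ⊗ w) ⊗ (nα ⊗ q ⊕ f ⊗ D q) ⊕ ((mc ⊗ C a) ⊗ w ⊕ (C a ⊗ f) ⊗ v) ⊗ q) ⊗ q′)
        main = (C a ⊗ w ⊗ q ⊗ q′) ⊗ ((nβ ⊕ md) ⊕ ⊖ (nα ⊕ mc))
        rest = C a ⊗ (q ⊗ (w ⊗ D q′ ⊕ v′ ⊗ q′) ⊕ ⊖ ((w ⊗ D q ⊕ v ⊗ q) ⊗ q′))
        yzB : y ⊗ (z ⊗ B) ≋ []
        yzB = ≋-trans (≋-sym (≋-trans (⊕-cong (⊗-cong Q≋ (θ≋ β q′ md v′ ds Q′ Q′≋ Λ′≋)) (⊖-cong (⊗-cong (θ≋ α q mc v cs Q Q≋ Λ≋) Q′≋)))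
          (P.solve 6 (λ y z q q′ s t → (y P.:* q) P.:* (z P.:* s) P.:+ P.:- ((y P.:* t) P.:* (z P.:* q′)) P.:= y P.:* (z P.:* (q P.:* s P.:+ P.:- (t P.:* q′)))) ≋-refl
            y z q q′ _ _))) vanish
        B≋0 : B ≋ []
        B≋0 = X-cancel^ {r} β (≋-trans (X-cancel^ {r} α (≋-trans yzB (≋-sym (P.zeroʳ y)))) (≋-sym (P.zeroʳ z)))
        B≋ : B ≋ main ⊕ f ⊗ rest
        B≋ = P.solve 13 (λ a w f q q′ dq dq′ v v′ na nb mc md →
            q P.:* ((a P.:* w) P.:* (nb P.:* q′ P.:+ f P.:* dq′) P.:+ ((md P.:* a) P.:* w P.:+ (a P.:* f) P.:* v′) P.:* q′)
              P.:+ P.:- (((a P.:* w) P.:* (na P.:* q P.:+ f P.:* dq) P.:+ ((mc P.:* a) P.:* w P.:+ (a P.:* f) P.:* v) P.:* q) P.:* q′)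
            P.:= (a P.:* w P.:* q P.:* q′) P.:* ((nb P.:+ md) P.:+ P.:- (na P.:+ mc))
              P.:+ f P.:* (a P.:* (q P.:* (w P.:* dq′ P.:+ v′ P.:* q′) P.:+ P.:- ((w P.:* dq P.:+ v P.:* q) P.:* q′))))
          ≋-refl (C a) w f q q′ (D q) (D q′) v v′ nα nβ mc md
        main0 : eval main r ≈ 0#
        main0 = trans (sym (+-identityʳ _)) (trans (+-congˡ (sym (eval-X-⊗ r rest))) (trans (sym (eval-⊕ main _ r)) (trans (sym (eval-cong B≋ r)) (eval-cong B≋0 r ⟨ trans ⟩ eval-[] r))))
          where open import Function using (_⟨_⟩_)
        factor≉0 : eval (C a ⊗ w ⊗ q ⊗ q′) r ≉ 0#
        factor≉0 e = *-≉0 (*-≉0 (*-≉0 (nonzero dist i) w≉0) nq) nq′ (trans (sym (trans (eval-⊗ _ _ r) (*-congʳ (trans (eval-⊗ _ _ r) (*-congʳ (trans (eval-⊗ _ _ r) (*-congʳ (eval-C a r)))))))) e)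
        num : ∀ m n → eval (C (m ×ₙ 1#) ⊕ C (n ×ₙ 1#)) r ≈ (m N.+ n) ×ₙ 1#
        num m n = trans (eval-⊕ _ _ r) (trans (+-cong (eval-C _ r) (eval-C _ r)) (sym (×-homo-+ 1# m n)))
        equal : (β N.+ M N.* lookup ds i) ×ₙ 1# ≈ (α N.+ M N.* lookup cs i) ×ₙ 1#
        equal = x-y≈0⇒x≈y _ _ (trans (sym (trans (eval-⊕ _ _ r) (+-cong (num β _) (trans (eval-⊖ _ r) (-‿cong (num α _))))))
          (integral (trans (sym (eval-⊗ _ _ r)) main0) factor≉0))

  Term : ℕ → Set
  Term k = Poly × Vec ℕ k

  total : ∀ {k} → Vec Carrier k → List (Term k) → Poly
  total as [] = []
  total as ((Q , cs) ∷ ts) = Q ⊗ Mon as cs ⊕ total as ts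

  -- Eliminating the head term of a vanishing combination by a Wronskian.
  module _ {k} (as : Vec Carrier k) (dist : Distinct as) where

    reduce : Term k → Term k → Term k
    reduce (Q , cs) (Q′ , ds) = Q ⊗ θ as ds Q′ ⊕ ⊖ (θ as cs Q ⊗ Q′) , ds

    -- The operator Q · U D - θ(Q) kills the head Q Mon(cs), by the rule `U-D-⊗Mon`, and acts on
    -- every other term through `reduce`.
    total-reduce : ∀ Q cs ts → total as (List.map (reduce (Q , cs)) ts) ≋ Q ⊗ (U as ⊗ D (total as ts)) ⊕ ⊖ (θ as cs Q ⊗ total as ts)
    total-reduce Q cs [] = ≋-sym (≋-trans (⊕-cong (≋-trans (⊗-cong ≋-refl (≋-trans (⊗-cong ≋-refl D-[]) (P.zeroʳ _))) (P.zeroʳ Q)) (⊖-cong (P.zeroʳ _)))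
      (⊖-inverseʳ []))
    total-reduce Q cs ((Q′ , ds) ∷ ts) = ≋-trans (⊕-cong ≋-refl (total-reduce Q cs ts))
      (≋-trans (P.solve 7 (λ q t q′ r g ud tot → (q P.:* r P.:+ P.:- (t P.:* q′)) P.:* g P.:+ (q P.:* ud P.:+ P.:- (t P.:* tot)) P.:= q P.:* (r P.:* g P.:+ ud) P.:+ P.:- (t P.:* (q′ P.:* g P.:+ tot)))
        ≋-refl Q (θ as cs Q) Q′ (θ as ds Q′) (Mon as ds) (U as ⊗ D (total as ts)) (total as ts))
      (⊕-cong (⊗-cong ≋-refl (≋-sym (≋-trans (⊗-cong ≋-refl (D-⊕ _ _)) (≋-trans (⊗-distribˡ (U as) _ _) (⊕-cong (U-D-⊗Mon as ds Q′) ≋-refl))))) ≋-refl))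

    total-zero : ∀ ts → All (λ t → proj₁ t ≋ []) ts → total as ts ≋ []
    total-zero [] [] = ≋-refl
    total-zero (t ∷ ts) (z ∷ zs) = ≋-trans (⊕-cong (≋-trans (⊗-cong z ≋-refl) (P.zeroˡ _)) (total-zero ts zs)) (P.+-identityˡ [])

    -- A reduction removes the head, costs one order of vanishing at 0 and replaces R by 2 R + k;
    -- this leads to the requirement 2^n (k + R + 1). If all reduced terms are 0, `wronskian` leaves
    -- only the head, which cannot vanish to high order at 0, where the monomial is nonzero.
    independent : ∀ n {H R h} ts → length ts ≡ n → AllPairs (λ s t → Sep H (proj₂ s) (proj₂ t)) ts → All (λ t → Deg R (proj₁ t)) ts →
      2 N.^ n N.* suc (k N.+ R) ≤ h → h ≤ H → Van 0# h (total as ts) → All (λ t → proj₁ t ≋ []) ts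
    independent n [] _ ap ds b hH v = []
    independent (suc n) {H} {R} {h} ((Q , cs) ∷ ts) len (sep ∷ ap) (dQ ∷ ds) b hH v with zero? Q
    ... | yes z = z ∷ independent n {H} ts (N.suc-injective len) ap ds (N.*-monoˡ-≤ (suc (k N.+ R)) (N.^-monoʳ-≤ 2 (N.n≤1+n n)) ⟫ b) hH
          (van-resp (≋-trans (⊕-cong (≋-trans (⊗-cong z ≋-refl) (P.zeroˡ _)) ≋-refl) (P.+-identityˡ _)) v)
    independent (suc n) {H} {R} {zero} ((Q , cs) ∷ ts) len (sep ∷ ap) (dQ ∷ ds) b hH v | no nz =
      ⊥-elim (N.<⇒≱ (N.*-mono-≤ (N.m^n>0 2 (suc n)) (s≤s (z≤n {k N.+ R}))) b)
    independent (suc n) {H} {R} {suc h} ((Q , cs) ∷ ts) len (sep ∷ ap) (dQ ∷ ds) b hH v | no nz = ⊥-elim (nz Q≋0)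
      where
      R≤h : R ≤ suc h
      R≤h = (N.m≤n+m R (suc k) ⟫ N.m≤n*m (suc (k N.+ R)) (2 N.^ suc n) {{N.m^n≢0 2 (suc n)}}) ⟫ b
      R′ : ℕ
      R′ = R N.+ (k N.+ R)
      bound : 2 N.^ n N.* suc (k N.+ R′) ≤ h
      bound = N.s≤s⁻¹ ((N.+-monoˡ-≤ (2 N.^ n N.* suc (k N.+ R′)) (N.m^n>0 2 n) ⟫ N.≤-reflexive (lem (2 N.^ n) k R)) ⟫ b)
        where
        lem : ∀ t k R → t N.+ t N.* suc (k N.+ (R N.+ (k N.+ R))) ≡ 2 N.* t N.* suc (k N.+ R)
        lem = solve-∀
      vanish : Van 0# h (total as (List.map (reduce (Q , cs)) ts))
      vanish = van-resp (≋-trans (≋-trans (⊕-cong (⊗-cong ≋-refl (≋-trans (⊗-cong ≋-refl (D-⊕ _ _)) (≋-trans (⊗-distribˡ (U as) _ _) (⊕-cong (U-D-⊗Mon as cs Q) ≋-refl)))) ≋-refl)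
          (P.solve 5 (λ q t g ud tot → q P.:* (t P.:* g P.:+ ud) P.:+ P.:- (t P.:* (q P.:* g P.:+ tot)) P.:= q P.:* ud P.:+ P.:- (t P.:* tot)) ≋-refl
            Q (θ as cs Q) (Mon as cs) (U as ⊗ D (total as ts)) (total as ts)))
          (≋-sym (total-reduce Q cs ts)))
        (van-⊕ (van-⊗ Q (van-⊗ (U as) (van-D v))) (van-⊖ (van-⊗ (θ as cs Q) (van-pred v))))
      degs : ∀ {ts} → All (λ t → Deg R (proj₁ t)) ts → All (λ t → Deg R′ (proj₁ (reduce (Q , cs) t))) ts
      degs = All.map (λ {(Q′ , ds)} d → deg-⊕ (deg-⊗ (deg-mono (N.n≤1+n R) dQ) (deg-θ as ds d))
        (deg-⊖ (deg-mono (N.≤-reflexive (N.+-comm (k N.+ R) R)) (deg-⊗ (deg-mono (N.n≤1+n _) (deg-θ as cs dQ)) d))))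
      reduced : All (λ t → proj₁ (reduce (Q , cs) t) ≋ []) ts
      reduced = map⁻ (independent n {H} (List.map (reduce (Q , cs)) ts) (≡.trans (length-map _ ts) (N.suc-injective len))
        (AP.map⁺ ap) (map⁺ (degs ds)) bound (N.n≤1+n h ⟫ hH) vanish)
      up : ∀ {Q} → Deg R Q → Deg H Q
      up = deg-mono (R≤h ⟫ hH)
      zeros : ∀ {ts} → All (λ t → Sep H cs (proj₂ t)) ts → All (λ t → Deg R (proj₁ t)) ts → All (λ t → proj₁ (reduce (Q , cs) t) ≋ []) ts → All (λ t → proj₁ t ≋ []) ts
      zeros [] [] [] = []
      zeros {(Q′ , ds) ∷ _} (s ∷ ss) (d ∷ dd) (r ∷ rs) with zero? Q′
      ... | yes z = z ∷ zeros ss dd rs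
      ... | no nz′ = ⊥-elim (wronskian as cs ds dist s (up dQ) (up d) nz nz′ r)
      Q≋0 : Q ≋ []
      Q≋0 = van-deg R≤h (van-coprime (suc h) (Mon-0 as cs) (van-resp (≋-trans (⊕-cong (⊗-comm Q (Mon as cs)) (total-zero ts (zeros sep ds reduced))) (⊕-identityʳ _)) v)) dQ

length-cartesianProductWith : ∀ {A B C : Set} (f : A → B → C) xs ys → length (cartesianProductWith f xs ys) ≡ length xs N.* length ys
length-cartesianProductWith f [] ys = ≡.refl
length-cartesianProductWith f (x ∷ xs) ys = ≡.trans (length-++ (List.map (f x) ys)) (≡.cong₂ N._+_ (length-map (f x) ys) (length-cartesianProductWith f xs ys))

-- The auxiliary polynomial

module StepanovTheory {p : ℕ} (F : PrimeField p) (M : ℕ) where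
  open FieldTheory F
  open KernelTheory F
  open IndepTheory F M
  open Sum commutativeRing
  module Σᵖ = Sum polyRing
  open Σᵖ using () renaming (∑ to ∑ᵖ)
  open Exp semiring using (^-assocʳ)

  ∑ᵖ-map : (g : Poly → Poly) → g [] ≋ [] → (∀ a b → g (a ⊕ b) ≋ g a ⊕ g b) → (∀ {a b} → a ≋ b → g a ≋ g b) →
    ∀ n f → g (∑ᵖ n f) ≋ ∑ᵖ n (λ i → g (f i))
  ∑ᵖ-map g z a c zero f = z
  ∑ᵖ-map g z a c (suc n) f = ≋-trans (a _ _) (⊕-cong ≋-refl (∑ᵖ-map g z a c n (λ i → f (suc i))))

  eval-∑ : ∀ n f x → eval (∑ᵖ n f) x ≈ ∑ n (λ i → eval (f i) x)
  eval-∑ zero f x = eval-[] x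
  eval-∑ (suc n) f x = trans (eval-⊕ _ _ x) (+-congˡ (eval-∑ n _ x))

  coeff-∑ : ∀ n f i → coeff (∑ᵖ n f) i ≈ ∑ n (λ j → coeff (f j) i)
  coeff-∑ zero f i = refl
  coeff-∑ (suc n) f i = trans (coeff-⊕ _ _ i) (+-congˡ (coeff-∑ n _ i))

  deg-∑ : ∀ {N} n {f} → (∀ i → i < n → Deg N (f i)) → Deg N (∑ᵖ n f)
  deg-∑ zero d = deg-[]
  deg-∑ (suc n) d = deg-⊕ (d 0 (s≤s z≤n)) (deg-∑ n (λ i h → d (suc i) (s≤s h)))

  -- Decodes one index below J E R into a triple (j, e, s), so that `kernel` applies to coefficients
  -- with three indices.
  flat : (E R : ℕ) .{{_ : NonZero (E N.* R)}} .{{_ : NonZero R}} → (ℕ → ℕ → ℕ → Carrier) → ℕ → Carrier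
  flat E R ψ t = ψ (t N./ (E N.* R)) ((t N.% (E N.* R)) N./ R) ((t N.% (E N.* R)) N.% R)

  block-/ : ∀ j N b .{{_ : NonZero N}} → b < N → (j N.* N N.+ b) N./ N ≡ j
  block-/ j N b h = ≡.trans (N.+-distrib-/-∣ˡ b (divides-refl j)) (≡.trans (≡.cong₂ N._+_ (N.m*n/n≡m j N) (N.m<n⇒m/n≡0 h)) (N.+-identityʳ j))

  block-% : ∀ j N b .{{_ : NonZero N}} → b < N → (j N.* N N.+ b) N.% N ≡ b
  block-% j N b h = ≡.trans (≡.cong (N._% N) (N.+-comm (j N.* N) b)) (≡.trans (N.[m+kn]%n≡m%n b j N) (N.m<n⇒m%n≡m h))

  flat-∑ : ∀ J E R .{{_ : NonZero (E N.* R)}} .{{_ : NonZero R}} (c : ℕ → Carrier) (ψ : ℕ → ℕ → ℕ → Carrier) →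
    ∑ (J N.* (E N.* R)) (λ t → c t * flat E R ψ t) ≈ ∑ J (λ j → ∑ E (λ e → ∑ R (λ s → c (j N.* (E N.* R) N.+ (e N.* R N.+ s)) * ψ j e s)))
  flat-∑ J E R c ψ = trans (∑-blocks J (E N.* R) _) (∑-cong J (λ j → trans (∑-blocks E R _)
    (∑-cong< E (λ e e<E → ∑-cong< R (λ s s<R → *-congˡ (reflexive (lem j e s e<E s<R)))))))
    where
    inner : ∀ e s → e < E → s < R → e N.* R N.+ s < E N.* R
    inner e s e<E s<R = N.<-≤-trans (N.+-monoʳ-< (e N.* R) s<R) (N.≤-reflexive (N.+-comm (e N.* R) R) ⟫ N.*-monoˡ-≤ R e<E)
    lem : ∀ j e s → e < E → s < R → flat E R ψ (j N.* (E N.* R) N.+ (e N.* R N.+ s)) ≡ ψ j e s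
    lem j e s e<E s<R rewrite block-/ j (E N.* R) (e N.* R N.+ s) (inner e s e<E s<R) | block-% j (E N.* R) (e N.* R N.+ s) (inner e s e<E s<R)
                            | block-/ e R s s<R | block-% e R s s<R = ≡.refl

  -- The variable in the shape X - 0, so that divisibility by its powers is vanishing at 0.
  Y : Poly
  Y = X- 0#

  eval-Y : ∀ x → eval Y x ≈ x
  eval-Y x = trans (eval-X- 0# x) (trans (+-congˡ -0#≈0#) (+-identityʳ x))

  D-Y^p : D (Y ^ᵖ p) ≋ []
  D-Y^p = go p char
    where
    go : ∀ n → n ×ₙ 1# ≈ 0# → D (Y ^ᵖ n) ≋ []
    go zero e = D-C 1#
    go (suc n) e = ≋-trans (D-^ Y n) (≋-trans (⊗-cong (≋-trans (⊗-cong (≋-trans (C-cong e) C-0) ≋-refl) (P.zeroˡ _)) ≋-refl) (P.zeroˡ _))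

  D-Y^pj : ∀ j → D (Y ^ᵖ (p N.* j)) ≋ []
  D-Y^pj j = ≋-trans (D-cong (≋-sym (P.^-assocʳ Y p j))) (go j)
    where
    go : ∀ j → D ((Y ^ᵖ p) ^ᵖ j) ≋ []
    go zero = D-C 1#
    go (suc j) = ≋-trans (D-⊗ (Y ^ᵖ p) _) (≋-trans (⊕-cong (≋-trans (⊗-cong D-Y^p ≋-refl) (P.zeroˡ _)) (⊗-[] _ (go j))) (P.+-identityˡ []))

  -- A polynomial in Y^q whose coefficients are determined by their residues modulo Y^q.
  peel : ∀ q n (row : ℕ → Poly) → (∀ j → j < n → Van 0# q (row j) → row j ≋ []) → ∑ᵖ n (λ j → Y ^ᵖ (q N.* j) ⊗ row j) ≋ [] → ∀ j → j < n → row j ≋ []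
  peel q (suc n) row h e = all
    where
    rest : Poly
    rest = ∑ᵖ n (λ j → Y ^ᵖ (q N.* j) ⊗ row (suc j))
    shift : ∀ j → Y ^ᵖ (q N.* suc j) ⊗ row (suc j) ≋ Y ^ᵖ q ⊗ (Y ^ᵖ (q N.* j) ⊗ row (suc j))
    shift j = ≋-trans (⊗-cong (≋-trans (P.reflexive (≡.cong (Y ^ᵖ_) (N.*-suc q j))) (P.^-homo-* Y q (q N.* j))) ≋-refl) (⊗-assoc _ _ _)
    split : row 0 ⊕ Y ^ᵖ q ⊗ rest ≋ []
    split = ≋-trans (⊕-cong (≋-sym (≋-trans (⊗-cong (P.reflexive (≡.cong (Y ^ᵖ_) (N.*-zeroʳ q))) ≋-refl) (⊗-identityˡ _)))
      (≋-sym (≋-trans (Σᵖ.∑-cong n shift) (Σᵖ.∑-*ˡ n (Y ^ᵖ q) (λ j → Y ^ᵖ (q N.* j) ⊗ row (suc j)))))) e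
    row0 : row 0 ≋ []
    row0 = h 0 (s≤s z≤n) (mkVan (⊖ rest) (≋-trans (P.solve 3 (λ r y t → r P.:= (r P.:+ y P.:* t) P.:+ y P.:* P.:- t) ≋-refl (row 0) (Y ^ᵖ q) rest)
      (≋-trans (⊕-cong split ≋-refl) (P.+-identityˡ _))))
    rest0 : rest ≋ []
    rest0 = X-cancel^ {0#} q (≋-trans (≋-trans (≋-sym (≋-trans (⊕-cong row0 ≋-refl) (P.+-identityˡ _))) split) (≋-sym (P.zeroʳ _)))
    all : ∀ j → j < suc n → row j ≋ []
    all zero _ = row0
    all (suc j) (s≤s l) = peel q n (λ j → row (suc j)) (λ j l → h (suc j) (s≤s l)) rest0 j l

  coefficients-zero : ∀ n (c : ℕ → Carrier) → ∑ᵖ n (λ s → C (c s) ⊗ Y ^ᵖ s) ≋ [] → ∀ s → s < n → c s ≈ 0#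
  coefficients-zero n c e s l = trans (sym (coeff-C-0 (c s))) (at (peel 1 n (λ s → C (c s)) (λ j _ v → van-deg N.≤-refl v (deg-C (c j)))
    (≋-trans (Σᵖ.∑-cong n (λ s → ≋-trans (⊗-cong (P.reflexive (≡.cong (Y ^ᵖ_) (N.*-identityˡ s))) ≋-refl) (⊗-comm _ _))) e) s l) 0)

  module _ {k} (as : Vec Carrier k) (dist : Distinct as) (E : ℕ → Vec ℕ k) (n J R H : ℕ) .{{_ : NonZero (n N.* R)}} .{{_ : NonZero R}}
           (sep : ∀ i j → i < j → j < n → Sep H (E i) (E j)) (small : 2 N.^ n N.* suc (k N.+ R) ≤ H) (H≤p : H ≤ p) where

    δ : Poly → Poly
    δ h = U as ⊗ D h

    δ-cong : ∀ {a b} → a ≋ b → δ a ≋ δ b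
    δ-cong e = ⊗-cong ≋-refl (D-cong e)

    δ-∑ : ∀ n f → δ (∑ᵖ n f) ≋ ∑ᵖ n (λ i → δ (f i))
    δ-∑ = ∑ᵖ-map δ (⊗-[] (U as) D-[]) (λ a b → ≋-trans (⊗-cong ≋-refl (D-⊕ a b)) (⊗-distribˡ _ _ _)) δ-cong

    iter-cong : ∀ l {a b} → a ≋ b → iter δ l a ≋ iter δ l b
    iter-cong zero e = e
    iter-cong (suc l) e = iter-cong l (δ-cong e)

    iter-∑ : ∀ l n f → iter δ l (∑ᵖ n f) ≋ ∑ᵖ n (λ i → iter δ l (f i))
    iter-∑ zero n f = ≋-refl
    iter-∑ (suc l) n f = ≋-trans (iter-cong l (δ-∑ n f)) (iter-∑ l n (λ i → δ (f i)))

    term : ℕ → Vec ℕ k → Carrier → Poly → Poly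
    term j cs a Q = C a ⊗ (Y ^ᵖ (p N.* j) ⊗ (Q ⊗ Mon as cs))

    δ-term : ∀ j cs a Q → δ (term j cs a Q) ≋ term j cs a (θ as cs Q)
    δ-term j cs a Q = ≋-trans (⊗-cong ≋-refl (≋-trans (D-C⊗ a _) (⊗-cong ≋-refl (≋-trans (D-⊗ _ _)
        (≋-trans (⊕-cong (≋-trans (⊗-cong (D-Y^pj j) ≋-refl) (P.zeroˡ _)) ≋-refl) (P.+-identityˡ _))))))
      (≋-trans (P.solve 4 (λ u a y d → u P.:* (a P.:* (y P.:* d)) P.:= a P.:* (y P.:* (u P.:* d))) ≋-refl (U as) (C a) (Y ^ᵖ (p N.* j)) (D (Q ⊗ Mon as cs)))
        (⊗-cong ≋-refl (⊗-cong ≋-refl (U-D-⊗Mon as cs Q))))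

    iter-term : ∀ l j cs a Q → iter δ l (term j cs a Q) ≋ term j cs a (iter (θ as cs) l Q)
    iter-term zero j cs a Q = ≋-refl
    iter-term (suc l) j cs a Q = ≋-trans (iter-cong l (δ-term j cs a Q)) (iter-term l j cs a (θ as cs Q))

    deg-iter : ∀ l cs {R Q} → Deg R Q → Deg (l N.* k N.+ R) (iter (θ as cs) l Q)
    deg-iter zero cs d = d
    deg-iter (suc l) cs {R} d = deg-mono (N.≤-reflexive (lem (l N.* k) k R)) (deg-iter l cs (deg-θ as cs d))
      where
      lem : ∀ a k R → a N.+ (k N.+ R) ≡ k N.+ a N.+ R
      lem = solve-∀

    deg-Y^ : ∀ j → Deg (suc j) (Y ^ᵖ j)
    deg-Y^ j = deg-mono (s≤s (N.≤-reflexive (N.*-identityʳ j))) (deg-^ (deg-X- 0#) j)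

    idx : ℕ → ℕ → ℕ → ℕ
    idx j e s = j N.* (n N.* R) N.+ (e N.* R N.+ s)

    ∑∑∑ᵖ : (ℕ → ℕ → ℕ → Poly) → Poly
    ∑∑∑ᵖ f = ∑ᵖ J (λ j → ∑ᵖ n (λ e → ∑ᵖ R (λ s → f j e s)))

    -- The factors Y^(p j) have derivative 0 and take the values of Y^j on the field. They multiply
    -- the number of free coefficients by J, while the conditions at the points only see degree j.
    Φ : (ℕ → Carrier) → Poly
    Φ c = ∑∑∑ᵖ (λ j e s → term j (E e) (c (idx j e s)) (Y ^ᵖ s))

    -- `peel` separates the powers Y^(p j): a row that vanishes to order p at 0 is zero by
    -- `independent`, because p is at least H.
    Φ-zero : ∀ c → Φ c ≋ [] → ∀ j e s → j < J → e < n → s < R → c (idx j e s) ≈ 0#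
    Φ-zero c e₀ j e s j<J e<n s<R = coefficients-zero R (λ s → c (idx j e s)) (rowP j j<J e e<n) s s<R
      where
      Pol : ℕ → ℕ → Poly
      Pol j e = ∑ᵖ R (λ s → C (c (idx j e s)) ⊗ Y ^ᵖ s)
      row : ℕ → Poly
      row j = ∑ᵖ n (λ e → Pol j e ⊗ Mon as (E e))
      regroup : Φ c ≋ ∑ᵖ J (λ j → Y ^ᵖ (p N.* j) ⊗ row j)
      regroup = Σᵖ.∑-cong J (λ j → ≋-trans (Σᵖ.∑-cong n (λ e → ≋-trans (Σᵖ.∑-cong R (λ s →
            P.solve 4 (λ a y q m → a P.:* (y P.:* (q P.:* m)) P.:= y P.:* ((a P.:* q) P.:* m)) ≋-refl (C (c (idx j e s))) (Y ^ᵖ (p N.* j)) (Y ^ᵖ s) (Mon as (E e))))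
          (≋-trans (Σᵖ.∑-*ˡ R (Y ^ᵖ (p N.* j)) (λ s → (C (c (idx j e s)) ⊗ Y ^ᵖ s) ⊗ Mon as (E e)))
            (⊗-cong ≋-refl (Σᵖ.∑-*ʳ R (Mon as (E e)) (λ s → C (c (idx j e s)) ⊗ Y ^ᵖ s))))))
        (Σᵖ.∑-*ˡ n (Y ^ᵖ (p N.* j)) (λ e → Pol j e ⊗ Mon as (E e))))
      terms : ℕ → List (Term k)
      terms j = applyUpTo (λ e → Pol j e , E e) n
      total-terms : ∀ m (g : ℕ → Term k) → total as (applyUpTo g m) ≋ ∑ᵖ m (λ e → proj₁ (g e) ⊗ Mon as (proj₂ (g e)))
      total-terms zero g = ≋-refl
      total-terms (suc m) g = ⊕-cong ≋-refl (total-terms m (λ e → g (suc e)))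
      polys-zero : ∀ j → Van 0# p (row j) → ∀ e → e < n → Pol j e ≋ []
      polys-zero j v e e<n = AllP.applyUpTo⁻ (λ e → Pol j e , E e) n (independent as dist n {H} {R} (terms j) (length-applyUpTo _ n)
          (AP.applyUpTo⁺₁ _ n (λ {i} {j} i<j j<n → sep i j i<j j<n))
          (AllP.applyUpTo⁺₂ _ n (λ e → deg-∑ R (λ s s<R → deg-C⊗ _ (deg-mono s<R (deg-Y^ s)))))
          small N.≤-refl (van-resp (≋-sym (total-terms n _)) (van-≤ (N.≤⇒≤′ H≤p) v))) e<n
      row-zero : ∀ j → j < J → Van 0# p (row j) → row j ≋ []
      row-zero j _ v = Σᵖ.∑-zero n (λ e e<n → ≋-trans (⊗-cong (polys-zero j v e e<n) ≋-refl) (P.zeroˡ _))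
      rowP : ∀ j → j < J → ∀ e → e < n → Pol j e ≋ []
      rowP j j<J = polys-zero j (mkVan [] (≋-trans (peel p J row row-zero (≋-trans (≋-sym regroup) e₀) j j<J) (≋-sym (P.zeroʳ _))))

    -- Stepanov's method: an auxiliary polynomial vanishing to order L on the points xs.
    stepanov : ∀ (κ : ℕ → Carrier) (L T : ℕ) (xs : List Carrier) → L ≤ p → (∀ e → e < n → sum (E e) ≤ T) →
      L N.* (J N.+ (L N.* k N.+ R)) < J N.* (n N.* R) → AllPairs _≉_ xs →
      All (λ x → eval (U as) x ≉ 0# × (∀ e → e < n → eval (Mon as (E e)) x ≈ κ e)) xs →
      length xs N.* L < p N.* J N.+ M N.* T
    stepanov κ L T xs L≤p ΣE≤T count distinct points = conclude (kernel (J N.* (n N.* R)) φs (≡.subst (_< J N.* (n N.* R)) (≡.sym length-φs) count))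
      where
      -- At the points, x^p = x and the monomials equal κ e, so the l-th derivative takes the values
      -- of `Ψ l`, of degree below W. Annihilating its coefficients for all l < L costs L W linear
      -- conditions, however many points there are.
      W : ℕ
      W = J N.+ (L N.* k N.+ R)
      ψ : ℕ → ℕ → ℕ → ℕ → Poly
      ψ l j e s = Y ^ᵖ j ⊗ (C (κ e) ⊗ iter (θ as (E e)) l (Y ^ᵖ s))
      φ : ℕ → ℕ → ℕ → Carrier
      φ l i = flat n R (λ j e s → coeff (ψ l j e s) i)
      φs : List (ℕ → Carrier)
      φs = cartesianProductWith φ (upTo L) (upTo W)
      length-φs : length φs ≡ L N.* W
      length-φs = ≡.trans (length-cartesianProductWith φ (upTo L) (upTo W)) (≡.cong₂ N._*_ (length-applyUpTo _ L) (length-applyUpTo _ W))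
      R≤p : R ≤ p
      R≤p = (N.m≤n+m R (suc k) ⟫ N.m≤n*m (suc (k N.+ R)) (2 N.^ n) {{N.m^n≢0 2 n}}) ⟫ small ⟫ H≤p
      degΦ : ∀ c → Deg (p N.* J N.+ M N.* T) (Φ c)
      degΦ c = deg-∑ J (λ j j<J → deg-∑ n (λ e e<n → deg-∑ R (λ s s<R → deg-C⊗ _ (deg-mono (bound j e s j<J e<n s<R)
          (deg-⊗ (deg-Y^ (p N.* j)) (deg-⊗ (deg-Y^ s) (deg-Mon as (E e))))))))
        where
        bound : ∀ j e s → j < J → e < n → s < R → p N.* j N.+ (s N.+ suc (M N.* sum (E e))) ≤ p N.* J N.+ M N.* T
        bound j e s j<J e<n s<R = N.≤-trans (N.≤-reflexive (lem (p N.* j) s (M N.* sum (E e))))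
          (N.+-mono-≤ (N.+-monoʳ-≤ (p N.* j) (s<R ⟫ R≤p) ⟫ N.≤-reflexive (≡.trans (N.+-comm (p N.* j) p) (≡.sym (N.*-suc p j))) ⟫ N.*-monoʳ-≤ p j<J)
            (N.*-monoʳ-≤ M (ΣE≤T e e<n)))
          where
          lem : ∀ a s m → a N.+ (s N.+ suc m) ≡ a N.+ suc s N.+ m
          lem = solve-∀
      conclude : Solutionℕ (J N.* (n N.* R)) φs → length xs N.* L < p N.* J N.+ M N.* T
      conclude (c , (t , t<N , ct≉0) , zs) = root-count L xs distinct (All.map vanishes points) (degΦ c) nonzeroΦ
        where
        nonzeroΦ : ¬ Φ c ≋ []
        nonzeroΦ e₀ = ct≉0 (trans (reflexive (≡.cong c decode)) (Φ-zero c e₀ (t N./ (n N.* R)) ((t N.% (n N.* R)) N./ R) ((t N.% (n N.* R)) N.% R)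
            (N.m<n*o⇒m/o<n t<N) (N.m<n*o⇒m/o<n (N.m%n<n t (n N.* R))) (N.m%n<n _ R)))
          where
          divmod : ∀ m N .{{_ : NonZero N}} → m ≡ (m N./ N) N.* N N.+ m N.% N
          divmod m N = ≡.trans (N.m≡m%n+[m/n]*n m N) (N.+-comm (m N.% N) _)
          decode : t ≡ idx (t N./ (n N.* R)) ((t N.% (n N.* R)) N./ R) ((t N.% (n N.* R)) N.% R)
          decode = ≡.trans (divmod t (n N.* R)) (≡.cong ((t N./ (n N.* R)) N.* (n N.* R) N.+_) (divmod (t N.% (n N.* R)) R))
        Ψ : ℕ → Poly
        Ψ l = ∑∑∑ᵖ (λ j e s → C (c (idx j e s)) ⊗ ψ l j e s)
        Ψ≋0 : ∀ l → l < L → Ψ l ≋ []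
        Ψ≋0 l l<L = mk≋ λ i → at-i i (N.<-≤-connex i W)
          where
          at-i : ∀ i → i < W ⊎ W ≤ i → coeff (Ψ l) i ≈ 0#
          at-i i (inj₁ i<W) = trans (trans (coeff-∑ J _ i) (∑-cong J (λ j → trans (coeff-∑ n _ i) (∑-cong n (λ e → trans (coeff-∑ R _ i)
              (∑-cong R (λ s → coeff-C⊗ _ (ψ l j e s) i)))))))
            (trans (sym (flat-∑ J n R c (λ j e s → coeff (ψ l j e s) i))) (All.lookup zs (∈-cartesianProductWith⁺ φ (∈-upTo⁺ l<L) (∈-upTo⁺ i<W))))
          at-i i (inj₂ W≤i) = above (deg-∑ J (λ j j<J → deg-∑ n (λ e e<n → deg-∑ R (λ s s<R → deg-C⊗ _
            (deg-mono (N.+-mono-≤ (N.<⇒≤ j<J) (N.+-monoˡ-≤ R (N.*-monoˡ-≤ k (N.<⇒≤ l<L))))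
              (deg-⊗ (deg-Y^ j) (deg-C⊗ (κ e) (deg-iter l (E e) (deg-mono s<R (deg-Y^ s)))))))))) i W≤i
        vanishes : ∀ {x} → eval (U as) x ≉ 0# × (∀ e → e < n → eval (Mon as (E e)) x ≈ κ e) → Van x L (Φ c)
        vanishes {x} (u≉0 , vals) = van-iter L L≤p u≉0 (λ l l<L → trans (value l) (trans (eval-cong (Ψ≋0 l l<L) x) (eval-[] x)))
          where
          x^p : ∀ j → eval (Y ^ᵖ (p N.* j)) x ≈ eval (Y ^ᵖ j) x
          x^p j = trans (eval-^ Y (p N.* j) x) (trans (^-congˡ (p N.* j) (eval-Y x)) (trans (sym (^-assocʳ x p j))
            (trans (^-congˡ j (fermat x)) (sym (trans (eval-^ Y j x) (^-congˡ j (eval-Y x)))))))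
          term-value : ∀ l j e s a → e < n → eval (iter δ l (term j (E e) a (Y ^ᵖ s))) x ≈ eval (C a ⊗ ψ l j e s) x
          term-value l j e s a e<n = trans (eval-cong (iter-term l j (E e) a (Y ^ᵖ s)) x) (trans (eval-⊗ _ _ x) (trans (*-congˡ (trans (eval-⊗ _ _ x)
            (trans (*-cong (x^p j) (trans (eval-⊗ _ _ x) (trans (*-comm _ _) (trans (*-congʳ (trans (vals e e<n) (sym (eval-C _ x)))) (sym (eval-⊗ _ _ x)))))) (sym (eval-⊗ _ _ x))))) (sym (eval-⊗ _ _ x))))
          value : ∀ l → eval (iter δ l (Φ c)) x ≈ eval (Ψ l) x
          value l = trans (eval-cong (≋-trans (iter-∑ l J _) (Σᵖ.∑-cong J (λ j → ≋-trans (iter-∑ l n _) (Σᵖ.∑-cong n (λ e → iter-∑ l R _))))) x)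
            (trans (trans (eval-∑ J _ x) (∑-cong J (λ j → trans (eval-∑ n _ x) (∑-cong< n (λ e e<n → trans (eval-∑ R _ x)
              (trans (∑-cong R (λ s → term-value l j e s _ e<n)) (sym (eval-∑ R _ x))))))))
            (trans (∑-cong J (λ j → sym (eval-∑ n _ x))) (sym (eval-∑ J _ x))))

-- With B = d 2^n (k + 2) and R = ⌊p / B⌋, the choice L = n s - c reduces the count of conditions to
-- L (s + L k) < c R. The left side is at most n (1 + n k) s² ≤ n (1 + n k) p, and p < 2 R B; so c =
-- 2 n (1 + n k) B is enough.
errorConst : (d k n : ℕ) → ℕ
errorConst d k n = 2 N.* n N.* (1 N.+ n N.* k) N.* (d N.* (2 N.^ n N.* (k N.+ 2)))

module BoundTheory {p : ℕ} (F : PrimeField p) (d M : ℕ) (dM : suc (d N.* M) ≡ p) where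
  open FieldTheory F
  open IndepTheory F M
  open StepanovTheory F M

  private
    ×-sorted : ∀ {m n} → m ≤ n → n < p → m ×ₙ 1# ≈ n ×ₙ 1# → m ≡ n
    ×-sorted {m} {n} m≤n n<p e = difference (n N.∸ m) (N.m+[n∸m]≡n m≤n)
      where
      difference : ∀ c → m N.+ c ≡ n → m ≡ n
      difference zero eq = ≡.trans (≡.sym (N.+-identityʳ m)) eq
      difference (suc c) eq = ⊥-elim (×≉0 (s≤s z≤n) (N.≤-<-trans (N.m≤n+m (suc c) m ⟫ N.≤-reflexive eq) n<p)
        (trans (S.solve 2 (λ x y → y S.:= (x S.:+ y) S.:+ S.:- x) refl (m ×ₙ 1#) (suc c ×ₙ 1#))
          (trans (+-congʳ (trans (sym (×-homo-+ 1# m (suc c))) (trans (reflexive (≡.cong (_×ₙ 1#) eq)) (sym e)))) (-‿inverseʳ _))))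

  ×-injective : ∀ {m n} → m < p → n < p → m ×ₙ 1# ≈ n ×ₙ 1# → m ≡ n
  ×-injective {m} {n} m<p n<p e with N.≤-total m n
  ... | inj₁ m≤n = ×-sorted m≤n n<p e
  ... | inj₂ n≤m = ≡.sym (×-sorted n≤m m<p (sym e))

  dM×≈-1 : (d N.* M) ×ₙ 1# ≈ - 1#
  dM×≈-1 = trans (S.solve 2 (λ o x → x S.:= (o S.:+ x) S.:+ S.:- o) refl 1# _) (trans (+-congʳ (trans (reflexive (≡.cong (_×ₙ 1#) dM)) char)) (+-identityˡ _))

  -- Since d M = −1 in the field, orders of vanishing below p / d and exponents below d do not interfere.
  residues-differ : ∀ {H c c′} α β → d N.* H ≤ p → c < d → c′ < d → c ≢ c′ → α < H → β < H → (β N.+ M N.* c′) ×ₙ 1# ≉ (α N.+ M N.* c) ×ₙ 1#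
  residues-differ {H} {c} {c′} α β dH c<d c′<d c≢c′ α<H β<H e = c≢c′ (≡.trans (≡.sym (N.m<n⇒m%n≡m {{nz}} c<d)) (≡.trans (≡.sym (mod β c)) (≡.trans (≡.cong (λ t → N._%_ t d {{nz}}) numbers) (≡.trans (mod α c′) (N.m<n⇒m%n≡m {{nz}} c′<d)))))
    where
    nz : NonZero d
    nz = N.>-nonZero (N.≤-<-trans z≤n c<d)
    mod : ∀ α c → N._%_ (d N.* α N.+ c) d {{nz}} ≡ N._%_ c d {{nz}}
    mod α c = ≡.trans (≡.cong (λ t → N._%_ t d {{nz}}) (≡.trans (N.+-comm (d N.* α) c) (≡.cong (c N.+_) (N.*-comm d α)))) (N.[m+kn]%n≡m%n c α d {{nz}})
    bound : ∀ {α c} → α < H → c < d → d N.* α N.+ c < p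
    bound {α} {c} α<H c<d = N.<-≤-trans (N.+-monoʳ-< (d N.* α) c<d) (N.≤-reflexive (≡.trans (N.+-comm (d N.* α) d) (≡.sym (N.*-suc d α))) ⟫ N.*-monoʳ-≤ d α<H ⟫ dH)
    value : ∀ β c c′ → (d N.* β N.+ c) ×ₙ 1# ≈ (d ×ₙ 1#) * ((β N.+ M N.* c′) ×ₙ 1#) + (c ×ₙ 1# + c′ ×ₙ 1#)
    value β c c′ = trans (×-homo-+ 1# (d N.* β) c) (trans (+-congʳ (×1-homo-* d β))
      (trans (S.solve 5 (λ d b c c′ o → d S.:* b S.:+ c S.:= (d S.:* b S.:+ S.:- c′) S.:+ (c S.:+ c′)) refl (d ×ₙ 1#) (β ×ₙ 1#) (c ×ₙ 1#) (c′ ×ₙ 1#) 1#)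
      (+-congʳ (sym (trans (*-congˡ (trans (×-homo-+ 1# β (M N.* c′)) (+-congˡ (×1-homo-* M c′))))
        (trans (S.solve 4 (λ d b m c → d S.:* (b S.:+ m S.:* c) S.:= d S.:* b S.:+ (d S.:* m) S.:* c) refl (d ×ₙ 1#) (β ×ₙ 1#) (M ×ₙ 1#) (c′ ×ₙ 1#))
        (+-congˡ (trans (*-congʳ (trans (sym (×1-homo-* d M)) dM×≈-1)) (trans (S.solve 2 (λ o c → (S.:- o) S.:* c S.:= S.:- (o S.:* c)) refl 1# _) (-‿cong (*-identityˡ _)))))))))))
    numbers : d N.* β N.+ c ≡ d N.* α N.+ c′
    numbers = ×-injective (bound β<H c<d) (bound α<H c′<d) (trans (value β c c′) (trans (+-cong (*-congˡ e) (+-comm _ _)) (sym (value α c′ c))))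

  -- When n separated monomials have prescribed values, at most p/n + O(p/s) points remain: take J =
  -- s and order of vanishing L = n s - c in `stepanov`. The best s is about √p.
  stepanov-√ : ∀ {k} (as : Vec Carrier k) → Distinct as → (E : ℕ → Vec ℕ k) (n T s : ℕ) (κ : ℕ → Carrier) → 0 < n →
    (∀ i j → i < j → j < n → ∃[ t ] (lookup (E i) t < d × lookup (E j) t < d × lookup (E i) t ≢ lookup (E j) t)) →
    (∀ e → e < n → sum (E e) ≤ T) → s N.* s ≤ p → errorConst d k n < s → 0 < d →
    ∀ xs → AllPairs _≉_ xs → length xs ≤ p → All (λ x → eval (U as) x ≉ 0# × (∀ e → e < n → eval (Mon as (E e)) x ≈ κ e)) xs →
    n N.* length xs N.* s ≤ p N.* s N.+ p N.* (T N.+ errorConst d k n)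
  stepanov-√ {k} as dist E n T s κ 0<n sep ΣE≤T s²≤p c<s 0<d xs distinct len≤p points = final
    where
    c A B R H L : ℕ
    c = errorConst d k n
    A = 2 N.^ n N.* (k N.+ 2)
    B = d N.* A
    1≤A : 1 ≤ A
    1≤A = N.*-mono-≤ (N.m^n>0 2 n) (s≤s z≤n ⟫ N.m≤n+m 2 k)
    instance
      B≢0 : NonZero B
      B≢0 = N.>-nonZero (N.*-mono-≤ 0<d 1≤A)
    R = p N./ B
    H = 2 N.^ n N.* suc (k N.+ R)
    L = n N.* s N.∸ c
    w : ℕ
    w = 2 N.* n N.* (1 N.+ n N.* k)
    2n≤w : 2 N.* n ≤ w
    2n≤w = N.m≤m*n (2 N.* n) (1 N.+ n N.* k)
    n≤w : n ≤ w
    n≤w = N.m≤n*m n 2 ⟫ 2n≤w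
    B≤c : B ≤ c
    B≤c = N.m≤n*m B w {{N.>-nonZero (0<n ⟫ n≤w)}}
    n≤c : n ≤ c
    n≤c = n≤w ⟫ N.m≤m*n w B
    s≤p : s ≤ p
    s≤p = N.m≤m*n s s {{N.>-nonZero (N.≤-<-trans z≤n c<s)}} ⟫ s²≤p
    B≤p : B ≤ p
    B≤p = B≤c ⟫ N.<⇒≤ c<s ⟫ s≤p
    1≤R : 1 ≤ R
    1≤R = N.≤-reflexive (≡.sym (N.n/n≡1 B)) ⟫ N./-monoˡ-≤ B B≤p
    instance
      R≢0 : NonZero R
      R≢0 = N.>-nonZero 1≤R
      nR≢0 : NonZero (n N.* R)
      nR≢0 = N.>-nonZero (N.*-mono-≤ 0<n 1≤R)
    RB≤p : R N.* B ≤ p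
    RB≤p = N.m/n*n≤m p B
    p<2RB : p < 2 N.* (R N.* B)
    p<2RB = N.<-≤-trans (N.≤-<-trans (N.≤-reflexive (N.m≡m%n+[m/n]*n p B)) (N.+-monoˡ-< (R N.* B) (N.m%n<n p B)))
      (N.+-monoˡ-≤ (R N.* B) (N.m≤n*m B R) ⟫ N.≤-reflexive (≡.cong (R N.* B N.+_) (≡.sym (N.+-identityʳ _))))
    dH≤p : d N.* H ≤ p
    dH≤p = N.*-monoʳ-≤ d (N.*-monoʳ-≤ (2 N.^ n) grow) ⟫ N.≤-reflexive (lem d (2 N.^ n) k R) ⟫ RB≤p
      where
      grow : suc (k N.+ R) ≤ (k N.+ 2) N.* R
      grow = N.+-monoˡ-≤ R (N.m≤m*n (suc k) R) ⟫ N.≤-reflexive (lem′ k R)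
        where
        lem′ : ∀ k R → suc k N.* R N.+ R ≡ (k N.+ 2) N.* R
        lem′ = solve-∀
      lem : ∀ d t k R → d N.* (t N.* ((k N.+ 2) N.* R)) ≡ R N.* (d N.* (t N.* (k N.+ 2)))
      lem = solve-∀
    H≤p : H ≤ p
    H≤p = N.m≤n*m H d {{N.>-nonZero 0<d}} ⟫ dH≤p
    n≤s : n ≤ s
    n≤s = n≤c ⟫ N.<⇒≤ c<s
    ns≤p : n N.* s ≤ p
    ns≤p = N.*-monoˡ-≤ s n≤s ⟫ s²≤p
    c≤ns : c ≤ n N.* s
    c≤ns = N.<⇒≤ c<s ⟫ N.m≤n*m s n {{N.>-nonZero 0<n}}
    L+c : L N.+ c ≡ n N.* s
    L+c = N.m∸n+n≡m c≤ns
    L≤ns : L ≤ n N.* s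
    L≤ns = N.m∸n≤m (n N.* s) c
    LW<cR : L N.* (s N.+ L N.* k) < c N.* R
    LW<cR = N.≤-<-trans (N.*-mono-≤ L≤ns (N.+-monoʳ-≤ s (N.*-monoˡ-≤ k L≤ns)) ⟫ N.≤-reflexive (lem n s k) ⟫ N.*-monoʳ-≤ (n N.* (1 N.+ n N.* k)) s²≤p)
      (N.<-≤-trans (N.*-monoʳ-< (n N.* (1 N.+ n N.* k)) {{N.>-nonZero (N.*-mono-≤ 0<n (s≤s z≤n))}} p<2RB) (N.≤-reflexive (lem′ n (1 N.+ n N.* k) R B)))
      where
      lem : ∀ n s k → (n N.* s) N.* (s N.+ n N.* s N.* k) ≡ n N.* (1 N.+ n N.* k) N.* (s N.* s)
      lem = solve-∀
      lem′ : ∀ n u R B → n N.* u N.* (2 N.* (R N.* B)) ≡ 2 N.* n N.* u N.* B N.* R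
      lem′ = solve-∀
    count : L N.* (s N.+ (L N.* k N.+ R)) < s N.* (n N.* R)
    count = N.≤-<-trans (N.≤-reflexive (lem L s k R)) (N.<-≤-trans (N.+-monoˡ-< (L N.* R) LW<cR)
      (N.≤-reflexive (≡.trans (lem′ c L R) (≡.trans (≡.cong (N._* R) L+c) (lem″ n s R)))))
      where
      lem : ∀ L s k R → L N.* (s N.+ (L N.* k N.+ R)) ≡ L N.* (s N.+ L N.* k) N.+ L N.* R
      lem = solve-∀
      lem′ : ∀ c L R → c N.* R N.+ L N.* R ≡ (L N.+ c) N.* R
      lem′ = solve-∀
      lem″ : ∀ n s R → n N.* s N.* R ≡ s N.* (n N.* R)
      lem″ = solve-∀
    M≤p : M ≤ p
    M≤p = N.m≤n*m M d {{N.>-nonZero 0<d}} ⟫ (N.n≤1+n _) ⟫ N.≤-reflexive dM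
    main : length xs N.* L < p N.* s N.+ M N.* T
    main = stepanov as dist E n s R H (λ i j i<j j<n → let (t , lt , lt′ , ne) = sep i j i<j j<n in t , λ α β → residues-differ α β dH≤p lt lt′ ne)
      N.≤-refl H≤p κ L T xs (L≤ns ⟫ ns≤p) ΣE≤T count distinct points
    final : n N.* length xs N.* s ≤ p N.* s N.+ p N.* (T N.+ c)
    final = N.≤-trans (N.≤-reflexive (≡.trans (lem n (length xs) s) (≡.trans (≡.cong (length xs N.*_) (≡.sym L+c)) (N.*-distribˡ-+ (length xs) L c))))
      (N.+-mono-≤ (N.<⇒≤ main) (N.*-monoˡ-≤ c len≤p) ⟫ (N.≤-trans (N.+-monoˡ-≤ (p N.* c) (N.+-monoʳ-≤ (p N.* s) (N.*-monoˡ-≤ T M≤p)))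
        (N.≤-reflexive (lem′ p s T c))))
      where
      lem : ∀ n x s → n N.* x N.* s ≡ x N.* (n N.* s)
      lem = solve-∀
      lem′ : ∀ p s T c → p N.* s N.+ p N.* T N.+ p N.* c ≡ p N.* s N.+ p N.* (T N.+ c)
      lem′ = solve-∀

-- Stepanov's method with an exact bound

module ExactTheory {p : ℕ} (F : PrimeField p) (M : ℕ) where
  open FieldTheory F
  open KernelTheory F
  open IndepTheory F M using (form; eval-form; D-form; deg-form)
  open StepanovTheory F M using (eval-∑; coeff-∑; deg-∑; ∑ᵖ-map; module Σᵖ)
  open Σᵖ using () renaming (∑ to ∑ᵖ)
  open Sum commutativeRing
  open Exp semiring using (^-homo-*)

  -- Subtracting a_0 times each equation from the next removes c_0 and multiplies the other c_t by
  -- a_t - a_0, which leaves a system of size n.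
  vandermonde : ∀ n (c a : ℕ → Carrier) → (∀ i j → i < j → j < n → a i ≉ a j) → (∀ l → l < n → ∑ n (λ t → c t * a t ^ l) ≈ 0#) → ∀ t → t < n → c t ≈ 0#
  vandermonde (suc n) c a dist z = λ { zero _ → head ; (suc t) (s≤s h) → tail t h }
    where
    open Reasoning setoid
    c′ : ℕ → Carrier
    c′ t = c (suc t) * (a (suc t) + - a 0)
    z′ : ∀ l → l < n → ∑ n (λ t → c′ t * a (suc t) ^ l) ≈ 0#
    z′ l h = begin
      ∑ n (λ t → c′ t * a (suc t) ^ l) ≈⟨ +-identityˡ _ ⟨
      0# + ∑ n (λ t → c′ t * a (suc t) ^ l) ≈⟨ +-congʳ (trans (*-congʳ (trans (*-congˡ (-‿inverseʳ (a 0))) (zeroʳ (c 0)))) (zeroˡ _)) ⟨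
      ∑ (suc n) (λ t → c t * (a t + - a 0) * a t ^ l)
        ≈⟨ ∑-cong (suc n) (λ t → S.solve 4 (λ c a o y → c S.:* (a S.:+ S.:- o) S.:* y S.:= c S.:* (a S.:* y) S.:+ (S.:- o) S.:* (c S.:* y)) refl (c t) (a t) (a 0) (a t ^ l)) ⟩
      ∑ (suc n) (λ t → c t * a t ^ suc l + - a 0 * (c t * a t ^ l)) ≈⟨ ∑-+ (suc n) (λ t → c t * a t ^ suc l) (λ t → - a 0 * (c t * a t ^ l)) ⟩
      ∑ (suc n) (λ t → c t * a t ^ suc l) + ∑ (suc n) (λ t → - a 0 * (c t * a t ^ l))
        ≈⟨ +-cong (z (suc l) (s≤s h)) (trans (∑-*ˡ (suc n) (- a 0) (λ t → c t * a t ^ l)) (trans (*-congˡ (z l (N.m<n⇒m<1+n h))) (zeroʳ _))) ⟩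
      0# + 0# ≈⟨ +-identityʳ 0# ⟩
      0# ∎
    tail : ∀ t → t < n → c (suc t) ≈ 0#
    tail t h = integral (trans (*-comm _ _) (vandermonde n c′ (λ t → a (suc t)) (λ i j i<j j<n → dist (suc i) (suc j) (s≤s i<j) (s≤s j<n)) z′ t h))
      (λ e → dist 0 (suc t) (s≤s z≤n) (s≤s h) (sym (x-y≈0⇒x≈y _ _ e)))
    head : c 0 ≈ 0#
    head = trans (sym (*-identityʳ (c 0))) (trans (sym (+-identityʳ _)) (trans (+-congˡ (sym (∑-zero n (λ t h → trans (*-congʳ (tail t h)) (zeroˡ _))))) (z 0 (s≤s z≤n))))

  δ : Poly → Poly
  δ h = C 1# ⊗ D h

  module _ (n : ℕ) (a c : ℕ → Carrier) where

    -- A family closed under differentiation: up to the factor m + 1, D lowers m + 1 to m and raises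
    -- l by one, so l + m is constant along the chain.
    P[_,_] : ℕ → ℕ → Poly
    P[ l , m ] = ∑ᵖ n (λ t → C (c t * a t ^ l) ⊗ form (a t) ^ᵖ m)

    D-P : ∀ l m → D P[ l , suc m ] ≋ C (suc m ×ₙ 1#) ⊗ P[ suc l , m ]
    D-P l m = ≋-trans (∑ᵖ-map D D-[] D-⊕ D-cong n _) (≋-trans (Σᵖ.∑-cong n term)
        (Σᵖ.∑-*ˡ n (C (suc m ×ₙ 1#)) (λ t → C (c t * a t ^ suc l) ⊗ form (a t) ^ᵖ m)))
      where
      term : ∀ t → D (C (c t * a t ^ l) ⊗ form (a t) ^ᵖ suc m) ≋ C (suc m ×ₙ 1#) ⊗ (C (c t * a t ^ suc l) ⊗ form (a t) ^ᵖ m)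
      term t = ≋-trans (D-C⊗ _ _) (≋-trans (⊗-cong ≋-refl (≋-trans (D-^ (form (a t)) m) (⊗-cong ≋-refl (D-form (a t)))))
        (≋-trans (P.solve 4 (λ c n y a → c P.:* ((n P.:* y) P.:* a) P.:= n P.:* ((c P.:* a) P.:* y)) ≋-refl (C (c t * a t ^ l)) (C (suc m ×ₙ 1#)) (form (a t) ^ᵖ m) (C (a t)))
        (⊗-cong ≋-refl (⊗-cong (≋-trans (≋-sym (C-⊗ _ _)) (C-cong (S.solve 3 (λ c y a → (c S.:* y) S.:* a S.:= c S.:* (a S.:* y)) refl (c t) (a t ^ l) (a t)))) ≋-refl))))

    C-cancel : ∀ {u f} → u ≉ 0# → C u ⊗ f ≋ [] → f ≋ []
    C-cancel {u} {f} nu e = mk≋ λ i → integral (trans (sym (coeff-C⊗ u f i)) (at e i)) nu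

    lower : ∀ l m → suc m < p → P[ l , suc m ] ≋ [] → P[ suc l , m ] ≋ []
    lower l m h e = C-cancel (×≉0 (s≤s z≤n) h) (≋-trans (≋-sym (D-P l m)) (≋-trans (D-cong e) D-[]))

    lower^ : ∀ i l m → i N.+ m < p → P[ l , i N.+ m ] ≋ [] → P[ i N.+ l , m ] ≋ []
    lower^ zero l m h e = e
    lower^ (suc i) l m h e = ≋-trans (P.reflexive (≡.cong (λ k → P[ k , m ]) (≡.sym (N.+-suc i l)))) (lower^ i (suc l) m (N.<⇒≤ h) (lower l (i N.+ m) h e))

    iter-δ-C : ∀ i u f → iter δ i (C u ⊗ f) ≋ C u ⊗ iter δ i f
    iter-δ-C zero u f = ≋-refl
    iter-δ-C (suc i) u f = ≋-trans (iter-cong i (≋-trans (⊗-cong ≋-refl (D-C⊗ u f)) (X-swap _ _ _))) (iter-δ-C i u (δ f))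
      where
      iter-cong : ∀ i {f g} → f ≋ g → iter δ i f ≋ iter δ i g
      iter-cong zero e = e
      iter-cong (suc i) e = iter-cong i (⊗-cong ≋-refl (D-cong e))

    iter-δ-cong : ∀ i {f g} → f ≋ g → iter δ i f ≋ iter δ i g
    iter-δ-cong zero e = e
    iter-δ-cong (suc i) e = iter-δ-cong i (⊗-cong ≋-refl (D-cong e))

    eval-P : ∀ l m x → eval P[ l , m ] x ≈ ∑ n (λ t → (c t * a t ^ l) * (1# + a t * x) ^ m)
    eval-P l m x = trans (eval-∑ n _ x) (∑-cong n (λ t → trans (eval-⊗ _ _ x) (*-cong (eval-C _ x) (trans (eval-^ _ m x) (^-congˡ m (eval-form (a t) x))))))

    -- At such a point the exponent m + M may be replaced by m, and the polynomial with exponent m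
    -- is zero. Differentiating preserves this shape, which gives one order of vanishing for every
    -- step down in m.
    vanish : ∀ x → (∀ t → t < n → (1# + a t * x) ^ M ≈ 1#) → ∀ i l m → i ≤ m → m < p → P[ l , m ] ≋ [] → eval (iter δ i P[ l , m N.+ M ]) x ≈ 0#
    vanish x h zero l m _ _ e = trans (eval-P l (m N.+ M) x) (trans (∑-cong< n (λ t t<n → *-congˡ (trans (^-homo-* _ m M) (trans (*-congˡ (h t t<n)) (*-identityʳ _)))))
      (trans (sym (eval-P l m x)) (trans (eval-cong e x) (eval-[] x))))
    vanish x h (suc i) l (suc m) (s≤s i≤m) m<p e = trans (eval-cong (≋-trans (iter-δ-cong i (≋-trans (⊗-identityˡ _) (D-P l (m N.+ M)))) (iter-δ-C i _ _)) x)
      (trans (eval-⊗ _ _ x) (trans (*-congˡ (vanish x h i (suc l) m i≤m (N.<⇒≤ m<p) (lower l m m<p e))) (zeroʳ _)))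

  -- Stepanov's method with the auxiliary polynomial Σ c_t (1 + a_t X)^(K+M), where Σ c_t (1 + a_t X)^K = 0.
  exact-bound : ∀ K (a : ℕ → Carrier) (xs : List Carrier) → (∀ i j → i < j → j < suc (suc K) → a i ≉ a j) → AllPairs _≉_ xs →
    All (λ x → ∀ t → t < suc (suc K) → (1# + a t * x) ^ M ≈ 1#) xs → 0 < M → K N.+ M < p → length xs N.* suc K < suc K N.+ M
  exact-bound K a xs dist distinct points 0<M small = conclude (kernel n φs (≡.subst (_< n) (≡.sym length-φs) N.≤-refl))
    where
    n : ℕ
    n = suc (suc K)
    φs : List (ℕ → Carrier)
    φs = map (λ i t → coeff (form (a t) ^ᵖ K) i) (upTo (suc K))
    length-φs : length φs ≡ suc K
    length-φs = ≡.trans (length-map _ (upTo (suc K))) (length-applyUpTo (λ i → i) (suc K))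
    K<p : K < p
    K<p = N.≤-<-trans (N.m≤m+n K M) small
    deg-term : ∀ u b m → Deg (suc m) (C u ⊗ form b ^ᵖ m)
    deg-term u b m = deg-C⊗ u (deg-mono (s≤s (N.≤-reflexive (N.*-identityʳ m))) (deg-^ (deg-form b) m))
    conclude : Solutionℕ n φs → length xs N.* suc K < suc K N.+ M
    conclude (c , (t , t<n , ct≉0) , zs) = root-count (suc K) xs distinct
        (All.map (λ {x} h → van-iter {C 1#} (suc K) K<p (λ e → 1≉0 (trans (sym (eval-C 1# x)) e))
          (λ i i≤K → vanish n a c x h i 0 K (N.s≤s⁻¹ i≤K) K<p base)) points)
        (deg-∑ n (λ t _ → deg-term (c t * a t ^ 0) (a t) (K N.+ M))) nonzero
      where
      zs′ : All (λ i → ∑ n (λ t → c t * coeff (form (a t) ^ᵖ K) i) ≈ 0#) (upTo (suc K))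
      zs′ = AllP.map⁻ zs
      base : P[_,_] n a c 0 K ≋ []
      base = mk≋ λ i → by i (N.<-≤-connex i (suc K))
        where
        by : ∀ i → i < suc K ⊎ suc K ≤ i → coeff (P[_,_] n a c 0 K) i ≈ 0#
        by i (inj₁ h) = trans (coeff-∑ n (λ t → C (c t * a t ^ 0) ⊗ form (a t) ^ᵖ K) i) (trans (∑-cong n (λ t → trans (coeff-C⊗ (c t * a t ^ 0) (form (a t) ^ᵖ K) i) (*-congʳ (*-identityʳ (c t)))))
          (All.lookup zs′ (∈-upTo⁺ h)))
        by i (inj₂ h) = above (deg-∑ n (λ t _ → deg-term (c t * a t ^ 0) (a t) K)) i h
      nonzero : ¬ P[_,_] n a c 0 (K N.+ M) ≋ []
      -- Were the polynomial zero, its derivatives at 0 would give Σ c_t a_t^l = 0 for all l < K +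
      -- 2, and Vandermonde would annihilate every c_t.
      nonzero e = ct≉0 (vandermonde n c a dist (λ l l<n → trans (∑-cong n (λ t → sym (trans (*-congˡ {c t * a t ^ l} (trans (^-congˡ (K N.+ M N.∸ l) (trans (+-congˡ (zeroʳ (a t))) (+-identityʳ 1#))) (1^ (K N.+ M N.∸ l)))) (*-identityʳ _))))
          (trans (sym (eval-P n a c l (K N.+ M N.∸ l) 0#)) (trans (eval-cong (at-l l l<n) 0#) (eval-[] 0#)))) t t<n)
        where
        at-l : ∀ l → l < n → P[_,_] n a c l (K N.+ M N.∸ l) ≋ []
        at-l l l<n = ≋-trans (P.reflexive (≡.cong (λ k → P[_,_] n a c k (K N.+ M N.∸ l)) (≡.sym (N.+-identityʳ l))))
          (lower^ n a c l 0 (K N.+ M N.∸ l) (≡.subst (_< p) (≡.sym eq₁) small) (≋-trans (P.reflexive (≡.cong (λ m → P[_,_] n a c 0 m) eq₁)) e))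
          where
          eq₁ : l N.+ (K N.+ M N.∸ l) ≡ K N.+ M
          eq₁ = N.m+[n∸m]≡n (N.s≤s⁻¹ l<n ⟫ N.≤-reflexive (N.+-comm 1 K) ⟫ (N.+-monoʳ-≤ K 0<M))

-- Residues modulo p and multiplicative decompositions

module IntegersModulo where
  open import Data.Integer as ℤ using (ℤ; _+_; _*_; -_; 0ℤ; 1ℤ) renaming (+_ to pos)
  import Data.Integer.Properties as ℤ
  open import Data.Integer.DivMod using (_%ℕ_; _/ℕ_; a≡a%ℕn+[a/ℕn]*n; n%ℕd<d)
  open import Data.Integer.Divisibility.Signed using (divides; ∣⇒∣ᵤ) renaming (_∣_ to _∣ₛ_; _∣?_ to _∣ₛ?_)
  open import Data.Integer.Tactic.RingSolver using () renaming (solve-∀ to solveℤ-∀)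
  open import Relation.Binary.PropositionalEquality using (refl; sym; trans; cong; cong₂; subst)

  infix 4 _≈[_]_
  record _≈[_]_ (x : ℤ) (p : ℕ) (y : ℤ) : Set where
    constructor mk≈
    field
      {quotient} : ℤ
      equation : x ≡ y + quotient * pos p

  modRing : ℕ → CommutativeRing 0ℓ 0ℓ
  modRing p = record
    { Carrier = ℤ ; _≈_ = λ x y → x ≈[ p ] y ; _+_ = _+_ ; _*_ = _*_ ; -_ = -_ ; 0# = 0ℤ ; 1# = 1ℤ
    ; isCommutativeRing = record
      { isRing = record
        { +-isAbelianGroup = record
          { isGroup = record
            { isMonoid = record
              { isSemigroup = record
                { isMagma = record
                  { isEquivalence = record
                    { refl = λ {x} → mk≈ {quotient = 0ℤ} (r x (pos p))
                    ; sym = λ { {x} {y} (mk≈ {quotient = q} refl) → mk≈ {quotient = - q} (s y q (pos p)) }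
                    ; trans = λ { {x} {y} {z} (mk≈ {quotient = q} refl) (mk≈ {quotient = q′} refl) → mk≈ {quotient = q′ + q} (t z q q′ (pos p)) } }
                  ; ∙-cong = λ { {x} {y} {u} {v} (mk≈ {quotient = q} refl) (mk≈ {quotient = q′} refl) → mk≈ {quotient = q + q′} (a y v q q′ (pos p)) } }
                ; assoc = λ x y z → lift (ℤ.+-assoc x y z) }
              ; identity = (λ x → lift (ℤ.+-identityˡ x)) , (λ x → lift (ℤ.+-identityʳ x)) }
            ; inverse = (λ x → lift (ℤ.+-inverseˡ x)) , (λ x → lift (ℤ.+-inverseʳ x))
            ; ⁻¹-cong = λ { {x} {y} (mk≈ {quotient = q} refl) → mk≈ {quotient = - q} (n y q (pos p)) } }
          ; comm = λ x y → lift (ℤ.+-comm x y) }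
        ; *-cong = λ { {x} {y} {u} {v} (mk≈ {quotient = q} refl) (mk≈ {quotient = q′} refl) → mk≈ {quotient = y * q′ + q * v + q * q′ * pos p} (m y v q q′ (pos p)) }
        ; *-assoc = λ x y z → lift (ℤ.*-assoc x y z)
        ; *-identity = (λ x → lift (ℤ.*-identityˡ x)) , (λ x → lift (ℤ.*-identityʳ x))
        ; distrib = (λ x y z → lift (ℤ.*-distribˡ-+ x y z)) , (λ x y z → lift (ℤ.*-distribʳ-+ x y z)) }
      ; *-comm = λ x y → lift (ℤ.*-comm x y) } }
    where
    r : ∀ x p → x ≡ x + 0ℤ * p
    r = solveℤ-∀
    s : ∀ y q p → y ≡ y + q * p + - q * p
    s = solveℤ-∀
    t : ∀ z q q′ p → z + q′ * p + q * p ≡ z + (q′ + q) * p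
    t = solveℤ-∀
    a : ∀ y v q q′ p → (y + q * p) + (v + q′ * p) ≡ y + v + (q + q′) * p
    a = solveℤ-∀
    n : ∀ y q p → - (y + q * p) ≡ - y + - q * p
    n = solveℤ-∀
    m : ∀ y v q q′ p → (y + q * p) * (v + q′ * p) ≡ y * v + (y * q′ + q * v + q * q′ * p) * p
    m = solveℤ-∀
    lift : ∀ {x y} → x ≡ y → x ≈[ p ] y
    lift {x} refl = mk≈ {quotient = 0ℤ} (r x (pos p))

  pos-≈⇒∣ : ∀ {p} n → pos n ≈[ p ] 0ℤ → p ∣ n
  pos-≈⇒∣ {p} n (mk≈ {quotient = q} e) = ∣⇒∣ᵤ (divides q (trans e (ℤ.+-identityˡ (q * pos p))))

  ∣⇒pos-≈ : ∀ {p n} → p ∣ n → pos n ≈[ p ] 0ℤ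
  ∣⇒pos-≈ {p} (divides q refl) = mk≈ {quotient = pos q} (trans (ℤ.pos-* q p) (sym (ℤ.+-identityˡ _)))

  private
    residue-sorted : ∀ {p a b} → a < p → b N.≤ a → pos a ≈[ p ] pos b → a ≡ b
    residue-sorted {p} {a} {b} a<p b≤a (mk≈ {quotient = q} e) = trans (sym (N.m+[n∸m]≡n b≤a)) (trans (cong (b N.+_) (zero-or (a N.∸ b) refl)) (N.+-identityʳ b))
      where
      difference : pos (a N.∸ b) ≡ q * pos p
      difference = GroupProps.∙-cancelˡ (CommutativeRing.+-group ℤ.+-*-commutativeRing) (pos b) _ _ (trans (sym (ℤ.pos-+ b _)) (trans (cong pos (N.m+[n∸m]≡n b≤a)) e))
      zero-or : ∀ c → c ≡ a N.∸ b → c ≡ 0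
      zero-or zero _ = refl
      zero-or (suc c) eq = ⊥-elim (N.<⇒≱ (N.≤-<-trans (N.≤-reflexive eq ⟫ N.m∸n≤m a b) a<p)
        (∣⇒≤ (∣⇒∣ᵤ (divides q (trans (cong pos eq) difference)))))

  residue-unique : ∀ {p a b} → a < p → b < p → pos a ≈[ p ] pos b → a ≡ b
  residue-unique {p} {a} {b} a<p b<p e with N.≤-total b a
  ... | inj₁ b≤a = residue-sorted a<p b≤a e
  ... | inj₂ a≤b = sym (residue-sorted b<p a≤b (CommutativeRing.sym (modRing p) e))

  module _ {p} (p-prime : Prime p) where
    private
      instance
        p≢0 : NonZero p
        p≢0 = prime⇒nonZero p-prime

    open CommutativeRing (modRing p) using (_≈_; semiring) renaming (refl to ≈-refl; trans to ≈-trans; sym to ≈-sym; *-congʳ to ≈-*-congʳ; reflexive to ≈-reflexive)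
    open Mult semiring using () renaming (_×_ to _×ₙ_)

    1<p : 1 < p
    1<p = N.nonTrivial⇒n>1 p {{prime⇒nonTrivial p-prime}}

    residue : ∀ x → x ≈ pos (x %ℕ p)
    residue x = mk≈ {quotient = x /ℕ p} (a≡a%ℕn+[a/ℕn]*n x p)

    ×-pos : ∀ n → n ×ₙ 1ℤ ≡ pos n
    ×-pos zero = refl
    ×-pos (suc n) = cong (λ z → 1ℤ + z) (×-pos n)

    inverse-residue : ∀ r → 0 < r → r < p → ∃[ y ] (pos r * y ≈ 1ℤ)
    inverse-residue (suc r) _ r<p with coprime-Bézout (prime⇒coprime p-prime r<p)
    ... | Bézout.+- x y e = - pos y , mk≈ {quotient = - pos x} (lem (pos (suc r)) (pos x) (pos y) (pos p)
            (trans (sym (trans (ℤ.pos-+ 1 _) (cong (λ z → 1ℤ + z) (ℤ.pos-* y (suc r))))) (trans (cong pos e) (ℤ.pos-* x p))))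
      where
      lem₁ : ∀ r y → r * - y ≡ 1ℤ + - (1ℤ + y * r)
      lem₁ = solveℤ-∀
      lem₂ : ∀ x p → 1ℤ + - (x * p) ≡ 1ℤ + - x * p
      lem₂ = solveℤ-∀
      lem : ∀ r x y p → 1ℤ + y * r ≡ x * p → r * - y ≡ 1ℤ + - x * p
      lem r x y p e = trans (lem₁ r y) (trans (cong (λ z → 1ℤ + - z) e) (lem₂ x p))
    ... | Bézout.-+ x y e = pos y , mk≈ {quotient = pos x} (trans (ℤ.*-comm (pos (suc r)) (pos y)) (trans (sym (ℤ.pos-* y (suc r))) (trans (cong pos (sym e)) (trans (ℤ.pos-+ 1 _) (cong (λ z → 1ℤ + z) (ℤ.pos-* x p))))))

    primeField : PrimeField p
    primeField = record
      { commutativeRing = modRing p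
      ; _≟_ = λ x y → map′ (λ e → ≈-trans (residue x) (≈-trans (≈-reflexive (cong pos e)) (≈-sym (residue y))))
          (λ e → residue-unique (n%ℕd<d x p) (n%ℕd<d y p) (≈-trans (≈-sym (residue x)) (≈-trans e (residue y)))) ((x %ℕ p) N.≟ (y %ℕ p))
      ; inverse = inverse
      ; 1≉0 = λ e → N.<⇒≢ (s≤s z≤n) (residue-unique (N.<-trans (s≤s z≤n) 1<p) 1<p (≈-sym e))
      ; char = ≈-trans (≈-reflexive (×-pos p)) (∣⇒pos-≈ ∣-refl)
      ; char-∣ = λ n e → pos-≈⇒∣ n (≈-trans (≈-reflexive (sym (×-pos n))) e)
      ; generated = λ x → x %ℕ p , ≈-trans (≈-reflexive (×-pos _)) (≈-sym (residue x))
      ; p>0 = N.<-trans (s≤s z≤n) 1<p }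
      where
      inverse : ∀ x → ¬ x ≈ 0ℤ → ∃[ y ] x * y ≈ 1ℤ
      inverse x x≉0 = found (inverse-residue (x %ℕ p) (N.n≢0⇒n>0 (λ e → x≉0 (≈-trans (residue x) (≈-reflexive (cong pos e))))) (n%ℕd<d x p))
        where
        found : ∃[ y ] (pos (x %ℕ p) * y ≈ 1ℤ) → ∃[ y ] x * y ≈ 1ℤ
        found (y , e) = y , ≈-trans (≈-*-congʳ {y} (residue x)) e

open IntegersModulo using (primeField)

open import Data.Vec.Properties using (lookup∘tabulate)

-- Residue patterns of several forms and their collisions

patternConstant : ℕ → ℕ → ℕ
patternConstant d k = k N.* d N.+ errorConst d k (d N.^ k)

collisionConstant₂ collisionConstant₄ : ℕ → ℕ
collisionConstant₂ d = d N.* (1 N.+ (d N.∸ 1 N.+ 0)) N.+ errorConst d 2 d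
collisionConstant₄ d = d N.* (1 N.+ (1 N.+ (d N.∸ 1 N.+ (d N.∸ 1 N.+ 0)))) N.+ errorConst d 4 d

module ResiduePatterns {p : ℕ} (F : PrimeField p) (d M : ℕ) (dM : suc (d N.* M) ≡ p) (0<d : 0 < d) (0<M : 0 < M) where
  open FieldTheory F
  open IndepTheory F M
  open BoundTheory F d M dM
  open StepanovTheory F M using (Y; eval-Y)
  open Exp semiring using (^-assocʳ; ^-homo-*)
  open CExp commutativeSemiring using (^-distrib-*)

  elems : List Carrier
  elems = applyUpTo (_×ₙ 1#) p

  length-elems : length elems ≡ p
  length-elems = length-applyUpTo _ p

  elems-distinct : AllPairs _≉_ elems
  elems-distinct = AP.applyUpTo⁺₁ _ p (λ i<j j<p e → N.<⇒≢ i<j (×-injective (N.<-trans i<j j<p) j<p e))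

  reduced : ∀ n → ∃[ r ] (r < p × n ×ₙ 1# ≈ r ×ₙ 1#)
  reduced zero = 0 , p>0 , refl
  reduced (suc n) with reduced n
  ... | r , r<p , e with suc r N.<? p
  ... | yes h = suc r , h , +-congˡ e
  ... | no h = 0 , p>0 , trans (+-congˡ e) (trans (reflexive (≡.cong (_×ₙ 1#) (N.≤-antisym r<p (N.≮⇒≥ h)))) char)

  complete : ∀ x → Any (x ≈_) elems
  complete x with generated x
  ... | n , e with reduced n
  ... | r , r<p , e′ = AnyP.applyUpTo⁺ _ (trans (sym e) e′) r<p

  length≤ : ∀ xs ys → AllPairs _≉_ xs → All (λ x → Any (x ≈_) ys) xs → length xs ≤ length ys
  length≤ = length-≤ _≈_ sym trans

  length≤p : ∀ xs → AllPairs _≉_ xs → length xs ≤ p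
  length≤p xs ap = length≤ xs elems ap (All.universal complete xs) ⟫ N.≤-reflexive length-elems

  power-roots : ∀ n z xs → 0 < n → AllPairs _≉_ xs → All (λ x → x ^ n ≈ z) xs → length xs ≤ n
  power-roots n z xs 0<n ap h = N.s≤s⁻¹ (≡.subst (_< suc n) (N.*-identityʳ (length xs)) (root-count 1 xs ap (All.map root h) degree nonzero))
    where
    f : Poly
    f = Y ^ᵖ n ⊕ ⊖ C z
    degree : Deg (suc n) f
    degree = deg-⊕ (deg-mono (s≤s (N.≤-reflexive (N.*-identityʳ n))) (deg-^ (deg-X- 0#) n)) (deg-⊖ (deg-mono (s≤s z≤n) (deg-C z)))
    top : ∀ n → 0 < n → coeff (⊖ C z) n ≈ 0#
    top (suc n) _ = trans (coeff-⊖ _ _) (trans (-‿cong (coeff-C-suc z n)) -0#≈0#)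
    nonzero : ¬ f ≋ []
    nonzero e = 1≉0 (trans (sym (trans (coeff-⊕ (Y ^ᵖ n) (⊖ C z) n) (trans (+-cong (monic 0# n) (top n 0<n)) (+-identityʳ 1#)))) (at e n))
    root : ∀ {x} → x ^ n ≈ z → Van x 1 f
    root {x} e = divided (factor {f} {x} (trans (eval-⊕ _ _ x) (trans (+-cong (trans (eval-^ Y n x) (trans (^-congˡ n (eval-Y x)) e)) (trans (eval-⊖ _ x) (-‿cong (eval-C z x)))) (-‿inverseʳ z))))
      where
      divided : ∃[ g ] f ≋ X- x ⊗ g → Van x 1 f
      divided (g , e) = mkVan g (≋-trans e (⊗-cong (≋-sym (P.*-identityʳ (X- x))) ≋-refl))

  Σ-single : ∀ v zs → AllPairs _≉_ zs → Σ[ zs ] (λ z → ⟦ v ≟ z ⟧) ≤ 1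
  Σ-single v [] _ = z≤n
  Σ-single v (z ∷ zs) (n ∷ ap) with v ≟ z
  ... | yes e = s≤s (Σ-mono zs (All.map (λ {y} ne → N.≤-reflexive (⟦⟧-no (v ≟ y) (λ e′ → ne (trans (sym e) e′)))) n) ⟫ N.≤-reflexive (≡.trans (Σ-const 0 zs) (N.*-zeroʳ (length zs))))
  ... | no _ = Σ-single v zs ap

  Σ-any : ∀ v zs → Any (v ≈_) zs → 1 ≤ Σ[ zs ] (λ z → ⟦ v ≟ z ⟧)
  Σ-any v (z ∷ zs) (here e) = N.≤-reflexive (≡.sym (⟦⟧-yes (v ≟ z) e)) ⟫ (N.m≤m+n _ _)
  Σ-any v (z ∷ zs) (there m) = Σ-any v zs m ⟫ (N.m≤n+m _ ⟦ v ≟ z ⟧)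

  any-filter : ∀ {Q : Carrier → Set} (Q? : ∀ x → Dec (Q x)) {v} ys → (∀ {y} → v ≈ y → Q y) → Any (v ≈_) ys → Any (v ≈_) (filter Q? ys)
  any-filter Q? (y ∷ ys) f (here e) with Q? y
  ... | yes _ = here e
  ... | no n = ⊥-elim (n (f e))
  any-filter Q? (y ∷ ys) f (there m) with Q? y
  ... | yes _ = there (any-filter Q? ys f m)
  ... | no _ = any-filter Q? ys f m

  zero^ : ∀ {x} n → 0 < n → x ≈ 0# → x ^ n ≈ 0#
  zero^ (suc n) _ e = trans (*-congʳ e) (zeroˡ _)

  unit-power : ∀ {x} → x ≉ 0# → x ^ (d N.* M) ≈ 1#
  unit-power {x} nx = *-cancelˡ nx (trans (trans (reflexive (≡.cong (x ^_) dM)) (fermat x)) (sym (*-identityʳ x)))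

  unit-power′ : ∀ {x} → x ≉ 0# → (x ^ M) ^ d ≈ 1#
  unit-power′ {x} nx = trans (^-assocʳ x M d) (trans (reflexive (≡.cong (x ^_) (N.*-comm M d))) (unit-power nx))

  u : Carrier → Carrier → Carrier
  u a x = 1# + a * x

  val : ∀ {k} → Vec Carrier k → Vec ℕ k → Carrier
  val [] [] = 1#
  val (e ∷ es) (c ∷ cs) = e ^ c * val es cs

  Mon-value : ∀ {k} (as es : Vec Carrier k) cs x → (∀ i → u (lookup as i) x ^ M ≈ lookup es i) → eval (Mon as cs) x ≈ val es cs
  Mon-value [] [] [] x h = eval-C 1# x
  Mon-value (a ∷ as) (e ∷ es) (c ∷ cs) x h = trans (eval-⊗ _ _ x) (*-cong (trans (eval-^ (form a) (M N.* c) x) (trans (^-congˡ (M N.* c) (eval-form a x))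
    (trans (sym (^-assocʳ (u a x) M c)) (^-congˡ c (h zero))))) (Mon-value as es cs x (λ i → h (suc i))))

  Mon-scale : ∀ {k} (as : Vec Carrier k) g e x → eval (Mon as (Vec.map (e N.*_) g)) x ≈ eval (Mon as g) x ^ e
  Mon-scale [] [] e x = trans (eval-C 1# x) (sym (trans (^-congˡ e (eval-C 1# x)) (1^ e)))
  Mon-scale (a ∷ as) (c ∷ g) e x = trans (eval-⊗ _ _ x) (trans (*-cong (trans (eval-^ (form a) (M N.* (e N.* c)) x) (trans (reflexive (≡.cong (eval (form a) x ^_) (lem M e c)))
      (trans (sym (^-assocʳ _ (M N.* c) e)) (^-congˡ e (sym (eval-^ (form a) (M N.* c) x)))))) (Mon-scale as g e x))
    (trans (sym (^-distrib-* _ _ e)) (^-congˡ e (sym (eval-⊗ _ _ x)))))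
    where
    lem : ∀ M e c → M N.* (e N.* c) ≡ M N.* c N.* e
    lem = solve-∀

  instance
    d≢0 : NonZero d
    d≢0 = N.>-nonZero 0<d

  Good : ℕ → (ℕ → Carrier) → Set
  Good n a = (∀ i → i < n → a i ≉ 0#) × (∀ i j → i < n → j < n → i ≢ j → a i ≉ a j)

  vec : ∀ k → (ℕ → Carrier) → Vec Carrier k
  vec k a = tabulate (λ i → a (toℕ i))

  vec-distinct : ∀ {k a} → Good k a → Distinct (vec k a)
  vec-distinct {k} {a} (nz , ne) = record
    { nonzero = λ i e → nz (toℕ i) (Fin.toℕ<n i) (trans (reflexive (≡.sym (lookup∘tabulate _ i))) e)
    ; distinct = λ i j i≢j e → ne (toℕ i) (toℕ j) (Fin.toℕ<n i) (Fin.toℕ<n j) (λ q → i≢j (Fin.toℕ-injective q))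
        (trans (reflexive (≡.sym (lookup∘tabulate _ i))) (trans e (reflexive (lookup∘tabulate _ j)))) }

  patternConst : ℕ → ℕ
  patternConst = patternConstant d

  -- Prescribing the classes of k forms fixes all d^k monomials with exponents below d, hence the
  -- density d^(-k).
  pattern-bound : ∀ k a (ε : ℕ → Carrier) s → Good k a → (∀ i → i < k → ε i ≉ 0#) → s N.* s ≤ p → patternConst k < s →
    ∀ xs → AllPairs _≉_ xs → All (λ x → ∀ i → i < k → u (a i) x ^ M ≈ ε i) xs →
    d N.^ k N.* length xs N.* s ≤ p N.* s N.+ p N.* patternConst k
  pattern-bound k a ε s good εnz s²≤p c<s xs ap h = stepanov-√ (vec k a) (vec-distinct good) (digits d k) (d N.^ k) (k N.* d) s (λ e → val (vec k ε) (digits d k e))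
      (N.m^n>0 d k) (λ i j i<j j< → let (t , ne) = digits-distinct d k (N.<⇒≢ i<j) (N.<-trans i<j j<) j< in t , digits-< d k i t , digits-< d k j t , ne)
      (λ e _ → digits-sum d k e) s²≤p (N.≤-<-trans (N.m≤n+m _ (k N.* d)) c<s) 0<d xs ap (length≤p xs ap) (All.map point h)
    where
    point : ∀ {x} → (∀ i → i < k → u (a i) x ^ M ≈ ε i) → eval (U (vec k a)) x ≉ 0# × (∀ e → e < d N.^ k → eval (Mon (vec k a) (digits d k e)) x ≈ val (vec k ε) (digits d k e))
    point {x} h = U-≉0 (vec k a) x (λ j e → εnz (toℕ j) (Fin.toℕ<n j) (trans (sym (h (toℕ j) (Fin.toℕ<n j)))
        (zero^ M 0<M (trans (+-congˡ (*-congʳ (reflexive (≡.sym (lookup∘tabulate _ j))))) e)))) ,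
      λ e _ → Mon-value (vec k a) (vec k ε) (digits d k e) x (λ i → trans (^-congˡ M (+-congˡ (*-congʳ (reflexive (lookup∘tabulate _ i)))))
        (trans (h (toℕ i) (Fin.toℕ<n i)) (reflexive (≡.sym (lookup∘tabulate _ i)))))

  sum-scale : ∀ {k} e (g : Vec ℕ k) → sum (Vec.map (e N.*_) g) ≡ e N.* sum g
  sum-scale e [] = ≡.sym (N.*-zeroʳ e)
  sum-scale e (c ∷ g) = ≡.trans (≡.cong (e N.* c N.+_) (sum-scale e g)) (≡.sym (N.*-distribˡ-+ e c (sum g)))

  -- A single multiplicative relation fixes only the powers e = 0, ..., d - 1 of one monomial, hence
  -- the density 1/d. The leading exponent 1 keeps these powers separated in the first coordinate.
  relation-bound : ∀ {k} (as : Vec Carrier (suc k)) (g : Vec ℕ k) s → Distinct as → s N.* s ≤ p → errorConst d (suc k) d < s →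
    ∀ xs → AllPairs _≉_ xs → All (λ x → eval (U as) x ≉ 0# × eval (Mon as (1 ∷ g)) x ≈ 1#) xs →
    d N.* length xs N.* s ≤ p N.* s N.+ p N.* (d N.* sum (1 ∷ g) N.+ errorConst d (suc k) d)
  relation-bound as g s dist s²≤p c<s xs ap h = stepanov-√ as dist (λ e → Vec.map (e N.*_) (1 ∷ g)) d (d N.* sum (1 ∷ g)) s (λ _ → 1#) 0<d
    (λ i j i<j j<d → zero , ≡.subst (_< d) (≡.sym (N.*-identityʳ i)) (N.<-trans i<j j<d) , ≡.subst (_< d) (≡.sym (N.*-identityʳ j)) j<d ,
      λ e → N.<⇒≢ i<j (≡.trans (≡.sym (N.*-identityʳ i)) (≡.trans e (N.*-identityʳ j))))
    (λ e e<d → N.≤-reflexive (sum-scale e (1 ∷ g)) ⟫ N.*-monoˡ-≤ (sum (1 ∷ g)) (N.<⇒≤ e<d)) s²≤p c<s 0<d xs ap (length≤p xs ap)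
    (All.map (λ {x} (u≉0 , v) → u≉0 , λ e _ → trans (Mon-scale as (1 ∷ g) e x) (trans (^-congˡ e v) (1^ e))) h)

  -- As an exponent d - 1 serves as -1, because the M-th power of a unit is a d-th root of unity.
  d′ : ℕ
  d′ = d N.∸ 1

  suc-d′ : suc d′ ≡ d
  suc-d′ = N.m+[n∸m]≡n 0<d

  const₂ const₄ collisionConst : ℕ
  const₂ = collisionConstant₂ d
  const₄ = collisionConstant₄ d
  collisionConst = const₂ N.+ const₄

  relation₂ : ∀ b c s → b ≉ 0# → c ≉ 0# → b ≉ c → s N.* s ≤ p → collisionConst < s →
    ∀ xs → AllPairs _≉_ xs → All (λ x → u b x ≉ 0# × u c x ≉ 0# × u b x ^ M ≈ u c x ^ M) xs → d N.* length xs N.* s ≤ p N.* s N.+ p N.* collisionConst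
  relation₂ b c s b≉0 c≉0 b≉c s²≤p K<s xs ap h = N.≤-trans (relation-bound (b ∷ c ∷ []) (d′ ∷ []) s
      (record { nonzero = λ { zero → b≉0 ; (suc zero) → c≉0 } ; distinct = λ { zero zero n → ⊥-elim (n ≡.refl) ; zero (suc zero) _ → b≉c ; (suc zero) zero _ e → b≉c (sym e) ; (suc zero) (suc zero) n → ⊥-elim (n ≡.refl) } })
      s²≤p (N.≤-<-trans ((N.m≤n+m _ (d N.* (1 N.+ (d′ N.+ 0)))) ⟫ N.m≤m+n const₂ const₄) K<s) xs ap (All.map point h))
      (N.+-monoʳ-≤ (p N.* s) (N.*-monoʳ-≤ p (N.m≤m+n const₂ const₄)))
    where
    point : ∀ {x} → u b x ≉ 0# × u c x ≉ 0# × u b x ^ M ≈ u c x ^ M → eval (U (b ∷ c ∷ [])) x ≉ 0# × eval (Mon (b ∷ c ∷ []) (1 ∷ d′ ∷ [])) x ≈ 1#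
    point {x} (nb , nc , e) = U-≉0 (b ∷ c ∷ []) x (λ { zero → nb ; (suc zero) → nc }) ,
      trans (Mon-value (b ∷ c ∷ []) (u c x ^ M ∷ u c x ^ M ∷ []) (1 ∷ d′ ∷ []) x (λ { zero → e ; (suc zero) → refl }))
        (trans (*-cong (*-identityʳ _) (*-identityʳ _)) (trans (reflexive (≡.cong ((u c x ^ M) ^_) suc-d′)) (unit-power′ nc)))

  relation₄ : ∀ a b c e s → Distinct (a ∷ b ∷ c ∷ e ∷ []) → s N.* s ≤ p → collisionConst < s →
    ∀ xs → AllPairs _≉_ xs → All (λ x → u a x ≉ 0# × u b x ≉ 0# × u c x ≉ 0# × u e x ≉ 0# × (u a x * u b x) ^ M ≈ (u c x * u e x) ^ M) xs →
    d N.* length xs N.* s ≤ p N.* s N.+ p N.* collisionConst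
  relation₄ a b c e s dist s²≤p K<s xs ap h = N.≤-trans (relation-bound (a ∷ b ∷ c ∷ e ∷ []) (1 ∷ d′ ∷ d′ ∷ []) s dist s²≤p
      (N.≤-<-trans ((N.m≤n+m _ (d N.* (1 N.+ (1 N.+ (d′ N.+ (d′ N.+ 0)))))) ⟫ N.m≤n+m const₄ const₂) K<s) xs ap (All.map point h))
      (N.+-monoʳ-≤ (p N.* s) (N.*-monoʳ-≤ p (N.m≤n+m const₄ const₂)))
    where
    point : ∀ {x} → u a x ≉ 0# × u b x ≉ 0# × u c x ≉ 0# × u e x ≉ 0# × (u a x * u b x) ^ M ≈ (u c x * u e x) ^ M →
      eval (U (a ∷ b ∷ c ∷ e ∷ [])) x ≉ 0# × eval (Mon (a ∷ b ∷ c ∷ e ∷ []) (1 ∷ 1 ∷ d′ ∷ d′ ∷ [])) x ≈ 1#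
    point {x} (na , nb , nc , ne , eq) = U-≉0 (a ∷ b ∷ c ∷ e ∷ []) x (λ { zero → na ; (suc zero) → nb ; (suc (suc zero)) → nc ; (suc (suc (suc zero))) → ne }) ,
      trans (Mon-value (a ∷ b ∷ c ∷ e ∷ []) (A ∷ B ∷ W ∷ V ∷ []) (1 ∷ 1 ∷ d′ ∷ d′ ∷ []) x (λ { zero → refl ; (suc zero) → refl ; (suc (suc zero)) → refl ; (suc (suc (suc zero))) → refl }))
      (trans (*-cong (*-identityʳ A) (*-cong (*-identityʳ B) (trans (*-congˡ (*-identityʳ _)) (sym (^-distrib-* W V d′)))))
      (trans (sym (*-assoc A B _)) (trans (*-congʳ (trans (sym (^-distrib-* _ _ M)) (trans eq (^-distrib-* _ _ M))))
      (trans (reflexive (≡.cong ((W * V) ^_) suc-d′)) (trans (^-congˡ d (sym (^-distrib-* _ _ M))) (unit-power′ (*-≉0 nc ne)))))))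
      where
      A B W V : Carrier
      A = u a x ^ M
      B = u b x ^ M
      W = u c x ^ M
      V = u e x ^ M

  module Collisions (n : ℕ) (a : ℕ → Carrier) (good : Good n a) (s : ℕ) (s²≤p : s N.* s ≤ p) (K<s : collisionConst < s) where

    value : Carrier → ℕ × ℕ → Carrier
    value x (i , j) = (u (a i) x * u (a j) x) ^ M

    Regular : Carrier → Set
    Regular x = All (λ t → u (a t) x ≉ 0#) (upTo n)

    regular? : ∀ x → Dec (Regular x)
    regular? x = All.all? (λ t → ¬? (u (a t) x ≟ 0#)) (upTo n)

    regular-at : ∀ {x t} → Regular x → t < n → u (a t) x ≉ 0#
    regular-at r h = AllP.applyUpTo⁻ (λ t → t) n r h

    Valid : ℕ × ℕ → Set
    Valid (i , j) = i < j × j < n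

    -- Two distinct pairs share at most one index. A shared form cancels and leaves a relation
    -- between two forms; disjoint pairs give a relation between four.
    pair-bound : ∀ q r → Valid q → Valid r → q ≢ r → ∀ xs → AllPairs _≉_ xs → All (λ x → Regular x × value x q ≈ value x r) xs →
      d N.* length xs N.* s ≤ p N.* s N.+ p N.* collisionConst
    pair-bound (i , j) (k , l) (i<j , j<n) (k<l , l<n) q≢r xs ap h = cases (i N.≟ k) (j N.≟ l) (i N.≟ l) (j N.≟ k)
      where
      i<n : i < n
      i<n = N.<-trans i<j j<n
      k<n : k < n
      k<n = N.<-trans k<l l<n
      shared : ∀ t y z → t < n → y < n → z < n → y ≢ z →
        (∀ {x} → value x (i , j) ≈ value x (k , l) → (u (a t) x * u (a y) x) ^ M ≈ (u (a t) x * u (a z) x) ^ M) → d N.* length xs N.* s ≤ p N.* s N.+ p N.* collisionConst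
      shared t y z t<n y<n z<n y≢z f = relation₂ (a y) (a z) s (proj₁ good y y<n) (proj₁ good z z<n) (proj₂ good y z y<n z<n y≢z) s²≤p K<s xs ap
        (All.map (λ (r , e) → regular-at r y<n , regular-at r z<n , *-cancelˡ (^-≉0 M (regular-at r t<n)) (trans (sym (^-distrib-* _ _ M)) (trans (f e) (^-distrib-* _ _ M)))) h)
      comm^ : ∀ x y → (x * y) ^ M ≈ (y * x) ^ M
      comm^ x y = ^-congˡ M (*-comm x y)
      cases : Dec (i ≡ k) → Dec (j ≡ l) → Dec (i ≡ l) → Dec (j ≡ k) → d N.* length xs N.* s ≤ p N.* s N.+ p N.* collisionConst
      cases (yes ≡.refl) (yes ≡.refl) _ _ = ⊥-elim (q≢r ≡.refl)
      cases (yes ≡.refl) (no ne) _ _ = shared i j l i<n j<n l<n ne (λ e → e)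
      cases (no ne) (yes ≡.refl) _ _ = shared j i k j<n i<n k<n ne (λ {x} e → trans (comm^ _ _) (trans e (comm^ _ _)))
      cases (no _) (no _) (yes ≡.refl) _ = shared i j k i<n j<n k<n (λ j≡k → N.<-asym i<j (≡.subst (_< i) (≡.sym j≡k) k<l)) (λ e → trans e (comm^ _ _))
      cases (no _) (no _) (no _) (yes ≡.refl) = shared j i l j<n i<n l<n (λ i≡l → N.<-asym i<j (≡.subst (j <_) (≡.sym i≡l) k<l)) (λ e → trans (comm^ _ _) e)
      cases (no i≢k) (no j≢l) (no i≢l) (no j≢k) = relation₄ (a i) (a j) (a k) (a l) s
        (record { nonzero = λ { zero → proj₁ good i i<n ; (suc zero) → proj₁ good j j<n ; (suc (suc zero)) → proj₁ good k k<n ; (suc (suc (suc zero))) → proj₁ good l l<n }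
                ; distinct = λ t t′ ne → dist t t′ ne })
        s²≤p K<s xs ap (All.map (λ (r , e) → regular-at r i<n , regular-at r j<n , regular-at r k<n , regular-at r l<n , e) h)
        where
        ne : ∀ {x y} → x < n → y < n → x ≢ y → a x ≉ a y
        ne {x} {y} = proj₂ good x y
        dist : ∀ (t t′ : Fin 4) → t ≢ t′ → lookup (a i ∷ a j ∷ a k ∷ a l ∷ []) t ≉ lookup (a i ∷ a j ∷ a k ∷ a l ∷ []) t′
        dist zero zero n = ⊥-elim (n ≡.refl)
        dist zero (suc zero) _ = ne i<n j<n (N.<⇒≢ i<j)
        dist zero (suc (suc zero)) _ = ne i<n k<n i≢k
        dist zero (suc (suc (suc zero))) _ = ne i<n l<n i≢l
        dist (suc zero) zero _ e = ne i<n j<n (N.<⇒≢ i<j) (sym e)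
        dist (suc zero) (suc zero) n = ⊥-elim (n ≡.refl)
        dist (suc zero) (suc (suc zero)) _ = ne j<n k<n j≢k
        dist (suc zero) (suc (suc (suc zero))) _ = ne j<n l<n j≢l
        dist (suc (suc zero)) zero _ e = ne i<n k<n i≢k (sym e)
        dist (suc (suc zero)) (suc zero) _ e = ne j<n k<n j≢k (sym e)
        dist (suc (suc zero)) (suc (suc zero)) n = ⊥-elim (n ≡.refl)
        dist (suc (suc zero)) (suc (suc (suc zero))) _ = ne k<n l<n (N.<⇒≢ k<l)
        dist (suc (suc (suc zero))) zero _ e = ne i<n l<n i≢l (sym e)
        dist (suc (suc (suc zero))) (suc zero) _ e = ne j<n l<n j≢l (sym e)
        dist (suc (suc (suc zero))) (suc (suc zero)) _ e = ne k<n l<n (N.<⇒≢ k<l) (sym e)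
        dist (suc (suc (suc zero))) (suc (suc (suc zero))) n = ⊥-elim (n ≡.refl)

    Ps : List (ℕ × ℕ)
    Ps = pairs n

    N : ℕ
    N = length Ps

    X′ : List Carrier
    X′ = filter regular? elems

    hit : ℕ × ℕ → ℕ × ℕ → Carrier → ℕ
    hit q r x = ⟦ value x q ≟ value x r ⟧

    coll : Carrier → ℕ
    coll x = Σ[ Ps ] (λ q → Σ[ Ps ] (λ r → hit q r x))

    Z : List Carrier
    Z = filter (λ z → (z ^ d) ≟ 1#) elems

    Z-distinct : AllPairs _≉_ Z
    Z-distinct = AP.filter⁺ _ elems-distinct

    length-Z : length Z ≤ d
    length-Z = power-roots d 1# Z 0<d Z-distinct (AllP.all-filter _ elems)

    -- Cauchy–Schwarz over the at most d values.
    many-collisions : ∀ {x} → Regular x → N N.* N ≤ d N.* coll x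
    many-collisions {x} r = N.*-cancelˡ-≤ d (N.+-cancelʳ-≤ (d N.* (N N.* N)) _ _ (begin
      d N.* (N N.* N) N.+ d N.* (N N.* N) ≡⟨ lem₁ d N ⟩
      2 N.* d N.* N N.* N ≤⟨ N.*-monoʳ-≤ (2 N.* d N.* N) N≤Σc ⟩
      2 N.* d N.* N N.* Σ[ Z ] c ≡⟨ Σ-*ˡ (2 N.* d N.* N) c Z ⟨
      Σ[ Z ] (λ z → 2 N.* d N.* N N.* c z) ≤⟨ Σ-mono Z (All.universal (λ z → amgm (d N.* c z) N (lem₂ d N (c z))) Z) ⟩
      Σ[ Z ] (λ z → d N.* c z N.* (d N.* c z) N.+ N N.* N) ≡⟨ Σ-+ _ _ Z ⟩
      Σ[ Z ] (λ z → d N.* c z N.* (d N.* c z)) N.+ Σ[ Z ] (λ _ → N N.* N)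
        ≡⟨ ≡.cong₂ N._+_ (≡.trans (Σ-cong Z (λ z → lem₃ d (c z))) (Σ-*ˡ (d N.* d) (λ z → c z N.* c z) Z)) (Σ-const (N N.* N) Z) ⟩
      d N.* d N.* Σ[ Z ] (λ z → c z N.* c z) N.+ length Z N.* (N N.* N)
        ≤⟨ N.+-mono-≤ (N.*-monoʳ-≤ (d N.* d) squares) (N.*-monoˡ-≤ (N N.* N) length-Z) ⟩
      d N.* d N.* coll x N.+ d N.* (N N.* N) ≡⟨ ≡.cong (N._+ d N.* (N N.* N)) (N.*-assoc d d (coll x)) ⟩
      d N.* (d N.* coll x) N.+ d N.* (N N.* N) ∎))
      where
      open N.≤-Reasoning
      c : Carrier → ℕ
      c z = Σ[ Ps ] (λ q → ⟦ value x q ≟ z ⟧)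
      lem₁ : ∀ d N → d N.* (N N.* N) N.+ d N.* (N N.* N) ≡ 2 N.* d N.* N N.* N
      lem₁ = solve-∀
      lem₂ : ∀ d N c → 2 N.* d N.* N N.* c ≡ 2 N.* (d N.* c N.* N)
      lem₂ = solve-∀
      lem₃ : ∀ d c → d N.* c N.* (d N.* c) ≡ d N.* d N.* (c N.* c)
      lem₃ = solve-∀
      amgm-sorted : ∀ a b → 2 N.* (a N.* (a N.+ b)) ≤ a N.* a N.+ (a N.+ b) N.* (a N.+ b)
      amgm-sorted a b = (N.m≤m+n _ (b N.* b)) ⟫ N.≤-reflexive (lem a b)
        where
        lem : ∀ a b → 2 N.* (a N.* (a N.+ b)) N.+ b N.* b ≡ a N.* a N.+ (a N.+ b) N.* (a N.+ b)
        lem = solve-∀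
      amgm : ∀ a b {t} → t ≡ 2 N.* (a N.* b) → t ≤ a N.* a N.+ b N.* b
      amgm a b ≡.refl with N.≤-total a b
      ... | inj₁ a≤b = ≡.subst (λ b → 2 N.* (a N.* b) ≤ a N.* a N.+ b N.* b) (N.m+[n∸m]≡n a≤b) (amgm-sorted a (b N.∸ a))
      ... | inj₂ b≤a = ≡.subst (λ a → 2 N.* (a N.* b) ≤ a N.* a N.+ b N.* b) (N.m+[n∸m]≡n b≤a)
              (N.≤-reflexive (≡.cong (2 N.*_) (N.*-comm _ b)) ⟫ amgm-sorted b (a N.∸ b) ⟫ N.≤-reflexive (N.+-comm (b N.* b) _))
      covered : ∀ {q} → Valid q → Any (value x q ≈_) Z
      covered {i , j} (i<j , j<n) = any-filter (λ z → (z ^ d) ≟ 1#) elems (λ e → trans (^-congˡ d (sym e)) (unit-power′ (*-≉0 (regular-at r (N.<-trans i<j j<n)) (regular-at r j<n)))) (complete _)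
      N≤Σc : N ≤ Σ[ Z ] c
      N≤Σc = N.≤-reflexive (≡.trans (≡.sym (N.*-identityʳ N)) (≡.sym (Σ-const 1 Ps))) ⟫ (N.≤-trans (Σ-mono Ps (All.map (λ v → Σ-any _ Z (covered v)) (pairs-bounds n)))
        (N.≤-reflexive (Σ-swap (λ q z → ⟦ value x q ≟ z ⟧) Ps Z)))
      at-most : ∀ v w → Σ[ Z ] (λ z → ⟦ v ≟ z ⟧ N.* ⟦ w ≟ z ⟧) ≤ ⟦ v ≟ w ⟧
      at-most v w with v ≟ w
      ... | yes _ = Σ-mono Z (All.universal (λ z → (N.*-monoʳ-≤ ⟦ v ≟ z ⟧ (⟦⟧≤1 (w ≟ z))) ⟫ N.≤-reflexive (N.*-identityʳ _)) Z) ⟫ Σ-single v Z Z-distinct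
      ... | no ne = Σ-mono Z (All.universal zero-term Z) ⟫ N.≤-reflexive (≡.trans (Σ-const 0 Z) (N.*-zeroʳ (length Z)))
        where
        zero-term : ∀ z → ⟦ v ≟ z ⟧ N.* ⟦ w ≟ z ⟧ ≤ 0
        zero-term z with v ≟ z | w ≟ z
        ... | yes e | yes e′ = ⊥-elim (ne (trans e (sym e′)))
        ... | yes _ | no _ = z≤n
        ... | no _ | _ = z≤n
      square : ∀ z → c z N.* c z ≡ Σ[ Ps ] (λ q → Σ[ Ps ] (λ r → ⟦ value x q ≟ z ⟧ N.* ⟦ value x r ≟ z ⟧))
      square z = ≡.trans (N.*-comm (c z) (c z)) (≡.trans (≡.sym (Σ-*ˡ (c z) (λ q → ⟦ value x q ≟ z ⟧) Ps)) (Σ-cong Ps (λ q → ≡.trans (N.*-comm (c z) _) (≡.sym (Σ-*ˡ ⟦ value x q ≟ z ⟧ (λ r → ⟦ value x r ≟ z ⟧) Ps)))))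
      squares : Σ[ Z ] (λ z → c z N.* c z) ≤ coll x
      squares = N.≤-trans (N.≤-reflexive (≡.trans (Σ-cong Z square) (≡.trans (Σ-swap _ Z Ps) (Σ-cong Ps (λ q → Σ-swap _ Z Ps)))))
        (Σ-mono Ps (All.universal (λ q → Σ-mono Ps (All.universal (λ r → at-most (value x q) (value x r)) Ps)) Ps))

    AllOne : Carrier → Set
    AllOne x = All (λ q → value x q ≈ 1#) Ps

    allOne? : ∀ x → Dec (AllOne x)
    allOne? x = All.all? (λ q → value x q ≟ 1#) Ps

    -- Where all values are 1 there are N² collisions, d times the Cauchy-Schwarz minimum; the
    -- surplus (d - 1) N² will be charged for every element of B.
    pointwise : ∀ {x} → Regular x → N N.* N N.+ ⟦ allOne? x ⟧ N.* (d′ N.* (N N.* N)) ≤ d N.* coll x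
    pointwise {x} r with allOne? x
    ... | no _ = N.≤-reflexive (N.+-identityʳ _) ⟫ many-collisions r
    ... | yes o = N.≤-reflexive (≡.trans (≡.cong (N N.* N N.+_) (N.+-identityʳ _)) (≡.cong (N._* (N N.* N)) suc-d′)) ⟫ N.*-monoʳ-≤ d all
      where
      all : N N.* N ≤ coll x
      all = N.≤-trans (N.≤-reflexive (≡.trans (≡.sym (Σ-const N Ps)) (Σ-cong Ps (λ _ → ≡.trans (≡.sym (N.*-identityʳ N)) (≡.sym (Σ-const 1 Ps))))))
        (Σ-mono Ps (All.map (λ e → Σ-mono Ps (All.map (λ e′ → N.≤-reflexive (≡.sym (⟦⟧-yes (_ ≟ _) (trans e (sym e′))))) o)) o))

    module _ (bs : List Carrier) (bs-distinct : AllPairs _≉_ bs) (bs-one : All (λ b → ∀ t → t < n → u (a t) b ^ M ≈ 1#) bs) where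

      goods : List Carrier
      goods = filter allOne? X′

      bs≤goods : length bs ≤ length goods
      bs≤goods = length≤ bs goods bs-distinct (All.map (λ {b} h → any-filter allOne? X′ (λ {y} e → one e h) (any-filter regular? elems (λ {y} e → reg e h) (complete b))) bs-one)
        where
        move : ∀ {b y} t → b ≈ y → u (a t) b ^ M ≈ 1# → u (a t) y ^ M ≈ 1#
        move t e h = trans (^-congˡ M (+-congˡ (*-congˡ (sym e)))) h
        reg : ∀ {b y} → b ≈ y → (∀ t → t < n → u (a t) b ^ M ≈ 1#) → Regular y
        reg e h = AllP.applyUpTo⁺₁ _ n (λ {t} t<n z → 1≉0 (trans (sym (move t e (h t t<n))) (zero^ M 0<M z)))
        one : ∀ {b y} → b ≈ y → (∀ t → t < n → u (a t) b ^ M ≈ 1#) → AllOne y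
        one e h = All.map (λ { {i , j} (i<j , j<n) → trans (^-distrib-* _ _ M) (trans (*-cong (move i e (h i (N.<-trans i<j j<n))) (move j e (h j j<n))) (*-identityʳ 1#)) }) (pairs-bounds n)

      root : ℕ → Carrier
      root t with a t ≟ 0#
      ... | yes _ = 0#
      ... | no ne = - proj₁ (inverse (a t) ne)

      root-unique : ∀ {x} t → t < n → u (a t) x ≈ 0# → x ≈ root t
      root-unique {x} t t<n e with a t ≟ 0#
      ... | yes z = ⊥-elim (proj₁ good t t<n z)
      ... | no ne = *-cancelˡ ne (trans (S.solve 2 (λ o y → y S.:= (o S.:+ y) S.:+ S.:- o) refl 1# (a t * x))
        (trans (+-cong e (-‿cong (sym (proj₂ (inverse (a t) ne))))) (S.solve 3 (λ o a y → o S.:+ S.:- (a S.:* y) S.:= o S.:+ a S.:* S.:- y) refl 0# (a t) _ ⟨ trans ⟩ +-identityˡ _)))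
        where open import Function using (_⟨_⟩_)

      p≤X+n : p ≤ length X′ N.+ n
      p≤X+n = ≡.subst₂ _≤_ length-elems (≡.trans (length-++ X′) (≡.cong (length X′ N.+_) (length-applyUpTo root n)))
        (length≤ elems (X′ ++ applyUpTo root n) elems-distinct (All.universal place elems))
        where
        place : ∀ x → Any (x ≈_) (X′ ++ applyUpTo root n)
        place x with Any.any? (λ t → u (a t) x ≟ 0#) (upTo n)
        ... | yes some with AnyP.applyUpTo⁻ (λ t → t) some
        ... | t , t<n , e = AnyP.++⁺ʳ X′ (AnyP.applyUpTo⁺ root (root-unique t t<n e) t<n)
        place x | no none = AnyP.++⁺ˡ (any-filter regular? elems (λ {y} e → All.map (λ {t} ne z → ne (trans (+-congˡ (*-congˡ e)) z)) (AllP.¬Any⇒All¬ (upTo n) none)) (complete x))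

      -- Sum `pointwise` over the regular points. Different pairs collide on about p/d points, and
      -- the diagonal on at most p; so N² p cancels on both sides, and the surplus of B has to be
      -- paid by the diagonal and the error terms. Omitting the at most n zeros of the forms costs s
      -- n N².
      collision-bound : s N.* (length bs N.* (d′ N.* (N N.* N))) ≤ N N.* (d N.* s N.* p) N.+ N N.* N N.* (p N.* collisionConst) N.+ s N.* n N.* (N N.* N)
      collision-bound = N.+-cancelˡ-≤ (s N.* p N.* (N N.* N)) _ _ (begin
        s N.* p N.* (N N.* N) N.+ s N.* (length bs N.* (d′ N.* (N N.* N)))
          ≤⟨ N.+-mono-≤ (N.*-monoˡ-≤ (N N.* N) (N.*-monoʳ-≤ s p≤X+n)) (N.*-monoʳ-≤ s (N.*-monoˡ-≤ (d′ N.* (N N.* N)) bs≤goods)) ⟩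
        s N.* (length X′ N.+ n) N.* (N N.* N) N.+ s N.* (length goods N.* (d′ N.* (N N.* N)))
          ≡⟨ lem₁ s (length X′) n (N N.* N) _ ⟩
        s N.* (length X′ N.* (N N.* N) N.+ length goods N.* (d′ N.* (N N.* N))) N.+ s N.* n N.* (N N.* N)
          ≤⟨ N.+-monoˡ-≤ (s N.* n N.* (N N.* N)) (N.*-monoʳ-≤ s averaged) ⟩
        s N.* (d N.* Σ[ X′ ] coll) N.+ s N.* n N.* (N N.* N)
          ≡⟨ ≡.cong (N._+ s N.* n N.* (N N.* N)) (≡.trans (lem₂ s d _) (≡.cong (d N.* s N.*_) swapped)) ⟩
        d N.* s N.* Σ[ Ps ] (λ q → Σ[ Ps ] (λ r → cnt q r)) N.+ s N.* n N.* (N N.* N)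
          ≤⟨ N.+-monoˡ-≤ (s N.* n N.* (N N.* N)) counted ⟩
        N N.* (d N.* s N.* p N.+ N N.* (p N.* s N.+ p N.* collisionConst)) N.+ s N.* n N.* (N N.* N)
          ≡⟨ lem₃ N (d N.* s N.* p) p s (p N.* collisionConst) (s N.* n N.* (N N.* N)) ⟩
        s N.* p N.* (N N.* N) N.+ (N N.* (d N.* s N.* p) N.+ N N.* N N.* (p N.* collisionConst) N.+ s N.* n N.* (N N.* N)) ∎)
        where
        open N.≤-Reasoning
        lem₁ : ∀ s x n k g → s N.* (x N.+ n) N.* k N.+ s N.* g ≡ s N.* (x N.* k N.+ g) N.+ s N.* n N.* k
        lem₁ = solve-∀
        lem₂ : ∀ s d c → s N.* (d N.* c) ≡ d N.* s N.* c
        lem₂ = solve-∀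
        lem₃ : ∀ N t p s k e → N N.* (t N.+ N N.* (p N.* s N.+ k)) N.+ e ≡ s N.* p N.* (N N.* N) N.+ (N N.* t N.+ N N.* N N.* k N.+ e)
        lem₃ = solve-∀
        X′-distinct : AllPairs _≉_ X′
        X′-distinct = AP.filter⁺ regular? elems-distinct
        X′-regular : All Regular X′
        X′-regular = AllP.all-filter regular? elems
        cnt : ℕ × ℕ → ℕ × ℕ → ℕ
        cnt q r = Σ[ X′ ] (hit q r)
        swapped : Σ[ X′ ] coll ≡ Σ[ Ps ] (λ q → Σ[ Ps ] (λ r → cnt q r))
        swapped = ≡.trans (Σ-swap (λ x q → Σ[ Ps ] (λ r → hit q r x)) X′ Ps) (Σ-cong Ps (λ q → Σ-swap (λ x r → hit q r x) X′ Ps))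
        averaged : length X′ N.* (N N.* N) N.+ length goods N.* (d′ N.* (N N.* N)) ≤ d N.* Σ[ X′ ] coll
        averaged = begin
          length X′ N.* (N N.* N) N.+ length goods N.* (d′ N.* (N N.* N))
            ≡⟨ ≡.cong₂ N._+_ (≡.sym (Σ-const (N N.* N) X′)) (≡.trans (≡.cong (N._* (d′ N.* (N N.* N))) (length-filter allOne? X′))
                 (≡.trans (N.*-comm _ (d′ N.* (N N.* N))) (≡.trans (≡.sym (Σ-*ˡ (d′ N.* (N N.* N)) (λ x → ⟦ allOne? x ⟧) X′)) (Σ-cong X′ (λ x → N.*-comm (d′ N.* (N N.* N)) _))))) ⟩
          Σ[ X′ ] (λ _ → N N.* N) N.+ Σ[ X′ ] (λ x → ⟦ allOne? x ⟧ N.* (d′ N.* (N N.* N))) ≡⟨ Σ-+ _ _ X′ ⟨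
          Σ[ X′ ] (λ x → N N.* N N.+ ⟦ allOne? x ⟧ N.* (d′ N.* (N N.* N))) ≤⟨ Σ-mono X′ (All.map pointwise X′-regular) ⟩
          Σ[ X′ ] (λ x → d N.* coll x) ≡⟨ Σ-*ˡ d coll X′ ⟩
          d N.* Σ[ X′ ] coll ∎
        _≟²_ : (q r : ℕ × ℕ) → Dec (q ≡ r)
        _≟²_ = ≡-dec N._≟_ N._≟_
        same≤1 : ∀ q rs → AllPairs _≢_ rs → Σ[ rs ] (λ r → ⟦ q ≟² r ⟧) ≤ 1
        same≤1 q [] _ = z≤n
        same≤1 q (r ∷ rs) (ne ∷ ap) with q ≟² r
        ... | yes ≡.refl = s≤s (Σ-mono rs (All.map (λ {t} q≢t → N.≤-reflexive (⟦⟧-no (q ≟² t) q≢t)) ne) ⟫ N.≤-reflexive (≡.trans (Σ-const 0 rs) (N.*-zeroʳ (length rs))))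
        ... | no _ = same≤1 q rs ap
        R : ℕ
        R = p N.* s N.+ p N.* collisionConst
        cnt-bound : ∀ q r → Valid q → Valid r → d N.* s N.* cnt q r ≤ (d N.* s N.* p) N.* ⟦ q ≟² r ⟧ N.+ R
        cnt-bound q r vq vr with q ≟² r
        ... | yes _ = (N.*-monoʳ-≤ (d N.* s) (N.≤-trans (Σ-mono X′ (All.universal (λ x → ⟦⟧≤1 (value x q ≟ value x r)) X′))
              (N.≤-reflexive (≡.trans (Σ-const 1 X′) (N.*-identityʳ _)) ⟫ length≤p X′ X′-distinct))) ⟫ N.≤-reflexive (≡.sym (N.*-identityʳ _)) ⟫ (N.m≤m+n _ R)
        ... | no ne = N.≤-trans (N.≤-reflexive (≡.trans (≡.cong (d N.* s N.*_) (≡.sym (length-filter same? X′))) (lem₄ d s _)))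
              (pair-bound q r vq vr ne (filter same? X′) (AP.filter⁺ same? X′-distinct) (All.zip (AllP.filter⁺ same? X′-regular , AllP.all-filter same? X′)) ⟫ N.m≤n+m R (d N.* s N.* p N.* 0))
          where
          same? : ∀ x → Dec (value x q ≈ value x r)
          same? x = value x q ≟ value x r
          lem₄ : ∀ d s l → d N.* s N.* l ≡ d N.* l N.* s
          lem₄ = solve-∀
        row : ∀ q → Valid q → d N.* s N.* Σ[ Ps ] (λ r → cnt q r) ≤ d N.* s N.* p N.+ N N.* R
        row q vq = begin
          d N.* s N.* Σ[ Ps ] (λ r → cnt q r) ≡⟨ Σ-*ˡ (d N.* s) (cnt q) Ps ⟨
          Σ[ Ps ] (λ r → d N.* s N.* cnt q r) ≤⟨ Σ-mono Ps (All.map (λ {r} vr → cnt-bound q r vq vr) (pairs-bounds n)) ⟩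
          Σ[ Ps ] (λ r → (d N.* s N.* p) N.* ⟦ q ≟² r ⟧ N.+ R) ≡⟨ Σ-+ _ _ Ps ⟩
          Σ[ Ps ] (λ r → (d N.* s N.* p) N.* ⟦ q ≟² r ⟧) N.+ Σ[ Ps ] (λ _ → R) ≡⟨ ≡.cong₂ N._+_ (Σ-*ˡ (d N.* s N.* p) (λ r → ⟦ q ≟² r ⟧) Ps) (Σ-const R Ps) ⟩
          (d N.* s N.* p) N.* Σ[ Ps ] (λ r → ⟦ q ≟² r ⟧) N.+ N N.* R
            ≤⟨ N.+-monoˡ-≤ (N N.* R) (N.*-monoʳ-≤ (d N.* s N.* p) (same≤1 q Ps (pairs-distinct n)) ⟫ N.≤-reflexive (N.*-identityʳ _)) ⟩
          d N.* s N.* p N.+ N N.* R ∎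
        counted : d N.* s N.* Σ[ Ps ] (λ q → Σ[ Ps ] (λ r → cnt q r)) ≤ N N.* (d N.* s N.* p N.+ N N.* R)
        counted = begin
          d N.* s N.* Σ[ Ps ] (λ q → Σ[ Ps ] (λ r → cnt q r)) ≡⟨ Σ-*ˡ (d N.* s) (λ q → Σ[ Ps ] (λ r → cnt q r)) Ps ⟨
          Σ[ Ps ] (λ q → d N.* s N.* Σ[ Ps ] (λ r → cnt q r)) ≤⟨ Σ-mono Ps (All.map (λ {q} vq → row q vq) (pairs-bounds n)) ⟩
          Σ[ Ps ] (λ _ → d N.* s N.* p N.+ N N.* R) ≡⟨ Σ-const _ Ps ⟩
          N N.* (d N.* s N.* p N.+ N N.* R) ∎

  nonzeros : List Carrier
  nonzeros = filter (λ x → ¬? (x ≟ 0#)) elems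

  p≤nonzeros : p ≤ suc (length nonzeros)
  p≤nonzeros = ≡.subst (_≤ suc (length nonzeros)) length-elems (length≤ elems (0# ∷ nonzeros) elems-distinct (All.universal place elems))
    where
    decide : ∀ x → Dec (x ≈ 0#) → Any (x ≈_) (0# ∷ nonzeros)
    decide x (yes e) = here e
    decide x (no ne) = there (any-filter (λ x → ¬? (x ≟ 0#)) elems (λ e z → ne (trans e z)) (complete x))
    place : ∀ x → Any (x ≈_) (0# ∷ nonzeros)
    place x = decide x (x ≟ 0#)

  isPower? : ∀ r → Dec (Any (λ x → (x ^ d) ≈ r) nonzeros)
  isPower? r = Any.any? (λ x → (x ^ d) ≟ r) nonzeros

  powers : List Carrier
  powers = filter isPower? elems

  powers-distinct : AllPairs _≉_ powers
  powers-distinct = AP.filter⁺ isPower? elems-distinct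

  -- The fibres of x ↦ x^d on the p - 1 = d M units have at most d elements.
  M≤powers : M ≤ length powers
  M≤powers = N.*-cancelˡ-≤ d (N.s≤s⁻¹ (N.≤-reflexive dM ⟫ p≤nonzeros ⟫ s≤s fibres))
    where
    open N.≤-Reasoning
    self : ∀ {x} ys → Any (x ≈_) ys → Any (λ y → (y ^ d) ≈ (x ^ d)) ys
    self ys = Any.map (λ e → ^-congˡ d (sym e))
    covered : ∀ {x} → x ≉ 0# → Any ((x ^ d) ≈_) powers
    covered {x} nx = any-filter isPower? elems (λ e → Any.map (λ e′ → trans e′ e) (self nonzeros (any-filter (λ x → ¬? (x ≟ 0#)) elems (λ e z → nx (trans e z)) (complete x)))) (complete (x ^ d))
    fibre : ∀ r → Σ[ nonzeros ] (λ x → ⟦ (x ^ d) ≟ r ⟧) ≤ d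
    fibre r = N.≤-trans (N.≤-reflexive (≡.sym (length-filter (λ x → (x ^ d) ≟ r) nonzeros)))
      (power-roots d r (filter (λ x → (x ^ d) ≟ r) nonzeros) 0<d (AP.filter⁺ _ (AP.filter⁺ _ elems-distinct)) (AllP.all-filter (λ x → (x ^ d) ≟ r) nonzeros))
    fibres : length nonzeros ≤ d N.* length powers
    fibres = begin
      length nonzeros ≡⟨ ≡.trans (≡.sym (N.*-identityʳ _)) (≡.sym (Σ-const 1 nonzeros)) ⟩
      Σ[ nonzeros ] (λ _ → 1) ≤⟨ Σ-mono nonzeros (All.map (λ {x} nx → Σ-any (x ^ d) powers (covered nx)) (AllP.all-filter (λ x → ¬? (x ≟ 0#)) elems)) ⟩
      Σ[ nonzeros ] (λ x → Σ[ powers ] (λ r → ⟦ (x ^ d) ≟ r ⟧)) ≡⟨ Σ-swap (λ x r → ⟦ (x ^ d) ≟ r ⟧) nonzeros powers ⟩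
      Σ[ powers ] (λ r → Σ[ nonzeros ] (λ x → ⟦ (x ^ d) ≟ r ⟧)) ≤⟨ Σ-mono powers (All.universal fibre powers) ⟩
      Σ[ powers ] (λ _ → d) ≡⟨ Σ-const d powers ⟩
      length powers N.* d ≡⟨ N.*-comm (length powers) d ⟩
      d N.* length powers ∎

  targets : List Carrier
  targets = filter (λ t → ¬? (t ≟ 0#)) (List.map (λ r → r + - 1#) powers)

  targets-distinct : AllPairs _≉_ targets
  targets-distinct = AP.filter⁺ _ (AP.map⁺ (AllPairs.map (λ {x} {y} ne e → ne (trans (trans (S.solve 2 (λ o x → x S.:= (x S.:+ S.:- o) S.:+ o) refl 1# x) (+-congʳ e)) (S.solve 2 (λ o x → (x S.:+ S.:- o) S.:+ o S.:= x) refl 1# y))) powers-distinct))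

  targets-many : M ≤ suc (length targets)
  targets-many = M≤powers ⟫ (≡.subst (_≤ suc (length targets)) (length-map (λ r → r + - 1#) powers)
    (length≤ _ (0# ∷ targets) (AP.map⁺ (AllPairs.map (λ {x} {y} ne e → ne (trans (trans (S.solve 2 (λ o x → x S.:= (x S.:+ S.:- o) S.:+ o) refl 1# x) (+-congʳ e)) (S.solve 2 (λ o x → (x S.:+ S.:- o) S.:+ o S.:= x) refl 1# y))) powers-distinct))
      (All.tabulate (λ {x} x∈ → decide x x∈ (x ≟ 0#)))))
    where
    open import Data.List.Membership.Propositional using (_∈_)
    decide : ∀ x → x ∈ List.map (λ r → r + - 1#) powers → Dec (x ≈ 0#) → Any (x ≈_) (0# ∷ targets)
    decide x x∈ (yes e) = here e
    decide x x∈ (no ne) = there (any-filter (λ t → ¬? (t ≟ 0#)) _ (λ e z → ne (trans e z)) (Any.map (λ { ≡.refl → refl }) x∈))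

  targets-nonzero : All (_≉ 0#) targets
  targets-nonzero = AllP.all-filter (λ t → ¬? (t ≟ 0#)) (List.map (λ r → r + - 1#) powers)

  targets-power : All (λ t → ∃[ x ] (x ≉ 0# × 1# + t ≈ x ^ d)) targets
  targets-power = AllP.filter⁺ (λ t → ¬? (t ≟ 0#)) (AllP.map⁺ (All.map witness (AllP.all-filter isPower? elems)))
    where
    witness : ∀ {r} → Any (λ x → (x ^ d) ≈ r) nonzeros → ∃[ x ] (x ≉ 0# × 1# + (r + - 1#) ≈ x ^ d)
    witness {r} m with All.lookupAny (AllP.all-filter (λ x → ¬? (x ≟ 0#)) elems) m
    ... | nx , e = Any.lookup m , nx , trans (S.solve 2 (λ o r → o S.:+ (r S.:+ S.:- o) S.:= r) refl 1# r) (sym e)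

  power-unit : ∀ {x} → x ≉ 0# → (x ^ d) ^ M ≈ 1#
  power-unit {x} nx = trans (^-assocʳ x d M) (unit-power nx)

-- Numerical consequences of the counting bounds

private
  square-dominates : ∀ d s p p′ K → p ≡ p′ N.+ (d N.+ 1) → s N.* s ≤ p → (d N.+ 1) N.* (K N.+ 2) ≤ s → (d N.+ 1) N.* (s N.+ K) ≤ p′
  square-dominates d s p p′ K ≡.refl s²≤p big = N.+-cancelʳ-≤ (d N.+ 1) _ _ (begin
    (d N.+ 1) N.* (s N.+ K) N.+ (d N.+ 1) ≡⟨ lem₁ d s K ⟩
    (d N.+ 1) N.* s N.+ (d N.+ 1) N.* (K N.+ 1) N.* 1 ≤⟨ N.+-monoʳ-≤ ((d N.+ 1) N.* s) (N.*-monoʳ-≤ ((d N.+ 1) N.* (K N.+ 1)) 1≤s) ⟩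
    (d N.+ 1) N.* s N.+ (d N.+ 1) N.* (K N.+ 1) N.* s ≡⟨ lem₂ d s K ⟩
    (d N.+ 1) N.* (K N.+ 2) N.* s ≤⟨ N.*-monoˡ-≤ s big ⟩
    s N.* s ≤⟨ s²≤p ⟩
    p′ N.+ (d N.+ 1) ∎)
    where
    open N.≤-Reasoning
    1≤s : 1 ≤ s
    1≤s = N.*-mono-≤ (N.m≤n+m 1 d) (s≤s z≤n ⟫ N.m≤n+m 2 K) ⟫ big
    lem₁ : ∀ d s K → (d N.+ 1) N.* (s N.+ K) N.+ (d N.+ 1) ≡ (d N.+ 1) N.* s N.+ (d N.+ 1) N.* (K N.+ 1) N.* 1
    lem₁ = solve-∀
    lem₂ : ∀ d s K → (d N.+ 1) N.* s N.+ (d N.+ 1) N.* (K N.+ 1) N.* s ≡ (d N.+ 1) N.* (K N.+ 2) N.* s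
    lem₂ = solve-∀

  -- Since d n m is p up to d + 1, the bound m ≤ (p/D)(1 + K/s) with D > d n misses the truth by a
  -- factor of about 1 + 1/(d n). The error K/s can make up for this only while s ≤ d n (K + 1).
  few-impossible : ∀ d n m s p K D → p ≡ d N.* m N.* n N.+ (d N.+ 1) → d N.* n N.+ 1 ≤ D → D N.* m N.* s ≤ p N.* s N.+ p N.* K →
    s N.* s ≤ p → 0 < d N.* m N.* n → (d N.+ 1) N.* (K N.+ 2) ≤ s → s ≤ d N.* n N.* (K N.+ 1)
  few-impossible d n m s p K D p≡ big bound s²≤p 0<p′ large = N.*-cancelˡ-≤ p′ {{N.>-nonZero 0<p′}} (N.+-cancelˡ-≤ (d N.* n N.* p′ N.* s) _ _ (begin
    d N.* n N.* p′ N.* s N.+ p′ N.* s ≡⟨ lem₁ (d N.* n) p′ s ⟩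
    (d N.* n N.+ 1) N.* (p′ N.* s) ≤⟨ N.*-monoˡ-≤ (p′ N.* s) big ⟩
    D N.* (p′ N.* s) ≡⟨ lem₂ D d m n s ⟩
    d N.* n N.* (D N.* m N.* s) ≤⟨ N.*-monoʳ-≤ (d N.* n) bound ⟩
    d N.* n N.* (p N.* s N.+ p N.* K) ≡⟨ ≡.cong (λ p → d N.* n N.* (p N.* s N.+ p N.* K)) p≡ ⟩
    d N.* n N.* ((p′ N.+ (d N.+ 1)) N.* s N.+ (p′ N.+ (d N.+ 1)) N.* K) ≡⟨ lem₃ (d N.* n) p′ (d N.+ 1) s K ⟩
    d N.* n N.* p′ N.* s N.+ d N.* n N.* (p′ N.* K N.+ (d N.+ 1) N.* (s N.+ K))
      ≤⟨ N.+-monoʳ-≤ (d N.* n N.* p′ N.* s) (N.*-monoʳ-≤ (d N.* n) (N.+-monoʳ-≤ (p′ N.* K) (square-dominates d s p p′ K p≡ s²≤p large))) ⟩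
    d N.* n N.* p′ N.* s N.+ d N.* n N.* (p′ N.* K N.+ p′) ≡⟨ lem₄ (d N.* n) p′ s K ⟩
    d N.* n N.* p′ N.* s N.+ p′ N.* (d N.* n N.* (K N.+ 1)) ∎))
    where
    open N.≤-Reasoning
    p′ : ℕ
    p′ = d N.* m N.* n
    lem₁ : ∀ e p s → e N.* p N.* s N.+ p N.* s ≡ (e N.+ 1) N.* (p N.* s)
    lem₁ = solve-∀
    lem₂ : ∀ D d m n s → D N.* (d N.* m N.* n N.* s) ≡ d N.* n N.* (D N.* m N.* s)
    lem₂ = solve-∀
    lem₃ : ∀ e p c s K → e N.* ((p N.+ c) N.* s N.+ (p N.+ c) N.* K) ≡ e N.* p N.* s N.+ e N.* (p N.* K N.+ c N.* (s N.+ K))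
    lem₃ = solve-∀
    lem₄ : ∀ e p s K → e N.* p N.* s N.+ e N.* (p N.* K N.+ p) ≡ e N.* p N.* s N.+ p N.* (e N.* (K N.+ 1))
    lem₄ = solve-∀

  -- With m about p/(d n) and N about n²/2, the diagonal term is roughly 2 d²/((d - 1) n) of the
  -- left side. The conditions 4 d² ≤ n and 16 ≤ n keep a positive proportion of the left side,
  -- which then has to be covered by the terms with K and s n.
  many-bound : ∀ d d′ n m s p K N → 1 ≤ d → 1 ≤ d′ → 2 N.* N N.+ n ≡ n N.* n → 16 ≤ n → 4 N.* (d N.* d) ≤ n → p ≡ d N.* m N.* n N.+ (d N.+ 1) →
    s N.* (m N.* (d′ N.* (N N.* N))) ≤ N N.* (d N.* s N.* p) N.+ N N.* N N.* (p N.* K) N.+ s N.* n N.* (N N.* N) →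
    s N.* s ≤ p → (d N.+ 1) N.* 32 ≤ s → s ≤ 4 N.* d N.* (K N.+ 1) N.* n
  many-bound d d′ (suc ν) m s p K N 1≤d 1≤d′ 2N 16≤n d²≤n p≡ bound s²≤p large = conclude (N.≤-total n s)
    where
    open N.≤-Reasoning
    n p′ : ℕ
    n = suc ν
    p′ = d N.* m N.* n
    2N≡ : 2 N.* N ≡ n N.* ν
    2N≡ = N.+-cancelʳ-≡ n (2 N.* N) (n N.* ν) (≡.trans 2N (lem ν))
      where
      lem : ∀ ν → suc ν N.* suc ν ≡ suc ν N.* ν N.+ suc ν
      lem = solve-∀
    15≤ν : 15 ≤ ν
    15≤ν = N.s≤s⁻¹ 16≤n
    N≢0 : NonZero N
    N≢0 = N.≢-nonZero (λ e → N.<⇒≢ (N.*-mono-≤ (s≤s (z≤n {ν})) (s≤s z≤n ⟫ 15≤ν)) (≡.trans (≡.cong (2 N.*_) (≡.sym e)) 2N≡))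
    1≤s : 1 ≤ s
    1≤s = N.*-mono-≤ (N.m≤n+m 1 d) (s≤s z≤n) ⟫ large
    p-nz : NonZero p
    p-nz = N.>-nonZero ((N.*-mono-≤ 1≤s 1≤s) ⟫ s²≤p)
    step₁ : s N.* m N.* d′ N.* N ≤ d N.* s N.* p N.+ N N.* (p N.* K N.+ s N.* n)
    step₁ = N.*-cancelˡ-≤ N {{N≢0}} (≡.subst₂ _≤_ (lem s m d′ N) (lem′ N (d N.* s N.* p) (p N.* K) (s N.* n)) bound)
      where
      lem : ∀ s m d′ N → s N.* (m N.* (d′ N.* (N N.* N))) ≡ N N.* (s N.* m N.* d′ N.* N)
      lem = solve-∀
      lem′ : ∀ N a b c → N N.* a N.+ N N.* N N.* b N.+ c N.* (N N.* N) ≡ N N.* (a N.+ N N.* (b N.+ c))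
      lem′ = solve-∀
    step₂ : p′ N.* s N.* d′ N.* ν ≤ 2 N.* (d N.* d) N.* s N.* p N.+ d N.* n N.* ν N.* (p N.* K N.+ s N.* n)
    step₂ = N.*-cancelˡ-≤ n (begin
      n N.* (p′ N.* s N.* d′ N.* ν) ≡⟨ lem₁ n d m s d′ ν ⟩
      d N.* n N.* (s N.* m N.* d′) N.* (n N.* ν) ≡⟨ ≡.cong (d N.* n N.* (s N.* m N.* d′) N.*_) 2N≡ ⟨
      d N.* n N.* (s N.* m N.* d′) N.* (2 N.* N) ≡⟨ lem₂ (d N.* n) (s N.* m N.* d′) N ⟩
      2 N.* (d N.* n) N.* (s N.* m N.* d′ N.* N) ≤⟨ N.*-monoʳ-≤ (2 N.* (d N.* n)) step₁ ⟩
      2 N.* (d N.* n) N.* (d N.* s N.* p N.+ N N.* (p N.* K N.+ s N.* n)) ≡⟨ lem₃ d n s p N (p N.* K N.+ s N.* n) ⟩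
      n N.* (2 N.* (d N.* d) N.* s N.* p) N.+ d N.* n N.* (2 N.* N) N.* (p N.* K N.+ s N.* n)
        ≡⟨ ≡.cong (λ t → n N.* (2 N.* (d N.* d) N.* s N.* p) N.+ d N.* n N.* t N.* (p N.* K N.+ s N.* n)) 2N≡ ⟩
      n N.* (2 N.* (d N.* d) N.* s N.* p) N.+ d N.* n N.* (n N.* ν) N.* (p N.* K N.+ s N.* n) ≡⟨ lem₄ n (2 N.* (d N.* d) N.* s N.* p) d ν (p N.* K N.+ s N.* n) ⟩
      n N.* (2 N.* (d N.* d) N.* s N.* p N.+ d N.* n N.* ν N.* (p N.* K N.+ s N.* n)) ∎)
      where
      lem₁ : ∀ n d m s d′ ν → n N.* (d N.* m N.* n N.* s N.* d′ N.* ν) ≡ d N.* n N.* (s N.* m N.* d′) N.* (n N.* ν)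
      lem₁ = solve-∀
      lem₂ : ∀ a b N → a N.* b N.* (2 N.* N) ≡ 2 N.* a N.* (b N.* N)
      lem₂ = solve-∀
      lem₃ : ∀ d n s p N t → 2 N.* (d N.* n) N.* (d N.* s N.* p N.+ N N.* t) ≡ n N.* (2 N.* (d N.* d) N.* s N.* p) N.+ d N.* n N.* (2 N.* N) N.* t
      lem₃ = solve-∀
      lem₄ : ∀ n a d ν t → n N.* a N.+ d N.* n N.* (n N.* ν) N.* t ≡ n N.* (a N.+ d N.* n N.* ν N.* t)
      lem₄ = solve-∀
    31p≤32p′ : 31 N.* p ≤ 32 N.* p′
    31p≤32p′ = begin
      31 N.* p ≡⟨ ≡.cong (31 N.*_) p≡ ⟩
      31 N.* (p′ N.+ (d N.+ 1)) ≡⟨ N.*-distribˡ-+ 31 p′ (d N.+ 1) ⟩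
      31 N.* p′ N.+ 31 N.* (d N.+ 1) ≤⟨ N.+-monoʳ-≤ (31 N.* p′) (N.≤-trans (N.≤-reflexive (N.*-comm 31 (d N.+ 1)) ⟫ N.*-monoʳ-≤ (d N.+ 1) ((N.n≤1+n 31 ⟫ N.m≤n*m 32 (d N.+ 1) {{N.>-nonZero (N.m≤n+m 1 d)}} ⟫ large) ⟫ N.m≤m+n s 30))
                                                      (square-dominates d s p p′ 30 p≡ s²≤p large)) ⟩
      31 N.* p′ N.+ p′ ≡⟨ N.+-comm (31 N.* p′) p′ ⟩
      32 N.* p′ ∎
    weight : 32 N.* (8 N.* (d N.* d) N.+ n) ≤ 31 N.* (4 N.* (d′ N.* ν))
    weight = begin
      32 N.* (8 N.* (d N.* d) N.+ n) ≡⟨ lem₁ (d N.* d) n ⟩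
      64 N.* (4 N.* (d N.* d)) N.+ 32 N.* n ≤⟨ N.+-monoˡ-≤ (32 N.* n) (N.*-monoʳ-≤ 64 d²≤n) ⟩
      64 N.* n N.+ 32 N.* n ≡⟨ lem₂ ν ⟩
      96 N.+ 96 N.* ν ≤⟨ N.+-monoˡ-≤ (96 N.* ν) (N.m≤m+n 96 324 ⟫ (N.*-monoʳ-≤ 28 15≤ν)) ⟩
      28 N.* ν N.+ 96 N.* ν ≡⟨ lem₃ ν ⟩
      31 N.* (4 N.* (1 N.* ν)) ≤⟨ N.*-monoʳ-≤ 31 (N.*-monoʳ-≤ 4 (N.*-monoˡ-≤ ν 1≤d′)) ⟩
      31 N.* (4 N.* (d′ N.* ν)) ∎
      where
      lem₁ : ∀ e n → 32 N.* (8 N.* e N.+ n) ≡ 64 N.* (4 N.* e) N.+ 32 N.* n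
      lem₁ = solve-∀
      lem₂ : ∀ ν → 64 N.* suc ν N.+ 32 N.* suc ν ≡ 96 N.+ 96 N.* ν
      lem₂ = solve-∀
      lem₃ : ∀ ν → 28 N.* ν N.+ 96 N.* ν ≡ 31 N.* (4 N.* (1 N.* ν))
      lem₃ = solve-∀
    claim : (8 N.* (d N.* d) N.+ n) N.* p ≤ 4 N.* (p′ N.* d′ N.* ν)
    claim = N.*-cancelˡ-≤ 31 (begin
      31 N.* (e N.* p) ≡⟨ lem₁ e p ⟩
      e N.* (31 N.* p) ≤⟨ N.*-monoʳ-≤ e 31p≤32p′ ⟩
      e N.* (32 N.* p′) ≡⟨ lem₂ e p′ ⟩
      32 N.* e N.* p′ ≤⟨ N.*-monoˡ-≤ p′ weight ⟩
      31 N.* (4 N.* (d′ N.* ν)) N.* p′ ≡⟨ lem₃ d′ ν p′ ⟩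
      31 N.* (4 N.* (p′ N.* d′ N.* ν)) ∎)
      where
      e : ℕ
      e = 8 N.* (d N.* d) N.+ n
      lem₁ : ∀ e p → 31 N.* (e N.* p) ≡ e N.* (31 N.* p)
      lem₁ = solve-∀
      lem₂ : ∀ e p → e N.* (32 N.* p) ≡ 32 N.* e N.* p
      lem₂ = solve-∀
      lem₃ : ∀ d ν p → 31 N.* (4 N.* (d N.* ν)) N.* p ≡ 31 N.* (4 N.* (p N.* d N.* ν))
      lem₃ = solve-∀
    step₃ : p N.* s ≤ 4 N.* d N.* ν N.* (p N.* K N.+ s N.* n)
    step₃ = N.*-cancelˡ-≤ n (N.+-cancelˡ-≤ (8 N.* (d N.* d) N.* p N.* s) _ _ (begin
      8 N.* (d N.* d) N.* p N.* s N.+ n N.* (p N.* s) ≡⟨ lem₁ (8 N.* (d N.* d)) p s n ⟩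
      (8 N.* (d N.* d) N.+ n) N.* p N.* s ≤⟨ N.*-monoˡ-≤ s claim ⟩
      4 N.* (p′ N.* d′ N.* ν) N.* s ≡⟨ lem₂ p′ d′ ν s ⟩
      4 N.* (p′ N.* s N.* d′ N.* ν) ≤⟨ N.*-monoʳ-≤ 4 step₂ ⟩
      4 N.* (2 N.* (d N.* d) N.* s N.* p N.+ d N.* n N.* ν N.* t) ≡⟨ lem₃ d s p n ν t ⟩
      8 N.* (d N.* d) N.* p N.* s N.+ n N.* (4 N.* d N.* ν N.* t) ∎))
      where
      t : ℕ
      t = p N.* K N.+ s N.* n
      lem₁ : ∀ e p s n → e N.* p N.* s N.+ n N.* (p N.* s) ≡ (e N.+ n) N.* p N.* s
      lem₁ = solve-∀
      lem₂ : ∀ p d ν s → 4 N.* (p N.* d N.* ν) N.* s ≡ 4 N.* (p N.* s N.* d N.* ν)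
      lem₂ = solve-∀
      lem₃ : ∀ d s p n ν t → 4 N.* (2 N.* (d N.* d) N.* s N.* p N.+ d N.* n N.* ν N.* t) ≡ 8 N.* (d N.* d) N.* p N.* s N.+ n N.* (4 N.* d N.* ν N.* t)
      lem₃ = solve-∀
    conclude : n ≤ s ⊎ s ≤ n → s ≤ 4 N.* d N.* (K N.+ 1) N.* n
    -- In this case s n ≤ s² ≤ p; for n ≥ s the claim is immediate.
    conclude (inj₁ n≤s) = N.*-cancelˡ-≤ p {{p-nz}} (begin
      p N.* s ≤⟨ step₃ ⟩
      4 N.* d N.* ν N.* (p N.* K N.+ s N.* n) ≤⟨ N.*-mono-≤ (N.*-monoʳ-≤ (4 N.* d) (N.n≤1+n ν)) (N.+-monoʳ-≤ (p N.* K) (N.*-monoʳ-≤ s n≤s ⟫ s²≤p)) ⟩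
      4 N.* d N.* n N.* (p N.* K N.+ p) ≡⟨ lem d n p K ⟩
      p N.* (4 N.* d N.* (K N.+ 1) N.* n) ∎)
      where
      lem : ∀ d n p K → 4 N.* d N.* n N.* (p N.* K N.+ p) ≡ p N.* (4 N.* d N.* (K N.+ 1) N.* n)
      lem = solve-∀
    conclude (inj₂ s≤n) = s≤n ⟫ N.m≤n*m n (4 N.* d N.* (K N.+ 1)) {{N.>-nonZero (N.*-mono-≤ (N.*-mono-≤ (s≤s (z≤n {3})) 1≤d) (N.m≤n+m 1 K))}}

  room : ∀ d K s → (d N.+ 1) N.* (32 N.* (K N.+ 2)) ≤ s → 3 N.* K N.+ 29 ≤ s
  room d K s h = N.m≤m+n (3 N.* K N.+ 29) (29 N.* K N.+ 35) ⟫ N.≤-reflexive (lem K) ⟫ N.*-monoˡ-≤ (32 N.* (K N.+ 2)) (N.m≤n+m 1 d) ⟫ h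
    where
    lem : ∀ K → 3 N.* K N.+ 29 N.+ (29 N.* K N.+ 35) ≡ 1 N.* (32 N.* (K N.+ 2))
    lem = solve-∀

  combine : ∀ l x y z s R → l ≤ x N.+ (y N.+ (z N.+ 2)) → 8 N.* x N.* s ≤ R → 8 N.* y N.* s ≤ R → 8 N.* z N.* s ≤ R → 8 N.* l N.* s ≤ 3 N.* R N.+ 16 N.* s
  combine l x y z s R h hx hy hz = begin
    8 N.* l N.* s ≤⟨ N.*-monoˡ-≤ s (N.*-monoʳ-≤ 8 h) ⟩
    8 N.* (x N.+ (y N.+ (z N.+ 2))) N.* s ≡⟨ lem x y z s ⟩
    (8 N.* x N.* s N.+ (8 N.* y N.* s N.+ 8 N.* z N.* s)) N.+ 16 N.* s ≤⟨ N.+-monoˡ-≤ (16 N.* s) (N.+-mono-≤ hx (N.+-mono-≤ hy hz)) ⟩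
    (R N.+ (R N.+ R)) N.+ 16 N.* s ≡⟨ ≡.cong (λ t → R N.+ (R N.+ t) N.+ 16 N.* s) (≡.sym (N.+-identityʳ R)) ⟩
    3 N.* R N.+ 16 N.* s ∎
    where
    open N.≤-Reasoning
    lem : ∀ x y z s → 8 N.* (x N.+ (y N.+ (z N.+ 2))) N.* s ≡ (8 N.* x N.* s N.+ (8 N.* y N.* s N.+ 8 N.* z N.* s)) N.+ 16 N.* s
    lem = solve-∀

  -- T is about p/2, whereas the hypothesis leaves room for about 3 p/8.
  exceptional-impossible : ∀ p M T s K → p ≡ suc (2 N.* M) → M ≤ suc T → s ≤ p → 3 N.* K N.+ 29 ≤ s → 8 N.* T N.* s ≤ 3 N.* (p N.* s N.+ p N.* K) N.+ 16 N.* s → ⊥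
  exceptional-impossible p M T s K p≡ M≤T s≤p big bound = N.<⇒≱ (N.m<m+n (28 N.* p) 0<p) (N.≤-reflexive (N.+-comm (28 N.* p) p) ⟫ 29p≤28s ⟫ N.*-monoʳ-≤ 28 s≤p)
    where
    open N.≤-Reasoning
    0<p : 0 < p
    0<p = ≡.subst (0 <_) (≡.sym p≡) (s≤s z≤n)
    4p≤ : 4 N.* p ≤ 8 N.* T N.+ 12
    4p≤ = begin
      4 N.* p ≡⟨ ≡.cong (4 N.*_) p≡ ⟩
      4 N.* suc (2 N.* M) ≤⟨ N.*-monoʳ-≤ 4 (s≤s (N.*-monoʳ-≤ 2 M≤T)) ⟩
      4 N.* suc (2 N.* suc T) ≡⟨ lem T ⟩
      8 N.* T N.+ 12 ∎
      where
      lem : ∀ T → 4 N.* suc (2 N.* suc T) ≡ 8 N.* T N.+ 12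
      lem = solve-∀
    ps≤ : p N.* s ≤ 3 N.* K N.* p N.+ 28 N.* s
    ps≤ = N.+-cancelˡ-≤ (3 N.* (p N.* s)) _ _ (begin
      3 N.* (p N.* s) N.+ p N.* s ≡⟨ lem₁ p s ⟩
      4 N.* p N.* s ≤⟨ N.*-monoˡ-≤ s 4p≤ ⟩
      (8 N.* T N.+ 12) N.* s ≡⟨ N.*-distribʳ-+ s (8 N.* T) 12 ⟩
      8 N.* T N.* s N.+ 12 N.* s ≤⟨ N.+-monoˡ-≤ (12 N.* s) bound ⟩
      3 N.* (p N.* s N.+ p N.* K) N.+ 16 N.* s N.+ 12 N.* s ≡⟨ lem₂ p s K ⟩
      3 N.* (p N.* s) N.+ (3 N.* K N.* p N.+ 28 N.* s) ∎)
      where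
      lem₁ : ∀ p s → 3 N.* (p N.* s) N.+ p N.* s ≡ 4 N.* p N.* s
      lem₁ = solve-∀
      lem₂ : ∀ p s K → 3 N.* (p N.* s N.+ p N.* K) N.+ 16 N.* s N.+ 12 N.* s ≡ 3 N.* (p N.* s) N.+ (3 N.* K N.* p N.+ 28 N.* s)
      lem₂ = solve-∀
    29p≤28s : p N.+ 28 N.* p ≤ 28 N.* s
    29p≤28s = N.+-cancelˡ-≤ (3 N.* K N.* p) _ _ (begin
      3 N.* K N.* p N.+ (p N.+ 28 N.* p) ≡⟨ lem p K ⟩
      p N.* (3 N.* K N.+ 29) ≤⟨ N.*-monoʳ-≤ p big ⟩
      p N.* s ≤⟨ ps≤ ⟩
      3 N.* K N.* p N.+ 28 N.* s ∎)
      where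
      lem : ∀ p K → 3 N.* K N.* p N.+ (p N.+ 28 N.* p) ≡ p N.* (3 N.* K N.+ 29)
      lem = solve-∀

opaque
  -- A sum standing in for the maximum of all error constants used.
  totalConstant : ℕ → ℕ
  totalConstant d = (collisionConstant₂ d N.+ collisionConstant₄ d) N.+ (patternConstant d 2 N.+ patternConstant d 3 N.+ patternConstant d 4 N.+ patternConstant d 5)

  coll≤total : ∀ d → collisionConstant₂ d N.+ collisionConstant₄ d ≤ totalConstant d
  coll≤total d = N.m≤m+n (collisionConstant₂ d N.+ collisionConstant₄ d) _

  pat₂≤total : ∀ d → patternConstant d 2 ≤ totalConstant d
  pat₂≤total d = ((N.m≤m+n _ (patternConstant d 3)) ⟫ (N.m≤m+n _ (patternConstant d 4)) ⟫ (N.m≤m+n _ (patternConstant d 5))) ⟫ (N.m≤n+m _ (collisionConstant₂ d N.+ collisionConstant₄ d))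

  pat₃≤total : ∀ d → patternConstant d 3 ≤ totalConstant d
  pat₃≤total d = ((N.m≤n+m _ (patternConstant d 2)) ⟫ (N.m≤m+n _ (patternConstant d 4)) ⟫ (N.m≤m+n _ (patternConstant d 5))) ⟫ (N.m≤n+m _ (collisionConstant₂ d N.+ collisionConstant₄ d))

  pat₄≤total : ∀ d → patternConstant d 4 ≤ totalConstant d
  pat₄≤total d = ((N.m≤n+m _ (patternConstant d 2 N.+ patternConstant d 3)) ⟫ (N.m≤m+n _ (patternConstant d 5))) ⟫ (N.m≤n+m _ (collisionConstant₂ d N.+ collisionConstant₄ d))

  pat₅≤total : ∀ d → patternConstant d 5 ≤ totalConstant d
  pat₅≤total d = (N.m≤n+m _ (patternConstant d 2 N.+ patternConstant d 3 N.+ patternConstant d 4)) ⟫ (N.m≤n+m _ (collisionConstant₂ d N.+ collisionConstant₄ d))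

-- The first summand feeds the numerical lemmas; the second, with d^5 = d · d^4, excludes n < d^4.
threshold : ℕ → ℕ
threshold d = (d N.+ 1) N.* (32 N.* (totalConstant d N.+ 2)) N.+ d N.^ 5 N.* (totalConstant d N.+ 2) N.+ 30

factorConstant : ℕ → ℕ
factorConstant d = 4 N.* d N.* (totalConstant d N.+ 1)

-- Both factors have order √p

module FactorTheory {p : ℕ} (F : PrimeField p) (d M : ℕ) (dM : suc (d N.* M) ≡ p) (2≤d : 2 ≤ d) (0<M : 0 < M) where
  0<d : 0 < d
  0<d = N.<-trans (s≤s z≤n) 2≤d
  open FieldTheory F
  open ResiduePatterns F d M dM 0<d 0<M
  open ExactTheory F M using (exact-bound)

  -- The default 0 is used on purpose: position `length xs` supplies the extra constant form 1 + 0 x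
  -- in `product-bound`.
  nth : List Carrier → ℕ → Carrier
  nth [] _ = 0#
  nth (x ∷ xs) zero = x
  nth (x ∷ xs) (suc i) = nth xs i

  nth-end : ∀ xs → nth xs (length xs) ≈ 0#
  nth-end [] = refl
  nth-end (x ∷ xs) = nth-end xs

  nth-All : ∀ {Q : Carrier → Set} {xs} → All Q xs → ∀ i → i < length xs → Q (nth xs i)
  nth-All (q ∷ qs) zero _ = q
  nth-All (q ∷ qs) (suc i) (s≤s h) = nth-All qs i h

  nth-< : ∀ {xs} → AllPairs _≉_ xs → ∀ i j → i < j → j < length xs → nth xs i ≉ nth xs j
  nth-< (n ∷ ap) zero (suc j) _ (s≤s h) = nth-All n j h
  nth-< (n ∷ ap) (suc i) (suc j) (s≤s l) (s≤s h) = nth-< ap i j l h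

  good : ∀ {xs} → AllPairs _≉_ xs → All (_≉ 0#) xs → Good (length xs) (nth xs)
  good {xs} ap nz = nth-All nz , ne
    where
    ne : ∀ i j → i < length xs → j < length xs → i ≢ j → nth xs i ≉ nth xs j
    ne i j i< j< i≢j with N.<-cmp i j
    ... | tri< l _ _ = nth-< ap i j l j<
    ... | tri≈ _ e _ = ⊥-elim (i≢j e)
    ... | tri> _ _ l = λ e → nth-< ap j i l i< (sym e)

  good-≤ : ∀ {k n a} → k ≤ n → Good n a → Good k a
  good-≤ le (nz , ne) = (λ i h → nz i (N.<-≤-trans h le)) , (λ i j h h′ → ne i j (N.<-≤-trans h le) (N.<-≤-trans h′ le))

  -- Of 1 + a b being a nonzero d-th power, this keeps the equation (1 + a b)^M = 1.
  Compatible : List Carrier → List Carrier → Set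
  Compatible As Bs = All (λ a → All (λ b → u a b ^ M ≈ 1#) Bs) As

  compatible-swap : ∀ {As Bs} → Compatible As Bs → Compatible Bs As
  compatible-swap {As} {[]} h = []
  compatible-swap {As} {b ∷ Bs} h = All.map (λ { {a} (e ∷ _) → trans (^-congˡ M (+-congˡ (*-comm b a))) e }) h ∷ compatible-swap (All.map (λ { (_ ∷ es) → es }) h)

  nth-compatible : ∀ {As Bs} → Compatible As Bs → All (λ b → ∀ i → i < length As → u (nth As i) b ^ M ≈ 1#) Bs
  nth-compatible h = All.map (λ es → λ i l → trans (^-congˡ M (+-congˡ (*-comm _ _))) (nth-All es i l)) (compatible-swap h)

  record Side (xs : List Carrier) : Set where
    field
      distinct : AllPairs _≉_ xs
      nonzero : All (_≉ 0#) xs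
      two : 2 ≤ length xs
  open Side

  -- With n + 1 coefficients, those of A and 0, and m + 1 points, those of B and 0, `exact-bound`
  -- reads (m + 1) n < n + M.
  product-bound : ∀ {As Bs} → Side As → Side Bs → Compatible As Bs → length As N.* length Bs < M
  product-bound {[]} {Bs} sA sB h = ⊥-elim (N.<⇒≱ (s≤s z≤n) (two sA))
  product-bound {a ∷ As} {[]} sA sB h = ⊥-elim (N.<⇒≱ (s≤s z≤n) (two sB))
  product-bound {As₀@(a ∷ As)} {Bs₀@(b ∷ Bs)} sA sB h = N.+-cancelˡ-< (suc K) _ _ (≡.subst (_< suc K N.+ M) (≡.cong (suc K N.+_) (N.*-comm (length Bs₀) (suc K)))
      (exact-bound K (nth As₀) (0# ∷ Bs₀) dist (All.map (λ ne e → ne (sym e)) (nonzero sB) ∷ distinct sB) (at-zero ∷ All.map at-point (nth-compatible h)) 0<M small))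
    where
    K : ℕ
    K = length As
    dist : ∀ i j → i < j → j < suc (suc K) → nth As₀ i ≉ nth As₀ j
    dist i j i<j j< with N.m≤n⇒m<n∨m≡n (N.s≤s⁻¹ j<)
    ... | inj₁ l = nth-< (distinct sA) i j i<j l
    ... | inj₂ ≡.refl = λ e → nth-All (nonzero sA) i i<j (trans e (nth-end As₀))
    at-zero : ∀ t → t < suc (suc K) → (1# + nth As₀ t * 0#) ^ M ≈ 1#
    at-zero t _ = trans (^-congˡ M (trans (+-congˡ (zeroʳ _)) (+-identityʳ 1#))) (1^ M)
    at-point : ∀ {b} → (∀ i → i < suc K → u (nth As₀ i) b ^ M ≈ 1#) → ∀ t → t < suc (suc K) → (1# + nth As₀ t * b) ^ M ≈ 1#
    at-point f t t< with N.m≤n⇒m<n∨m≡n (N.s≤s⁻¹ t<)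
    ... | inj₁ l = f t l
    ... | inj₂ ≡.refl = trans (^-congˡ M (trans (+-congˡ (trans (*-congʳ (nth-end As₀)) (zeroˡ _))) (+-identityʳ 1#))) (1^ M)
    b≉0 : b ≉ 0#
    b≉0 = All.head (nonzero sB)
    n≤M : suc K ≤ M
    n≤M = ≡.subst (_≤ M) (length-map (λ a → u a b) As₀) (power-roots M 1# (map (λ a → u a b) As₀) 0<M
      (AP.map⁺ (AllPairs.map (λ {x} {y} ne e → ne (*-cancelˡ b≉0 (trans (*-comm b x) (trans (cancel1 e) (*-comm y b))))) (distinct sA))) (AllP.map⁺ (All.map All.head h)))
      where
      cancel1 : ∀ {x y} → 1# + x ≈ 1# + y → x ≈ y
      cancel1 {x} {y} e = trans (S.solve 2 (λ o x → x S.:= (o S.:+ x) S.:+ S.:- o) refl 1# x) (trans (+-congʳ e) (S.solve 2 (λ o x → (o S.:+ x) S.:+ S.:- o S.:= x) refl 1# y))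
    small : K N.+ M < p
    small = N.<-≤-trans (N.+-monoˡ-≤ M n≤M) (N.≤-reflexive (≡.cong (M N.+_) (≡.sym (N.+-identityʳ M))) ⟫ (N.*-monoˡ-≤ M 2≤d) ⟫ (N.n≤1+n _) ⟫ N.≤-reflexive dM)

  -- The elements of (S − 1) \ {0}, each represented as a product.
  record Target (As Bs Ts : List Carrier) : Set where
    field
      distinctT : AllPairs _≉_ Ts
      manyT : M ≤ suc (length Ts)
      nonzeroT : All (_≉ 0#) Ts
      powerT : All (λ t → u 1# t ^ M ≈ 1#) Ts
      productT : All (λ t → Any (λ a → Any (λ b → t ≈ a * b) Bs) As) Ts
  open Target

  any-product : ∀ {t} {As Bs : List Carrier} → Any (λ a → Any (λ b → t ≈ a * b) Bs) As → Any (t ≈_) (cartesianProductWith _*_ As Bs)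
  any-product (here m) = AnyP.++⁺ˡ (AnyP.map⁺ m)
  any-product {As = a ∷ As} {Bs} (there m) = AnyP.++⁺ʳ (map (a *_) Bs) (any-product m)

  product-≥ : ∀ {As Bs Ts} → Target As Bs Ts → M ≤ suc (length As N.* length Bs)
  product-≥ {As} {Bs} {Ts} T = manyT T ⟫ (s≤s ((length≤ Ts (cartesianProductWith _*_ As Bs) (distinctT T)
      (All.map any-product (productT T))) ⟫ N.≤-reflexive (length-cartesianProductWith _*_ As Bs)))

  totalConst : ℕ
  totalConst = totalConstant d

  module _ (s : ℕ) (s²≤p : s N.* s ≤ p) (big : threshold d ≤ s) where

    K+2≤s : totalConst N.+ 2 ≤ s
    K+2≤s = (((N.m≤n*m _ (d N.^ 5) {{N.m^n≢0 d 5}}) ⟫ (N.m≤n+m _ ((d N.+ 1) N.* (32 N.* (totalConst N.+ 2))))) ⟫ (N.m≤m+n _ 30)) ⟫ big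

    linear≤s : (d N.+ 1) N.* (32 N.* (totalConst N.+ 2)) ≤ s
    linear≤s = ((N.m≤m+n _ _) ⟫ (N.m≤m+n _ 30)) ⟫ big

    power≤s : d N.^ 5 N.* (totalConst N.+ 2) ≤ s
    power≤s = ((N.m≤n+m _ ((d N.+ 1) N.* (32 N.* (totalConst N.+ 2)))) ⟫ (N.m≤m+n _ 30)) ⟫ big

    const<s : ∀ {c} → c ≤ totalConst → c < s
    const<s le = N.<-≤-trans (s≤s le) (N.≤-reflexive (N.+-comm 1 totalConst) ⟫ N.+-monoʳ-≤ totalConst (N.n≤1+n 1) ⟫ K+2≤s)

    pattern-total : ∀ k a (ε : ℕ → Carrier) → patternConst k ≤ totalConst → Good k a → (∀ i → i < k → ε i ≉ 0#) →
      ∀ xs → AllPairs _≉_ xs → All (λ x → ∀ i → i < k → u (a i) x ^ M ≈ ε i) xs →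
      d N.^ k N.* length xs N.* s ≤ p N.* s N.+ p N.* totalConst
    pattern-total k a ε le good εnz xs ap h = (pattern-bound k a ε s good εnz s²≤p (const<s le) xs ap h) ⟫ N.+-monoʳ-≤ (p N.* s) (N.*-monoʳ-≤ p le)

    module _ {As Bs : List Carrier} (sA : Side As) (sB : Side Bs) (comp : Compatible As Bs) (nm : suc (length As N.* length Bs) ≡ M) where

      n m : ℕ
      n = length As
      m = length Bs

      p≡ : p ≡ d N.* m N.* n N.+ (d N.+ 1)
      p≡ = ≡.trans (≡.sym dM) (≡.trans (≡.cong (λ M → suc (d N.* M)) (≡.sym nm)) (lem d n m))
        where
        lem : ∀ d n m → suc (d N.* suc (n N.* m)) ≡ d N.* m N.* n N.+ (d N.+ 1)
        lem = solve-∀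

      -- Already k of the forms confine B to density d^(-k), which is less than the density 1/(d n)
      -- forced by the product of the sizes.
      few : ∀ k → patternConst k ≤ totalConst → k ≤ n → d N.* n N.+ 1 ≤ d N.^ k → n < d N.^ 4 → ⊥
      few k le k≤n dn<d^k n<d⁴ = N.<⇒≱ (N.<-≤-trans (N.*-monoˡ-< (totalConst N.+ 1) {{N.>-nonZero (N.m≤n+m 1 totalConst)}} (N.*-monoʳ-< d n<d⁴))
          (N.*-monoʳ-≤ (d N.^ 5) (N.+-monoʳ-≤ totalConst (N.n≤1+n 1)) ⟫ power≤s))
        (few-impossible d n m s p totalConst (d N.^ k) p≡ dn<d^k
          (pattern-total k (nth As) (λ _ → 1#) le (good-≤ k≤n (good (distinct sA) (nonzero sA))) (λ _ _ → 1≉0) Bs (distinct sB) (All.map (λ h i l → h i (N.<-≤-trans l k≤n)) (nth-compatible comp)))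
          s²≤p (N.*-mono-≤ (N.*-mono-≤ 0<d (N.<⇒≤ (two sB))) (N.<⇒≤ (two sA)))
          (N.*-monoʳ-≤ (d N.+ 1) (N.m≤n*m (totalConst N.+ 2) 32) ⟫ linear≤s))

      many : 16 ≤ n → d N.^ 4 ≤ n → s ≤ factorConstant d N.* n
      many 16≤n d⁴≤n = many-bound d d′ n m s p totalConst N 0<d (N.s≤s⁻¹ (2≤d ⟫ N.≤-reflexive (≡.sym suc-d′))) (length-pairs n) 16≤n 4d²≤n p≡
          (collision-bound Bs (distinct sB) (nth-compatible comp) ⟫ N.+-monoˡ-≤ (s N.* n N.* (N N.* N)) (N.+-monoʳ-≤ (N N.* (d N.* s N.* p)) (N.*-monoʳ-≤ (N N.* N) (N.*-monoʳ-≤ p (coll≤total d)))))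
          s²≤p (N.*-monoʳ-≤ (d N.+ 1) (N.m≤m*n 32 (totalConst N.+ 2) {{N.>-nonZero (s≤s z≤n ⟫ N.m≤n+m 2 totalConst)}}) ⟫ linear≤s)
        where
        open Collisions n (nth As) (good (distinct sA) (nonzero sA)) s s²≤p (const<s (coll≤total d))
        4d²≤n : 4 N.* (d N.* d) ≤ n
        4d²≤n = N.*-monoˡ-≤ (d N.* d) (N.*-mono-≤ 2≤d 2≤d) ⟫ N.≤-reflexive (lem d) ⟫ d⁴≤n
          where
          lem : ∀ d → d N.* d N.* (d N.* d) ≡ d N.* (d N.* (d N.* (d N.* 1)))
          lem = solve-∀

      module _ {Ts : List Carrier} (T : Target As Bs Ts) where

        -- For d = 2 and |A| = 2 the sizes alone are consistent; instead every y in the target satisfies one of three patterns of density 1/8.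
        exceptional : d ≡ 2 → n ≡ 2 → ⊥
        exceptional d≡2 n≡2 = exceptional-impossible p M (length Ts) s totalConst (≡.trans (≡.sym dM) (≡.cong (λ d → suc (d N.* M)) d≡2)) (manyT T) s≤p
            (room d totalConst s linear≤s) (count (t ≟ t′))
          where
          s≤p : s ≤ p
          s≤p = N.m≤m*n s s {{N.>-nonZero ((s≤s z≤n ⟫ N.m≤n+m 2 totalConst) ⟫ K+2≤s)}} ⟫ s²≤p
          R : ℕ
          R = p N.* s N.+ p N.* totalConst
          0<n : 0 < n
          0<n = N.<⇒≤ (two sA)
          a₀ a₁ : Carrier
          a₀ = nth As 0
          a₁ = nth As 1
          a₀≉0 : a₀ ≉ 0#
          a₀≉0 = nth-All (nonzero sA) 0 0<n
          a₁≉0 : a₁ ≉ 0#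
          a₁≉0 = nth-All (nonzero sA) 1 (two sA)
          a₀≉a₁ : a₀ ≉ a₁
          a₀≉a₁ = nth-< (distinct sA) 0 1 (s≤s z≤n) (two sA)
          i₀ i₁ t t′ : Carrier
          i₀ = proj₁ (inverse a₀ a₀≉0)
          i₁ = proj₁ (inverse a₁ a₁≉0)
          -- If y = a₀ b then 1 + t y = 1 + a₁ b, and if y = a₁ b then 1 + t′ y = 1 + a₀ b. So each
          -- target lies in the class of 1 for one of these two forms, besides 1 + y.
          t = a₁ * i₀
          t′ = a₀ * i₁
          ratio : ∀ {a b i} → a * i ≈ 1# → (b * i) * a ≈ b
          ratio {a} {b} {i} e = trans (S.solve 3 (λ a b i → (b S.:* i) S.:* a S.:= b S.:* (a S.:* i)) refl a b i) (trans (*-congˡ e) (*-identityʳ b))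
          t*a₀ : t * a₀ ≈ a₁
          t*a₀ = ratio (proj₂ (inverse a₀ a₀≉0))
          t′*a₁ : t′ * a₁ ≈ a₀
          t′*a₁ = ratio (proj₂ (inverse a₁ a₁≉0))
          t≉0 : t ≉ 0#
          t≉0 e = a₁≉0 (trans (sym t*a₀) (trans (*-congʳ e) (zeroˡ _)))
          t′≉0 : t′ ≉ 0#
          t′≉0 e = a₀≉0 (trans (sym t′*a₁) (trans (*-congʳ e) (zeroˡ _)))
          t≉1 : 1# ≉ t
          t≉1 e = a₀≉a₁ (trans (sym (*-identityˡ _)) (trans (*-congʳ e) t*a₀))
          t′≉1 : 1# ≉ t′
          t′≉1 e = a₀≉a₁ (sym (trans (sym (*-identityˡ _)) (trans (*-congʳ e) t′*a₁)))
          One : Carrier → Carrier → Set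
          One c y = u c y ^ M ≈ 1#
          shift : ∀ {y a a′ c} → c * a ≈ a′ → All (λ b → One a′ b) Bs → Any (λ b → y ≈ a * b) Bs → One c y
          shift {y} {a} {a′} {c} e all m with All.lookupAny all m
          ... | one , y≈ = trans (^-congˡ M (+-congˡ (trans (*-congˡ y≈) (trans (sym (*-assoc c a _)) (*-congʳ e))))) one
          first-two : ∀ {Q : Carrier → Set} As → length As ≡ 2 → Any Q As → Q (nth As 0) ⊎ Q (nth As 1)
          first-two (x ∷ y ∷ []) _ (here q) = inj₁ q
          first-two (x ∷ y ∷ []) _ (there (here q)) = inj₂ q
          either : ∀ {y} → Any (λ a → Any (λ b → y ≈ a * b) Bs) As → One t y ⊎ One t′ y
          either m with first-two As n≡2 m
          ... | inj₁ m₀ = inj₁ (shift t*a₀ (nth-All comp 1 (two sA)) m₀)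
          ... | inj₂ m₁ = inj₂ (shift t′*a₁ (nth-All comp 0 0<n) m₁)
          cases : All (λ y → One 1# y × (One t y ⊎ One t′ y)) Ts
          cases = All.zip (powerT T , All.map either (productT T))
          eight : d N.^ 3 ≡ 8
          eight = ≡.cong (N._^ 3) d≡2
          four : d N.^ 2 ≡ 4
          four = ≡.cong (N._^ 2) d≡2
          count : Dec (t ≈ t′) → 8 N.* length Ts N.* s ≤ 3 N.* R N.+ 16 N.* s
          -- The two alternatives coincide, so a single pattern of two forms, of density 1/4, covers
          -- the target.
          count (yes t≈t′) = N.≤-reflexive (lem (length Ts) s) ⟫ (N.≤-trans (N.*-monoʳ-≤ 2 (≡.subst (λ k → k N.* length Ts N.* s ≤ R) four
              (pattern-total 2 (nth (1# ∷ t ∷ [])) (λ _ → 1#) (pat₂≤total d) (good ((t≉1 ∷ []) ∷ [] ∷ []) (1≉0 ∷ t≉0 ∷ [])) (λ _ _ → 1≉0) Ts (distinctT T) (All.map point cases))))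
              (N.*-monoˡ-≤ R (N.n≤1+n 2) ⟫ (N.m≤m+n (3 N.* R) _)))
            where
            lem : ∀ l s → 8 N.* l N.* s ≡ 2 N.* (4 N.* l N.* s)
            lem = solve-∀
            point : ∀ {y} → One 1# y × (One t y ⊎ One t′ y) → ∀ i → i < 2 → u (nth (1# ∷ t ∷ []) i) y ^ M ≈ 1#
            point (o , _) 0 _ = o
            point (_ , inj₁ o) 1 _ = o
            point (_ , inj₂ o) 1 _ = trans (^-congˡ M (+-congˡ (*-congʳ t≈t′))) o
            point _ (suc (suc _)) (s≤s (s≤s ()))
          count (no t≉t′) = combine (length Ts) (length (T₁ 1# 1#)) (length (T₁ 1# (- 1#))) (length (T₁ (- 1#) 1#)) s R partition (bound 1≉0 1≉0) (bound 1≉0 -1≉0) (bound -1≉0 1≉0)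
            where
            pattern? : ∀ e e′ y → Dec ((u t y ^ M) ≈ e × (u t′ y ^ M) ≈ e′)
            pattern? e e′ y = ((u t y ^ M) ≟ e) ×-dec ((u t′ y ^ M) ≟ e′)
            T₁ : Carrier → Carrier → List Carrier
            T₁ e e′ = filter (pattern? e e′) Ts
            -1≉0 : - 1# ≉ 0#
            -1≉0 e = 1≉0 (trans (S.solve 1 (λ o → o S.:= S.:- (S.:- o)) refl 1#) (trans (-‿cong e) -0#≈0#))
            bound : ∀ {e e′} → e ≉ 0# → e′ ≉ 0# → 8 N.* length (T₁ e e′) N.* s ≤ R
            bound {e} {e′} ne ne′ = ≡.subst (λ k → k N.* length (T₁ e e′) N.* s ≤ R) eight
              (pattern-total 3 (nth (1# ∷ t ∷ t′ ∷ [])) (nth (1# ∷ e ∷ e′ ∷ [])) (pat₃≤total d) (good ((t≉1 ∷ t′≉1 ∷ []) ∷ (t≉t′ ∷ []) ∷ [] ∷ []) (1≉0 ∷ t≉0 ∷ t′≉0 ∷ []))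
                (λ { 0 _ → 1≉0 ; 1 _ → ne ; 2 _ → ne′ ; (suc (suc (suc _))) (s≤s (s≤s (s≤s ()))) })
                (T₁ e e′) (AP.filter⁺ (pattern? e e′) (distinctT T)) (All.zipWith (λ { (o , (q , q′)) → λ { 0 _ → o ; 1 _ → q ; 2 _ → q′ ; (suc (suc (suc _))) (s≤s (s≤s (s≤s ()))) } })
                  (AllP.filter⁺ (pattern? e e′) (powerT T) , AllP.all-filter (pattern? e e′) Ts)))
            r r′ : Carrier
            r = - proj₁ (inverse t t≉0)
            r′ = - proj₁ (inverse t′ t′≉0)
            root : ∀ c (nc : c ≉ 0#) {y} → u c y ≈ 0# → - proj₁ (inverse c nc) ≈ y
            root c nc {y} e = sym (*-cancelˡ nc (trans (S.solve 2 (λ o y → y S.:= (o S.:+ y) S.:+ S.:- o) refl 1# (c * y))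
              (trans (+-cong e (-‿cong (sym (proj₂ (inverse c nc))))) (trans (+-identityˡ _) (S.solve 2 (λ a y → S.:- (a S.:* y) S.:= a S.:* S.:- y) refl c _)))))
            sign : ∀ {w} → w ≉ 0# → (w ^ M) ≈ 1# ⊎ (w ^ M) ≈ - 1#
            sign {w} nw = decide ((w ^ M) ≟ 1#)
              where
              square : (w ^ M) * (w ^ M) ≈ 1# * 1#
              square = trans (*-congˡ (sym (*-identityʳ _))) (trans (trans (reflexive (≡.cong ((w ^ M) ^_) (≡.sym d≡2))) (unit-power′ nw)) (sym (*-identityʳ 1#)))
              difference-of-squares : ((w ^ M) + - 1#) * ((w ^ M) + 1#) ≈ 0#
              difference-of-squares = trans (S.solve 2 (λ o w → (w S.:+ S.:- o) S.:* (w S.:+ o) S.:= w S.:* w S.:+ S.:- (o S.:* o)) refl 1# (w ^ M)) (x≈y⇒x-y≈0 _ _ square)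
              decide : Dec ((w ^ M) ≈ 1#) → (w ^ M) ≈ 1# ⊎ (w ^ M) ≈ - 1#
              decide (yes e) = inj₁ e
              decide (no ne) = inj₂ (trans (S.solve 2 (λ o w → w S.:= (w S.:+ o) S.:+ S.:- o) refl 1# (w ^ M)) (trans (+-congʳ (integral {(w ^ M) + - 1#} difference-of-squares (λ z → ne (x-y≈0⇒x≈y _ _ z)))) (+-identityˡ _)))
            g₁ g₂ g₃ g₄ g₅ : Carrier → ℕ
            g₁ y = ⟦ pattern? 1# 1# y ⟧
            g₂ y = ⟦ pattern? 1# (- 1#) y ⟧
            g₃ y = ⟦ pattern? (- 1#) 1# y ⟧
            g₄ y = ⟦ r ≟ y ⟧
            g₅ y = ⟦ r′ ≟ y ⟧
            open N.≤-Reasoning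
            hit₁ : ∀ y → 1 ≤ g₁ y → 1 ≤ g₁ y N.+ (g₂ y N.+ (g₃ y N.+ (g₄ y N.+ g₅ y)))
            hit₁ y h = h ⟫ (N.m≤m+n _ _)
            hit₂ : ∀ y → 1 ≤ g₂ y → 1 ≤ g₁ y N.+ (g₂ y N.+ (g₃ y N.+ (g₄ y N.+ g₅ y)))
            hit₂ y h = (h ⟫ (N.m≤m+n _ _)) ⟫ (N.m≤n+m _ (g₁ y))
            hit₃ : ∀ y → 1 ≤ g₃ y → 1 ≤ g₁ y N.+ (g₂ y N.+ (g₃ y N.+ (g₄ y N.+ g₅ y)))
            hit₃ y h = ((h ⟫ (N.m≤m+n _ _)) ⟫ (N.m≤n+m _ (g₂ y))) ⟫ (N.m≤n+m _ (g₁ y))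
            hit₄ : ∀ y → 1 ≤ g₄ y N.+ g₅ y → 1 ≤ g₁ y N.+ (g₂ y N.+ (g₃ y N.+ (g₄ y N.+ g₅ y)))
            hit₄ y h = ((h ⟫ (N.m≤n+m _ (g₃ y))) ⟫ (N.m≤n+m _ (g₂ y))) ⟫ (N.m≤n+m _ (g₁ y))
            one≤ : ∀ {A : Set} (a : Dec A) → A → 1 ≤ ⟦ a ⟧
            one≤ a x = N.≤-reflexive (≡.sym (⟦⟧-yes a x))
            each : ∀ y → One t y ⊎ One t′ y → 1 ≤ g₁ y N.+ (g₂ y N.+ (g₃ y N.+ (g₄ y N.+ g₅ y)))
            each y (inj₁ o) = decide (u t′ y ≟ 0#)
              where
              signed : One t′ y ⊎ (u t′ y ^ M) ≈ - 1# → 1 ≤ g₁ y N.+ (g₂ y N.+ (g₃ y N.+ (g₄ y N.+ g₅ y)))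
              signed (inj₁ o′) = hit₁ y (one≤ (pattern? 1# 1# y) (o , o′))
              signed (inj₂ o′) = hit₂ y (one≤ (pattern? 1# (- 1#) y) (o , o′))
              decide : Dec (u t′ y ≈ 0#) → 1 ≤ g₁ y N.+ (g₂ y N.+ (g₃ y N.+ (g₄ y N.+ g₅ y)))
              decide (yes z) = hit₄ y (one≤ (r′ ≟ y) (root t′ t′≉0 z) ⟫ (N.m≤n+m _ (g₄ y)))
              decide (no nz) = signed (sign nz)
            each y (inj₂ o) = decide (u t y ≟ 0#)
              where
              signed : One t y ⊎ (u t y ^ M) ≈ - 1# → 1 ≤ g₁ y N.+ (g₂ y N.+ (g₃ y N.+ (g₄ y N.+ g₅ y)))
              signed (inj₁ o′) = hit₁ y (one≤ (pattern? 1# 1# y) (o′ , o))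
              signed (inj₂ o′) = hit₃ y (one≤ (pattern? (- 1#) 1# y) (o′ , o))
              decide : Dec (u t y ≈ 0#) → 1 ≤ g₁ y N.+ (g₂ y N.+ (g₃ y N.+ (g₄ y N.+ g₅ y)))
              decide (yes z) = hit₄ y (one≤ (r ≟ y) (root t t≉0 z) ⟫ (N.m≤m+n _ (g₅ y)))
              decide (no nz) = signed (sign nz)
            -- Each of the two forms has one zero, at which its M-th power is neither 1 nor -1;
            -- these points account for the summand 2.
            partition : length Ts ≤ length (T₁ 1# 1#) N.+ (length (T₁ 1# (- 1#)) N.+ (length (T₁ (- 1#) 1#) N.+ 2))
            partition = begin
              length Ts ≡⟨ ≡.trans (≡.sym (N.*-identityʳ _)) (≡.sym (Σ-const 1 Ts)) ⟩
              Σ[ Ts ] (λ _ → 1) ≤⟨ Σ-mono Ts (All.map (λ {y} (_ , e) → each y e) cases) ⟩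
              Σ[ Ts ] (λ y → g₁ y N.+ (g₂ y N.+ (g₃ y N.+ (g₄ y N.+ g₅ y))))
                ≡⟨ ≡.trans (Σ-+ g₁ _ Ts) (≡.cong (Σ[ Ts ] g₁ N.+_) (≡.trans (Σ-+ g₂ _ Ts) (≡.cong (Σ[ Ts ] g₂ N.+_) (≡.trans (Σ-+ g₃ _ Ts) (≡.cong (Σ[ Ts ] g₃ N.+_) (Σ-+ g₄ g₅ Ts)))))) ⟩
              Σ[ Ts ] g₁ N.+ (Σ[ Ts ] g₂ N.+ (Σ[ Ts ] g₃ N.+ (Σ[ Ts ] g₄ N.+ Σ[ Ts ] g₅)))
                ≤⟨ N.+-mono-≤ (N.≤-reflexive (≡.sym (length-filter (pattern? 1# 1#) Ts))) (N.+-mono-≤ (N.≤-reflexive (≡.sym (length-filter (pattern? 1# (- 1#)) Ts)))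
                     (N.+-mono-≤ (N.≤-reflexive (≡.sym (length-filter (pattern? (- 1#) 1#) Ts))) (N.+-mono-≤ (Σ-single r Ts (distinctT T)) (Σ-single r′ Ts (distinctT T))))) ⟩
              length (T₁ 1# 1#) N.+ (length (T₁ 1# (- 1#)) N.+ (length (T₁ (- 1#) 1#) N.+ 2)) ∎

        -- For n < d^4 the plan is to use k = min(n, 5) forms, which works when d n + 1 ≤ d^k. The
        -- only failure is d = n = 2; larger n are handled by collisions.
        large-factor : s ≤ factorConstant d N.* n
        large-factor with d N.^ 4 N.≤? n
        ... | yes d⁴≤n = many ((N.^-monoˡ-≤ 4 2≤d) ⟫ d⁴≤n) d⁴≤n
        ... | no d⁴≰n = ⊥-elim (small n ≡.refl)
          where
          n<d⁴ : n < d N.^ 4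
          n<d⁴ = N.≰⇒> d⁴≰n
          small : ∀ k → k ≡ n → ⊥
          small 0 e = N.<⇒≱ (s≤s z≤n) (two sA ⟫ N.≤-reflexive (≡.sym e))
          small 1 e = N.<⇒≱ N.≤-refl (two sA ⟫ N.≤-reflexive (≡.sym e))
          small 2 e with d N.≟ 2
          ... | yes d≡2 = exceptional d≡2 (≡.sym e)
          ... | no d≢2 = few 2 (pat₂≤total d) (N.≤-reflexive e) (≡.subst (λ n → d N.* n N.+ 1 ≤ d N.^ 2) e ((N.+-monoʳ-≤ (d N.* 2) 0<d) ⟫ N.≤-reflexive (lem d) ⟫ N.*-monoʳ-≤ d (N.*-monoˡ-≤ 1 (N.≤∧≢⇒< 2≤d (λ q → d≢2 (≡.sym q)))))) n<d⁴
            where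
            lem : ∀ d → d N.* 2 N.+ d ≡ d N.* (3 N.* 1)
            lem = solve-∀
          small 3 e = few 3 (pat₃≤total d) (N.≤-reflexive e) (≡.subst (λ n → d N.* n N.+ 1 ≤ d N.^ 3) e ((N.+-monoʳ-≤ (d N.* 3) 0<d) ⟫ N.≤-reflexive (lem d) ⟫ N.*-monoʳ-≤ d (N.*-mono-≤ 2≤d (N.*-monoˡ-≤ 1 2≤d)))) n<d⁴
            where
            lem : ∀ d → d N.* 3 N.+ d ≡ d N.* (2 N.* (2 N.* 1))
            lem = solve-∀
          small 4 e = few 4 (pat₄≤total d) (N.≤-reflexive e) (≡.subst (λ n → d N.* n N.+ 1 ≤ d N.^ 4) e (N.+-monoʳ-≤ (d N.* 4) (0<d ⟫ N.m≤m*n d 4) ⟫ N.≤-reflexive (lem d) ⟫ N.*-monoʳ-≤ d (N.*-mono-≤ 2≤d (N.*-mono-≤ 2≤d (N.*-monoˡ-≤ 1 2≤d))))) n<d⁴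
            where
            lem : ∀ d → d N.* 4 N.+ d N.* 4 ≡ d N.* (2 N.* (2 N.* (2 N.* 1)))
            lem = solve-∀
          small (suc (suc (suc (suc (suc k))))) e = few 5 (pat₅≤total d) (N.m≤m+n 5 k ⟫ N.≤-reflexive e)
            ((N.+-monoʳ-≤ (d N.* n) 0<d) ⟫ N.≤-reflexive (≡.trans (N.+-comm (d N.* n) d) (≡.sym (N.*-suc d n))) ⟫ N.*-monoʳ-≤ d n<d⁴) n<d⁴

-- From subsets of residues to lists in the field

module Decomposition where
  open import Data.Fin.Subset using (Subset; inside; outside; _∈_; ∣_∣)

  members : ∀ {n} → Subset n → List (Fin n)
  members [] = []
  members (inside ∷ A) = zero ∷ map suc (members A)
  members (outside ∷ A) = map suc (members A)

  length-members : ∀ {n} (A : Subset n) → length (members A) ≡ ∣ A ∣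
  length-members [] = ≡.refl
  length-members (inside ∷ A) = ≡.cong suc (≡.trans (length-map suc (members A)) (length-members A))
  length-members (outside ∷ A) = ≡.trans (length-map suc (members A)) (length-members A)

  members-∈ : ∀ {n} (A : Subset n) → All (_∈ A) (members A)
  members-∈ [] = []
  members-∈ (inside ∷ A) = here ∷ AllP.map⁺ (All.map there (members-∈ A))
  members-∈ (outside ∷ A) = AllP.map⁺ (All.map there (members-∈ A))

  members-distinct : ∀ {n} (A : Subset n) → AllPairs _≢_ (members A)
  members-distinct [] = []
  members-distinct (inside ∷ A) = AllP.map⁺ (All.universal (λ _ ()) (members A)) ∷ AP.map⁺ (AllPairs.map (λ ne e → ne (Fin.suc-injective e)) (members-distinct A))
  members-distinct (outside ∷ A) = AP.map⁺ (AllPairs.map (λ ne e → ne (Fin.suc-injective e)) (members-distinct A))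

  ∈⇒members : ∀ {n} {A : Subset n} {a} → a ∈ A → Any (a ≡_) (members A)
  ∈⇒members {A = inside ∷ A} here = here ≡.refl
  ∈⇒members {A = inside ∷ A} (there m) = there (AnyP.map⁺ (Any.map (≡.cong suc) (∈⇒members m)))
  ∈⇒members {A = outside ∷ A} (there m) = AnyP.map⁺ (Any.map (≡.cong suc) (∈⇒members m))

  mod-% : ∀ n p .{{_ : NonZero p}} → n mod⟨ p ⟩ ≡ n N.% p
  mod-% n (suc p) = ≡.refl

  √-exists : ∀ p → ∃[ s ] (s N.* s ≤ p × p < suc s N.* suc s)
  √-exists zero = 0 , z≤n , s≤s z≤n
  √-exists (suc p) with √-exists p
  ... | s , s²≤p , p<t² with suc s N.* suc s N.≤? suc p
  ... | yes h = suc s , h , N.≤-<-trans p<t² (N.*-mono-< (N.n<1+n (suc s)) (N.n<1+n (suc s)))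
  ... | no h = s , N.m≤n⇒m≤1+n s²≤p , N.≰⇒> h

  module Bridge (d p : ℕ) (2≤d : 2 ≤ d) (p-prime : Prime p) (M : ℕ) (p-1 : p N.∸ 1 ≡ M N.* d) (F : PrimeField p) where
    private
      instance
        p≢0 : NonZero p
        p≢0 = prime⇒nonZero p-prime

    1<p : 1 < p
    1<p = N.nonTrivial⇒n>1 p {{prime⇒nonTrivial p-prime}}

    suc-p-1 : suc (p N.∸ 1) ≡ p
    suc-p-1 = N.m+[n∸m]≡n (N.<⇒≤ 1<p)

    dM : suc (d N.* M) ≡ p
    dM = ≡.trans (≡.cong suc (≡.trans (N.*-comm d M) (≡.sym p-1))) suc-p-1

    0<M : 0 < M
    0<M = N.n≢0⇒n>0 (λ e → N.<⇒≢ 1<p (≡.trans (≡.sym (≡.cong suc (N.*-zeroʳ d))) (≡.trans (≡.cong (λ M → suc (d N.* M)) (≡.sym e)) dM)))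

    open FieldTheory F hiding (eq)
    open FactorTheory F d M dM 2≤d 0<M
    open ResiduePatterns F d M dM 0<d 0<M hiding (M≤powers)
    open BoundTheory F d M dM using (×-injective)

    ι : ℕ → Carrier
    ι n = n ×ₙ 1#

    ⟪_⟫ : Fin p → Carrier
    ⟪ a ⟫ = ι (toℕ a)

    list : Subset p → List Carrier
    list A = map ⟪_⟫ (members A)

    ι-^ : ∀ n k → ι (n N.^ k) ≈ ι n ^ k
    ι-^ n zero = +-identityʳ 1#
    ι-^ n (suc k) = trans (×1-homo-* n (n N.^ k)) (*-congˡ (ι-^ n k))

    ι-% : ∀ n → ι (n N.% p) ≈ ι n
    ι-% n = sym (trans (reflexive (≡.cong ι (N.m≡m%n+[m/n]*n n p))) (trans (×-homo-+ 1# (n N.% p) _) (trans (+-congˡ (trans (×1-homo-* (n N./ p) p) (trans (*-congˡ char) (zeroʳ _)))) (+-identityʳ _))))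

    ι-mod : ∀ n → ι (n mod⟨ p ⟩) ≈ ι n
    ι-mod n = trans (reflexive (≡.cong ι (mod-% n p))) (ι-% n)

    rep : Carrier → ℕ
    rep x = proj₁ (generated x) N.% p

    rep<p : ∀ x → rep x < p
    rep<p x = N.m%n<n _ p

    residue : ∀ x → x ≈ ι (rep x)
    residue x = trans (sym (proj₂ (generated x))) (sym (ι-% _))

    side : ∀ A → NonzeroSubset p A → 2 ≤ ∣ A ∣ → Side (list A)
    side A nz two = record
      { distinct = AP.map⁺ (AllPairs.map (λ ne e → ne (Fin.toℕ-injective (×-injective (Fin.toℕ<n _) (Fin.toℕ<n _) e))) (members-distinct A))
      ; nonzero = AllP.map⁺ (All.map (λ {a} a∈A e → nz a a∈A (×-injective (Fin.toℕ<n a) p>0 e)) (members-∈ A))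
      ; two = ≡.subst (2 ≤_) (≡.sym (≡.trans (length-map ⟪_⟫ (members A)) (length-members A))) two }

    pred-≈ : ∀ s → ι (s N.+ (p N.∸ 1)) ≈ ι s + - 1#
    pred-≈ s = trans (×-homo-+ 1# s (p N.∸ 1)) (+-congˡ (trans (S.solve 2 (λ o x → x S.:= (o S.:+ x) S.:+ S.:- o) refl 1# (ι (p N.∸ 1)))
      (trans (+-congʳ (trans (reflexive (≡.cong ι suc-p-1)) char)) (+-identityˡ _))))

    InT⇒power : ∀ {r} → InT d p r → ∃[ x ] (x ≉ 0# × 1# + ι r ≈ x ^ d)
    InT⇒power {r} (_ , s , (x , 1≤x , x<p , xd) , sr) = ι x , (λ e → N.<⇒≢ 1≤x (≡.sym (×-injective x<p p>0 e))) ,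
      trans (+-congˡ (trans (reflexive (≡.cong ι (≡.sym sr))) (trans (ι-mod _) (pred-≈ s)))) (trans (S.solve 2 (λ o s → o S.:+ (s S.:+ S.:- o) S.:= s) refl 1# (ι s))
        (trans (reflexive (≡.cong ι (≡.sym xd))) (trans (ι-mod (x N.^ d)) (ι-^ x d))))

    power⇒InT : ∀ {r x} → r < p → r ≢ 0 → x ≉ 0# → 1# + ι r ≈ x ^ d → InT d p r
    power⇒InT {r} {x} r<p r≢0 nx e = r≢0 , s , (x₀ , N.n≢0⇒n>0 (λ z → nx (trans (residue x) (reflexive (≡.cong ι z)))) , rep<p x , ≡.refl) ,
      ×-injective (≡.subst (_< p) (≡.sym (mod-% _ p)) (N.m%n<n _ p)) r<p (trans (ι-mod _) (trans (pred-≈ s) (trans (+-congʳ (trans (ι-mod (x₀ N.^ d)) (trans (ι-^ x₀ d) (trans (^-congˡ d (sym (residue x))) (sym e)))))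
        (S.solve 2 (λ o r → (o S.:+ r) S.:+ S.:- o S.:= r) refl 1# (ι r)))))
      where
      x₀ s : ℕ
      x₀ = rep x
      s = (x₀ N.^ d) mod⟨ p ⟩

    module _ (A B : Subset p) (nzA : NonzeroSubset p A) (nzB : NonzeroSubset p B) (twoA : 2 ≤ ∣ A ∣) (twoB : 2 ≤ ∣ B ∣)
             (dec : ∀ (r : Fin p) → (InT d p (toℕ r) → InProd p A B r) × (InProd p A B r → InT d p (toℕ r))) where

      ι-product : ∀ a b {r} → (toℕ a N.* toℕ b) mod⟨ p ⟩ ≡ r → ⟪ a ⟫ * ⟪ b ⟫ ≈ ι r
      ι-product a b e = trans (sym (trans (ι-mod _) (×1-homo-* (toℕ a) (toℕ b)))) (reflexive (≡.cong ι e))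

      compat : Compatible (list A) (list B)
      compat = AllP.map⁺ (All.map (λ {a} a∈ → AllP.map⁺ (All.map (λ {b} b∈ → point a b a∈ b∈) (members-∈ B))) (members-∈ A))
        where
        point : ∀ a b → a ∈ A → b ∈ B → u ⟪ a ⟫ ⟪ b ⟫ ^ M ≈ 1#
        point a b a∈ b∈ = from (InT⇒power (proj₂ (dec r) (a , b , a∈ , b∈ , eq)))
          where
          bound : (toℕ a N.* toℕ b) mod⟨ p ⟩ < p
          bound = ≡.subst (_< p) (≡.sym (mod-% _ p)) (N.m%n<n _ p)
          r : Fin p
          r = fromℕ< bound
          eq : (toℕ a N.* toℕ b) mod⟨ p ⟩ ≡ toℕ r
          eq = ≡.sym (Fin.toℕ-fromℕ< bound)
          from : ∃[ x ] (x ≉ 0# × 1# + ι (toℕ r) ≈ x ^ d) → u ⟪ a ⟫ ⟪ b ⟫ ^ M ≈ 1#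
          from (x , nx , e) = trans (^-congˡ M (trans (+-congˡ (ι-product a b eq)) e)) (power-unit nx)

      target : Target (list A) (list B) targets
      target = record
        { distinctT = targets-distinct ; manyT = targets-many ; nonzeroT = targets-nonzero
        ; powerT = All.map (λ (x , nx , e) → trans (^-congˡ M (trans (+-congˡ (*-identityˡ _)) e)) (power-unit nx)) targets-power
        ; productT = All.zipWith (λ {t} (nt , (x , nx , e)) → represented t nt x nx e) (targets-nonzero , targets-power) }
        where
        represented : ∀ t → t ≉ 0# → ∀ x → x ≉ 0# → 1# + t ≈ x ^ d → Any (λ a → Any (λ b → t ≈ a * b) (list B)) (list A)
        represented t nt x nx e = from (proj₁ (dec r) (≡.subst (InT d p) (≡.sym r≡) (power⇒InT (rep<p t) (λ z → nt (trans (residue t) (reflexive (≡.cong ι z)))) nx (trans (+-congˡ (sym (residue t))) e))))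
          where
          r : Fin p
          r = fromℕ< (rep<p t)
          r≡ : toℕ r ≡ rep t
          r≡ = Fin.toℕ-fromℕ< (rep<p t)
          from : InProd p A B r → Any (λ a → Any (λ b → t ≈ a * b) (list B)) (list A)
          from (a , b , a∈ , b∈ , eq) = AnyP.map⁺ (Any.map (λ { ≡.refl → AnyP.map⁺ (Any.map (λ { ≡.refl →
            trans (residue t) (trans (reflexive (≡.cong ι (≡.sym r≡))) (sym (ι-product a b eq))) }) (∈⇒members b∈)) }) (∈⇒members a∈))

      target-swap : Target (list B) (list A) targets
      target-swap = record { distinctT = distinctT ; manyT = manyT ; nonzeroT = nonzeroT ; powerT = powerT ; productT = All.map swap productT }
        where
        open Target target
        swap : ∀ {t As Bs} → Any (λ a → Any (λ b → t ≈ a * b) Bs) As → Any (λ b → Any (λ a → t ≈ b * a) As) Bs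
        swap m = AnyP.swap (Any.map (Any.map (λ e → trans e (*-comm _ _))) m)

      exact : suc (length (list A) N.* length (list B)) ≡ M
      exact = N.≤-antisym (product-bound (side A nzA twoA) (side B nzB twoB) compat) (product-≥ target)

      factors : ∀ s → s N.* s ≤ p → threshold d ≤ s →
        s ≤ factorConstant d N.* length (list A) × s ≤ factorConstant d N.* length (list B)
      factors s s²≤p big = large-factor s s²≤p big (side A nzA twoA) (side B nzB twoB) compat exact target ,
        large-factor s s²≤p big (side B nzB twoB) (side A nzA twoA) (compatible-swap compat) (≡.trans (≡.cong suc (N.*-comm (length (list B)) (length (list A)))) exact) target-swap

  -- Combine n s ≤ c n m ≤ c p with p ≤ (2 s)².
  balanced : ∀ c s n m p → n N.* m ≤ p → s ≤ c N.* m → p < suc s N.* suc s → 1 ≤ s → 0 < p → n N.* n ≤ 4 N.* (c N.* c) N.* p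
  balanced c s n m p nm≤p s≤cm p<t² 1≤s 0<p = N.*-cancelʳ-≤ (n N.* n) _ p {{N.>-nonZero 0<p}} (begin
    n N.* n N.* p ≤⟨ N.*-monoʳ-≤ (n N.* n) p≤4s² ⟩
    n N.* n N.* (2 N.* s N.* (2 N.* s)) ≡⟨ lem₁ n s ⟩
    4 N.* (n N.* s N.* (n N.* s)) ≤⟨ N.*-monoʳ-≤ 4 (N.*-mono-≤ ns≤cp ns≤cp) ⟩
    4 N.* (c N.* p N.* (c N.* p)) ≡⟨ lem₂ c p ⟩
    4 N.* (c N.* c) N.* p N.* p ∎)
    where
    open N.≤-Reasoning
    lem₁ : ∀ n s → n N.* n N.* (2 N.* s N.* (2 N.* s)) ≡ 4 N.* (n N.* s N.* (n N.* s))
    lem₁ = solve-∀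
    lem₂ : ∀ c p → 4 N.* (c N.* p N.* (c N.* p)) ≡ 4 N.* (c N.* c) N.* p N.* p
    lem₂ = solve-∀
    lem₃ : ∀ n c m → n N.* (c N.* m) ≡ c N.* (n N.* m)
    lem₃ = solve-∀
    2s : suc s ≤ 2 N.* s
    2s = (N.+-monoˡ-≤ s 1≤s) ⟫ N.≤-reflexive (≡.cong (s N.+_) (≡.sym (N.+-identityʳ s)))
    p≤4s² : p ≤ 2 N.* s N.* (2 N.* s)
    p≤4s² = N.<⇒≤ p<t² ⟫ (N.*-mono-≤ 2s 2s)
    ns≤cp : n N.* s ≤ c N.* p
    ns≤cp = N.*-monoʳ-≤ n s≤cm ⟫ N.≤-reflexive (lem₃ n c m) ⟫ N.*-monoʳ-≤ c nm≤p

  Balanced : ℕ → ℕ → ℕ → Set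
  Balanced d c p = ∃[ n ] ∃[ m ] (p ≡ d N.* (n N.* m) N.+ (d N.+ 1) × n N.* n ≤ c N.* p × m N.* m ≤ c N.* p)

  balanceConstant : ℕ → ℕ
  balanceConstant d = 4 N.* (factorConstant d N.* factorConstant d)

  decomposable⇒balanced : ∀ d p → 2 ≤ d → Prime p → d ∣ (p N.∸ 1) → threshold d N.* threshold d ≤ p → Decomposable d p → Balanced d (balanceConstant d) p
  decomposable⇒balanced d p 2≤d p-prime (divides M p-1) big (A , B , nzA , nzB , twoA , twoB , dec) = finish (√-exists p)
    where
    open Bridge d p 2≤d p-prime M p-1 (primeField p-prime)
    n m : ℕ
    n = length (list A)
    m = length (list B)
    exact′ : suc (n N.* m) ≡ M
    exact′ = exact A B nzA nzB twoA twoB dec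
    p≡ : p ≡ d N.* (n N.* m) N.+ (d N.+ 1)
    p≡ = ≡.trans (≡.sym dM) (≡.trans (≡.cong (λ M → suc (d N.* M)) (≡.sym exact′)) (lem d (n N.* m)))
      where
      lem : ∀ d x → suc (d N.* suc x) ≡ d N.* x N.+ (d N.+ 1)
      lem = solve-∀
    nm≤p : n N.* m ≤ p
    nm≤p = N.m≤n*m (n N.* m) d {{N.>-nonZero (N.<-trans (s≤s z≤n) 2≤d)}} ⟫ (N.m≤m+n _ (d N.+ 1)) ⟫ N.≤-reflexive (≡.sym p≡)
    0<p : 0 < p
    0<p = N.<-trans (s≤s z≤n) 1<p
    finish : ∃[ s ] (s N.* s ≤ p × p < suc s N.* suc s) → Balanced d (balanceConstant d) p
    finish (s , s²≤p , p<t²) = n , m , p≡ , balanced (factorConstant d) s n m p nm≤p (proj₂ both) p<t² 1≤s 0<p ,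
        balanced (factorConstant d) s m n p (N.≤-reflexive (N.*-comm m n) ⟫ nm≤p) (proj₁ both) p<t² 1≤s 0<p
      where
      threshold≤s : threshold d ≤ s
      threshold≤s = N.≮⇒≥ (λ s<t → N.<⇒≱ p<t² (N.*-mono-≤ s<t s<t ⟫ big))
      1≤s : 1 ≤ s
      1≤s = (s≤s z≤n ⟫ (N.m≤n+m 30 _)) ⟫ threshold≤s
      both : s ≤ factorConstant d N.* n × s ≤ factorConstant d N.* m
      both = factors A B nzA nzB twoA twoB dec s s²≤p threshold≤s

open Decomposition
open ShiftedProducts
open Binomial using (power-below; π-lower)

open import Data.Nat using (_+_; _*_; _∸_; _^_)
open import Relation.Binary.PropositionalEquality using (refl; sym; trans; cong; subst)

-- The density of decomposable primes

Eventually : (ℕ → Set) → Set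
Eventually P = ∃[ B ] (∀ b → B ≤ b → P b)

n<2^n : ∀ n → n < 2 ^ n
n<2^n zero = s≤s z≤n
n<2^n (suc n) = N.+-mono-≤ (N.m^n>0 2 n) (n<2^n n) ⟫ N.≤-reflexive (cong (2 ^ n +_) (sym (N.+-identityʳ _)))

halves : ∀ n → (n N./ 2 + n N./ 2 ≤ n) × (n ≤ 1 + (n N./ 2 + n N./ 2))
halves n = N.≤-reflexive (lem (n N./ 2)) ⟫ (N.m≤n+m _ (n N.% 2)) ⟫ N.≤-reflexive (sym eq)
         , N.≤-reflexive eq ⟫ N.+-mono-≤ (N.≤-pred (N.m%n<n n 2)) (N.≤-reflexive (sym (lem (n N./ 2))))
  where
  eq : n ≡ n N.% 2 + n N./ 2 * 2
  eq = N.m≡m%n+[m/n]*n n 2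
  lem : ∀ h → h + h ≡ h * 2
  lem = solve-∀

linear≤2^ : ∀ K → Eventually (λ b → K * suc b ≤ 2 ^ b)
linear≤2^ K = 4 * K , λ b h → bound b h (b N./ 2) (proj₁ (halves b)) (proj₂ (halves b))
  where
  bound : ∀ b → 4 * K ≤ b → ∀ m → m + m ≤ b → b ≤ 1 + (m + m) → K * suc b ≤ 2 ^ b
  bound b h m lo hi = N.*-monoʳ-≤ K (s≤s hi) ⟫ N.≤-reflexive (lem K m) ⟫ (N.≤-trans (N.*-monoˡ-≤ (suc m) 2K≤)
      (N.*-mono-≤ (n<2^n m) (n<2^n m) ⟫ N.≤-reflexive (sym (N.^-distribˡ-+-* 2 m m)) ⟫ N.^-monoʳ-≤ 2 lo))
    where
    lem : ∀ K m → K * suc (1 + (m + m)) ≡ 2 * K * suc m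
    lem = solve-∀
    2K≤ : 2 * K ≤ suc m
    2K≤ = N.*-cancelˡ-≤ 2 (N.≤-reflexive (sym (N.*-assoc 2 2 K)) ⟫ h ⟫ hi ⟫ (N.n≤1+n _) ⟫ N.≤-reflexive (lem′ m))
      where
      lem′ : ∀ m → suc (1 + (m + m)) ≡ 2 * suc m
      lem′ = solve-∀

bernoulli-9/8 : ∀ m → (8 + m) * 8 ^ m ≤ 8 * 9 ^ m
bernoulli-9/8 zero = N.≤-refl
bernoulli-9/8 (suc m) = ((N.m≤m+n _ (m * 8 ^ m)) ⟫ N.≤-reflexive (lem m (8 ^ m))) ⟫ N.*-monoʳ-≤ 9 (bernoulli-9/8 m) ⟫ N.≤-reflexive (lem′ (9 ^ m))
  where
  lem : ∀ m t → (8 + suc m) * (8 * t) + m * t ≡ 9 * ((8 + m) * t)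
  lem = solve-∀
  lem′ : ∀ t → 9 * (8 * t) ≡ 8 * (9 * t)
  lem′ = solve-∀

-- The cube of Bernoulli's inequality for n = 3 m + ρ. Two of the three linear factors dominate the
-- square in `square-9/8`, and the third outgrows its constants.
cubic-9/8 : ∀ n → (8 + n N./ 3) * ((8 + n N./ 3) * (8 + n N./ 3)) * 8 ^ n ≤ 512 * 9 ^ n
cubic-9/8 n = subst (λ t → M * (M * M) * 8 ^ t ≤ 512 * 9 ^ t) (sym (N.m≡m%n+[m/n]*n n 3)) (N.≤-reflexive expand ⟫ N.*-mono-≤ (N.*-mono-≤ one (N.*-mono-≤ one one)) (N.^-monoˡ-≤ ρ (N.n≤1+n 8)) ⟫ N.≤-reflexive collect)
  where
  m M ρ : ℕ
  m = n N./ 3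
  M = 8 + m
  ρ = n N.% 3
  one : M * 8 ^ m ≤ 8 * 9 ^ m
  one = bernoulli-9/8 m
  power : ∀ x → x ^ (ρ + m * 3) ≡ x ^ ρ * (x ^ m * (x ^ m * x ^ m))
  power x = trans (N.^-distribˡ-+-* x ρ (m * 3)) (cong (x ^ ρ *_) (trans (cong (x ^_) (lem m)) (trans (N.^-distribˡ-+-* x m (m + m)) (cong (x ^ m *_) (N.^-distribˡ-+-* x m m)))))
    where
    lem : ∀ m → m * 3 ≡ m + (m + m)
    lem = solve-∀
  expand : M * (M * M) * 8 ^ (ρ + m * 3) ≡ M * 8 ^ m * (M * 8 ^ m * (M * 8 ^ m)) * 8 ^ ρ
  expand = trans (cong (M * (M * M) *_) (power 8)) (lem M (8 ^ ρ) (8 ^ m))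
    where
    lem : ∀ M r t → M * (M * M) * (r * (t * (t * t))) ≡ M * t * (M * t * (M * t)) * r
    lem = solve-∀
  collect : 8 * 9 ^ m * (8 * 9 ^ m * (8 * 9 ^ m)) * 9 ^ ρ ≡ 512 * 9 ^ (ρ + m * 3)
  collect = trans (lem (9 ^ m) (9 ^ ρ)) (cong (512 *_) (sym (power 9)))
    where
    lem : ∀ t r → 8 * t * (8 * t * (8 * t)) * r ≡ 512 * (r * (t * (t * t)))
    lem = solve-∀

square-9/8 : ∀ K e → Eventually (λ n → K * ((8 * n + e) * (8 * n + e)) * 8 ^ n ≤ 9 ^ n)
square-9/8 K e = 3 * L , λ n h → N.*-cancelˡ-≤ 512 (bound n h)
  where
  E L : ℕ
  E = 24 + e
  L = 512 * (K * (E * E))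
  bound : ∀ n → 3 * L ≤ n → 512 * (K * ((8 * n + e) * (8 * n + e)) * 8 ^ n) ≤ 512 * 9 ^ n
  bound n h = N.≤-trans (N.*-monoʳ-≤ 512 (N.*-monoˡ-≤ (8 ^ n) (N.*-monoʳ-≤ K (N.*-mono-≤ base base))))
      (N.≤-reflexive (lem K E M (8 ^ n)) ⟫ N.*-monoˡ-≤ (8 ^ n) (N.*-monoˡ-≤ (M * M) L≤M) ⟫ cubic-9/8 n)
    where
    m M : ℕ
    m = n N./ 3
    M = 8 + m
    lem : ∀ K E M t → 512 * (K * (E * M * (E * M)) * t) ≡ 512 * (K * (E * E)) * (M * M) * t
    lem = solve-∀
    n≤ : n ≤ 2 + m * 3
    n≤ = N.≤-reflexive (N.m≡m%n+[m/n]*n n 3) ⟫ N.+-monoˡ-≤ (m * 3) (N.≤-pred (N.m%n<n n 3))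
    base : 8 * n + e ≤ E * M
    base = N.+-monoˡ-≤ e (N.*-monoʳ-≤ 8 n≤) ⟫ (N.m≤m+n _ (176 + 7 * e + e * m)) ⟫ N.≤-reflexive (lem′ m e)
      where
      lem′ : ∀ m e → 8 * (2 + m * 3) + e + (176 + 7 * e + e * m) ≡ (24 + e) * (8 + m)
      lem′ = solve-∀
    L≤M : L ≤ M
    L≤M = N.*-cancelˡ-≤ 3 (h ⟫ n≤ ⟫ (N.m≤n+m _ 22) ⟫ N.≤-reflexive (lem′ m))
      where
      lem′ : ∀ m → 22 + (2 + m * 3) ≡ 3 * (8 + m)
      lem′ = solve-∀

-- For κ ≥ b/8 the factor (9/8)^κ beats the square. For smaller κ, 9^κ ≤ 2^(4 κ) is at most about
-- 2^(b/2), which contradicts the hypothesis on 2^b. One factor b + e counts dyadic boxes; the other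
-- absorbs the loss in log x / log w.
saving : ∀ K₁ K₂ e → Eventually (λ b → ∀ κ → 2 ^ b ≤ K₂ * suc b * 9 ^ κ → K₁ * ((b + e) * (b + e)) * 8 ^ κ ≤ 9 ^ κ)
saving K₁ K₂ e = from-thresholds (square-9/8 K₁ e) (linear≤2^ (1 + 2 * K₂))
  where
  from-thresholds : Eventually (λ n → K₁ * ((8 * n + e) * (8 * n + e)) * 8 ^ n ≤ 9 ^ n) → Eventually (λ b → (1 + 2 * K₂) * suc b ≤ 2 ^ b) →
            Eventually (λ b → ∀ κ → 2 ^ b ≤ K₂ * suc b * 9 ^ κ → K₁ * ((b + e) * (b + e)) * 8 ^ κ ≤ 9 ^ κ)
  from-thresholds (N , f) (B , g) = 8 * N + (2 * B + 1) , λ b le κ h → cases b le κ h (N.≤-<-connex b (8 * κ))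
    where
    cases : ∀ b → 8 * N + (2 * B + 1) ≤ b → ∀ κ → 2 ^ b ≤ K₂ * suc b * 9 ^ κ → b ≤ 8 * κ ⊎ 8 * κ < b → K₁ * ((b + e) * (b + e)) * 8 ^ κ ≤ 9 ^ κ
    cases b le κ h (inj₁ b≤) = N.≤-trans (N.*-monoˡ-≤ (8 ^ κ) (N.*-monoʳ-≤ K₁ (N.*-mono-≤ (N.+-monoˡ-≤ e b≤) (N.+-monoˡ-≤ e b≤))))
      (f κ (N.*-cancelˡ-≤ 8 ((N.m≤m+n (8 * N) (2 * B + 1) ⟫ le) ⟫ b≤)))
    cases b le κ h (inj₂ lt) = ⊥-elim (impossible (b N./ 2) (proj₁ (halves b)) (proj₂ (halves b)))
      where
      impossible : ∀ m → m + m ≤ b → b ≤ 1 + (m + m) → ⊥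
      impossible m lo hi = N.<⇒≱ {K₂ * suc b} {2 ^ m} small large
        where
        4κ≤m : 4 * κ ≤ m
        4κ≤m = N.*-cancelˡ-≤ 2 (N.≤-pred (N.≤-reflexive (cong suc (sym (N.*-assoc 2 4 κ))) ⟫ lt ⟫ hi ⟫ N.≤-reflexive (cong (λ t → suc (m + t)) (sym (N.+-identityʳ m)))))
        B≤m : B ≤ m
        B≤m = N.*-cancelˡ-≤ 2 (N.≤-pred (N.≤-reflexive (N.+-comm 1 (2 * B)) ⟫ (N.m≤n+m (2 * B + 1) (8 * N) ⟫ le) ⟫ hi ⟫ N.≤-reflexive (cong (λ t → suc (m + t)) (sym (N.+-identityʳ m)))))
        large : 2 ^ m ≤ K₂ * suc b
        large = N.*-cancelʳ-≤ (2 ^ m) (K₂ * suc b) (2 ^ m) {{N.m^n≢0 2 m}} (N.≤-reflexive (sym (N.^-distribˡ-+-* 2 m m)) ⟫ (N.≤-trans (N.^-monoʳ-≤ 2 lo)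
          (h ⟫ N.*-monoʳ-≤ (K₂ * suc b) (N.^-monoˡ-≤ κ (N.m≤m+n 9 7) ⟫ N.≤-reflexive (N.^-*-assoc 2 4 κ) ⟫ (N.^-monoʳ-≤ 2 4κ≤m)))))
        small : K₂ * suc b < 2 ^ m
        small = s≤s (N.*-monoʳ-≤ K₂ (s≤s hi)) ⟫ ((N.m≤m+n _ m) ⟫ N.≤-reflexive (lem K₂ m)) ⟫ g m B≤m
          where
          lem : ∀ K m → suc (K * suc (1 + (m + m))) + m ≡ (1 + 2 * K) * suc m
          lem = solve-∀

2^-cancel-< : ∀ {m n} → 2 ^ m < 2 ^ n → m < n
2^-cancel-< {m} {n} h = N.≰⇒> (λ le → N.<⇒≱ h (N.^-monoʳ-≤ 2 le))

-- Two factors n, m ≤ √(g p) of a number of order p have order √p; with p of order 2^a this confines n to the dyadic intervals near 2^(a/2).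
dyadic-range : ∀ {d g e a b h i n m p} → 1 ≤ n * m → p ≡ d * (n * m) + (d + 1) → n * n ≤ g * p → m * m ≤ g * p → g * ((2 * d + 1) * (2 * d + 1)) ≤ 2 ^ e →
               2 ^ a ≤ p * 2 ^ (2 * b + 1) → p < 2 ^ suc a → 2 ^ i ≤ n → n < 2 ^ suc i → h + h ≤ a → a ≤ 1 + (h + h) →
               h ≤ i + (b + e + 3) × i ≤ h + (b + e + 3)
dyadic-range {d} {g} {e} {a} {b} {h} {i} {n} {m} {p} nm≥1 p≡ nn≤ mm≤ g≤ big p< i≤ n< h≤ ≤h = lower , upper
  where
  D : ℕ
  D = 2 * d + 1
  p≤ : p ≤ D * (n * m)
  p≤ = N.≤-reflexive p≡ ⟫ N.+-monoʳ-≤ (d * (n * m)) (N.≤-reflexive (sym (N.*-identityʳ (d + 1))) ⟫ N.*-monoʳ-≤ (d + 1) nm≥1) ⟫ N.≤-reflexive (lem d (n * m))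
    where
    lem : ∀ d t → d * t + (d + 1) * t ≡ (2 * d + 1) * t
    lem = solve-∀
  p≥1 : 1 ≤ p
  p≥1 = subst (1 ≤_) (sym (trans p≡ (trans (cong (d * (n * m) +_) (N.+-comm d 1)) (N.+-suc (d * (n * m)) d)))) (s≤s z≤n)
  p≤n² : p ≤ 2 ^ e * (n * n)
  p≤n² = N.*-cancelʳ-≤ p (2 ^ e * (n * n)) p {{N.>-nonZero p≥1}} (N.*-mono-≤ p≤ p≤ ⟫ N.≤-reflexive (lem₁ D n m) ⟫ (N.≤-trans (N.*-monoʳ-≤ (D * D * (n * n)) mm≤)
      (N.≤-reflexive (lem₂ (D * D) (n * n) g p) ⟫ N.*-monoˡ-≤ p (N.*-monoˡ-≤ (n * n) g≤))))
    where
    lem₁ : ∀ D n m → D * (n * m) * (D * (n * m)) ≡ D * D * (n * n) * (m * m)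
    lem₁ = solve-∀
    lem₂ : ∀ D n g p → D * n * (g * p) ≡ g * D * n * p
    lem₂ = solve-∀
  a< : a < e + (suc i + suc i) + (2 * b + 1)
  a< = 2^-cancel-< (N.≤-<-trans big (N.<-≤-trans (N.*-monoˡ-< (2 ^ (2 * b + 1)) {{N.m^n≢0 2 (2 * b + 1)}} (N.≤-<-trans p≤n² (N.*-monoʳ-< (2 ^ e) {{N.m^n≢0 2 e}} (N.*-mono-< n< n<))))
      (N.≤-reflexive (sym (trans (N.^-distribˡ-+-* 2 (e + (suc i + suc i)) (2 * b + 1)) (cong (_* 2 ^ (2 * b + 1)) (trans (N.^-distribˡ-+-* 2 e (suc i + suc i)) (cong (2 ^ e *_) (N.^-distribˡ-+-* 2 (suc i) (suc i))))))))))
  lower : h ≤ i + (b + e + 3)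
  lower = N.*-cancelˡ-≤ 2 ((N.≤-reflexive (lem h) ⟫ h≤) ⟫ N.<⇒≤ a< ⟫ (N.m≤m+n _ (3 + e)) ⟫ N.≤-reflexive (lem′ e i b))
    where
    lem : ∀ h → 2 * h ≡ h + h
    lem = solve-∀
    lem′ : ∀ e i b → e + (suc i + suc i) + (2 * b + 1) + (3 + e) ≡ 2 * (i + (b + e + 3))
    lem′ = solve-∀
  g≤2^e : g ≤ 2 ^ e
  g≤2^e = (N.≤-reflexive (sym (N.*-identityʳ g)) ⟫ N.*-monoʳ-≤ g (N.*-mono-≤ D≥1 D≥1)) ⟫ g≤
    where
    D≥1 : 1 ≤ D
    D≥1 = N.m≤n+m 1 (2 * d)
  upper : i ≤ h + (b + e + 3)
  upper = N.*-cancelˡ-≤ 2 ((N.≤-reflexive (lem i) ⟫ i+i≤) ⟫ N.+-monoʳ-≤ e (s≤s ≤h) ⟫ (N.m≤m+n _ (2 * b + e + 4)) ⟫ N.≤-reflexive (lem′ e h b))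
    where
    lem : ∀ h → 2 * h ≡ h + h
    lem = solve-∀
    lem′ : ∀ e h b → e + suc (1 + (h + h)) + (2 * b + e + 4) ≡ 2 * (h + (b + e + 3))
    lem′ = solve-∀
    i+i≤ : i + i ≤ e + suc a
    i+i≤ = N.<⇒≤ (2^-cancel-< (N.≤-<-trans (N.≤-reflexive (N.^-distribˡ-+-* 2 i i)) (N.≤-<-trans (N.*-mono-≤ i≤ i≤) (N.≤-<-trans nn≤ (N.≤-<-trans (N.*-monoˡ-≤ p g≤2^e)
      (N.<-≤-trans (N.*-monoʳ-< (2 ^ e) {{N.m^n≢0 2 e}} p<) (N.≤-reflexive (sym (N.^-distribˡ-+-* 2 e (suc a))))))))))

open import Data.List.Membership.Propositional using (_∈_)

-- Covering the balanced primes by sifted lists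

length-gather-≤ : ∀ {A : Set} Q B n (f : ℕ → List A) → (∀ j → j < n → Q * length (f j) ≤ B) → Q * length (gather n f) ≤ n * B
length-gather-≤ Q B zero f h = N.≤-reflexive (N.*-zeroʳ Q)
length-gather-≤ Q B (suc n) f h = N.≤-trans (N.≤-reflexive (trans (cong (Q *_) (length-++ (f 0))) (N.*-distribˡ-+ Q (length (f 0)) _)))
  (N.+-mono-≤ (h 0 (s≤s z≤n)) (length-gather-≤ Q B n (λ i → f (suc i)) (λ j lt → h (suc j) (s≤s lt))))

-- 2^e bounds the constants of the balance condition. As 444 = 4 · 111, the least side H ≤ w^(111 (b
-- + 1)) is at most x^(1/4) and fits into the dyadic ranges near √x; 888 = 2 · 444 allows for
-- rounding in c.
module Cover (d g t k e a b c x : ℕ) (d≥1 : 1 ≤ d) (g≤ : g * ((2 * d + 1) * (2 * d + 1)) ≤ 2 ^ e)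
    (2^a≤x : 2 ^ a ≤ x) (x< : x < 2 ^ suc a) (2^b≤a : 2 ^ b ≤ a) (a< : a < 2 ^ suc b)
    (c-lower : a ≤ 888 * suc b * c) (c-upper : c * (444 * suc b) ≤ a)
    (s-small : 4 * (b + e + 3) + 2 ≤ 2 ^ b) (t-small : t + (d + 2) ≤ 2 ^ b) (k-small : 8 * k ≤ 2 ^ b)
    (D : SieveData d c b) (saved : 128 * (888 * (k * sieveConstant d)) * ((b + (e + 4)) * (b + (e + 4))) * 8 ^ SieveData.κ D ≤ 9 ^ SieveData.κ D) where
  open SieveData D

  s h U P₀ T i₀ Q C : ℕ
  s = b + e + 3
  h = a N./ 2
  U = c * (111 * suc b)
  -- Of order x / (log x)²: all numbers below it may be counted trivially, and a prime above it
  -- exceeds both w and the threshold t.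
  P₀ = 2 ^ (a ∸ (2 * b + 1))
  T = 3 * κ
  i₀ = h ∸ s
  Q = 9 ^ κ * c
  C = sieveConstant d
  qs : List ℕ
  qs = sieving d n₀

  h≤ : h + h ≤ a
  h≤ = proj₁ (halves a)
  ≤h : a ≤ 1 + (h + h)
  ≤h = proj₂ (halves a)

  2[U+s]<a : suc (2 * (U + s)) ≤ a
  2[U+s]<a = N.*-cancelˡ-≤ 2 (N.≤-reflexive (lem c (suc b) s) ⟫ N.+-mono-≤ c-upper (s-small ⟫ 2^b≤a) ⟫ N.≤-reflexive (cong (a +_) (sym (N.+-identityʳ a))))
    where
    lem : ∀ c b s → 2 * suc (2 * (c * (111 * b) + s)) ≡ c * (444 * b) + (4 * s + 2)
    lem = solve-∀

  U+s≤h : U + s ≤ h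
  U+s≤h = N.*-cancelˡ-≤ 2 (N.≤-pred (2[U+s]<a ⟫ ≤h ⟫ N.≤-reflexive (cong (λ t → suc (h + t)) (sym (N.+-identityʳ h)))))

  s≤h : s ≤ h
  s≤h = N.m≤n+m s U ⟫ U+s≤h

  U≤i₀ : U ≤ i₀
  U≤i₀ = N.≤-reflexive (sym (N.m+n∸n≡m U s)) ⟫ N.∸-monoˡ-≤ s U+s≤h

  c≤U : c ≤ U
  c≤U = N.m≤m*n c (111 * suc b)

  w-gap : c + suc (2 * b + 1) ≤ a
  w-gap = (N.+-monoˡ-≤ (suc (2 * b + 1)) c≤U ⟫ (N.m≤m+n _ (U + 2 * e + 5)) ⟫ N.≤-reflexive (lem U b e)) ⟫ 2[U+s]<a
    where
    lem : ∀ U b e → U + suc (2 * b + 1) + (U + 2 * e + 5) ≡ suc (2 * (U + (b + e + 3)))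
    lem = solve-∀

  2b+1≤a : 2 * b + 1 ≤ a
  2b+1≤a = ((N.n≤1+n _) ⟫ (N.m≤n+m _ c)) ⟫ w-gap

  w<P₀ : 2 ^ c < P₀
  w<P₀ = N.^-monoʳ-< 2 (s≤s (s≤s z≤n)) (N.≤-reflexive (sym (N.m+n∸n≡m (suc c) (2 * b + 1))) ⟫ N.∸-monoˡ-≤ (2 * b + 1) (N.≤-reflexive (sym (N.+-suc c (2 * b + 1))) ⟫ w-gap))

  2^b≤P₀ : 2 ^ b ≤ P₀
  2^b≤P₀ = N.^-monoʳ-≤ 2 (N.≤-reflexive (sym (N.m+n∸n≡m b (2 * b + 1))) ⟫ (N.∸-monoˡ-≤ (2 * b + 1)
    (((N.m≤m+n _ (b + 4 * e + 13)) ⟫ N.≤-reflexive (lem b e)) ⟫ s-small ⟫ 2^b≤a)))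
    where
    lem : ∀ b e → b + (2 * b + 1) + (b + 4 * e + 13) ≡ 4 * (b + e + 3) + 2
    lem = solve-∀

  P₀-split : P₀ * 2 ^ (2 * b + 1) ≡ 2 ^ a
  P₀-split = trans (sym (N.^-distribˡ-+-* 2 (a ∸ (2 * b + 1)) (2 * b + 1))) (cong (2 ^_) (N.m∸n+n≡m 2b+1≤a))

  H≤2^U : H ≤ 2 ^ U
  H≤2^U = H≤ ⟫ N.≤-reflexive (N.^-*-assoc 2 c (111 * suc b))

  box : ℕ → List ℕ
  box j = fewHitsList d qs T (2 ^ suc (i₀ + j)) (2 ^ (suc a ∸ (i₀ + j)))

  dense sparse cover : List ℕ
  dense = manyHitsList d qs T (2 ^ suc a)
  sparse = gather (suc (2 * s)) box
  cover = upTo P₀ ++ (dense ++ sparse)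

  module _ {p : ℕ} (p≤x : p ≤ x) (pr : Prime p) (balanced : t ≤ p → Balanced d g p) where
    -- A sieving prime dividing p would equal p, but p exceeds w.
    rough : P₀ ≤ p → Rough qs p
    rough P₀≤p = All.zipWith (λ { {q} ((pq , _) , (_ , q≤)) q∣p → small pq q≤ (prime⇒irreducible pr q∣p) }) (sieving-admissible d n₀ , sieving-range d n₀)
      where
      small : ∀ {q} → Prime q → q ≤ 2 + n₀ → q ≡ 1 ⊎ q ≡ p → ⊥
      small pq q≤ (inj₁ refl) = N.<⇒≱ (prime≥2 pq) N.≤-refl
      small pq q≤ (inj₂ refl) = N.<⇒≱ (N.<-≤-trans w<P₀ P₀≤p) (q≤ ⟫ N.≤-reflexive (sym w≡))

    covered : p ∈ cover
    covered = size (N.≤-<-connex P₀ p)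
      where
      size : P₀ ≤ p ⊎ p < P₀ → p ∈ cover
      size (inj₂ lt) = ∈-++⁺ˡ (∈-upTo⁺ lt)
      size (inj₁ P₀≤p) = ∈-++⁺ʳ (upTo P₀) (factors (balanced ((N.m≤m+n t (d + 2) ⟫ t-small) ⟫ 2^b≤p)))
        where
        2^b≤p : 2 ^ b ≤ p
        2^b≤p = 2^b≤P₀ ⟫ P₀≤p
        factors : Balanced d g p → p ∈ dense ++ sparse
        factors (n , m , p≡ , nn≤ , mm≤) = count (T N.≤? hits qs (n * m))
          where
          p≡′ : p ≡ d * (n * m) + suc d
          p≡′ = trans p≡ (cong (d * (n * m) +_) (N.+-comm d 1))
          rough′ : Rough qs (d * (n * m) + suc d)
          rough′ = subst (Rough qs) p≡′ (rough P₀≤p)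
          nm≢0 : n * m ≢ 0
          nm≢0 z = N.<⇒≱ (N.m≤n+m (suc (suc d)) t ⟫ N.≤-reflexive (cong (t +_) (N.+-comm 2 d)) ⟫ t-small ⟫ 2^b≤p)
            (N.≤-reflexive (trans p≡′ (trans (cong (λ u → d * u + suc d) z) (cong (_+ suc d) (N.*-zeroʳ d)))))
          nm≥1 : 1 ≤ n * m
          nm≥1 = N.n≢0⇒n>0 nm≢0
          n≥1 : 1 ≤ n
          n≥1 = N.n≢0⇒n>0 (λ { refl → nm≢0 refl })
          p< : p < 2 ^ suc a
          p< = N.≤-<-trans p≤x x<
          nm< : n * m < 2 ^ suc a
          nm< = N.≤-<-trans (N.m≤n*m (n * m) d {{N.>-nonZero d≥1}} ⟫ (N.m≤m+n _ (suc d)) ⟫ N.≤-reflexive (sym p≡′)) p<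
          count : Dec (T ≤ hits qs (n * m)) → p ∈ dense ++ sparse
          count (yes many) = ∈-++⁺ˡ (gather-∈ {n = 2 ^ suc a} {f = λ N → single (manyHits? d qs T N) (d * N + suc d)} (n * m) nm< (subst (_∈ single (manyHits? d qs T (n * m)) (d * (n * m) + suc d)) (sym p≡′) (single-∈ (manyHits? d qs T (n * m)) (rough′ , many))))
          count (no few) = ∈-++⁺ʳ dense (locate (power-below 2 n N.≤-refl n≥1))
            where
            locate : ∃[ i ] (2 ^ i ≤ n × n < 2 ^ suc i) → p ∈ sparse
            locate (i , lo , hi) = place (dyadic-range {d} {g} {e} {a} {b} {h} {i} nm≥1 p≡ nn≤ mm≤ g≤ (N.≤-reflexive (sym P₀-split) ⟫ N.*-monoˡ-≤ (2 ^ (2 * b + 1)) P₀≤p) p< lo hi h≤ ≤h)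
              where
              place : h ≤ i + s × i ≤ h + s → p ∈ sparse
              place (below , above) = gather-∈ {n = suc (2 * s)} {f = box} j j< (subst (λ i → p ∈ fewHitsList d qs T (2 ^ suc i) (2 ^ (suc a ∸ i))) i≡
                  (gather-∈ {n = 2 ^ suc i} {f = λ n → gather (2 ^ (suc a ∸ i)) (row n)} n hi (gather-∈ {n = 2 ^ (suc a ∸ i)} {f = row n} m m< (subst (_∈ single (fewHits? d qs T n m) (d * (n * m) + suc d)) (sym p≡′) (single-∈ (fewHits? d qs T n m) (rough′ , N.<⇒≤ (N.≰⇒> few)))))))
                where
                j : ℕ
                j = i ∸ i₀
                row : ℕ → ℕ → List ℕ
                row n m = single (fewHits? d qs T n m) (d * (n * m) + suc d)
                i₀≤i : i₀ ≤ i
                i₀≤i = N.∸-monoˡ-≤ s below ⟫ N.≤-reflexive (N.m+n∸n≡m i s)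
                i≡ : i ≡ i₀ + j
                i≡ = sym (N.m+[n∸m]≡n i₀≤i)
                j< : j < suc (2 * s)
                j< = s≤s (N.+-cancelˡ-≤ i₀ j (2 * s) (N.≤-reflexive (sym i≡) ⟫ above ⟫ N.≤-reflexive (trans (cong (_+ s) (sym (N.m∸n+n≡m s≤h))) (lem i₀ s))))
                  where
                  lem : ∀ i s → i + s + s ≡ i + 2 * s
                  lem = solve-∀
                i≤1+a : i ≤ suc a
                i≤1+a = above ⟫ N.+-monoʳ-≤ h s≤h ⟫ N.m≤n⇒m≤1+n h≤
                m< : m < 2 ^ (suc a ∸ i)
                m< = N.*-cancelˡ-< (2 ^ i) m (2 ^ (suc a ∸ i)) (N.≤-<-trans (N.*-monoˡ-≤ m lo) (N.<-≤-trans nm< (N.≤-reflexive (trans (cong (2 ^_) (sym (N.m+[n∸m]≡n i≤1+a))) (N.^-distribˡ-+-* 2 i (suc a ∸ i))))))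

  box-bound : ∀ j → j < suc (2 * s) → Q * length (box j) ≤ 8 ^ κ * (C * 2 ^ suc (suc a))
  box-bound j (s≤s j≤) = N.≤-trans (few (2 ^ suc i) (2 ^ (suc a ∸ i)) (H≤2^U ⟫ N.^-monoʳ-≤ 2 (U≤i₀ ⟫ N.m≤m+n i₀ j ⟫ N.n≤1+n i)) (H≤2^U ⟫ N.^-monoʳ-≤ 2 U≤))
      (N.≤-reflexive (cong (λ t → 8 ^ κ * (C * t)) (trans (sym (N.^-distribˡ-+-* 2 (suc i) (suc a ∸ i))) (cong (λ t → 2 ^ suc t) (N.m+[n∸m]≡n i≤1+a)))))
    where
    i : ℕ
    i = i₀ + j
    i≤ : i ≤ h + s
    i≤ = N.+-monoʳ-≤ i₀ j≤ ⟫ N.≤-reflexive (trans (lem i₀ s) (cong (_+ s) (N.m∸n+n≡m s≤h)))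
      where
      lem : ∀ i s → i + 2 * s ≡ i + s + s
      lem = solve-∀
    i≤1+a : i ≤ suc a
    i≤1+a = i≤ ⟫ N.+-monoʳ-≤ h s≤h ⟫ N.m≤n⇒m≤1+n h≤
    U≤ : U ≤ suc a ∸ i
    U≤ = N.≤-reflexive (sym (N.m+n∸n≡m U i)) ⟫ N.∸-monoˡ-≤ i (N.+-monoʳ-≤ U i≤ ⟫ N.≤-reflexive (lem U h s) ⟫ N.+-monoˡ-≤ h U+s≤h ⟫ N.m≤n⇒m≤1+n h≤)
      where
      lem : ∀ U h s → U + (h + s) ≡ U + s + h
      lem = solve-∀

  dense-bound : Q * length dense ≤ 8 ^ κ * (C * 2 ^ suc (suc a))
  dense-bound = N.≤-trans (many (2 ^ suc a) (H≤2^U ⟫ N.^-monoʳ-≤ 2 ((N.m≤m+n U s ⟫ U+s≤h) ⟫ N.m≤m+n h h ⟫ N.m≤n⇒m≤1+n h≤)))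
    (N.*-monoʳ-≤ (8 ^ κ) (N.*-monoʳ-≤ C (N.^-monoʳ-≤ 2 (N.n≤1+n (suc a)))))

  F : ℕ
  F = length (dense ++ sparse)

  F-bound : Q * F ≤ 2 * (b + (e + 4)) * (8 ^ κ * (C * 2 ^ suc (suc a)))
  F-bound = N.≤-reflexive (trans (cong (Q *_) (length-++ dense)) (N.*-distribˡ-+ Q (length dense) _)) ⟫ (N.≤-trans (N.+-mono-≤ dense-bound (length-gather-≤ Q _ (suc (2 * s)) box box-bound))
    (N.≤-reflexive (cong (_* (8 ^ κ * (C * 2 ^ suc (suc a)))) (lem b e))))
    where
    lem : ∀ b e → suc (suc (2 * (b + e + 3))) ≡ 2 * (b + (e + 4))
    lem = solve-∀

  2^b≥1 : 1 ≤ 2 ^ b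
  2^b≥1 = N.m^n>0 2 b

  c≥1 : 1 ≤ c
  c≥1 = N.n≢0⇒n>0 (λ { refl → N.<⇒≱ (2^b≥1 ⟫ 2^b≤a) (c-lower ⟫ N.≤-reflexive (N.*-zeroʳ (888 * suc b))) })

  -- After multiplying by Q, the number 2 (b + e + 4) of lists and the ratio 2^b / c ≤ 888 (b + 1)
  -- use up the square in `saved`.
  large-part : 16 * 2 ^ b * k * F ≤ 2 ^ a
  large-part = N.*-cancelˡ-≤ Q {{N.>-nonZero (N.*-mono-≤ (N.m^n>0 9 κ) c≥1)}} scaled
    where
    lem : ∀ b e → suc b + (e + 3) ≡ b + (e + 4)
    lem = solve-∀
    suc-b≤ : suc b ≤ b + (e + 4)
    suc-b≤ = N.m≤m+n (suc b) (e + 3) ⟫ N.≤-reflexive (lem b e)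
    arithmetic : ∀ Gb G β α y E N F C → Gb ≡ G * suc b → suc b ≤ y → β ≤ Gb * c → N * c * F ≤ 2 * y * (E * (C * (2 * (2 * α)))) → 128 * (G * (k * C)) * (y * y) * E ≤ N →
                 N * c * (16 * β * k * F) ≤ N * c * α
    arithmetic Gb G β α y E N F C refl sb≤ β≤ F≤ sv = N.≤-reflexive (l₁ N c β k F) ⟫ N.*-monoʳ-≤ (16 * β * k) F≤ ⟫ N.≤-reflexive (l₂ β k y E C α) ⟫ (N.*-monoˡ-≤ (128 * (k * C) * y * E * α)
        (β≤ ⟫ N.*-monoˡ-≤ c (N.*-monoʳ-≤ G sb≤))) ⟫ N.≤-reflexive (l₃ G y c k C E α) ⟫ N.*-monoˡ-≤ (c * α) sv ⟫ N.≤-reflexive (sym (N.*-assoc N c α))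
      where
      l₁ : ∀ N c β k F → N * c * (16 * β * k * F) ≡ 16 * β * k * (N * c * F)
      l₁ = solve-∀
      l₂ : ∀ β k y E C α → 16 * β * k * (2 * y * (E * (C * (2 * (2 * α))))) ≡ β * (128 * (k * C) * y * E * α)
      l₂ = solve-∀
      l₃ : ∀ G y c k C E α → G * y * c * (128 * (k * C) * y * E * α) ≡ 128 * (G * (k * C)) * (y * y) * E * (c * α)
      l₃ = solve-∀
    scaled : Q * (16 * 2 ^ b * k * F) ≤ Q * 2 ^ a
    scaled = arithmetic (888 * suc b) 888 (2 ^ b) (2 ^ a) (b + (e + 4)) (8 ^ κ) (9 ^ κ) F C refl suc-b≤ (2^b≤a ⟫ c-lower) F-bound saved

  small-part : 16 * 2 ^ b * k * P₀ ≤ 2 ^ a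
  small-part = N.≤-reflexive (l₁ (2 ^ b) k P₀) ⟫ N.*-monoˡ-≤ (2 * 2 ^ b * P₀) k-small ⟫ N.≤-reflexive (trans (l₂ (2 ^ b) P₀) (trans (cong (P₀ *_) (sym power)) P₀-split))
    where
    l₁ : ∀ β k P → 16 * β * k * P ≡ 8 * k * (2 * β * P)
    l₁ = solve-∀
    l₂ : ∀ β P → β * (2 * β * P) ≡ P * (β * β * 2)
    l₂ = solve-∀
    power : 2 ^ (2 * b + 1) ≡ 2 ^ b * 2 ^ b * 2
    power = trans (N.^-distribˡ-+-* 2 (2 * b) 1) (cong (_* 2) (trans (cong (2 ^_) (cong (b +_) (N.+-identityʳ b))) (N.^-distribˡ-+-* 2 b b)))

  π-bound : 2 ^ a ≤ 8 * 2 ^ b * π x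
  π-bound = positive (π x) (2^a≤x ⟫ π-lower (suc a) x (N.m^n>0 2 a ⟫ 2^a≤x) (N.<⇒≤ x<) ⟫ s≤s (N.*-monoʳ-≤ 2 (N.*-monoˡ-≤ (π x) a<)))
    where
    positive : ∀ P → 2 ^ a ≤ 1 + 2 * (2 ^ suc b * P) → 2 ^ a ≤ 8 * 2 ^ b * P
    positive zero hh = ⊥-elim (N.<⇒≱ (N.^-monoʳ-≤ 2 (2^b≥1 ⟫ 2^b≤a) ⟫ hh) (N.≤-reflexive (lem (2 ^ suc b))))
      where
      lem : ∀ u → 1 + 2 * (u * 0) ≡ 1
      lem = solve-∀
    positive (suc P) hh = hh ⟫ (N.+-monoˡ-≤ _ (N.*-mono-≤ (s≤s (z≤n {1})) (N.m^n>0 2 (suc b)) ⟫ N.*-monoʳ-≤ 2 (N.m≤m*n (2 ^ suc b) (suc P)))) ⟫ N.≤-reflexive (lem (2 ^ b) (suc P))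
      where
      lem : ∀ β P → 2 * (2 * β * P) + 2 * (2 * β * P) ≡ 8 * β * P
      lem = solve-∀

  -- The trivial part P₀ and the sifted part F each become at most 2^a after multiplication by 16 ·
  -- 2^b k, and 2^a ≤ 8 · 2^b π(x).
  count : ∀ ps → Unique ps → All (λ p → p ≤ x × Prime p × (t ≤ p → Balanced d g p)) ps → k * length ps ≤ π x
  count ps u all = N.*-cancelˡ-≤ (16 * 2 ^ b) {{N.>-nonZero (N.*-mono-≤ (s≤s (z≤n {15})) 2^b≥1)}} (N.≤-reflexive (sym (N.*-assoc (16 * 2 ^ b) k (length ps))) ⟫ (N.≤-trans (N.*-monoʳ-≤ (16 * 2 ^ b * k) len)
      (N.≤-reflexive (N.*-distribˡ-+ (16 * 2 ^ b * k) P₀ F) ⟫ N.+-mono-≤ small-part large-part ⟫ N.+-mono-≤ π-bound π-bound ⟫ N.≤-reflexive (lem (2 ^ b) (π x)))))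
    where
    lem : ∀ β P → 8 * β * P + 8 * β * P ≡ 16 * β * P
    lem = solve-∀
    len : length ps ≤ P₀ + F
    len = (length-≤ _≡_ sym trans ps cover u (All.map (λ { (p≤ , pr , bal) → covered p≤ pr bal }) all)) ⟫ N.≤-reflexive (trans (length-++ (upTo P₀)) (cong (_+ F) (length-upTo P₀)))

-- Every size condition concerns b alone and holds from some B on, so X = 2^(2^B) is large enough.
balanced-primes-sparse : ∀ d g t k → 1 ≤ d → ∃[ X ] (∀ x → X ≤ x → ∀ ps → Unique ps → All (λ p → p ≤ x × Prime p × (t ≤ p → Balanced d g p)) ps → k * length ps ≤ π x)
balanced-primes-sparse d g t k d≥1 = assemble (linear≤2^ (8 * k)) (linear≤2^ 888) (linear≤2^ (4 * e + 14)) (linear≤2^ (t + (d + 2))) (saving (128 * (888 * (k * sieveConstant d))) (888 * (18 * suc d)) (e + 4))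
  where
  e : ℕ
  e = g * ((2 * d + 1) * (2 * d + 1))
  Saving : ℕ → Set
  Saving b = ∀ κ → 2 ^ b ≤ 888 * (18 * suc d) * suc b * 9 ^ κ → 128 * (888 * (k * sieveConstant d)) * ((b + (e + 4)) * (b + (e + 4))) * 8 ^ κ ≤ 9 ^ κ
  Result : ℕ → Set
  Result x = ∀ ps → Unique ps → All (λ p → p ≤ x × Prime p × (t ≤ p → Balanced d g p)) ps → k * length ps ≤ π x
  module _ {B₁ B₂ B₃ B₄ B₅} (f₁ : ∀ b → B₁ ≤ b → 8 * k * suc b ≤ 2 ^ b) (f₂ : ∀ b → B₂ ≤ b → 888 * suc b ≤ 2 ^ b) (f₃ : ∀ b → B₃ ≤ b → (4 * e + 14) * suc b ≤ 2 ^ b)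
      (f₄ : ∀ b → B₄ ≤ b → (t + (d + 2)) * suc b ≤ 2 ^ b) (f₅ : ∀ b → B₅ ≤ b → Saving b) where
    B : ℕ
    B = B₁ + (B₂ + (B₃ + (B₄ + B₅)))
    at : ∀ x a b → 2 ^ a ≤ x → x < 2 ^ suc a → 2 ^ b ≤ a → a < 2 ^ suc b → B ≤ b → Result x
    at x a b 2^a≤x x< 2^b≤a a< B≤b = Cover.count d g t k e a b c x d≥1 (N.<⇒≤ (n<2^n e)) 2^a≤x x< 2^b≤a a< c-lower c-upper s-small (weaken (f₄ b b₄)) (weaken (f₁ b b₁)) D
        (f₅ b b₅ κ (2^b≤a ⟫ c-lower ⟫ N.*-monoʳ-≤ (888 * suc b) c≤9^κ ⟫ N.≤-reflexive (lem 888 (suc b) (18 * suc d) (9 ^ κ))))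
      where
      b₁ : B₁ ≤ b
      b₁ = (N.m≤m+n B₁ _) ⟫ B≤b
      r₂ : B₂ + (B₃ + (B₄ + B₅)) ≤ b
      r₂ = (N.m≤n+m _ B₁) ⟫ B≤b
      r₃ : B₃ + (B₄ + B₅) ≤ b
      r₃ = (N.m≤n+m _ B₂) ⟫ r₂
      r₄ : B₄ + B₅ ≤ b
      r₄ = (N.m≤n+m _ B₃) ⟫ r₃
      b₄ : B₄ ≤ b
      b₄ = N.m≤m+n B₄ B₅ ⟫ r₄
      b₅ : B₅ ≤ b
      b₅ = N.m≤n+m B₅ B₄ ⟫ r₄
      c : ℕ
      c = a N./ (444 * suc b)
      weaken : ∀ {K} → K * suc b ≤ 2 ^ b → K ≤ 2 ^ b
      weaken {K} = N.≤-trans (N.m≤m*n K (suc b))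
      c-upper : c * (444 * suc b) ≤ a
      c-upper = N.m/n*n≤m a (444 * suc b)
      c≥1 : 1 ≤ c
      c≥1 = N.m≥n⇒m/n>0 {a} {444 * suc b} (N.*-monoˡ-≤ (suc b) (N.m≤m+n 444 444) ⟫ f₂ b ((N.m≤m+n B₂ _) ⟫ r₂) ⟫ 2^b≤a)
      c-lower : a ≤ 888 * suc b * c
      c-lower = N.≤-reflexive (N.m≡m%n+[m/n]*n a (444 * suc b)) ⟫ (N.+-monoˡ-≤ _ (N.<⇒≤ (N.m%n<n a (444 * suc b)) ⟫ N.m≤n*m (444 * suc b) c {{N.>-nonZero c≥1}})) ⟫ N.≤-reflexive (lem′ c (suc b))
        where
        lem′ : ∀ c b → c * (444 * b) + c * (444 * b) ≡ 888 * b * c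
        lem′ = solve-∀
      s-small : 4 * (b + e + 3) + 2 ≤ 2 ^ b
      s-small = ((N.m≤m+n _ (4 * e * b + 10 * b)) ⟫ N.≤-reflexive (lem′ b e)) ⟫ f₃ b ((N.m≤m+n B₃ _) ⟫ r₃)
        where
        lem′ : ∀ b e → 4 * (b + e + 3) + 2 + (4 * e * b + 10 * b) ≡ (4 * e + 14) * suc b
        lem′ = solve-∀
      D : SieveData d c b
      D = sieve-data d d≥1 c b c≥1 (N.m/n≤m a (444 * suc b) ⟫ N.<⇒≤ a<)
      open SieveData D using (κ; c≤9^κ)
      lem : ∀ G b D N → G * b * (D * N) ≡ G * D * b * N
      lem = solve-∀
    beyond : ∀ x → 2 ^ (2 ^ B) ≤ x → Result x
    beyond x X≤x = level₁ (power-below 2 x N.≤-refl (N.m^n>0 2 (2 ^ B) ⟫ X≤x))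
      where
      level₁ : ∃[ a ] (2 ^ a ≤ x × x < 2 ^ suc a) → Result x
      level₁ (a , lo , hi) = level₂ (power-below 2 a N.≤-refl (N.m^n>0 2 B ⟫ 2^B≤a))
        where
        2^B≤a : 2 ^ B ≤ a
        2^B≤a = N.≤-pred (2^-cancel-< {2 ^ B} {suc a} (N.≤-<-trans X≤x hi))
        level₂ : ∃[ b ] (2 ^ b ≤ a × a < 2 ^ suc b) → Result x
        level₂ (b , lo′ , hi′) = at x a b lo hi lo′ hi′ (N.≤-pred (2^-cancel-< {B} {suc b} (N.≤-<-trans 2^B≤a hi′)))
  assemble : Eventually (λ b → 8 * k * suc b ≤ 2 ^ b) → Eventually (λ b → 888 * suc b ≤ 2 ^ b) → Eventually (λ b → (4 * e + 14) * suc b ≤ 2 ^ b) → Eventually (λ b → (t + (d + 2)) * suc b ≤ 2 ^ b) →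
             Eventually Saving → ∃[ X ] (∀ x → X ≤ x → Result x)
  assemble (B₁ , f₁) (B₂ , f₂) (B₃ , f₃) (B₄ , f₄) (B₅ , f₅) = 2 ^ (2 ^ B f₁ f₂ f₃ f₄ f₅) , beyond f₁ f₂ f₃ f₄ f₅

theorem6p1 : ∀ (d : ℕ) → 2 ≤ d → ∀ (k : ℕ) → ∃[ X ] (∀ (x : ℕ) → X ≤ x →
    ∀ (ps : List ℕ) → Unique ps →
    All (λ p → p ≤ x × Prime p × d ∣ (p ∸ 1) × Decomposable d p) ps →
    k * length ps ≤ π x)
theorem6p1 d 2≤d k = result (balanced-primes-sparse d (balanceConstant d) (threshold d * threshold d) k (N.<⇒≤ 2≤d))
  where
  result : ∃[ X ] (∀ x → X ≤ x → ∀ ps → Unique ps → All (λ p → p ≤ x × Prime p × (threshold d * threshold d ≤ p → Balanced d (balanceConstant d) p)) ps → k * length ps ≤ π x) →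
           ∃[ X ] (∀ x → X ≤ x → ∀ ps → Unique ps → All (λ p → p ≤ x × Prime p × d ∣ (p ∸ 1) × Decomposable d p) ps → k * length ps ≤ π x)
  result (X , h) = X , λ x X≤x ps u all → h x X≤x ps u (All.map (λ { {p} (p≤ , pr , d∣ , dec) → p≤ , pr , λ t≤p → decomposable⇒balanced d p 2≤d pr d∣ t≤p dec }) all)
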